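{- Let $\lambda,\mu$ be partitions and $m\ge|\mu|-\mu_1$; set $b=0^m\times\mathrm{rev}(\mu')$, a weak composition of length $n=m+\mu_1$. Then the Kostka–Foulkes polynomial is $$K_{\lambda,\mu}(t)=\sum_{\substack{T\in\mathrm{SSKD}(b)\\ \mathrm{wt}(T)=\lambda'\\ e_i(T)=0\ \forall i}}t^{\mathrm{maj}(T)},$$ where $\lambda'$ is regarded as a weak composition of length $n$ by appending zeros.
   Context: $\mu'$ is the conjugate partition, $\mathrm{rev}(\mu')$ its weakly increasing rearrangement, and $0^m\times c$ prepends $m$ zeros. $K_{\lambda,\mu}(t)$ is defined by $s_\lambda(X)=\sum_\mu K_{\lambda,\mu}(t)P_\mu(X;t)$ with $P_\mu$ the Hall–Littlewood functions. Semistandard key tabloids: for $b=(b_1,\dots,b_n)$ the diagram has cells $(r,c)$ (row from the bottom, column from the left) with $1\le c\le b_r$, augmented (following Haglund–Haiman–Loehr) by a basement column $0$ whose cell $(r,0)$ contains $r$, basement cells being included in the conditions below (row lengths compared without basement). Entries lie in $\{1,\dots,n\}$. Cells attack if in the same column, or in adjacent columns with the left cell strictly higher; non-attacking: attacking cells have different entries. A triple: cells $(r,c),(r,c+1)$ with entries $i,j$ and a third cell with entry $k$, either $(s,c)$, $s>r$, row $r$ strictly longer than row $s$, or $(s,c+1)$, $s<r$, row $r$ weakly longer than row $s$; co-inversion if $i<j<k$, $j<k<i$ or $k<i<j$. $\mathrm{SSKD}(b)$: non-attacking fillings with no co-inversion triples. $\mathrm{wt}(T)_p$ = number of entries $p$;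 $\mathrm{maj}(T)=\sum(b_r-c)$ over cells $(r,c)$ with $(r,c+1)$ in the diagram and $T(r,c)<T(r,c+1)$. $i$-pairing: pair an $i$ and an $i+1$ in the same column, then iteratively pair an unpaired $i+1$ with an unpaired $i$ to its left whenever all entries $i,i+1$ between them are paired. $e_i(T)=0$ exactly when $T$ has no unpaired $i+1$ (the raising operator). -}

module Defs where

open import Data.Nat using (ℕ; zero; suc; _+_; _∸_; _≤_; _≡ᵇ_; _<ᵇ_; _≤ᵇ_; _⊔_)
open import Data.Integer using (ℤ; +_; -_) renaming (_+_ to _+ℤ_; _*_ to _*ℤ_)
open import Data.Bool using (Bool; true; false; _∧_; _∨_; not; if_then_else_)
open import Data.List using (List; []; _∷_; _++_; map; concatMap; concat; foldr; length; upTo; replicate; reverse)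
open import Data.Nat.ListAction using (sum)
open import Data.Bool.ListAction using (all; any)
import Data.List as L
open import Data.Vec using (Vec; tabulate; lookup; allFin) renaming ([] to []ᵥ; _∷_ to _∷ᵥ_)
import Data.Vec as V
open import Data.Vec.Properties using (≡-dec)
open import Data.Fin using (Fin; toℕ)
open import Data.Product using (_×_; _,_)
open import Data.Unit using (⊤)
open import Relation.Nullary using (yes; no)
open import Relation.Binary.PropositionalEquality using (_≡_)
import Data.Nat as N

filterᵇ : {A : Set} → (A → Bool) → List A → List A
filterᵇ p [] = []
filterᵇ p (x ∷ xs) = if p x then x ∷ filterᵇ p xs else filterᵇ p xs

countᵇ : {A : Set} → (A → Bool) → List A → ℕ
countᵇ p xs = length (filterᵇ p xs)

nthD : {A : Set} → A → List A → ℕ → A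
nthD d [] _ = d
nthD d (x ∷ xs) zero = x
nthD d (x ∷ xs) (suc k) = nthD d xs k

from1 : ℕ → List ℕ
from1 n = map suc (upTo n)

range0 : ℕ → List ℕ
range0 n = upTo (suc n)

eqListᵇ : List ℕ → List ℕ → Bool
eqListᵇ [] [] = true
eqListᵇ (x ∷ xs) (y ∷ ys) = (x ≡ᵇ y) ∧ eqListᵇ xs ys
eqListᵇ _ _ = false

isEven : ℕ → Bool
isEven zero = true
isEven (suc n) = not (isEven n)

IsPartition : List ℕ → Set
IsPartition [] = ⊤
IsPartition (x ∷ []) = 1 ≤ x
IsPartition (x ∷ y ∷ xs) = (y ≤ x) × IsPartition (y ∷ xs)

head0 : List ℕ → ℕ
head0 [] = 0
head0 (x ∷ _) = x

conj : List ℕ → List ℕ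
conj mu = map (λ j → countᵇ (λ x → j ≤ᵇ x) mu) (from1 (head0 mu))

padTo : ℕ → List ℕ → List ℕ
padTo n l = l ++ replicate (n ∸ length l) 0

partsGo : ℕ → ℕ → ℕ → List (List ℕ)
partsGo fuel zero k = [] ∷ []
partsGo zero (suc n) k = []
partsGo (suc f) (suc n) k =
  concatMap (λ a → map (a ∷_) (partsGo f (suc n ∸ a) a))
            (filterᵇ (λ a → a ≤ᵇ k) (from1 (suc n)))

partitions : ℕ → List (List ℕ)
partitions n = partsGo n n n

-- Fillings of a (weak) composition: row r (1-indexed, from the bottom)
-- is a list of length b_r with entries in {1,...,n}.

words : ℕ → ℕ → List (List ℕ)
words zero n = [] ∷ []
words (suc k) n = concatMap (λ a → map (a ∷_) (words k n)) (from1 n)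

fillings : List ℕ → ℕ → List (List (List ℕ))
fillings [] n = [] ∷ []
fillings (k ∷ ks) n = concatMap (λ w → map (w ∷_) (fillings ks n)) (words k n)

Filling : Set
Filling = List (List ℕ)

Cell : Set
Cell = ℕ × ℕ   -- (row r ≥ 1, column c ≥ 0); column 0 is the basement

module Tabloid (b : List ℕ) (n : ℕ) (T : Filling) where

  rowLen : ℕ → ℕ
  rowLen r = nthD 0 b (r ∸ 1)

  ent : Cell → ℕ
  ent (r , zero) = r
  ent (r , suc c) = nthD 0 (nthD [] T (r ∸ 1)) c

  cells : List Cell
  cells = concatMap (λ r → map (λ c → (r , c)) (range0 (rowLen r))) (from1 n)

  attacksDir : Cell → Cell → Bool
  attacksDir (r , c) (s , d) =
    ((c ≡ᵇ d) ∧ not (r ≡ᵇ s)) ∨ ((d ≡ᵇ suc c) ∧ (s <ᵇ r))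

  nonAttacking : Bool
  nonAttacking =
    all (λ u → all (λ v → not (attacksDir u v) ∨ not (ent u ≡ᵇ ent v)) cells) cells

  coinv : ℕ → ℕ → ℕ → Bool
  coinv i j k = ((i <ᵇ j) ∧ (j <ᵇ k)) ∨ ((j <ᵇ k) ∧ (k <ᵇ i)) ∨ ((k <ᵇ i) ∧ (i <ᵇ j))

  noCoinvAt : Cell → Bool
  noCoinvAt (r , c) =
    not (suc c ≤ᵇ rowLen r) ∨
    (all (λ s → not ((r <ᵇ s) ∧ (rowLen s <ᵇ rowLen r) ∧ (c ≤ᵇ rowLen s))
                ∨ not (coinv (ent (r , c)) (ent (r , suc c)) (ent (s , c))))
         (from1 n)
     ∧
     all (λ s → not ((s <ᵇ r) ∧ (rowLen s ≤ᵇ rowLen r) ∧ (suc c ≤ᵇ rowLen s))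
                ∨ not (coinv (ent (r , c)) (ent (r , suc c)) (ent (s , suc c))))
         (from1 n))

  noCoinv : Bool
  noCoinv = all noCoinvAt cells

  wt : List ℕ
  wt = map (λ p → countᵇ (λ x → x ≡ᵇ p) (concat T)) (from1 n)

  maj : ℕ
  maj = sum (map (λ u → majAt u) cells)
    where
    majAt : Cell → ℕ
    majAt (r , zero) = 0
    majAt (r , suc c) =
      if (suc (suc c) ≤ᵇ rowLen r) ∧ (ent (r , suc c) <ᵇ ent (r , suc (suc c)))
      then rowLen r ∸ suc c else 0

  maxLen : ℕ
  maxLen = foldr _⊔_ 0 b

  colHas : ℕ → ℕ → Bool
  colHas c v = any (λ r → (c ≤ᵇ rowLen r) ∧ (ent (r , c) ≡ᵇ v)) (from1 n)

  -- i-pairing scan, columns left to right, with the number of unpaired i's so far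
  -- (an i and an i+1 in the same column pair with each other; an i+1 pairs with the
  -- nearest unpaired i to its left).  Returns true iff an unpaired i+1 exists.
  scan : List (Bool × Bool) → ℕ → Bool
  scan [] k = false
  scan ((true , true) ∷ rest) k = scan rest k
  scan ((true , false) ∷ rest) k = scan rest (suc k)
  scan ((false , true) ∷ rest) zero = true
  scan ((false , true) ∷ rest) (suc k) = scan rest k
  scan ((false , false) ∷ rest) k = scan rest k

  eZero : ℕ → Bool
  eZero i = not (scan (map (λ c → (colHas c i , colHas c (suc i))) (from1 maxLen)) 0)

bComp : ℕ → List ℕ → List ℕ
bComp m mu = replicate m 0 ++ reverse (conj mu)

nLen : ℕ → List ℕ → ℕ
nLen m mu = m + head0 mu

goodT : List ℕ → List ℕ → ℕ → Filling → Bool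
goodT lam mu m T =
  nonAttacking ∧ noCoinv ∧ eqListᵇ wt (padTo (nLen m mu) (conj lam))
  ∧ all eZero (from1 (nLen m mu ∸ 1))
  where open Tabloid (bComp m mu) (nLen m mu) T

kfGen : List ℕ → List ℕ → ℕ → ℕ → ℕ
kfGen lam mu m k =
  countᵇ (λ T → goodT lam mu m T ∧ (Tabloid.maj (bComp m mu) (nLen m mu) T ≡ᵇ k))
         (fillings (bComp m mu) (nLen m mu))

-- Polynomials in t, x_1..x_N with integer coefficients.
-- An exponent vector has entry 0 for t and entry (suc j) for x_{j+1}.

Exp : ℕ → Set
Exp N = Vec ℕ (suc N)

Poly : ℕ → Set
Poly N = List (ℤ × Exp N)

coeff : {N : ℕ} → Poly N → Exp N → ℤ
coeff [] e = + 0
coeff ((a , f) ∷ p) e with ≡-dec N._≟_ f e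
... | yes _ = a +ℤ coeff p e
... | no _ = coeff p e

_≈P_ : {N : ℕ} → Poly N → Poly N → Set
p ≈P q = ∀ e → coeff p e ≡ coeff q e

_⊕_ : {N : ℕ} → Poly N → Poly N → Poly N
p ⊕ q = p ++ q

_⊗_ : {N : ℕ} → Poly N → Poly N → Poly N
p ⊗ q = concatMap (λ { (a , e) → map (λ { (c , f) → (a *ℤ c , V.zipWith _+_ e f) }) q }) p

negP : {N : ℕ} → Poly N → Poly N
negP p = map (λ { (a , e) → (- a , e) }) p

oneP : {N : ℕ} → Poly N
oneP {N} = (+ 1 , V.replicate (suc N) 0) ∷ []

sumP : {N : ℕ} → List (Poly N) → Poly N
sumP = foldr _⊕_ []

prodP : {N : ℕ} → List (Poly N) → Poly N
prodP = foldr _⊗_ oneP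

tPow : {N : ℕ} → ℕ → Poly N
tPow {N} k = (+ 1 , k ∷ᵥ V.replicate N 0) ∷ []

xVar : {N : ℕ} → Fin N → Poly N
xVar {N} i = (+ 1 , 0 ∷ᵥ tabulate (λ j → if toℕ i ≡ᵇ toℕ j then 1 else 0)) ∷ []

xMono : {N : ℕ} → List ℕ → Poly N
xMono {N} α = (+ 1 , 0 ∷ᵥ tabulate (λ j → nthD 0 α (toℕ j))) ∷ []

embedT : {N : ℕ} → List ℤ → Poly N
embedT {N} cs = go 0 cs
  where
  go : ℕ → List ℤ → Poly N
  go k [] = []
  go k (a ∷ as) = (a , k ∷ᵥ V.replicate N 0) ∷ go (suc k) as

coefT : List ℤ → ℕ → ℤ
coefT = nthD (+ 0)

pairsLt : (N : ℕ) → List (Fin N × Fin N)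
pairsLt N = concatMap (λ i → concatMap (λ j → if toℕ i <ᵇ toℕ j then (i , j) ∷ [] else [])
                                         (L.allFin N)) (L.allFin N)

aDelta : (N : ℕ) → Poly N
aDelta N = prodP (map (λ { (i , j) → xVar i ⊕ negP (xVar j) }) (pairsLt N))

insAll : {A : Set} {k : ℕ} → A → Vec A k → List (Vec A (suc k))
insAll x []ᵥ = (x ∷ᵥ []ᵥ) ∷ []
insAll x (y ∷ᵥ ys) = (x ∷ᵥ y ∷ᵥ ys) ∷ map (y ∷ᵥ_) (insAll x ys)

perms : {A : Set} {k : ℕ} → Vec A k → List (Vec A k)
perms []ᵥ = []ᵥ ∷ []
perms (x ∷ᵥ xs) = concatMap (insAll x) (perms xs)

symGroup : (N : ℕ) → List (Vec (Fin N) N)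
symGroup N = perms (allFin N)

sgn : {N : ℕ} → Vec (Fin N) N → ℤ
sgn {N} σ =
  if isEven (countᵇ (λ { (i , j) → toℕ (lookup σ j) <ᵇ toℕ (lookup σ i) }) (pairsLt N))
  then + 1 else - (+ 1)

-- action of σ⁻¹ on exponent vectors: x_j ↦ x_{σ⁻¹ j}, i.e. new exponent of x_j is
-- the old exponent of x_{σ j}
actE : {N : ℕ} → Vec (Fin N) N → Exp N → Exp N
actE σ (e₀ ∷ᵥ es) = e₀ ∷ᵥ tabulate (λ j → lookup es (lookup σ j))

-- Σ_{w ∈ S_N} sgn(w) w(f)   (summing over σ = w⁻¹, sgn σ = sgn w)
antisym : (N : ℕ) → Poly N → Poly N
antisym N f = concatMap (λ σ → map (λ { (a , e) → (sgn σ *ℤ a , actE σ e) }) f) (symGroup N)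

-- Hall–Littlewood P_μ(x_1..x_N; t) (Macdonald III (2.1)):
--   P_μ = (1 / v_μ(t)) Σ_{w ∈ S_N} w( x^μ Π_{i<j} (x_i - t x_j)/(x_i - x_j) ),
-- equivalently  v_μ(t) · a_δ · P_μ = Σ_w sgn(w) w( x^μ Π_{i<j}(x_i - t x_j) ).

hlNum : (N : ℕ) → List ℕ → Poly N
hlNum N mu =
  antisym N (xMono mu ⊗ prodP (map (λ { (i , j) → xVar i ⊕ negP (tPow 1 ⊗ xVar j) }) (pairsLt N)))

-- [j]_t = 1 + t + ... + t^{j-1} = (1 - t^j)/(1 - t)
qInt : {N : ℕ} → ℕ → Poly N
qInt j = sumP (map tPow (upTo j))

vm : {N : ℕ} → ℕ → Poly N
vm m = prodP (map qInt (from1 m))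

vPoly : (N : ℕ) → List ℕ → Poly N
vPoly N mu = prodP (map (λ k → vm (countᵇ (λ x → x ≡ᵇ k) (padTo N mu))) (range0 N))

weakInc : List ℕ → Bool
weakInc (x ∷ y ∷ xs) = (x ≤ᵇ y) ∧ weakInc (y ∷ xs)
weakInc _ = true

strictBelow : List ℕ → List ℕ → Bool
strictBelow (x ∷ xs) (y ∷ ys) = (x <ᵇ y) ∧ strictBelow xs ys
strictBelow _ [] = true
strictBelow [] (_ ∷ _) = false

colStrict : List (List ℕ) → Bool
colStrict (R ∷ R' ∷ Rs) = strictBelow R R' ∧ colStrict (R' ∷ Rs)
colStrict _ = true

-- rows listed top to bottom in English notation (row 1 longest)
isSSYT : List (List ℕ) → Bool
isSSYT T = all weakInc T ∧ colStrict T

schur : (N : ℕ) → List ℕ → Poly N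
schur N lam =
  map (λ T → (+ 1 , 0 ∷ᵥ tabulate (λ j → countᵇ (λ x → x ≡ᵇ suc (toℕ j)) (concat T))))
      (filterᵇ isSSYT (fillings lam N))

module Submission where

-- Read the tabloids by columns, from left to right. A column is determined by its set of letters
-- and the column to its left (`arr`), so fillings with column heights μ become chains of subsets;
-- let G_μ be their generating function Σ t^maj x^wt. It is symmetric in x, and antisymmetrizing
-- a_δ G_μ leaves the fillings all of whose prefixes have dominant weight, that is, those killed
-- by every e_i (`hw`).
-- Let R_β = Σ_w sgn(w) w(x^β ∏_{i<j} (x_i - t x_j)); then R_β = v_β a_δ P_β and R_0 = [N]! a_δ.
-- The branching rule of G in one variable matches the expansion of e_s R_β, and both together
-- with the dual Cauchy identity give
--   s_λ R_0 = Σ_α t^{inv α} hw_{λ, sort α} R_{sort α}   (α over weak compositions).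
-- Since v_β Σ t^{inv α} = [N]! over the rearrangements α of β, this is s_λ = Σ_β hw_{λβ} P_β. The
-- coefficients are unique because a_δ P_β = a_{β+δ} modulo t, which allows induction on powers of t.

open import Defs
open import Data.Nat using (ℕ; _∸_; _≤_)
open import Data.Nat.ListAction using (sum)
open import Data.Integer using (ℤ; +_)
open import Data.List using (List; map)
open import Data.Product using (_×_)
open import Relation.Binary.PropositionalEquality using (_≡_; _≢_)

open import Data.Nat as ℕ using (zero; suc; _<_; _≡ᵇ_; _<ᵇ_; _≤ᵇ_; z≤n; s≤s; pred)
import Data.Nat.Properties as ℕₚ
open import Data.Nat.Properties using (≤-trans; ≤-refl; n<1+n; <⇒≤; suc-injective; ≤-pred; n≤1+n; <-trans; <⇒≢; m≤m+n; ≤-reflexive; <⇒≱; <-≤-connex; ≤∧≢⇒<; <-≤-trans; ≤-<-trans; n≤0⇒n≡0; m≤n+m)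
open import Data.Integer as ℤ using (-[1+_]; -_; _+_; _-_; _*_; 0ℤ; 1ℤ)
import Data.Integer.Properties as ℤₚ
open import Data.Integer.Properties using (+-identityʳ; +-identityˡ; pos-+; *-identityˡ; +-injective; i-j≡0⇒i≡j; *-zeroʳ; +-inverseʳ; *-identityʳ)
open import Data.Integer.Tactic.RingSolver using (solve-∀)
open import Data.Bool using (Bool; true; false; _∧_; _∨_; not; if_then_else_; T)
open import Data.Bool.ListAction using (all; any)
open import Data.Fin as Fin using (Fin; zero; suc; toℕ)
open import Data.List as List using ([]; _∷_; _++_; concatMap; length; upTo; applyUpTo; replicate; reverse; foldr; concat)
import Data.List.Properties as Listₚ
open import Data.List.Relation.Unary.All as All using (All; []; _∷_)
open import Data.Vec as Vec using (Vec; []; _∷_; _∷ʳ_; toList)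
import Data.Vec.Properties as Vecₚ
open import Data.Maybe as Maybe using (Maybe; just; nothing)
open import Data.Product using (Σ; ∃; _,_; proj₁; proj₂)
open import Data.Sum using (_⊎_; inj₁; inj₂)
open import Data.Empty using (⊥; ⊥-elim)
open import Data.Unit using (⊤; tt)
open import Function using (_∘_; id; case_of_)
open import Relation.Nullary using (¬_; yes; no; does)
import Relation.Binary.Definitions as Rel
open import Relation.Binary.PropositionalEquality using (refl; sym; trans; cong; cong₂; subst; subst₂)

-- A polynomial is handled as the function of its coefficients at all integer exponents, so products
-- with monomials are shifts and no division by a_δ is made: an identity of symmetric series is
-- proved by comparing `alt` of both sides, and `alt-cancel` removes the factor a_δ. The gain is
-- that under `alt` the first column survives only if it is an initial interval of the letters
-- involved, and next to an interval the remaining columns see just a substitution of t x_j for some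
-- x_j. The obstacle is that removing a letter from the columns destroys the decreasing order of
-- their heights. It is overcome by an exchange rule for heights a and a + 1, each exchange giving
-- one t. The powers of t collected in this way are inversion numbers of 2α - S, where S marks the
-- columns that lose a cell; with γ = α - S this vector is also 2γ + S, whose inversions arise when
-- e_s R_γ is straightened. That coincidence makes the two recursions equal. `Φ` ends in an
-- arbitrary series `φ` in t because R has to be carried along while G is expanded. The bound on m
-- gives n ≥ |μ|, hence room for λ' in n letters when |λ| = |μ|.

minus-comm : ∀ x y z → (x - y) - z ≡ (x - z) - y
minus-comm = solve-∀

+-exchange : ∀ x y z u → (x + y) + (z + u) ≡ (x + z) + (y + u)
+-exchange = solve-∀

minus-0⁻ : ∀ x → x ≡ x - 0ℤ
minus-0⁻ = solve-∀

minus-0 : ∀ x → x - 0ℤ ≡ x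
minus-0 = solve-∀

minus-+ : ∀ x y z → x - (y + z) ≡ (x - y) - z
minus-+ = solve-∀

minus-minus : ∀ x y z → (x - y) - z ≡ x - (y + z)
minus-minus = solve-∀

+-swap : ∀ x y z → x + (y + z) ≡ y + (x + z)
+-swap = solve-∀

one+minus-1 : ∀ x → x ≡ 1ℤ + (x - 1ℤ)
one+minus-1 = solve-∀

*-swap : ∀ x y z → x * (y * z) ≡ y * (x * z)
*-swap = solve-∀

suc-minus-suc : ∀ x y → (1ℤ + x) - (1ℤ + y) ≡ x - y
suc-minus-suc = solve-∀

neg-* : ∀ x y → (- x) * y ≡ - (x * y)
neg-* = solve-∀

plus-minus : ∀ x y → x ≡ (x + y) - y
plus-minus = solve-∀

minus-suc-split : ∀ x y → x - (1ℤ + y) ≡ (x - y) - 1ℤ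
minus-suc-split = solve-∀

minus-1-minus : ∀ x y → (x - 1ℤ) - y ≡ x - (1ℤ + y)
minus-1-minus = solve-∀

1*+0 : ∀ x → x ≡ 1ℤ * x + 0ℤ
1*+0 = solve-∀

+-1-shift : ∀ x y → (x + 1ℤ) + y ≡ (x + y) + 1ℤ
+-1-shift = solve-∀

+-1-shift-0 : ∀ x y → (x + 1ℤ) + y ≡ (x + (1ℤ + y)) + 0ℤ
+-1-shift-0 = solve-∀

*0+0 : ∀ x → x * 0ℤ + 0ℤ ≡ 0ℤ
*0+0 = solve-∀

suc+minus-1 : ∀ x y → ((1ℤ + x) + y) - 1ℤ ≡ x + y
suc+minus-1 = solve-∀

suc+minus-0 : ∀ x y → ((1ℤ + x) + y) - 0ℤ ≡ x + (1ℤ + y)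
suc+minus-0 = solve-∀

minus-0-1 : ∀ x → x - 1ℤ ≡ (x - 0ℤ) - 1ℤ
minus-0-1 = solve-∀

infixr 2 _∙_
_∙_ : {A : Set} {x y z : A} → x ≡ y → y ≡ z → x ≡ z
_∙_ = trans

+ˡ : ∀ x {y z} → y ≡ z → x + y ≡ x + z
+ˡ x = cong (λ w → x + w)

+ʳ : ∀ z {x y} → x ≡ y → x + z ≡ y + z
+ʳ z = cong (λ w → w + z)

-- Guards and finite sums.

infixr 7 _▸_
-- An Iverson bracket: a sum over selected objects is written as a guarded sum over a fixed list, so
-- that sums can be exchanged freely.
_▸_ : Bool → ℤ → ℤ
true ▸ z = z
false ▸ z = 0ℤ

▸-zero : ∀ b → b ▸ 0ℤ ≡ 0ℤ
▸-zero true = refl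
▸-zero false = refl

▸-cong : ∀ b {x y} → (b ≡ true → x ≡ y) → b ▸ x ≡ b ▸ y
▸-cong true h = h refl
▸-cong false h = refl

▸-neg : ∀ b x → b ▸ (- x) ≡ - (b ▸ x)
▸-neg true x = refl
▸-neg false x = refl

▸-* : ∀ b x y → b ▸ (x * y) ≡ x * (b ▸ y)
▸-* true x y = refl
▸-* false x y = sym (*-zeroʳ x)

▸-comm : ∀ a b x → a ▸ b ▸ x ≡ b ▸ a ▸ x
▸-comm true b x = refl
▸-comm false true x = refl
▸-comm false false x = refl

▸-∧ : ∀ a b x → (a ∧ b) ▸ x ≡ a ▸ b ▸ x
▸-∧ true b x = refl
▸-∧ false b x = refl

∑ : {A : Set} → List A → (A → ℤ) → ℤ
∑ [] f = 0ℤ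
∑ (x ∷ xs) f = f x + ∑ xs f

module _ {A : Set} where

  ∑-cong : (xs : List A) {f g : A → ℤ} → (∀ x → f x ≡ g x) → ∑ xs f ≡ ∑ xs g
  ∑-cong [] h = refl
  ∑-cong (x ∷ xs) h = cong₂ _+_ (h x) (∑-cong xs h)

  ∑-zero : (xs : List A) {f : A → ℤ} → (∀ x → f x ≡ 0ℤ) → ∑ xs f ≡ 0ℤ
  ∑-zero [] h = refl
  ∑-zero (x ∷ xs) h = cong₂ _+_ (h x) (∑-zero xs h)

  ∑-++ : (xs ys : List A) (f : A → ℤ) → ∑ (xs ++ ys) f ≡ ∑ xs f + ∑ ys f
  ∑-++ [] ys f = sym (+-identityˡ _)
  ∑-++ (x ∷ xs) ys f = +ˡ (f x) (∑-++ xs ys f) ∙ sym (ℤₚ.+-assoc (f x) _ _)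

  ∑-+ : (xs : List A) (f g : A → ℤ) → ∑ xs (λ x → f x + g x) ≡ ∑ xs f + ∑ xs g
  ∑-+ [] f g = refl
  ∑-+ (x ∷ xs) f g = +ˡ (f x + g x) (∑-+ xs f g) ∙ +-exchange (f x) (g x) (∑ xs f) (∑ xs g)

  ∑-neg : (xs : List A) (f : A → ℤ) → ∑ xs (λ x → - f x) ≡ - ∑ xs f
  ∑-neg [] f = refl
  ∑-neg (x ∷ xs) f = +ˡ (- f x) (∑-neg xs f) ∙ sym (ℤₚ.neg-distrib-+ (f x) _)

  ∑-*ˡ : (xs : List A) (c : ℤ) (f : A → ℤ) → ∑ xs (λ x → c * f x) ≡ c * ∑ xs f
  ∑-*ˡ [] c f = sym (*-zeroʳ c)
  ∑-*ˡ (x ∷ xs) c f = +ˡ (c * f x) (∑-*ˡ xs c f) ∙ sym (ℤₚ.*-distribˡ-+ c (f x) _)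

  ∑-▸ : (xs : List A) (b : Bool) (f : A → ℤ) → ∑ xs (λ x → b ▸ f x) ≡ b ▸ ∑ xs f
  ∑-▸ xs true f = refl
  ∑-▸ xs false f = ∑-zero xs (λ _ → refl)

module _ {A B : Set} where

  ∑-map : (xs : List A) (g : A → B) (f : B → ℤ) → ∑ (map g xs) f ≡ ∑ xs (f ∘ g)
  ∑-map [] g f = refl
  ∑-map (x ∷ xs) g f = +ˡ (f (g x)) (∑-map xs g f)

  ∑-concatMap : (xs : List A) (g : A → List B) (f : B → ℤ) →
                ∑ (concatMap g xs) f ≡ ∑ xs (λ x → ∑ (g x) f)
  ∑-concatMap [] g f = refl
  ∑-concatMap (x ∷ xs) g f = ∑-++ (g x) _ f ∙ +ˡ (∑ (g x) f) (∑-concatMap xs g f)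

  ∑-swap : (xs : List A) (ys : List B) (f : A → B → ℤ) →
           ∑ xs (λ x → ∑ ys (f x)) ≡ ∑ ys (λ y → ∑ xs (λ x → f x y))
  ∑-swap [] ys f = sym (∑-zero ys (λ _ → refl))
  ∑-swap (x ∷ xs) ys f = +ˡ (∑ ys (f x)) (∑-swap xs ys f) ∙ sym (∑-+ ys (f x) _)

-- Sets of letters as bit vectors, and the exchange of two neighbouring positions.

bits : ∀ n → List (Vec Bool n)
bits zero = [] ∷ []
bits (suc n) = map (true ∷_) (bits n) ++ map (false ∷_) (bits n)

∑-bits : ∀ n (f : Vec Bool (suc n) → ℤ) →
         ∑ (bits (suc n)) f ≡ ∑ (bits n) (λ D → f (true ∷ D)) + ∑ (bits n) (λ D → f (false ∷ D))
∑-bits n f = ∑-++ (map (true ∷_) (bits n)) _ f ∙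
                   cong₂ _+_ (∑-map (bits n) (true ∷_) f) (∑-map (bits n) (false ∷_) f)

size : ∀ {n} → Vec Bool n → ℕ
size [] = 0
size (true ∷ D) = suc (size D)
size (false ∷ D) = size D

bit : ∀ {n} → ℕ → Vec Bool n → Bool
bit _ [] = false
bit zero (b ∷ D) = b
bit (suc i) (b ∷ D) = bit i D

[_]ᵇ : Bool → ℤ
[ true ]ᵇ = 1ℤ
[ false ]ᵇ = 0ℤ

infixl 6 _⊖_ _∔_
_⊖_ : ∀ {n} → Vec ℤ n → Vec Bool n → Vec ℤ n
[] ⊖ [] = []
(a ∷ α) ⊖ (b ∷ D) = (a - [ b ]ᵇ) ∷ (α ⊖ D)

_∔_ : ∀ {n} → Vec ℤ n → Vec Bool n → Vec ℤ n
[] ∔ [] = []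
(a ∷ α) ∔ (b ∷ D) = (a + [ b ]ᵇ) ∷ (α ∔ D)

swapAt : ∀ {A : Set} {n} → ℕ → Vec A n → Vec A n
swapAt _ [] = []
swapAt zero (a ∷ []) = a ∷ []
swapAt zero (a ∷ b ∷ r) = b ∷ a ∷ r
swapAt (suc i) (a ∷ r) = a ∷ swapAt i r

swapAt-invol : ∀ {A : Set} {n} i (v : Vec A n) → swapAt i (swapAt i v) ≡ v
swapAt-invol _ [] = refl
swapAt-invol zero (a ∷ []) = refl
swapAt-invol zero (a ∷ b ∷ r) = refl
swapAt-invol (suc i) (a ∷ r) = cong (a ∷_) (swapAt-invol i r)

swapAt-⊖ : ∀ {n} i (α : Vec ℤ n) D → swapAt i (α ⊖ D) ≡ swapAt i α ⊖ swapAt i D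
swapAt-⊖ _ [] [] = refl
swapAt-⊖ zero (a ∷ []) (b ∷ []) = refl
swapAt-⊖ zero (a ∷ a' ∷ α) (b ∷ b' ∷ D) = refl
swapAt-⊖ (suc i) (a ∷ α) (b ∷ D) = cong (_ ∷_) (swapAt-⊖ i α D)

size-swapAt : ∀ {n} i (D : Vec Bool n) → size (swapAt i D) ≡ size D
size-swapAt _ [] = refl
size-swapAt zero (a ∷ []) = refl
size-swapAt zero (true ∷ true ∷ D) = refl
size-swapAt zero (true ∷ false ∷ D) = refl
size-swapAt zero (false ∷ true ∷ D) = refl
size-swapAt zero (false ∷ false ∷ D) = refl
size-swapAt (suc i) (true ∷ D) = cong suc (size-swapAt i D)
size-swapAt (suc i) (false ∷ D) = size-swapAt i D

∑-swapAt : ∀ n i (f : Vec Bool n → ℤ) → ∑ (bits n) (f ∘ swapAt i) ≡ ∑ (bits n) f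
∑-swapAt zero i f = refl
∑-swapAt (suc n) (suc i) f =
  ∑-bits n _ ∙
    cong₂ _+_ (∑-swapAt n i (f ∘ (true ∷_))) (∑-swapAt n i (f ∘ (false ∷_))) ∙ sym (∑-bits n f)
∑-swapAt (suc zero) zero f = refl
∑-swapAt (suc (suc n)) zero f =
  ∑-bits (suc n) _ ∙ cong₂ _+_ (∑-bits n _) (∑-bits n _) ∙
    +-exchange (S true true) (S false true) (S true false) (S false false) ∙
      sym (∑-bits (suc n) _ ∙ cong₂ _+_ (∑-bits n _) (∑-bits n _))
  where
  S : Bool → Bool → ℤ
  S a b = ∑ (bits n) (λ D → f (a ∷ b ∷ D))

double-cancel : ∀ x y → x + x ≡ y + y → x ≡ y
double-cancel x y h = ℤₚ.*-cancelˡ-≡ (+ 2) x y (two x ∙ h ∙ sym (two y))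
  where
  two : ∀ z → + 2 * z ≡ z + z
  two = solve-∀

-- Adding the exchanged terms doubles both sums, and 2 can be cancelled in ℤ; no representatives of
-- the orbits have to be chosen.
∑-pair : ∀ n i (f g : Vec Bool n → ℤ) →
         (∀ D → f D + f (swapAt i D) ≡ g D + g (swapAt i D)) → ∑ (bits n) f ≡ ∑ (bits n) g
∑-pair n i f g h = double-cancel _ _
  (both f ∙ ∑-cong (bits n) h ∙ sym (both g))
  where
  both : ∀ k → ∑ (bits n) k + ∑ (bits n) k ≡ ∑ (bits n) (λ D → k D + k (swapAt i D))
  both k = +ˡ (∑ (bits n) k) (sym (∑-swapAt n i k)) ∙ sym (∑-+ (bits n) k _)

swapAt-same : ∀ {n} i (D : Vec Bool n) → bit i D ≡ bit (suc i) D → swapAt i D ≡ D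
swapAt-same _ [] h = refl
swapAt-same zero (a ∷ []) h = refl
swapAt-same zero (a ∷ b ∷ D) refl = refl
swapAt-same (suc i) (a ∷ D) h = cong (a ∷_) (swapAt-same i D h)

bit-swapAt : ∀ {n} i (D : Vec Bool n) → suc i < n → bit i (swapAt i D) ≡ bit (suc i) D
bit-swapAt zero (a ∷ b ∷ D) h = refl
bit-swapAt zero (a ∷ []) (s≤s ())
bit-swapAt (suc i) (a ∷ D) (s≤s h) = bit-swapAt i D h

bit-swapAt' : ∀ {n} i (D : Vec Bool n) → suc i < n → bit (suc i) (swapAt i D) ≡ bit i D
bit-swapAt' zero (a ∷ b ∷ D) h = refl
bit-swapAt' zero (a ∷ []) (s≤s ())
bit-swapAt' (suc i) (a ∷ D) (s≤s h) = bit-swapAt' i D h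

-- The orbits of the exchange are the fixed sets and the pairs; each pair is represented by the
-- member that contains `i` and not `suc i`.
∑-pairs : ∀ n i (f g : Vec Bool n → ℤ) → suc i < n →
          (∀ D → bit i D ≡ bit (suc i) D → f D ≡ g D) →
          (∀ D → bit i D ≡ true → bit (suc i) D ≡ false →
             f D + f (swapAt i D) ≡ g D + g (swapAt i D)) →
          ∑ (bits n) f ≡ ∑ (bits n) g
∑-pairs n i f g i<n same pair = ∑-pair n i f g go
  where
  go : ∀ D → f D + f (swapAt i D) ≡ g D + g (swapAt i D)
  go D with bit i D in p | bit (suc i) D in q
  ... | true | true rewrite swapAt-same i D (p ∙ sym q) =
    cong₂ _+_ (same D (p ∙ sym q)) (same D (p ∙ sym q))
  ... | false | false rewrite swapAt-same i D (p ∙ sym q) =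
    cong₂ _+_ (same D (p ∙ sym q)) (same D (p ∙ sym q))
  ... | true | false = pair D p q
  ... | false | true =
    ℤₚ.+-comm (f D) _ ∙
      subst (λ E → f D' + f E ≡ g D' + g E) (swapAt-invol i D)
               (pair D' (bit-swapAt i D i<n ∙ q) (bit-swapAt' i D i<n ∙ p)) ∙
        ℤₚ.+-comm (g D') _
    where D' = swapAt i D

-- Arrangement of a set of letters next to a given column; the generating function `Φ`.

up : Bool → Maybe ℕ → Maybe ℕ
up b (just j) = just (suc j)
up true nothing = just 0
up false nothing = nothing

-- The largest letter of `D` that is at most `x`. Letters are one-based and positions zero-based, so
-- the result is that letter minus one.
below : ∀ {n} → ℕ → Vec Bool n → Maybe ℕ
below zero D = nothing
below (suc x) [] = nothing
below (suc x) (b ∷ D) = up b (below x D)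

wrap : Maybe ℕ → Maybe (Bool × ℕ)
wrap (just j) = just (true , j)
wrap nothing = nothing

choose : Maybe ℕ → Maybe ℕ → Maybe (Bool × ℕ)
choose (just j) _ = just (false , j)
choose nothing m = wrap m

-- The entry which the absence of attacks and co-inversion triples forces to the right of `x`: the
-- first letter of `D` met when descending cyclically from `x`, starting at `x` itself. The flag
-- records a passage from 1 to the top, that is, an ascent in the row.
pick : ∀ {n} → ℕ → Vec Bool n → Maybe (Bool × ℕ)
pick {n} x D = choose (below x D) (below n D)

clear : ∀ {n} → ℕ → Vec Bool n → Vec Bool n
clear _ [] = []
clear zero (b ∷ D) = false ∷ D
clear (suc j) (b ∷ D) = b ∷ clear j D

mutual
  -- Columns are lists read from the top. A triple or an attack compares a row with a cell below it,
  -- so the choice is greedy from the top row downwards.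
  arr : ∀ {n} → List ℕ → Vec Bool n → List ℕ
  arr [] D = []
  arr (x ∷ v) D = arr′ v D (pick x D)

  arr′ : ∀ {n} → List ℕ → Vec Bool n → Maybe (Bool × ℕ) → List ℕ
  arr′ v D nothing = []
  arr′ v D (just (f , j)) = suc j ∷ arr v (clear j D)

mutual
  -- The maj contribution of the ascents between the two columns; `w r` stands for the number of
  -- cells to the right of the left-hand cell in row `r`, and it is shifted as the rows are
  -- consumed.
  cst : ∀ {n} → (ℕ → ℕ) → List ℕ → Vec Bool n → ℕ
  cst w [] D = 0
  cst w (x ∷ v) D = cst′ w v D (pick x D)

  cst′ : ∀ {n} → (ℕ → ℕ) → List ℕ → Vec Bool n → Maybe (Bool × ℕ) → ℕ
  cst′ w v D nothing = 0
  cst′ w v D (just (f , j)) = (if f then w 0 else 0) ℕ.+ cst (w ∘ suc) v (clear j D)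

-- The length of row `r`, counted from 0 at the top, in the diagram with the given column heights.
wt : List ℕ → ℕ → ℕ
wt [] r = 0
wt (h ∷ μ) r = (if r <ᵇ h then 1 else 0) ℕ.+ wt μ r

-- Coefficients of a series in t and x_1, ..., x_n. Integer exponents make multiplication by a
-- monomial a mere shift of the arguments.
Ser : ℕ → Set
Ser n = ℤ → Vec ℤ n → ℤ

isZ : ∀ {n} → Vec ℤ n → Bool
isZ [] = true
isZ (a ∷ α) = does (a ℤₚ.≟ 0ℤ) ∧ isZ α

-- The coefficient of t^e x^α in the sum over all columns of heights `μ` to the right of `v`,
-- multiplied by the series `φ` in t. With `φ` equal to 1 it counts fillings; a general `φ` lets
-- another series be carried along linearly.
Φ : ∀ {n} → (ℤ → ℤ) → List ℕ → List ℕ → Ser n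
Φ φ [] v e α = isZ α ▸ φ e
Φ {n} φ (h ∷ μ) v e α =
  ∑ (bits n) λ D → (size D ≡ᵇ h) ▸ Φ φ μ (arr v D) (e - + cst (wt (h ∷ μ)) v D) (α ⊖ D)

-- Symmetry of `Φ` in two neighbouring variables.

τ : ℕ → ℕ → ℕ
τ zero 0 = 1
τ zero 1 = 0
τ zero (suc (suc x)) = suc (suc x)
τ (suc i) zero = zero
τ (suc i) (suc x) = suc (τ i x)

θ : ℕ → ℕ → ℕ
θ i zero = zero
θ i (suc x) = suc (τ i x)

mapτ : ℕ → Maybe (Bool × ℕ) → Maybe (Bool × ℕ)
mapτ i (just (f , j)) = just (f , τ i j)
mapτ i nothing = nothing

up-τ : ∀ i b m → Maybe.map (τ (suc i)) (up b m) ≡ up b (Maybe.map (τ i) m)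
up-τ i b (just x) = refl
up-τ i true nothing = refl
up-τ i false nothing = refl

-- The bound `x` must not separate the two exchanged letters, and `x ≢ suc i` says just this;
-- otherwise exactly one of the two sets would have its letter below the bound.
below-swapAt : ∀ {n} i x (D : Vec Bool n) → suc i < n → x ≢ suc i → bit i D ≡ not (bit (suc i) D) →
               below x (swapAt i D) ≡ Maybe.map (τ i) (below x D)
below-swapAt i zero D _ _ _ = refl
below-swapAt zero (suc zero) D _ h _ = ⊥-elim (h refl)
below-swapAt zero (suc (suc x)) (a ∷ b ∷ D) _ _ t with below x D
... | just j = refl
below-swapAt zero (suc (suc x)) (true ∷ false ∷ D) _ _ t | nothing = refl
below-swapAt zero (suc (suc x)) (false ∷ true ∷ D) _ _ t | nothing = refl
below-swapAt zero (suc (suc x)) (a ∷ []) (s≤s ()) _ t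
below-swapAt (suc i) (suc x) (a ∷ D) (s≤s i<n) h t =
  cong (up a) (below-swapAt i x D i<n (h ∘ cong suc) t) ∙ sym (up-τ i a (below x D))

below-bit : ∀ {n} i (D : Vec Bool n) → bit i D ≡ true → below (suc i) D ≡ just i
below-bit zero (true ∷ D) refl = refl
below-bit (suc i) (a ∷ D) h = cong (up a) (below-bit i D h)

below-skip : ∀ {n} i (D : Vec Bool n) → bit i D ≡ false → below (suc i) D ≡ below i D
below-skip zero [] h = refl
below-skip zero (false ∷ D) refl = refl
below-skip (suc i) [] h = refl
below-skip (suc i) (a ∷ D) h = cong (up a) (below-skip i D h)

below-true : ∀ {n} x (D : Vec Bool n) {j} → below x D ≡ just j → bit j D ≡ true
below-true (suc x) (b ∷ D) h with below x D in eq
below-true (suc x) (b ∷ D) refl | just j = below-true x D eq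
below-true (suc x) (true ∷ D) refl | nothing = refl

below-≢ : ∀ {n} i x (D : Vec Bool n) → bit (suc i) D ≡ true → x ≢ suc i → below x D ≢ just i
below-≢ i zero D t h ()
below-≢ zero (suc zero) D t h = ⊥-elim (h refl)
below-≢ zero (suc (suc x)) (a ∷ true ∷ D) t h e with below x D
below-≢ zero (suc (suc x)) (a ∷ true ∷ D) t h () | just j
below-≢ zero (suc (suc x)) (a ∷ true ∷ D) t h () | nothing
below-≢ (suc i) (suc x) (a ∷ D) t h e with below x D in eq
below-≢ (suc i) (suc x) (a ∷ D) t h refl | just j = below-≢ i x D t (h ∘ cong suc) eq
below-≢ (suc i) (suc x) (true ∷ D) t h () | nothing

bit-clear : ∀ {n} j (D : Vec Bool n) → bit j (clear j D) ≡ false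
bit-clear _ [] = refl
bit-clear zero (b ∷ D) = refl
bit-clear (suc j) (b ∷ D) = bit-clear j D

bit-clear-≢ : ∀ {n} k j (D : Vec Bool n) → k ≢ j → bit k (clear j D) ≡ bit k D
bit-clear-≢ k j [] h = refl
bit-clear-≢ zero zero (b ∷ D) h = ⊥-elim (h refl)
bit-clear-≢ zero (suc j) (b ∷ D) h = refl
bit-clear-≢ (suc k) zero (b ∷ D) h = refl
bit-clear-≢ (suc k) (suc j) (b ∷ D) h = bit-clear-≢ k j D (h ∘ cong suc)

bit-clear-false : ∀ {n} k j (D : Vec Bool n) → bit k D ≡ false → bit k (clear j D) ≡ false
bit-clear-false k j D h with k ℕₚ.≟ j
... | yes refl = bit-clear k D
... | no ne = bit-clear-≢ k j D ne ∙ h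

clear-swapAt : ∀ {n} i j (D : Vec Bool n) → suc i < n → clear (τ i j) (swapAt i D) ≡ swapAt i (clear j D)
clear-swapAt i j [] ()
clear-swapAt zero 0 (a ∷ b ∷ D) _ = refl
clear-swapAt zero 1 (a ∷ b ∷ D) _ = refl
clear-swapAt zero (suc (suc j)) (a ∷ b ∷ D) _ = refl
clear-swapAt zero j (a ∷ []) (s≤s ())
clear-swapAt (suc i) zero (a ∷ D) _ = refl
clear-swapAt (suc i) (suc j) (a ∷ D) (s≤s h) = cong (a ∷_) (clear-swapAt i j D h)

τ-lo : ∀ i → τ i i ≡ suc i
τ-lo zero = refl
τ-lo (suc i) = cong suc (τ-lo i)

τ-hi : ∀ i → τ i (suc i) ≡ i
τ-hi zero = refl
τ-hi (suc i) = cong suc (τ-hi i)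

τ-other : ∀ i j → j ≢ i → j ≢ suc i → τ i j ≡ j
τ-other zero 0 h _ = ⊥-elim (h refl)
τ-other zero 1 _ h = ⊥-elim (h refl)
τ-other zero (suc (suc j)) _ _ = refl
τ-other (suc i) zero _ _ = refl
τ-other (suc i) (suc j) h h' = cong suc (τ-other i j (h ∘ cong suc) (h' ∘ cong suc))

θ-other : ∀ i x → x ≢ suc i → x ≢ suc (suc i) → θ i x ≡ x
θ-other i zero _ _ = refl
θ-other i (suc x) h h' = cong suc (τ-other i x (h ∘ cong suc) (h' ∘ cong suc))

Avoids : ℕ → List ℕ → Set
Avoids x = All (_≢ x)

θ-fix : ∀ i v → Avoids (suc i) v → Avoids (suc (suc i)) v → map (θ i) v ≡ v
θ-fix i [] [] [] = refl
θ-fix i (x ∷ v) (a ∷ as) (b ∷ bs) = cong₂ _∷_ (θ-other i x a b) (θ-fix i v as bs)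

-- Of the two letters `suc i` and `suc (suc i)`, the larger one is met first from the top, and only
-- once. Such a left column makes `Φ` symmetric in the two variables. An arrangement has the
-- property unless its set contains only the smaller letter.
data Good (i : ℕ) : List ℕ → Set where
  gnil : Good i []
  gskip : ∀ {x v} → x ≢ suc i → x ≢ suc (suc i) → Good i v → Good i (x ∷ v)
  gtop : ∀ {v} → Avoids (suc (suc i)) v → Good i (suc (suc i) ∷ v)

pick-true : ∀ {n} x (D : Vec Bool n) {f j} → pick x D ≡ just (f , j) → bit j D ≡ true
pick-true {n} x D h with below x D in eq | below n D in eq'
pick-true x D refl | just _ | _ = below-true x D eq
pick-true {n} x D refl | nothing | just _ = below-true n D eq'

arr-avoids : ∀ {n} k v (D : Vec Bool n) → bit k D ≡ false → Avoids (suc k) (arr v D)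
arr-avoids k [] D h = []
arr-avoids k (x ∷ v) D h with pick x D in eq
... | nothing = []
... | just (f , j) =
  (λ e → case trans (sym h) (cong (λ t → bit t D) (sym (suc-injective e)) ∙ pick-true x D eq) of λ ())
  ∷ arr-avoids k v (clear j D) (bit-clear-false k j D h)

good-arr : ∀ {n} i v (D : Vec Bool n) → bit i D ≡ false → Good i (arr v D)
good-arr i [] D h = gnil
good-arr i (x ∷ v) D h with pick x D in eq
... | nothing = gnil
... | just (f , j) with j ℕₚ.≟ suc i
...   | yes refl = gtop (arr-avoids (suc i) v (clear (suc i) D) (bit-clear (suc i) D))
...   | no ne = gskip (λ e → case trans (sym h) (cong (λ t → bit t D) (sym (suc-injective e)) ∙ pick-true x D eq) of λ ())
                      (ne ∘ suc-injective) (good-arr i v (clear j D) (bit-clear-false i j D h))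

module _ {n} (i : ℕ) (i<n : suc i < n) where

  n≢ : n ≢ suc i
  n≢ refl = ℕₚ.<-irrefl refl i<n

  -- The bounds `suc i` and `suc (suc i)` can be told apart only by the letter `suc (suc i)`, which
  -- is absent from `D`.
  pick-none : ∀ x (D : Vec Bool n) → bit i D ≡ false → bit (suc i) D ≡ false → pick (θ i x) D ≡ pick x D
  pick-none x D h h' with x ℕₚ.≟ suc i | x ℕₚ.≟ suc (suc i)
  ... | yes refl | _ rewrite τ-lo i | below-skip (suc i) D h' = refl
  ... | no _ | yes refl rewrite τ-hi i | below-skip (suc i) D h' = refl
  ... | no p | no q rewrite θ-other i x p q = refl

  pick-lo : ∀ x (D : Vec Bool n) → bit i D ≡ true → bit (suc i) D ≡ false → pick (θ i x) D ≡ pick x D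
  pick-lo x D h h' with x ℕₚ.≟ suc i | x ℕₚ.≟ suc (suc i)
  ... | yes refl | _ rewrite τ-lo i | below-skip (suc i) D h' = refl
  ... | no _ | yes refl rewrite τ-hi i | below-skip (suc i) D h' = refl
  ... | no p | no q rewrite θ-other i x p q = refl

  pick-swapAt : ∀ x (D : Vec Bool n) → bit i D ≡ not (bit (suc i) D) → x ≢ suc i →
                pick x (swapAt i D) ≡ mapτ i (pick x D)
  pick-swapAt x D t h rewrite below-swapAt i x D i<n h t | below-swapAt i n D i<n n≢ t with below x D | below n D
  ... | just _ | _ = refl
  ... | nothing | just _ = refl
  ... | nothing | nothing = refl

  θ≢ : ∀ x → x ≢ suc (suc i) → θ i x ≢ suc i
  θ≢ x h e with x ℕₚ.≟ suc i
  ... | yes refl = ℕₚ.1+n≢n (suc-injective (cong suc (sym (τ-lo i)) ∙ e))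
  ... | no p = p (sym (θ-other i x p h) ∙ e)

  pick-swapAt' : ∀ x (D : Vec Bool n) → bit i D ≡ true → bit (suc i) D ≡ false → x ≢ suc (suc i) →
                 pick (θ i x) (swapAt i D) ≡ mapτ i (pick x D)
  pick-swapAt' x D h h' ne =
    pick-swapAt (θ i x) D (h ∙ cong not (sym h')) (θ≢ x ne) ∙ cong (mapτ i) (pick-lo x D h h')

  arr-none : ∀ v (D : Vec Bool n) → bit i D ≡ false → bit (suc i) D ≡ false → arr (map (θ i) v) D ≡ arr v D
  arr-none [] D h h' = refl
  arr-none (x ∷ v) D h h' rewrite pick-none x D h h' with pick x D
  ... | nothing = refl
  ... | just (f , j) =
    cong (suc j ∷_) (arr-none v (clear j D) (bit-clear-false i j D h) (bit-clear-false (suc i) j D h'))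

  cst-none : ∀ w v (D : Vec Bool n) → bit i D ≡ false → bit (suc i) D ≡ false →
             cst w (map (θ i) v) D ≡ cst w v D
  cst-none w [] D h h' = refl
  cst-none w (x ∷ v) D h h' rewrite pick-none x D h h' with pick x D
  ... | nothing = refl
  ... | just (f , j) =
    cong (_ ℕ.+_) (cst-none (w ∘ suc) v (clear j D) (bit-clear-false i j D h) (bit-clear-false (suc i) j D h'))

  arr-none-fix : ∀ v (D : Vec Bool n) → bit i D ≡ false → bit (suc i) D ≡ false →
                 map (θ i) (arr v D) ≡ arr v D
  arr-none-fix v D h h' = θ-fix i _ (arr-avoids i v D h) (arr-avoids (suc i) v D h')

  clear-lo : (D : Vec Bool n) → bit (suc i) D ≡ false →
             bit i (clear i D) ≡ false × bit (suc i) (clear i D) ≡ false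
  clear-lo D h' = bit-clear i D , bit-clear-false (suc i) i D h'

  swap-clear : (D : Vec Bool n) → bit (suc i) D ≡ false → swapAt i (clear i D) ≡ clear i D
  swap-clear D h' = swapAt-same i (clear i D) (proj₁ (clear-lo D h') ∙ sym (proj₂ (clear-lo D h')))

  -- D contains the letter i+1 but not i+2 (letters are one-based, bits zero-based).
  arr-lo : ∀ v (D : Vec Bool n) → bit i D ≡ true → bit (suc i) D ≡ false → arr (map (θ i) v) D ≡ arr v D
  arr-lo [] D h h' = refl
  arr-lo (x ∷ v) D h h' rewrite pick-lo x D h h' with pick x D
  ... | nothing = refl
  ... | just (f , j) with j ℕₚ.≟ i
  ...   | yes refl = cong (suc j ∷_) (arr-none v (clear i D) (proj₁ (clear-lo D h')) (proj₂ (clear-lo D h')))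
  ...   | no ne = cong (suc j ∷_) (arr-lo v (clear j D) (bit-clear-≢ i j D (ne ∘ sym) ∙ h)
                                           (bit-clear-false (suc i) j D h'))

  cst-lo : ∀ w v (D : Vec Bool n) → bit i D ≡ true → bit (suc i) D ≡ false →
           cst w (map (θ i) v) D ≡ cst w v D
  cst-lo w [] D h h' = refl
  cst-lo w (x ∷ v) D h h' rewrite pick-lo x D h h' with pick x D
  ... | nothing = refl
  ... | just (f , j) with j ℕₚ.≟ i
  ...   | yes refl = cong (_ ℕ.+_) (cst-none (w ∘ suc) v (clear i D) (proj₁ (clear-lo D h')) (proj₂ (clear-lo D h')))
  ...   | no ne = cong (_ ℕ.+_) (cst-lo (w ∘ suc) v (clear j D) (bit-clear-≢ i j D (ne ∘ sym) ∙ h)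
                                           (bit-clear-false (suc i) j D h'))

  -- Both runs make corresponding choices until the exchanged letter is placed; then the remaining
  -- sets coincide and contain neither letter. A bound `suc i`, which would separate the letters,
  -- can come only after `suc (suc i)`, and there the letter has been used already.
  arr-hi : ∀ v (D : Vec Bool n) → bit i D ≡ true → bit (suc i) D ≡ false → Good i v →
           arr v (swapAt i D) ≡ map (θ i) (arr v D)
  arr-hi-top : ∀ x v (D : Vec Bool n) → bit i D ≡ true → bit (suc i) D ≡ false → x ≢ suc i →
               (∀ E → bit i E ≡ true → bit (suc i) E ≡ false → arr v (swapAt i E) ≡ map (θ i) (arr v E)) →
               arr (x ∷ v) (swapAt i D) ≡ map (θ i) (arr (x ∷ v) D)
  arr-hi-top x v D h h' ne rec rewrite pick-swapAt x D (h ∙ cong not (sym h')) ne with pick x D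
  ... | nothing = refl
  ... | just (f , j) rewrite clear-swapAt i j D i<n with j ℕₚ.≟ i
  ...   | yes refl rewrite swap-clear D h' =
    cong (_ ∷_) (sym (arr-none-fix v (clear i D) (proj₁ (clear-lo D h')) (proj₂ (clear-lo D h'))))
  ...   | no nej = cong (_ ∷_) (rec (clear j D) (bit-clear-≢ i j D (nej ∘ sym) ∙ h) (bit-clear-false (suc i) j D h'))

  arr-hi [] D h h' g = refl
  arr-hi (x ∷ v) D h h' (gskip a b g) = arr-hi-top x v D h h' a (λ E p q → arr-hi v E p q g)
  arr-hi (_ ∷ v) D h h' (gtop _)
    rewrite pick-swapAt (suc (suc i)) D (h ∙ cong not (sym h')) (ℕₚ.1+n≢n)
          | trans (below-skip (suc i) D h') (below-bit i D h)
          | clear-swapAt i i D i<n | swap-clear D h' =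
    cong (_ ∷_) (sym (arr-none-fix v (clear i D) (proj₁ (clear-lo D h')) (proj₂ (clear-lo D h'))))

  cst-hi : ∀ w v (D : Vec Bool n) → bit i D ≡ true → bit (suc i) D ≡ false → Good i v →
           cst w v (swapAt i D) ≡ cst w v D
  cst-hi w [] D h h' g = refl
  cst-hi w (x ∷ v) D h h' (gskip a b g)
    rewrite pick-swapAt x D (h ∙ cong not (sym h')) a with pick x D
  ... | nothing = refl
  ... | just (f , j) rewrite clear-swapAt i j D i<n with j ℕₚ.≟ i
  ...   | yes refl rewrite swap-clear D h' = refl
  ...   | no nej = cong (_ ℕ.+_) (cst-hi (w ∘ suc) v (clear j D) (bit-clear-≢ i j D (nej ∘ sym) ∙ h) (bit-clear-false (suc i) j D h') g)
  cst-hi w (_ ∷ v) D h h' (gtop _)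
    rewrite pick-swapAt (suc (suc i)) D (h ∙ cong not (sym h')) (ℕₚ.1+n≢n)
          | trans (below-skip (suc i) D h') (below-bit i D h)
          | clear-swapAt i i D i<n | swap-clear D h' = refl

  arr-hi' : ∀ v (D : Vec Bool n) → bit i D ≡ true → bit (suc i) D ≡ false → Avoids (suc (suc i)) v →
            arr (map (θ i) v) (swapAt i D) ≡ map (θ i) (arr v D)
  arr-hi' [] D h h' g = refl
  arr-hi' (x ∷ v) D h h' (ne ∷ g) rewrite pick-swapAt' x D h h' ne with pick x D
  ... | nothing = refl
  ... | just (f , j) rewrite clear-swapAt i j D i<n with j ℕₚ.≟ i
  ...   | yes refl rewrite swap-clear D h' =
    cong (_ ∷_) (arr-none v (clear i D) (proj₁ (clear-lo D h')) (proj₂ (clear-lo D h')) ∙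
                  sym (arr-none-fix v (clear i D) (proj₁ (clear-lo D h')) (proj₂ (clear-lo D h'))))
  ...   | no nej = cong (_ ∷_) (arr-hi' v (clear j D) (bit-clear-≢ i j D (nej ∘ sym) ∙ h) (bit-clear-false (suc i) j D h') g)

  cst-hi' : ∀ w v (D : Vec Bool n) → bit i D ≡ true → bit (suc i) D ≡ false → Avoids (suc (suc i)) v →
            cst w (map (θ i) v) (swapAt i D) ≡ cst w v D
  cst-hi' w [] D h h' g = refl
  cst-hi' w (x ∷ v) D h h' (ne ∷ g) rewrite pick-swapAt' x D h h' ne with pick x D
  ... | nothing = refl
  ... | just (f , j) rewrite clear-swapAt i j D i<n with j ℕₚ.≟ i
  ...   | yes refl rewrite swap-clear D h' =
    cong (_ ℕ.+_) (cst-none (w ∘ suc) v (clear i D) (proj₁ (clear-lo D h')) (proj₂ (clear-lo D h')))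
  ...   | no nej = cong (_ ℕ.+_) (cst-hi' (w ∘ suc) v (clear j D) (bit-clear-≢ i j D (nej ∘ sym) ∙ h) (bit-clear-false (suc i) j D h') g)

  pick-≢ : ∀ x (D : Vec Bool n) {f} → bit (suc i) D ≡ true → x ≢ suc i → pick x D ≢ just (f , i)
  pick-≢ x D t ne e with below x D in eq | below n D in eq'
  pick-≢ x D t ne refl | just _ | _ = below-≢ i x D t ne eq
  pick-≢ x D t ne refl | nothing | just _ = below-≢ i n D t n≢ eq'

  Related : List ℕ → List ℕ → Set
  Related w w' = w' ≡ w ⊎ w' ≡ map (θ i) w

  -- While no bound distinguishes the letters, the larger one is picked first, and after it the two
  -- runs agree. If the bound `suc (suc i)` comes first, the runs take different letters there and
  -- continue as exchanged copies of each other.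
  arr-both : ∀ v (D : Vec Bool n) → bit i D ≡ true → bit (suc i) D ≡ true → Good i v →
             Good i (arr v D) × Related (arr v D) (arr (map (θ i) v) D)
  arr-both [] D h h' g = gnil , inj₁ refl
  arr-both (x ∷ v) D h h' (gskip a b g) rewrite θ-other i x a b with pick x D in eq
  ... | nothing = gnil , inj₁ refl
  ... | just (f , j) with j ℕₚ.≟ suc i
  ...   | yes refl = gtop (arr-avoids (suc i) v (clear (suc i) D) (bit-clear (suc i) D)) ,
    inj₁ (cong (_ ∷_) (arr-lo v (clear (suc i) D) (bit-clear-≢ i (suc i) D (ℕₚ.1+n≢n ∘ sym) ∙ h) (bit-clear (suc i) D)))
  ...   | no ne with j ℕₚ.≟ i
  ...     | yes refl = ⊥-elim (pick-≢ x D h' a eq)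
  ...     | no nej with arr-both v (clear j D) (bit-clear-≢ i j D (nej ∘ sym) ∙ h) (bit-clear-≢ (suc i) j D (ne ∘ sym) ∙ h') g
  ...       | gd , inj₁ e = gskip (nej ∘ suc-injective) (ne ∘ suc-injective) gd , inj₁ (cong (_ ∷_) e)
  ...       | gd , inj₂ e = gskip (nej ∘ suc-injective) (ne ∘ suc-injective) gd ,
    inj₂ (cong₂ _∷_ (cong suc (sym (τ-other i j nej ne))) e)
  arr-both (_ ∷ v) D h h' (gtop av)
    rewrite below-bit (suc i) D h' | τ-hi i | below-bit i D h =
    gtop (arr-avoids (suc i) v (clear (suc i) D) (bit-clear (suc i) D)) ,
    inj₂ (cong (_ ∷_)
      (cong (arr (map (θ i) v)) clear≡ ∙
        arr-hi' v (clear (suc i) D) (bit-clear-≢ i (suc i) D (ℕₚ.1+n≢n ∘ sym) ∙ h) (bit-clear (suc i) D) av))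
    where
    clear≡ : clear i D ≡ swapAt i (clear (suc i) D)
    clear≡ = cong₂ clear (sym (τ-hi i)) (sym (swapAt-same i D (h ∙ sym h'))) ∙ clear-swapAt i (suc i) D i<n

  cst-both : ∀ w v (D : Vec Bool n) → bit i D ≡ true → bit (suc i) D ≡ true → Good i v →
             cst w (map (θ i) v) D ≡ cst w v D
  cst-both w [] D h h' g = refl
  cst-both w (x ∷ v) D h h' (gskip a b g) rewrite θ-other i x a b with pick x D in eq
  ... | nothing = refl
  ... | just (f , j) with j ℕₚ.≟ suc i
  ...   | yes refl = cong (_ ℕ.+_) (cst-lo (w ∘ suc) v (clear (suc i) D) (bit-clear-≢ i (suc i) D (ℕₚ.1+n≢n ∘ sym) ∙ h) (bit-clear (suc i) D))
  ...   | no ne with j ℕₚ.≟ i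
  ...     | yes refl = ⊥-elim (pick-≢ x D h' a eq)
  ...     | no nej = cong (_ ℕ.+_) (cst-both (w ∘ suc) v (clear j D) (bit-clear-≢ i j D (nej ∘ sym) ∙ h) (bit-clear-≢ (suc i) j D (ne ∘ sym) ∙ h') g)
  cst-both w (_ ∷ v) D h h' (gtop av)
    rewrite below-bit (suc i) D h' | τ-hi i | below-bit i D h =
      cong (cst (w ∘ suc) (map (θ i) v)) clear≡ ∙
        cst-hi' (w ∘ suc) v (clear (suc i) D) (bit-clear-≢ i (suc i) D (ℕₚ.1+n≢n ∘ sym) ∙ h) (bit-clear (suc i) D) av
    where
    clear≡ : clear i D ≡ swapAt i (clear (suc i) D)
    clear≡ = cong₂ clear (sym (τ-hi i)) (sym (swapAt-same i D (h ∙ sym h'))) ∙ clear-swapAt i (suc i) D i<n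

dec : ∀ {n} → ℕ → Vec ℤ n → Vec ℤ n
dec _ [] = []
dec zero (a ∷ α) = (a - 1ℤ) ∷ α
dec (suc i) (a ∷ α) = a ∷ dec i α

dec-⊖ : ∀ {n} i (α : Vec ℤ n) D → dec i α ⊖ D ≡ dec i (α ⊖ D)
dec-⊖ i [] [] = refl
dec-⊖ zero (a ∷ α) (b ∷ D) = cong (_∷ _) (lem a [ b ]ᵇ)
  where
  lem : ∀ a b → (a - 1ℤ) - b ≡ (a - b) - 1ℤ
  lem = solve-∀
dec-⊖ (suc i) (a ∷ α) (b ∷ D) = cong (_ ∷_) (dec-⊖ i α D)

dec-comm : ∀ {n} i j (α : Vec ℤ n) → dec i (dec j α) ≡ dec j (dec i α)
dec-comm i j [] = refl
dec-comm zero zero (a ∷ α) = refl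
dec-comm zero (suc j) (a ∷ α) = refl
dec-comm (suc i) zero (a ∷ α) = refl
dec-comm (suc i) (suc j) (a ∷ α) = cong (a ∷_) (dec-comm i j α)

⊖-dec : ∀ {n} i (α : Vec ℤ n) D → bit i D ≡ true → α ⊖ D ≡ dec i (α ⊖ clear i D)
⊖-dec zero (a ∷ α) (true ∷ D) refl = cong (_∷ _) (minus-0-1 a)
⊖-dec (suc i) (a ∷ α) (b ∷ D) h = cong (_ ∷_) (⊖-dec i α D h)

⊖-swap-dec : ∀ {n} i (α : Vec ℤ n) D → bit i D ≡ true → bit (suc i) D ≡ false → suc i < n →
             α ⊖ swapAt i D ≡ dec (suc i) (α ⊖ clear i D)
⊖-swap-dec i [] D h h' ()
⊖-swap-dec zero (a ∷ []) D h h' (s≤s ())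
⊖-swap-dec zero (a ∷ a' ∷ α) (true ∷ false ∷ D) refl refl _ = cong (λ t → _ ∷ t ∷ _) (minus-0-1 a')
⊖-swap-dec (suc i) (a ∷ α) (b ∷ D) h h' (s≤s l) = cong (_ ∷_) (⊖-swap-dec i α D h h' l)

isZ-swapAt : ∀ {n} i (α : Vec ℤ n) → isZ (swapAt i α) ≡ isZ α
isZ-swapAt _ [] = refl
isZ-swapAt zero (a ∷ []) = refl
isZ-swapAt zero (a ∷ b ∷ α) with does (a ℤₚ.≟ 0ℤ) | does (b ℤₚ.≟ 0ℤ)
... | true | true = refl
... | true | false = refl
... | false | true = refl
... | false | false = refl
isZ-swapAt (suc i) (a ∷ α) = cong (does (a ℤₚ.≟ 0ℤ) ∧_) (isZ-swapAt i α)

τ-invol : ∀ i k → τ i (τ i k) ≡ k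
τ-invol zero 0 = refl
τ-invol zero 1 = refl
τ-invol zero (suc (suc k)) = refl
τ-invol (suc i) zero = refl
τ-invol (suc i) (suc k) = cong suc (τ-invol i k)

θ-invol : ∀ i k → θ i (θ i k) ≡ k
θ-invol i zero = refl
θ-invol i (suc k) = cong suc (τ-invol i k)

map-θ-invol : ∀ i u → map (θ i) (map (θ i) u) ≡ u
map-θ-invol i [] = refl
map-θ-invol i (x ∷ u) = cong₂ _∷_ (θ-invol i x) (map-θ-invol i u)

guard₂ : ∀ b {b' x y z w} → b' ≡ b → x + y ≡ z + w → b ▸ x + b' ▸ y ≡ b ▸ z + b' ▸ w
guard₂ true refl h = h
guard₂ false refl h = refl

guard₄ : ∀ b {b' x₁ x₂ x₃ x₄ y₁ y₂ y₃ y₄} → b' ≡ b → (x₁ + x₂) + (x₃ + x₄) ≡ (y₁ + y₂) + (y₃ + y₄) →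
         (b ▸ x₁ + b ▸ x₂) + (b' ▸ x₃ + b' ▸ x₄) ≡ (b ▸ y₁ + b ▸ y₂) + (b' ▸ y₃ + b' ▸ y₄)
guard₄ true refl h = h
guard₄ false refl h = refl

-- The two halves are proved together; the second says that Φ_v = π_i Φ_{θ v} for the
-- Demazure operator π_i f = (x_i f - x_{i+1} s_i f) / (x_i - x_{i+1}), cleared of its denominator.
module _ {n} (i : ℕ) (i<n : suc i < n) (φ : ℤ → ℤ) where

  private j = suc i

  arr-hi⁻ : ∀ v (D : Vec Bool n) → bit i D ≡ true → bit j D ≡ false → Good i v →
            arr v D ≡ map (θ i) (arr v (swapAt i D))
  arr-hi⁻ v D p q g = sym (cong (map (θ i)) (arr-hi i i<n v D p q g) ∙ map-θ-invol i (arr v D))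

  Φ-sym : ∀ μ v → Good i v → ∀ e (α : Vec ℤ n) → Φ φ μ v e (swapAt i α) ≡ Φ φ μ v e α
  Φ-rel : ∀ μ v → Good i v → ∀ e (α : Vec ℤ n) →
          Φ φ μ v e (dec i α) + Φ φ μ (map (θ i) v) e (swapAt i (dec j α)) ≡
          Φ φ μ (map (θ i) v) e (dec i α) + Φ φ μ v e (dec j α)

  Φ-sym [] v g e α = cong (_▸ φ e) (isZ-swapAt i α)
  Φ-sym (h ∷ μ) v g e α = ∑-pairs n i _ _ i<n same pair
    where
    W = wt (h ∷ μ)
    f g′ : Vec Bool n → ℤ
    f D = (size D ≡ᵇ h) ▸ Φ φ μ (arr v D) (e - + cst W v D) (swapAt i α ⊖ D)
    g′ D = (size D ≡ᵇ h) ▸ Φ φ μ (arr v D) (e - + cst W v D) (α ⊖ D)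
    same : ∀ D → bit i D ≡ bit j D → f D ≡ g′ D
    same D eq = ▸-cong (size D ≡ᵇ h) λ _ →
      trans (cong (Φ φ μ (arr v D) _) (cong (swapAt i α ⊖_) (sym (swapAt-same i D eq)) ∙ sym (swapAt-⊖ i α D)))
        (Φ-sym μ (arr v D) good _ (α ⊖ D))
      where
      good : Good i (arr v D)
      good with bit i D in p
      ... | false = good-arr i v D p
      ... | true = proj₁ (arr-both i i<n v D p (sym eq) g)
    pair : ∀ D → bit i D ≡ true → bit j D ≡ false → f D + f (swapAt i D) ≡ g′ D + g′ (swapAt i D)
    -- The two sets of the orbit lead to the left columns `θ w` and `w`; neither summand need be
    -- symmetric alone, but their sum is, by `Φ-rel` for the remaining heights.
    pair D p q = guard₂ (size D ≡ᵇ h) (cong (_≡ᵇ h) (size-swapAt i D)) goal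
      where
      w = arr v (swapAt i D)
      w' = map (θ i) w
      c = e - + cst W v D
      γ = α ⊖ clear i D
      gw : Good i w
      gw = good-arr i v (swapAt i D) (bit-swapAt i D i<n ∙ q)
      w'≡ : arr v D ≡ w'
      w'≡ = arr-hi⁻ v D p q g
      lo : ∀ (α' : Vec ℤ n) → α' ⊖ D ≡ dec i (α' ⊖ clear i D)
      lo α' = ⊖-dec i α' D p
      hi : ∀ (α' : Vec ℤ n) → α' ⊖ swapAt i D ≡ dec j (α' ⊖ clear i D)
      hi α' = ⊖-swap-dec i α' D p q i<n
      s-lo : swapAt i α ⊖ D ≡ swapAt i (dec j γ)
      s-lo = cong (swapAt i α ⊖_) (sym (swapAt-invol i D)) ∙ sym (swapAt-⊖ i α (swapAt i D)) ∙ cong (swapAt i) (hi α)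
      s-hi : swapAt i α ⊖ swapAt i D ≡ swapAt i (dec i γ)
      s-hi = sym (swapAt-⊖ i α D) ∙ cong (swapAt i) (lo α)
      goal : Φ φ μ (arr v D) (e - + cst W v D) (swapAt i α ⊖ D) + Φ φ μ w (e - + cst W v (swapAt i D)) (swapAt i α ⊖ swapAt i D)
           ≡ Φ φ μ (arr v D) (e - + cst W v D) (α ⊖ D) + Φ φ μ w (e - + cst W v (swapAt i D)) (α ⊖ swapAt i D)
      goal rewrite cst-hi i i<n W v D p q g | w'≡ | lo α | hi α | s-lo | s-hi | Φ-sym μ w gw c (dec i γ) =
        ℤₚ.+-comm (Φ φ μ w' c (swapAt i (dec j γ))) _ ∙ Φ-rel μ w gw c γ

  Φ-rel [] v g e α rewrite isZ-swapAt i (dec j α) = refl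
  Φ-rel (h ∷ μ) v g e α =
    sym (∑-+ (bits n) _ _) ∙ ∑-pairs n i _ _ i<n same pair ∙ ∑-+ (bits n) _ _
    where
    W = wt (h ∷ μ)
    u = map (θ i) v
    f g′ : Vec Bool n → ℤ
    f D = (size D ≡ᵇ h) ▸ Φ φ μ (arr v D) (e - + cst W v D) (dec i α ⊖ D)
        + (size D ≡ᵇ h) ▸ Φ φ μ (arr u D) (e - + cst W u D) (swapAt i (dec j α) ⊖ D)
    g′ D = (size D ≡ᵇ h) ▸ Φ φ μ (arr u D) (e - + cst W u D) (dec i α ⊖ D)
         + (size D ≡ᵇ h) ▸ Φ φ μ (arr v D) (e - + cst W v D) (dec j α ⊖ D)
    same : ∀ D → bit i D ≡ bit j D → f D ≡ g′ D
    same D eq = guard₂ (size D ≡ᵇ h) refl goal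
      where
      γ = α ⊖ D
      s-hi : swapAt i (dec j α) ⊖ D ≡ swapAt i (dec j γ)
      s-hi = cong (swapAt i (dec j α) ⊖_) (sym (swapAt-same i D eq)) ∙
               sym (swapAt-⊖ i (dec j α) D) ∙ cong (swapAt i) (dec-⊖ j α D)
      facts : Good i (arr v D) × Related i i<n (arr v D) (arr u D) × cst W u D ≡ cst W v D
      facts with bit i D in p
      ... | false = good-arr i v D p , inj₁ (arr-none i i<n v D p (sym eq)) , cst-none i i<n W v D p (sym eq)
      ... | true = proj₁ ab , proj₂ ab , cst-both i i<n W v D p (sym eq) g
        where ab = arr-both i i<n v D p (sym eq) g
      goal : Φ φ μ (arr v D) (e - + cst W v D) (dec i α ⊖ D) + Φ φ μ (arr u D) (e - + cst W u D) (swapAt i (dec j α) ⊖ D)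
           ≡ Φ φ μ (arr u D) (e - + cst W u D) (dec i α ⊖ D) + Φ φ μ (arr v D) (e - + cst W v D) (dec j α ⊖ D)
      goal rewrite proj₂ (proj₂ facts) | dec-⊖ i α D | dec-⊖ j α D | s-hi with proj₁ (proj₂ facts)
      ... | inj₁ eq' rewrite eq' | Φ-sym μ (arr v D) (proj₁ facts) (e - + cst W v D) (dec j γ) = refl
      ... | inj₂ eq' rewrite eq' = Φ-rel μ (arr v D) (proj₁ facts) (e - + cst W v D) γ
    pair : ∀ D → bit i D ≡ true → bit j D ≡ false → f D + f (swapAt i D) ≡ g′ D + g′ (swapAt i D)
    pair D p q = guard₄ (size D ≡ᵇ h) (cong (_≡ᵇ h) (size-swapAt i D)) goal
      where
      D' = swapAt i D
      w = arr v D'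
      w' = map (θ i) w
      y = arr u D'
      c = e - + cst W v D
      c' = e - + cst W u D'
      γ = α ⊖ clear i D
      q' : bit i D' ≡ false
      q' = bit-swapAt i D i<n ∙ q
      gw : Good i w
      gw = good-arr i v D' q'
      gy : Good i y
      gy = good-arr i u D' q'
      w'≡ : arr v D ≡ w'
      w'≡ = arr-hi⁻ v D p q g
      lo : ∀ (α' : Vec ℤ n) → α' ⊖ D ≡ dec i (α' ⊖ clear i D)
      lo α' = ⊖-dec i α' D p
      hi : ∀ (α' : Vec ℤ n) → α' ⊖ D' ≡ dec j (α' ⊖ clear i D)
      hi α' = ⊖-swap-dec i α' D p q i<n
      s-lo : ∀ (α' : Vec ℤ n) → swapAt i α' ⊖ D ≡ swapAt i (dec j (α' ⊖ clear i D))
      s-lo α' = cong (swapAt i α' ⊖_) (sym (swapAt-invol i D)) ∙ sym (swapAt-⊖ i α' D') ∙ cong (swapAt i) (hi α')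
      s-hi : ∀ (α' : Vec ℤ n) → swapAt i α' ⊖ D' ≡ swapAt i (dec i (α' ⊖ clear i D))
      s-hi α' = sym (swapAt-⊖ i α' D) ∙ cong (swapAt i) (lo α')
      P = Φ φ μ
      arith : ∀ a b c d x y → c + a ≡ d + b → (x + a) + (c + y) ≡ (x + d) + (y + b)
      arith a b c d x y h = lem₁ a c x y ∙ cong (λ t → t + (x + y)) h ∙ lem₂ b d x y
        where
        lem₁ : ∀ a c x y → (x + a) + (c + y) ≡ (c + a) + (x + y)
        lem₁ = solve-∀
        lem₂ : ∀ b d x y → (d + b) + (x + y) ≡ (x + d) + (y + b)
        lem₂ = solve-∀
      -- The terms with left column `y` cancel because `y` is good; what remains is `Φ-rel` for `w`
      -- at the exponent `dec j γ`.
      goal : (P (arr v D) (e - + cst W v D) (dec i α ⊖ D) + P (arr u D) (e - + cst W u D) (swapAt i (dec j α) ⊖ D))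
             + (P w (e - + cst W v D') (dec i α ⊖ D') + P y c' (swapAt i (dec j α) ⊖ D'))
           ≡ (P (arr u D) (e - + cst W u D) (dec i α ⊖ D) + P (arr v D) (e - + cst W v D) (dec j α ⊖ D))
             + (P y c' (dec i α ⊖ D') + P w (e - + cst W v D') (dec j α ⊖ D'))
      goal rewrite cst-hi i i<n W v D p q g | cst-lo i i<n W v D p q | arr-lo i i<n v D p q | w'≡
                 | s-lo (dec j α) | s-hi (dec j α) | lo (dec i α) | hi (dec i α) | lo (dec j α) | hi (dec j α)
                 | dec-⊖ i α (clear i D) | dec-⊖ j α (clear i D)
                 | Φ-sym μ y gy c' (dec i (dec j γ)) | dec-comm j i γ
        = arith (P w' c (swapAt i (dec j (dec j γ)))) (P w c (dec j (dec j γ)))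
                (P w c (dec i (dec j γ))) (P w' c (dec i (dec j γ)))
                (P w' c (dec i (dec i γ))) (P y c' (dec i (dec j γ)))
                (Φ-rel μ w gw c (dec j γ))

-- Cyclic rotation of the alphabet.

∑-bits-∷ʳ : ∀ n (f : Vec Bool (suc n) → ℤ) →
            ∑ (bits (suc n)) f ≡ ∑ (bits n) (λ D → f (D ∷ʳ true)) + ∑ (bits n) (λ D → f (D ∷ʳ false))
∑-bits-∷ʳ zero f = ∑-bits zero f
∑-bits-∷ʳ (suc n) f =
  ∑-bits (suc n) f ∙
    cong₂ _+_ (∑-bits-∷ʳ n (f ∘ (true ∷_))) (∑-bits-∷ʳ n (f ∘ (false ∷_))) ∙
      +-exchange (S true true) (S true false) (S false true) (S false false) ∙
        sym (cong₂ _+_ (∑-bits n (λ D → f (D ∷ʳ true))) (∑-bits n (λ D → f (D ∷ʳ false))))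
  where
  S : Bool → Bool → ℤ
  S a b = ∑ (bits n) (λ D → f (a ∷ (D ∷ʳ b)))

⊖-∷ʳ : ∀ {n} (β : Vec ℤ n) a D b → (β ∷ʳ a) ⊖ (D ∷ʳ b) ≡ (β ⊖ D) ∷ʳ (a - [ b ]ᵇ)
⊖-∷ʳ [] a [] b = refl
⊖-∷ʳ (x ∷ β) a (d ∷ D) b = cong (_ ∷_) (⊖-∷ʳ β a D b)

size-∷ʳ : ∀ {n} (D : Vec Bool n) b → size (D ∷ʳ b) ≡ size (b ∷ D)
size-∷ʳ [] b = refl
size-∷ʳ (true ∷ D) true = cong suc (size-∷ʳ D true)
size-∷ʳ (true ∷ D) false = cong suc (size-∷ʳ D false)
size-∷ʳ (false ∷ D) true = size-∷ʳ D true
size-∷ʳ (false ∷ D) false = size-∷ʳ D false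

isZ-∷ʳ : ∀ {n} (β : Vec ℤ n) a → isZ (β ∷ʳ a) ≡ isZ (a ∷ β)
isZ-∷ʳ [] a = refl
isZ-∷ʳ (x ∷ β) a rewrite isZ-∷ʳ β a with does (a ℤₚ.≟ 0ℤ) | does (x ℤₚ.≟ 0ℤ)
... | true | true = refl
... | true | false = refl
... | false | true = refl
... | false | false = refl

below-∷ʳ : ∀ {n} y (D : Vec Bool n) b → y ≤ n → below y (D ∷ʳ b) ≡ below y D
below-∷ʳ zero D b _ = refl
below-∷ʳ (suc y) (d ∷ D) b (s≤s l) = cong (up d) (below-∷ʳ y D b l)

below-all-false : ∀ {n} (D : Vec Bool n) → below (suc n) (D ∷ʳ false) ≡ below n D
below-all-false [] = refl
below-all-false (d ∷ D) = cong (up d) (below-all-false D)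

below-all-true : ∀ {n} (D : Vec Bool n) → below (suc n) (D ∷ʳ true) ≡ just n
below-all-true [] = refl
below-all-true (d ∷ D) = cong (up d) (below-all-true D)

clear-∷ʳ : ∀ {n} j (D : Vec Bool n) b → bit j D ≡ true → clear j (D ∷ʳ b) ≡ clear j D ∷ʳ b
clear-∷ʳ zero (d ∷ D) b h = refl
clear-∷ʳ (suc j) (d ∷ D) b h = cong (d ∷_) (clear-∷ʳ j D b h)

clear-last : ∀ {n} (D : Vec Bool n) b → clear n (D ∷ʳ b) ≡ D ∷ʳ false
clear-last [] b = refl
clear-last (d ∷ D) b = cong (d ∷_) (clear-last D b)

size-clear : ∀ {n} j (D : Vec Bool n) → bit j D ≡ true → size D ≡ suc (size (clear j D))
size-clear zero (true ∷ D) refl = refl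
size-clear (suc j) (true ∷ D) h = cong suc (size-clear j D h)
size-clear (suc j) (false ∷ D) h = size-clear j D h

below-nothing : ∀ {n} (D : Vec Bool n) → below n D ≡ nothing → size D ≡ 0
below-nothing [] h = refl
below-nothing {suc n} (d ∷ D) h with below n D in eq
below-nothing {suc n} (d ∷ D) () | just _
below-nothing {suc n} (true ∷ D) () | nothing
below-nothing {suc n} (false ∷ D) h | nothing = below-nothing D eq

pick-nothing : ∀ {n} x (D : Vec Bool n) → pick x D ≡ nothing → size D ≡ 0
pick-nothing {n} x D h with below x D | below n D in eq
pick-nothing x D () | just _ | _
pick-nothing x D () | nothing | just _
pick-nothing x D h | nothing | nothing = below-nothing D eq

length-arr : ∀ {n} v (D : Vec Bool n) → size D ≤ length v → length (arr v D) ≡ size D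
length-arr [] D h = sym (n≤0⇒n≡0 h)
length-arr (x ∷ v) D h with pick x D in eq
... | nothing = sym (pick-nothing x D eq)
... | just (f , j) = cong suc (length-arr v (clear j D) (≤-pred (subst (_≤ _) sz h))) ∙ sym sz
  where sz = size-clear j D (pick-true x D eq)

Positive : ℕ → List ℕ → Set
Positive n = All (λ x → ∃ λ y → x ≡ suc y × y ≤ n)

-- Lowering all letters by one moves the absent letter 1 from the bottom of the order to the top,
-- where its absence is the final `false`; the other comparisons are unchanged.
arr-false : ∀ {n} v (D : Vec Bool n) → Positive n v →
            arr v (false ∷ D) ≡ map suc (arr (map pred v) (D ∷ʳ false))
arr-false [] D [] = refl
arr-false {n} (_ ∷ v) D ((y , refl , y≤n) ∷ ps)
  rewrite below-∷ʳ y D false y≤n | below-all-false D with below y D in eq | below n D in eq'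
... | just j | _ rewrite clear-∷ʳ j D false (below-true y D eq) = cong (_ ∷_) (arr-false v (clear j D) ps)
... | nothing | just j rewrite clear-∷ʳ j D false (below-true n D eq') = cong (_ ∷_) (arr-false v (clear j D) ps)
... | nothing | nothing = refl

cst-false : ∀ {n} w v (D : Vec Bool n) → Positive n v →
            cst w v (false ∷ D) ≡ cst w (map pred v) (D ∷ʳ false)
cst-false w [] D [] = refl
cst-false {n} w (_ ∷ v) D ((y , refl , y≤n) ∷ ps)
  rewrite below-∷ʳ y D false y≤n | below-all-false D with below y D in eq | below n D in eq'
... | just j | _ rewrite clear-∷ʳ j D false (below-true y D eq) = cst-false (w ∘ suc) v (clear j D) ps
... | nothing | just j rewrite clear-∷ʳ j D false (below-true n D eq') = cong (w 0 ℕ.+_) (cst-false (w ∘ suc) v (clear j D) ps)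
... | nothing | nothing = refl

-- The effect on one column that contains the letter 1, in row `length p`: rotated, this entry
-- becomes the top letter and hence an ascent, which costs `w (length p)`, while every other entry
-- is lowered by one.
record Rotated {n} (w : ℕ → ℕ) (v : List ℕ) (D : Vec Bool n) : Set where
  field
    p q : List ℕ
    before : arr v (true ∷ D) ≡ p ++ 1 ∷ q
    after : arr (map pred v) (D ∷ʳ true) ≡ map pred p ++ suc n ∷ map pred q
    short : length p < suc (size D)
    cost : cst w (map pred v) (D ∷ʳ true) ≡ w (length p) ℕ.+ cst w v (true ∷ D)

map-pred-suc : ∀ v → map pred (map suc v) ≡ v
map-pred-suc [] = refl
map-pred-suc (x ∷ v) = cong (x ∷_) (map-pred-suc v)

rotated : ∀ {n} w v (D : Vec Bool n) → Positive n v → suc (size D) ≤ length v → Rotated w v D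
rotated {n} w (_ ∷ v) D ((y , refl , y≤n) ∷ ps) (s≤s len) with below y D in eq
... | just j = record
    { p = suc (suc j) ∷ p ; q = q
    ; before = trans head (cong (_ ∷_) before)
    ; after = trans head' (cong (_ ∷_) after)
    ; short = s≤s (subst (length p <_) (sym sz) short)
    ; cost = chead' ∙ cost ∙ cong (w (suc (length p)) ℕ.+_) (sym chead) }
  where
  sz : size D ≡ suc (size (clear j D))
  sz = size-clear j D (below-true y D eq)
  open Rotated (rotated (w ∘ suc) v (clear j D) ps (subst (_≤ length v) sz len))
  head : arr (suc y ∷ v) (true ∷ D) ≡ suc (suc j) ∷ arr v (true ∷ clear j D)
  head rewrite eq = refl
  head' : arr (y ∷ map pred v) (D ∷ʳ true) ≡ suc j ∷ arr (map pred v) (clear j D ∷ʳ true)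
  head' rewrite below-∷ʳ y D true y≤n | eq | clear-∷ʳ j D true (below-true y D eq) = refl
  chead : cst w (suc y ∷ v) (true ∷ D) ≡ cst (w ∘ suc) v (true ∷ clear j D)
  chead rewrite eq = refl
  chead' : cst w (y ∷ map pred v) (D ∷ʳ true) ≡ cst (w ∘ suc) (map pred v) (clear j D ∷ʳ true)
  chead' rewrite below-∷ʳ y D true y≤n | eq | clear-∷ʳ j D true (below-true y D eq) = refl
-- No other letter lies under the bound, so this is the row that takes 1. After the rotation the
-- same bound finds nothing below it and wraps round to the new top letter.
... | nothing = record
    { p = [] ; q = arr v (false ∷ D)
    ; before = head
    ; after = trans head' (cong (suc n ∷_) (sym (map-pred-suc _) ∙ cong (map pred) (sym (arr-false v D ps))))
    ; short = s≤s z≤n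
    ; cost = chead' ∙ cong (w 0 ℕ.+_) (sym (cst-false (w ∘ suc) v D ps) ∙ sym chead) }
  where
  head : arr (suc y ∷ v) (true ∷ D) ≡ 1 ∷ arr v (false ∷ D)
  head rewrite eq = refl
  head' : arr (y ∷ map pred v) (D ∷ʳ true) ≡ suc n ∷ arr (map pred v) (D ∷ʳ false)
  head' rewrite below-∷ʳ y D true y≤n | eq | below-all-true D | clear-last D true = refl
  chead : cst w (suc y ∷ v) (true ∷ D) ≡ cst (w ∘ suc) v (false ∷ D)
  chead rewrite eq = refl
  chead' : cst w (y ∷ map pred v) (D ∷ʳ true) ≡ w 0 ℕ.+ cst (w ∘ suc) (map pred v) (D ∷ʳ false)
  chead' rewrite below-∷ʳ y D true y≤n | eq | below-all-true D | clear-last D true = refl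

-- Nothing lies below the bound 0, so the choice wraps round to the largest letter, which the bound
-- `n` finds directly; only the flag differs.
arr-zero : ∀ {n} p q (D : Vec Bool n) → arr (p ++ 0 ∷ q) D ≡ arr (p ++ n ∷ q) D
arr-zero {n} [] q D with below n D
... | just j = refl
... | nothing = refl
arr-zero (x ∷ p) q D with pick x D
... | nothing = refl
... | just (f , j) = cong (_ ∷_) (arr-zero p q (clear j D))

cst-zero : ∀ {n} w p q (D : Vec Bool n) → (length p < size D →
             cst w (p ++ 0 ∷ q) D ≡ w (length p) ℕ.+ cst w (p ++ n ∷ q) D)
           × (size D ≤ length p → cst w (p ++ 0 ∷ q) D ≡ cst w (p ++ n ∷ q) D)
cst-zero {n} w [] q D with below n D in eq
... | just j = (λ _ → refl) , λ l → ⊥-elim (ℕₚ.1+n≢0 (sym (size-clear j D (below-true n D eq)) ∙ n≤0⇒n≡0 l))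
... | nothing = (λ l → ⊥-elim (ℕₚ.<-irrefl refl (subst (0 <_) (below-nothing D eq) l))) , λ _ → refl
cst-zero {n} w (x ∷ p) q D with pick x D in eq
... | nothing = (λ l → ⊥-elim (ℕₚ.n≮0 (subst (_ <_) (pick-nothing x D eq) l))) , λ _ → refl
... | just (f , j) =
  (λ l → cong (c ℕ.+_) (proj₁ rec (≤-pred (subst (_ <_) sz l))) ∙ lem c (w (suc (length p))) _) ,
  (λ l → cong (c ℕ.+_) (proj₂ rec (≤-pred (subst (_≤ _) sz l))))
  where
  sz = size-clear j D (pick-true x D eq)
  rec = cst-zero (w ∘ suc) p q (clear j D)
  c = if f then w 0 else 0
  lem : ∀ a b c → a ℕ.+ (b ℕ.+ c) ≡ b ℕ.+ (a ℕ.+ c)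
  lem a b c = sym (ℕₚ.+-assoc a b c) ∙ cong (ℕ._+ c) (ℕₚ.+-comm a b) ∙ ℕₚ.+-assoc b a c

Dec≥ : List ℕ → Set
Dec≥ [] = ⊤
Dec≥ (h ∷ μ) = All (_≤ h) μ × Dec≥ μ

<ᵇ-true : ∀ {r h} → r < h → (r <ᵇ h) ≡ true
<ᵇ-true {r} {h} l with r <ᵇ h in eq
... | true = refl
... | false = ⊥-elim (subst T eq (ℕₚ.<⇒<ᵇ l))

<ᵇ-false : ∀ {r h} → h ≤ r → (r <ᵇ h) ≡ false
<ᵇ-false {r} {h} l with r <ᵇ h in eq
... | false = refl
... | true = ⊥-elim (<⇒≱ (ℕₚ.<ᵇ⇒< r h (subst T (sym eq) tt)) l)

≡ᵇ-true : ∀ {a b} → (a ≡ᵇ b) ≡ true → a ≡ b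
≡ᵇ-true {a} {b} h = ℕₚ.≡ᵇ⇒≡ a b (subst T (sym h) tt)

wt-zero : ∀ μ r → All (_≤ r) μ → wt μ r ≡ 0
wt-zero [] r [] = refl
wt-zero (h ∷ μ) r (l ∷ ls) rewrite <ᵇ-false l = wt-zero μ r ls

-- Next to 0 the following cell of the row is always an ascent, next to `n` never. The difference is
-- the length `wt μ` of the remaining row, which is 0 if the row has no further cell.
Φ-zero : ∀ {n} φ μ p q e (α : Vec ℤ n) → Dec≥ μ →
         Φ φ μ (p ++ 0 ∷ q) e α ≡ Φ φ μ (p ++ n ∷ q) (e - + wt μ (length p)) α
Φ-zero φ [] p q e α _ = cong (λ t → isZ α ▸ φ t) (minus-0⁻ e)
Φ-zero {n} φ (h ∷ μ) p q e α (bd , _) = ∑-cong (bits n) λ D → ▸-cong (size D ≡ᵇ h) λ sz →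
  cong₂ (λ a b → Φ φ μ a b (α ⊖ D)) (arr-zero p q D) (go D (≡ᵇ-true sz))
  where
  r = length p
  W = wt (h ∷ μ)
  go : ∀ D → size D ≡ h → e - + cst W (p ++ 0 ∷ q) D ≡ (e - + W r) - + cst W (p ++ n ∷ q) D
  go D sz with <-≤-connex r (size D)
  ... | inj₁ l rewrite proj₁ (cst-zero W p q D) l = cong (λ t → e - t) (pos-+ (W r) _) ∙ minus-+ e _ _
  ... | inj₂ l rewrite proj₂ (cst-zero W p q D) l
                     | wt-zero (h ∷ μ) r (subst (_≤ r) sz l ∷ All.map (λ x → ≤-trans x (subst (_≤ r) sz l)) bd) = lem e _
    where
    lem : ∀ e b → e - b ≡ (e - 0ℤ) - b
    lem = solve-∀

arr-positive : ∀ {n} v (D : Vec Bool (suc n)) → Positive n (arr v D)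
arr-positive [] D = []
arr-positive (x ∷ v) D with pick x D in eq
... | nothing = []
... | just (f , j) = (j , refl , ≤-pred (bit-< j D (pick-true x D eq))) ∷ arr-positive v (clear j D)
  where
  bit-< : ∀ {n} j (D : Vec Bool n) → bit j D ≡ true → j < n
  bit-< zero (d ∷ D) h = s≤s z≤n
  bit-< (suc j) (d ∷ D) h = s≤s (bit-< j D h)

-- Cyclic relabelling of the letters: the first letter becomes the last one, and each of its
-- occurrences is counted as one extra descent around the cycle.
Φ-rotate : ∀ {n} φ μ v e a (β : Vec ℤ n) → Dec≥ μ → All (_≤ length v) μ → Positive n v →
           Φ φ μ v (e - a) (a ∷ β) ≡ Φ φ μ (map pred v) e (β ∷ʳ a)
Φ-rotate φ [] v e a β _ _ _ rewrite isZ-∷ʳ β a with a ℤₚ.≟ 0ℤ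
... | yes refl = cong (λ t → isZ β ▸ φ t) (minus-0 e)
... | no _ = refl
Φ-rotate {n} φ (h ∷ μ) v e a β (bd , dm) (hv ∷ _) pos =
  ∑-bits n _ ∙ cong₂ _+_ (∑-cong (bits n) tr) (∑-cong (bits n) fa) ∙ sym (∑-bits-∷ʳ n _)
  where
  W = wt (h ∷ μ)
  u = map pred v
  fa : ∀ D → (size (false ∷ D) ≡ᵇ h) ▸ Φ φ μ (arr v (false ∷ D)) ((e - a) - + cst W v (false ∷ D)) ((a ∷ β) ⊖ (false ∷ D))
           ≡ (size (D ∷ʳ false) ≡ᵇ h) ▸ Φ φ μ (arr u (D ∷ʳ false)) (e - + cst W u (D ∷ʳ false)) ((β ∷ʳ a) ⊖ (D ∷ʳ false))
  fa D rewrite size-∷ʳ D false = ▸-cong (size D ≡ᵇ h) λ sz →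
    trans (cong (λ t → Φ φ μ (arr v (false ∷ D)) t ((a ∷ β) ⊖ (false ∷ D))) (lem e a _))
      (Φ-rotate φ μ (arr v (false ∷ D)) (e - + cst W v (false ∷ D)) (a - 0ℤ) (β ⊖ D) dm (len D (≡ᵇ-true sz)) (arr-positive v (false ∷ D)) ∙
        cong₂ (λ s t → Φ φ μ s (e - + t) ((β ⊖ D) ∷ʳ (a - 0ℤ)))
                 (cong (map pred) (arr-false v D pos) ∙ map-pred-suc _) (cst-false W v D pos) ∙
          cong (Φ φ μ _ _) (sym (⊖-∷ʳ β a D false)))
    where
    lem : ∀ e a c → (e - a) - c ≡ (e - c) - (a - 0ℤ)
    lem = solve-∀
    len : ∀ D → size D ≡ h → All (_≤ length (arr v (false ∷ D))) μ
    len D sz = subst (λ k → All (_≤ k) μ) (sym sz ∙ sym (length-arr v (false ∷ D) (subst (_≤ length v) (sym sz) hv))) bd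
  tr : ∀ D → (size (true ∷ D) ≡ᵇ h) ▸ Φ φ μ (arr v (true ∷ D)) ((e - a) - + cst W v (true ∷ D)) ((a ∷ β) ⊖ (true ∷ D))
           ≡ (size (D ∷ʳ true) ≡ᵇ h) ▸ Φ φ μ (arr u (D ∷ʳ true)) (e - + cst W u (D ∷ʳ true)) ((β ∷ʳ a) ⊖ (D ∷ʳ true))
  tr D rewrite size-∷ʳ D true = ▸-cong (suc (size D) ≡ᵇ h) λ sz → go (≡ᵇ-true sz)
    where
    go : suc (size D) ≡ h → Φ φ μ (arr v (true ∷ D)) ((e - a) - + cst W v (true ∷ D)) ((a ∷ β) ⊖ (true ∷ D))
         ≡ Φ φ μ (arr u (D ∷ʳ true)) (e - + cst W u (D ∷ʳ true)) ((β ∷ʳ a) ⊖ (D ∷ʳ true))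
    go sz =
      cong (λ t → Φ φ μ (arr v (true ∷ D)) t ((a ∷ β) ⊖ (true ∷ D))) (lem₁ e a (+ c)) ∙
        Φ-rotate φ μ (arr v (true ∷ D)) ((e - + c) - 1ℤ) (a - 1ℤ) (β ⊖ D) dm len (arr-positive v (true ∷ D)) ∙
          cong (λ t → Φ φ μ t ((e - + c) - 1ℤ) γ) (cong (map pred) before ∙ map-++ p (1 ∷ q)) ∙
            Φ-zero φ μ (map pred p) (map pred q) _ γ dm ∙
              cong₃ (Φ φ μ) (sym after) eqc (sym (⊖-∷ʳ β a D true))
      where
      open Rotated (rotated W v D pos (subst (_≤ length v) (sym sz) hv))
      c = cst W v (true ∷ D)
      γ = (β ⊖ D) ∷ʳ (a - 1ℤ)
      map-++ : ∀ (xs ys : List ℕ) → map pred (xs ++ ys) ≡ map pred xs ++ map pred ys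
      map-++ [] ys = refl
      map-++ (x ∷ xs) ys = cong (_ ∷_) (map-++ xs ys)
      len-map : ∀ (xs : List ℕ) → length (map pred xs) ≡ length xs
      len-map [] = refl
      len-map (x ∷ xs) = cong suc (len-map xs)
      cong₃ : ∀ {A B C : Set} (f : A → B → C → ℤ) {a a' b b' c c'} → a ≡ a' → b ≡ b' → c ≡ c' → f a b c ≡ f a' b' c'
      cong₃ f refl refl refl = refl
      len : All (_≤ length (arr v (true ∷ D))) μ
      len = subst (λ k → All (_≤ k) μ) (sym sz ∙ sym (length-arr v (true ∷ D) (subst (_≤ length v) (sym sz) hv))) bd
      lem₁ : ∀ e a c → (e - a) - c ≡ ((e - c) - 1ℤ) - (a - 1ℤ)
      lem₁ = solve-∀
      lem₂ : ∀ e a c → ((e - c) - 1ℤ) - a ≡ e - ((1ℤ + a) + c)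
      lem₂ = solve-∀
      -- Reason for exactly one t per letter 1: the ascent created in front of it costs the row
      -- length including this column, and the ascent lost behind it, by `Φ-zero`, costs the row
      -- length without it.
      Wr : W (length p) ≡ suc (wt μ (length p))
      Wr rewrite <ᵇ-true (subst (length p <_) sz short) = refl
      eqc : ((e - + c) - 1ℤ) - + wt μ (length (map pred p)) ≡ e - + cst W u (D ∷ʳ true)
      eqc rewrite cost | Wr | len-map p = lem₂ e (+ wt μ (length p)) (+ c)

-- Intervals as left columns; the symmetric function `G`.

dn : ℕ → ℕ → List ℕ
dn k zero = []
dn k (suc h) = (k ℕ.+ suc h) ∷ dn k h

below-empty : ∀ {n} x (D : Vec Bool n) → size D ≡ 0 → below x D ≡ nothing
below-empty zero D h = refl
below-empty (suc x) [] h = refl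
below-empty (suc x) (false ∷ D) h rewrite below-empty x D h = refl

pick-empty : ∀ {n} x (D : Vec Bool n) → size D ≡ 0 → pick x D ≡ nothing
pick-empty {n} x D h rewrite below-empty x D h | below-empty n D h = refl

arr-empty : ∀ {n} v (D : Vec Bool n) → size D ≡ 0 → arr v D ≡ []
arr-empty [] D h = refl
arr-empty (x ∷ v) D h rewrite pick-empty x D h = refl

cst-empty : ∀ {n} w v (D : Vec Bool n) → size D ≡ 0 → cst w v D ≡ 0
cst-empty w [] D h = refl
cst-empty w (x ∷ v) D h rewrite pick-empty x D h = refl

arr-++ : ∀ {n} v u (D : Vec Bool n) → size D ≤ length v → arr (v ++ u) D ≡ arr v D
arr-++ [] u D h = arr-empty u D (n≤0⇒n≡0 h)
arr-++ (x ∷ v) u D h with pick x D in eq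
... | nothing = refl
... | just (f , j) = cong (_ ∷_) (arr-++ v u (clear j D) (≤-pred (subst (_≤ _) (size-clear j D (pick-true x D eq)) h)))

cst-++ : ∀ {n} w v u (D : Vec Bool n) → size D ≤ length v → cst w (v ++ u) D ≡ cst w v D
cst-++ w [] u D h = cst-empty w u D (n≤0⇒n≡0 h)
cst-++ w (x ∷ v) u D h with pick x D in eq
... | nothing = refl
... | just (f , j) = cong (_ ℕ.+_) (cst-++ (w ∘ suc) v u (clear j D) (≤-pred (subst (_≤ _) (size-clear j D (pick-true x D eq)) h)))

Φ-++ : ∀ {n} φ μ v u e (α : Vec ℤ n) → All (_≤ length v) μ → Φ φ μ (v ++ u) e α ≡ Φ φ μ v e α
Φ-++ φ [] v u e α _ = refl
Φ-++ {n} φ (h ∷ μ) v u e α (l ∷ _) = ∑-cong (bits n) λ D → ▸-cong (size D ≡ᵇ h) λ sz →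
  cong₂ (λ a c → Φ φ μ a (e - + c) (α ⊖ D))
    (arr-++ v u D (subst (_≤ _) (sym (≡ᵇ-true sz)) l)) (cst-++ _ v u D (subst (_≤ _) (sym (≡ᵇ-true sz)) l))

length-dn : ∀ k h → length (dn k h) ≡ h
length-dn k zero = refl
length-dn k (suc h) = cong suc (length-dn k h)

pred-dn : ∀ k h → map pred (dn (suc k) h) ≡ dn k h
pred-dn k zero = refl
pred-dn k (suc h) = cong (k ℕ.+ suc h ∷_) (pred-dn k h)

dn-split : ∀ k h → dn 0 (k ℕ.+ h) ≡ dn k h ++ dn 0 k
dn-split k zero = cong (dn 0) (ℕₚ.+-identityʳ k)
dn-split k (suc h) rewrite ℕₚ.+-suc k h = cong (suc (k ℕ.+ h) ∷_) (dn-split k h)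

dn-≤ : ∀ {i} m → m ≤ suc i → Avoids (suc (suc i)) (dn 0 m)
dn-≤ zero _ = []
dn-≤ (suc m) l = (λ { refl → ℕₚ.<-irrefl refl l }) ∷ dn-≤ m (≤-trans (n≤1+n m) l)

good-dn : ∀ i m → suc i < m → Good i (dn 0 m)
good-dn i (suc m) l with m ℕₚ.≟ suc i
... | yes refl = gtop (dn-≤ (suc i) ≤-refl)
... | no ne = gskip (λ { refl → ℕₚ.<-irrefl refl l }) (ne ∘ suc-injective)
                (good-dn i m (≤∧≢⇒< (≤-pred l) (ne ∘ sym)))

positive-dn : ∀ n k h → k ℕ.+ h ≤ suc n → Positive n (dn k h)
positive-dn n k zero l = []
positive-dn n k (suc h) l =
  (k ℕ.+ h , ℕₚ.+-suc k h , ≤-pred (subst (_≤ suc n) (ℕₚ.+-suc k h) l)) ∷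
  positive-dn n k h (≤-trans (ℕₚ.+-monoʳ-≤ k (n≤1+n h)) l)

SymF : ∀ {n} → (Vec ℤ n → ℤ) → Set
SymF {n} p = ∀ i → suc i < n → ∀ γ → p (swapAt i γ) ≡ p γ

SymF-tail : ∀ {n} {p : Vec ℤ (suc n) → ℤ} → SymF p → ∀ x → SymF (λ γ → p (x ∷ γ))
SymF-tail s x i l γ = s (suc i) (s≤s l) (x ∷ γ)

sym-rotate : ∀ {n} (p : Vec ℤ (suc n) → ℤ) → SymF p → ∀ a β → p (a ∷ β) ≡ p (β ∷ʳ a)
sym-rotate p s a [] = refl
sym-rotate p s a (b ∷ β) =
  s 0 (s≤s (s≤s z≤n)) (b ∷ a ∷ β) ∙ sym-rotate (λ γ → p (b ∷ γ)) (SymF-tail s b) a β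

-- The left column is the basement, which reads n, ..., 1 from the top.
G : ∀ {n} → (ℤ → ℤ) → List ℕ → Ser n
G {n} φ μ = Φ φ μ (dn 0 n)

G-sym : ∀ {n} φ μ e → SymF {n} (G φ μ e)
G-sym {n} φ μ e i l γ = Φ-sym i l φ μ (dn 0 n) (good-dn i n l) e γ

tailSum : ∀ {n} → ℕ → Vec ℤ n → ℤ
tailSum m [] = 0ℤ
tailSum zero (a ∷ γ) = a + tailSum zero γ
tailSum (suc m) (a ∷ γ) = tailSum m γ

tailSum-all : ∀ {n} (γ : Vec ℤ n) → tailSum n γ ≡ 0ℤ
tailSum-all [] = refl
tailSum-all (a ∷ γ) = tailSum-all γ

tailSum-∷ʳ : ∀ {n} m (β : Vec ℤ n) a → m ≤ n → tailSum m (β ∷ʳ a) ≡ a + tailSum m β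
tailSum-∷ʳ zero [] a l = refl
tailSum-∷ʳ zero (b ∷ β) a l = +ˡ b (tailSum-∷ʳ zero β a z≤n) ∙ +-swap b a (tailSum 0 β)
tailSum-∷ʳ (suc m) (b ∷ β) a (s≤s l) = tailSum-∷ʳ m β a l

∷ʳ-view : ∀ {A : Set} {n} (γ : Vec A (suc n)) → ∃ λ β → ∃ λ a → γ ≡ β ∷ʳ a
∷ʳ-view (a ∷ []) = [] , a , refl
∷ʳ-view (a ∷ b ∷ γ) with ∷ʳ-view (b ∷ γ)
... | β , c , eq = a ∷ β , c , cong (a ∷_) eq

-- Substituting t x_j for every x_j with j > k + h.
Φ-interval : ∀ {n} φ μ k h j → k ℕ.+ h ℕ.+ j ≡ n → Dec≥ μ → All (_≤ h) μ → ∀ e (γ : Vec ℤ n) →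
             Φ φ μ (dn k h) e γ ≡ G φ μ (e - tailSum (k ℕ.+ h) γ) γ
Φ-interval φ μ k h zero refl dm bd e γ rewrite ℕₚ.+-identityʳ (k ℕ.+ h) | tailSum-all γ | dn-split k h =
  cong (λ t → Φ φ μ (dn k h) t γ) (minus-0⁻ e) ∙
    sym (Φ-++ φ μ (dn k h) (dn 0 k) _ γ (subst (λ l → All (_≤ l) μ) (sym (length-dn k h)) bd))
Φ-interval φ μ k h (suc j) eq dm bd e γ with trans (sym (ℕₚ.+-suc (k ℕ.+ h) j)) eq
... | refl with ∷ʳ-view γ
...   | β , a , refl =
  -- A rotation backwards raises the interval by one and brings the last variable to the front at
  -- the price t per occurrence; the symmetry of `G` later puts the variable back. This is repeated
  -- until the interval reaches the top letter, where the missing lower rows of the basement are not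
  -- met by `μ`.
  cong (λ v → Φ φ μ v e (β ∷ʳ a)) (sym (pred-dn k h)) ∙
   sym (Φ-rotate φ μ (dn (suc k) h) e a β dm (subst (λ l → All (_≤ l) μ) (sym (length-dn (suc k) h)) bd)
                 (positive-dn _ (suc k) h (s≤s (m≤m+n (k ℕ.+ h) j)))) ∙
    Φ-interval φ μ (suc k) h j refl dm bd (e - a) (a ∷ β) ∙
      sym-rotate (G φ μ _) (G-sym φ μ _) a β ∙
        cong (λ t → G φ μ t (β ∷ʳ a))
          (minus-minus e a (tailSum (k ℕ.+ h) β) ∙ cong (λ t → e - t) (sym (tailSum-∷ʳ (k ℕ.+ h) β a (m≤m+n (k ℕ.+ h) j))))

-- Antisymmetrization and cancellation of the Vandermonde factor.

pickSum : ∀ {n} → (ℤ → Vec ℤ n → ℤ) → Vec ℤ (suc n) → ℤ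
pickSum F (b ∷ []) = F b []
pickSum F (b ∷ c ∷ β) = F b (c ∷ β) - pickSum (λ x r → F x (b ∷ r)) (c ∷ β)

-- The signed sum of `f` over all rearrangements of the argument, written as a determinant expanded
-- repeatedly along the first row: `pickSum` extracts each entry in turn with alternating sign, so
-- no permutations are needed.
alt : ∀ {n} → (Vec ℤ n → ℤ) → Vec ℤ n → ℤ
alt {zero} f [] = f []
alt {suc n} f β = pickSum (λ x r → alt (λ γ → f (x ∷ γ)) r) β

pickSum-cong : ∀ {n} {F H : ℤ → Vec ℤ n → ℤ} β → (∀ x r → F x r ≡ H x r) → pickSum F β ≡ pickSum H β
pickSum-cong (b ∷ []) h = h b []
pickSum-cong (b ∷ c ∷ β) h = cong₂ _-_ (h b (c ∷ β)) (pickSum-cong (c ∷ β) λ x r → h x (b ∷ r))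

pickSum-zero : ∀ {n} {F : ℤ → Vec ℤ n → ℤ} β → (∀ x r → F x r ≡ 0ℤ) → pickSum F β ≡ 0ℤ
pickSum-zero (b ∷ []) h = h b []
pickSum-zero (b ∷ c ∷ β) h = cong₂ _-_ (h b (c ∷ β)) (pickSum-zero (c ∷ β) λ x r → h x (b ∷ r))

pickSum-+ : ∀ {n} (F H : ℤ → Vec ℤ n → ℤ) β → pickSum (λ x r → F x r + H x r) β ≡ pickSum F β + pickSum H β
pickSum-+ F H (b ∷ []) = refl
pickSum-+ F H (b ∷ c ∷ β) =
  cong (λ t → (F b (c ∷ β) + H b (c ∷ β)) - t) (pickSum-+ (λ x r → F x (b ∷ r)) (λ x r → H x (b ∷ r)) (c ∷ β)) ∙
    lem (F b (c ∷ β)) (H b (c ∷ β)) (pickSum (λ x r → F x (b ∷ r)) (c ∷ β)) _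
  where
  lem : ∀ a b c d → (a + b) - (c + d) ≡ (a - c) + (b - d)
  lem = solve-∀

pickSum-* : ∀ {n} k (F : ℤ → Vec ℤ n → ℤ) β → pickSum (λ x r → k * F x r) β ≡ k * pickSum F β
pickSum-* k F (b ∷ []) = refl
pickSum-* k F (b ∷ c ∷ β) =
  cong (λ t → k * F b (c ∷ β) - t) (pickSum-* k (λ x r → F x (b ∷ r)) (c ∷ β)) ∙ lem k (F b (c ∷ β)) _
  where
  lem : ∀ k a b → k * a - k * b ≡ k * (a - b)
  lem = solve-∀

alt-cong : ∀ {n} {f g : Vec ℤ n → ℤ} β → (∀ γ → f γ ≡ g γ) → alt f β ≡ alt g β
alt-cong {zero} [] h = h []
alt-cong {suc n} β h = pickSum-cong β λ x r → alt-cong r λ γ → h (x ∷ γ)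

alt-zero : ∀ {n} {f : Vec ℤ n → ℤ} β → (∀ γ → f γ ≡ 0ℤ) → alt f β ≡ 0ℤ
alt-zero {zero} [] h = h []
alt-zero {suc n} β h = pickSum-zero β λ x r → alt-zero r λ γ → h (x ∷ γ)

alt-+ : ∀ {n} (f g : Vec ℤ n → ℤ) β → alt (λ γ → f γ + g γ) β ≡ alt f β + alt g β
alt-+ {zero} f g [] = refl
alt-+ {suc n} f g β =
  (pickSum-cong β λ x r → alt-+ (λ γ → f (x ∷ γ)) (λ γ → g (x ∷ γ)) r) ∙ pickSum-+ _ _ β

alt-* : ∀ {n} k (f : Vec ℤ n → ℤ) β → alt (λ γ → k * f γ) β ≡ k * alt f β
alt-* {zero} k f [] = refl
alt-* {suc n} k f β = (pickSum-cong β λ x r → alt-* k (λ γ → f (x ∷ γ)) r) ∙ pickSum-* k _ β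

alt-neg : ∀ {n} (f : Vec ℤ n → ℤ) β → alt (λ γ → - f γ) β ≡ - alt f β
alt-neg f β = (alt-cong β λ γ → sym (ℤₚ.-1*i≡-i (f γ))) ∙ alt-* (- 1ℤ) f β ∙ ℤₚ.-1*i≡-i _

alt-∑ : ∀ {A : Set} {n} (xs : List A) (f : A → Vec ℤ n → ℤ) β →
        alt (λ γ → ∑ xs (λ x → f x γ)) β ≡ ∑ xs (λ x → alt (f x) β)
alt-∑ [] f β = alt-zero β λ _ → refl
alt-∑ (x ∷ xs) f β = alt-+ (f x) _ β ∙ +ˡ (alt (f x) β) (alt-∑ xs f β)

alt-▸ : ∀ {n} b (f : Vec ℤ n → ℤ) β → alt (λ γ → b ▸ f γ) β ≡ b ▸ alt f β
alt-▸ true f β = refl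
alt-▸ false f β = alt-zero β λ _ → refl

-- Extracting two given entries in one order or the other gives opposite signs.
pickSum-sym : ∀ {n} (H : ℤ → ℤ → Vec ℤ n → ℤ) → (∀ x y s → H x y s ≡ H y x s) →
              ∀ β → pickSum (λ x r → pickSum (H x) r) β ≡ 0ℤ
pickSum-sym H s (b ∷ c ∷ []) = cong (λ t → H b c [] - t) (s c b []) ∙ lem (H b c [])
  where
  lem : ∀ a → a - a ≡ 0ℤ
  lem = solve-∀
pickSum-sym H s (b ∷ c ∷ d ∷ β) =
  cong (λ t → pickSum (H b) β' - t)
          (pickSum-cong β' expand ∙
            pickSum-+ (λ x r → H x b r) (λ x r → - pickSum (λ y q → H x y (b ∷ q)) r) β' ∙
              cong₂ _+_ (pickSum-cong β' λ x r → s x b r)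
                (neg-pick β' ∙ cong -_ (pickSum-sym (λ x y q → H x y (b ∷ q)) (λ x y q → s x y (b ∷ q)) β'))) ∙
    lem (pickSum (H b) β')
  where
  β' = c ∷ d ∷ β
  expand : ∀ x r → pickSum (H x) (b ∷ r) ≡ H x b r + - pickSum (λ y q → H x y (b ∷ q)) r
  expand x (_ ∷ _) = refl
  neg-pick : ∀ β → pickSum (λ x r → - pickSum (λ y q → H x y (b ∷ q)) r) β ≡ - pickSum (λ x r → pickSum (λ y q → H x y (b ∷ q)) r) β
  neg-pick β = (pickSum-cong β λ x r → sym (ℤₚ.-1*i≡-i _)) ∙ pickSum-* (- 1ℤ) _ β ∙ ℤₚ.-1*i≡-i _
  lem : ∀ a → a - (a + - 0ℤ) ≡ 0ℤ
  lem = solve-∀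

SymAt : ∀ {n} → ℕ → (Vec ℤ n → ℤ) → Set
SymAt i f = ∀ γ → f (swapAt i γ) ≡ f γ

alt-kill : ∀ {n} i (f : Vec ℤ n → ℤ) → suc i < n → SymAt i f → ∀ β → alt f β ≡ 0ℤ
alt-kill {suc (suc n)} zero f l s β = pickSum-sym _ (λ x y r → alt-cong r λ γ → s (y ∷ x ∷ γ)) β
alt-kill {suc n} (suc i) f (s≤s l) s β =
  pickSum-zero β λ x r → alt-kill i (λ γ → f (x ∷ γ)) l (λ γ → s (x ∷ γ)) r
alt-kill {suc zero} zero f (s≤s ()) s β

alt-swap : ∀ {n} i (f : Vec ℤ n → ℤ) → suc i < n → ∀ β → alt (λ γ → f (swapAt i γ)) β ≡ - alt f β
alt-swap i f l β = lem (alt (λ γ → f (swapAt i γ)) β) (alt f β)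
  (sym (alt-+ (λ γ → f (swapAt i γ)) f β) ∙
    alt-kill i (λ γ → f (swapAt i γ) + f γ) l
      (λ γ → cong (λ t → f t + f (swapAt i γ)) (swapAt-invol i γ) ∙ ℤₚ.+-comm (f γ) _) β)
  where
  lem : ∀ a b → a + b ≡ 0ℤ → a ≡ - b
  lem a b h = plus-minus a b ∙ cong (λ t → t - b) h ∙ +-identityˡ (- b)

infix 4 _∈ᵥ_
data _∈ᵥ_ (x : ℤ) : ∀ {n} → Vec ℤ n → Set where
  here : ∀ {n} {γ : Vec ℤ n} → x ∈ᵥ (x ∷ γ)
  there : ∀ {n} {y} {γ : Vec ℤ n} → x ∈ᵥ γ → x ∈ᵥ (y ∷ γ)

pickSum-∈ : ∀ {n} b (F : ℤ → Vec ℤ n → ℤ) β → b ∈ᵥ β → (∀ x r → x ≡ b ⊎ b ∈ᵥ r → F x r ≡ 0ℤ) → pickSum F β ≡ 0ℤ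
pickSum-∈ b F (_ ∷ []) here h = h b [] (inj₁ refl)
pickSum-∈ b F (_ ∷ c ∷ β) here h =
  cong₂ _-_ (h b (c ∷ β) (inj₁ refl)) (pickSum-zero (c ∷ β) λ x r → h x (b ∷ r) (inj₂ here))
pickSum-∈ b F (a ∷ c ∷ β) (there m) h =
  cong₂ _-_ (h a (c ∷ β) (inj₂ m)) (pickSum-∈ b _ (c ∷ β) m λ { x r (inj₁ e) → h x (a ∷ r) (inj₁ e)
                                                                ; x r (inj₂ e) → h x (a ∷ r) (inj₂ (there e)) })

alt-∈ : ∀ {n} b (f : Vec ℤ n → ℤ) β → b ∈ᵥ β → (∀ γ → b ∈ᵥ γ → f γ ≡ 0ℤ) → alt f β ≡ 0ℤ
alt-∈ {suc n} b f β m h = pickSum-∈ b _ β m λ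
  { x r (inj₁ refl) → alt-zero r λ γ → h (x ∷ γ) here
  ; x r (inj₂ m') → alt-∈ b (λ γ → f (x ∷ γ)) r m' λ γ m'' → h (x ∷ γ) (there m'') }

-- Subtraction of δ = (n-1, ..., 0). For symmetric `p`, the value of `alt` of `p` after `ρ⁻` at β is
-- the coefficient of x^β in a_δ p.
ρ⁻ : ∀ {n} → Vec ℤ n → Vec ℤ n
ρ⁻ [] = []
ρ⁻ {suc n} (c ∷ γ) = (c - + n) ∷ ρ⁻ γ

ρ⁻-∈ : ∀ {n} b (γ : Vec ℤ n) → b ∈ᵥ γ → ∃ λ j → ∃ λ d → suc j ℕ.+ d ≡ n × (b - + d) ∈ᵥ ρ⁻ γ
ρ⁻-∈ {suc n} b (_ ∷ γ) here = 0 , n , refl , here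
ρ⁻-∈ {suc n} b (_ ∷ γ) (there m) with ρ⁻-∈ b γ m
... | j , d , eq , m' = suc j , d , cong suc eq , there m'

sym-front : ∀ {n} (p : Vec ℤ (suc n) → ℤ) → SymF p → ∀ c γ → c ∈ᵥ γ → ∃ λ γ' → p γ ≡ p (c ∷ γ')
sym-front p s c (_ ∷ γ) here = γ , refl
sym-front {suc n} p s c (x ∷ γ) (there m) with sym-front (λ γ → p (x ∷ γ)) (SymF-tail s x) c γ m
... | γ' , eq = x ∷ γ' , trans eq (s 0 (s≤s (s≤s z≤n)) (c ∷ x ∷ γ'))

-- A bound on the degree in each variable; it provides the starting point for the descent in
-- `alt-cancel`.
Bounded : ∀ {n} → ℤ → (Vec ℤ n → ℤ) → Set
Bounded B p = ∀ j γ → (B + + suc j) ∈ᵥ γ → p γ ≡ 0ℤ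

-- Cancellation of the Vandermonde factor: the coefficients of p with largest part K are recovered
-- from the coefficients of a_δ p by expanding along an entry K + n - 1.
alt-cancel : ∀ {n} (p : Vec ℤ n → ℤ) B → Bounded B p → SymF p →
             (∀ β → alt (λ γ → p (ρ⁻ γ)) β ≡ 0ℤ) → ∀ γ → p γ ≡ 0ℤ
alt-cancel {zero} p B bd s h [] = h []
alt-cancel {suc n} p B bd s h (c ∷ γ) = final (B + 1ℤ - c) refl
  where
  step : ∀ K → Bounded K p → ∀ γ → p (K ∷ γ) ≡ 0ℤ
  step K bK = alt-cancel (λ γ → p (K ∷ γ)) K (λ j γ m → bK j (K ∷ γ) (there m)) (SymF-tail s K) λ β →
    trans (sym (first β)) (h ((K + + n) ∷ β))
    where
    lem : ∀ K n → (K + n) - n ≡ K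
    lem = solve-∀
    first : ∀ β → alt (λ γ → p (ρ⁻ γ)) ((K + + n) ∷ β) ≡ alt (λ γ → p (K ∷ ρ⁻ γ)) β
    first [] = cong (λ t → p (t ∷ [])) (lem K 0ℤ)
    first β@(_ ∷ _) =
      cong₂ _-_ (alt-cong β λ γ → cong (λ t → p (t ∷ ρ⁻ γ)) (lem K (+ n)))
              (pickSum-zero β λ x r → alt-∈ (K + + n) _ ((K + + n) ∷ r) here λ γ m → van x γ (ρ⁻-∈ _ γ m)) ∙
        +-identityʳ _
      where
      van : ∀ x γ → (∃ λ j → ∃ λ d → suc j ℕ.+ d ≡ n × ((K + + n) - + d) ∈ᵥ ρ⁻ γ) → p ((x - + n) ∷ ρ⁻ γ) ≡ 0ℤ
      van x γ (j , d , refl , m) = bK j _ (there (subst (_∈ᵥ ρ⁻ γ) (lem' K (+ suc j) (+ d)) m))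
        where
        lem' : ∀ K a d → (K + (a + d)) - d ≡ K + a
        lem' = solve-∀
  -- The bound can be lowered by one as often as desired, and so it falls below any given part `c`.
  down : ∀ J → Bounded (B - + J) p
  down zero j γ m = bd j γ (subst (λ t → t ∈ᵥ γ) (lem B (+ suc j)) m)
    where
    lem : ∀ B a → (B - 0ℤ) + a ≡ B + a
    lem = solve-∀
  down (suc J) zero γ m with sym-front p s _ γ m
  ... | γ' , eq = eq ∙ cong (λ t → p (t ∷ γ')) (lem B (+ J)) ∙ step (B - + J) (down J) γ'
    where
    lem : ∀ B a → (B - (1ℤ + a)) + 1ℤ ≡ B - a
    lem = solve-∀
  down (suc J) (suc j) γ m = down J j γ (subst (_∈ᵥ γ) (lem B (+ J) (+ suc j)) m)
    where
    lem : ∀ B a b → (B - (1ℤ + a)) + (1ℤ + b) ≡ (B - a) + b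
    lem = solve-∀
  final : ∀ d → B + 1ℤ - c ≡ d → p (c ∷ γ) ≡ 0ℤ
  final (+ J) eq = down J 0 (c ∷ γ) (subst (_∈ᵥ (c ∷ γ)) (lem B c ∙ cong (λ t → (B - t) + 1ℤ) eq) here)
    where
    lem : ∀ B c → c ≡ (B - (B + 1ℤ - c)) + 1ℤ
    lem = solve-∀
  final -[1+ k ] eq = down 0 (suc k) (c ∷ γ) (subst (_∈ᵥ (c ∷ γ)) (lem B c ∙ cong (λ t → (B + 1ℤ) - t) eq ∙ lem' B (+ suc k)) here)
    where
    lem : ∀ B c → c ≡ (B + 1ℤ) - (B + 1ℤ - c)
    lem = solve-∀
    lem' : ∀ B k → (B + 1ℤ) - (- k) ≡ (B - 0ℤ) + (1ℤ + k)
    lem' = solve-∀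

-- The first column: symmetry, and what antisymmetrization leaves of it.

desc : ∀ {n} → Vec Bool n → List ℕ
desc [] = []
desc (true ∷ D) = map suc (desc D) ++ 1 ∷ []
desc (false ∷ D) = map suc (desc D)

desc-empty : ∀ {n} (D : Vec Bool n) → size D ≡ 0 → desc D ≡ []
desc-empty [] h = refl
desc-empty (false ∷ D) h = cong (map suc) (desc-empty D h)

desc-top : ∀ {n} (D : Vec Bool n) j → below n D ≡ just j → desc D ≡ suc j ∷ desc (clear j D)
desc-top {suc n} (b ∷ D) j h with below n D in eq
desc-top {suc n} (true ∷ D) _ refl | just j = cong (λ t → map suc t ++ 1 ∷ []) (desc-top D j eq)
desc-top {suc n} (false ∷ D) _ refl | just j = cong (map suc) (desc-top D j eq)
desc-top {suc n} (true ∷ D) _ refl | nothing rewrite desc-empty D (below-nothing D eq) = refl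

below-stable : ∀ {n} m (D : Vec Bool n) → m ≤ n → (∀ k → m ≤ k → bit k D ≡ false) → below m D ≡ below n D
below-stable {zero} zero [] l h = refl
below-stable {suc n} zero D l h = sym (below-empty (suc n) D (no-bits D (λ k → h k z≤n)))
  where
  no-bits : ∀ {n} (D : Vec Bool n) → (∀ k → bit k D ≡ false) → size D ≡ 0
  no-bits [] h = refl
  no-bits (true ∷ D) h = case h 0 of λ ()
  no-bits (false ∷ D) h = no-bits D (h ∘ suc)
below-stable (suc m) (b ∷ D) (s≤s l) h = cong (up b) (below-stable m D l (λ k k≥ → h (suc k) (s≤s k≥)))

below-< : ∀ {n} x (D : Vec Bool n) {j} → below x D ≡ just j → j < x
below-< (suc x) (b ∷ D) h with below x D in eq
below-< (suc x) (b ∷ D) refl | just j = s≤s (below-< x D eq)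
below-< (suc x) (true ∷ D) refl | nothing = s≤s z≤n

below-max : ∀ {n} x (D : Vec Bool n) {j} → below x D ≡ just j → ∀ k → j < k → k < x → bit k D ≡ false
below-max (suc x) (b ∷ D) h (suc k) jk (s≤s kx) with below x D in eq
below-max (suc x) (b ∷ D) refl (suc k) (s≤s jk) (s≤s kx) | just j = below-max x D eq k jk kx
below-max (suc x) (true ∷ D) refl (suc k) jk (s≤s kx) | nothing = none x D eq k kx
  where
  none : ∀ {n} x (D : Vec Bool n) → below x D ≡ nothing → ∀ k → k < x → bit k D ≡ false
  none (suc x) [] h k l = refl
  none (suc x) (b ∷ D) h k l with below x D in eq
  none (suc x) (b ∷ D) () k l | just _
  none (suc x) (true ∷ D) () k l | nothing
  none (suc x) (false ∷ D) h zero l | nothing = refl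
  none (suc x) (false ∷ D) h (suc k) (s≤s l) | nothing = none x D eq k l

-- The bound `m` is at least as large as every remaining letter, so each row takes the largest one
-- left and never wraps round: decreasing order and no ascent.
arr-dn : ∀ {n} m (D : Vec Bool n) → m ≤ n → (∀ k → m ≤ k → bit k D ≡ false) → arr (dn 0 m) D ≡ desc D
cst-dn : ∀ {n} w m (D : Vec Bool n) → m ≤ n → (∀ k → m ≤ k → bit k D ≡ false) → cst w (dn 0 m) D ≡ 0

module _ {n} m (D : Vec Bool n) (l : suc m ≤ n) (h : ∀ k → suc m ≤ k → bit k D ≡ false) where
  clear-bound : ∀ j → below (suc m) D ≡ just j → ∀ k → m ≤ k → bit k (clear j D) ≡ false
  clear-bound j e k mk with k ℕₚ.≟ j
  ... | yes refl = bit-clear j D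
  ... | no ne with k ℕₚ.≟ m
  ...   | yes refl = bit-clear-≢ k j D ne ∙ below-max (suc m) D e m (≤∧≢⇒< (≤-pred (below-< (suc m) D e)) (ne ∘ sym)) ≤-refl
  ...   | no ne' = bit-clear-≢ k j D ne ∙ h k (≤∧≢⇒< mk (ne' ∘ sym))

arr-dn {n} zero D l h = sym (desc-empty D (below-nothing D (sym (below-stable 0 D z≤n h))))
arr-dn {n} (suc m) D l h with below (suc m) D in eq
... | just j = cong (suc j ∷_) (arr-dn m (clear j D) (<⇒≤ l) (clear-bound m D l h j eq)) ∙
                 sym (desc-top D j (sym (below-stable (suc m) D l h) ∙ eq))
... | nothing rewrite trans (sym (below-stable (suc m) D l h)) eq =
  sym (desc-empty D (below-nothing D (sym (below-stable (suc m) D l h) ∙ eq)))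

cst-dn w zero D l h = refl
cst-dn {n} w (suc m) D l h with below (suc m) D in eq
... | just j = cst-dn (w ∘ suc) m (clear j D) (<⇒≤ l) (clear-bound m D l h j eq)
... | nothing rewrite trans (sym (below-stable (suc m) D l h)) eq = refl

bit-≥ : ∀ {n} (D : Vec Bool n) k → n ≤ k → bit k D ≡ false
bit-≥ [] k l = refl
bit-≥ (b ∷ D) (suc k) (s≤s l) = bit-≥ D k l

arr-desc : ∀ {n} (D : Vec Bool n) → arr (dn 0 n) D ≡ desc D
arr-desc {n} D = arr-dn n D ≤-refl (bit-≥ D)

cst-desc : ∀ {n} w (D : Vec Bool n) → cst w (dn 0 n) D ≡ 0
cst-desc {n} w D = cst-dn w n D ≤-refl (bit-≥ D)

desc-∷ʳ : ∀ {n} (D : Vec Bool n) → desc (D ∷ʳ false) ≡ desc D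
desc-∷ʳ [] = refl
desc-∷ʳ (true ∷ D) = cong (λ t → map suc t ++ 1 ∷ []) (desc-∷ʳ D)
desc-∷ʳ (false ∷ D) = cong (map suc) (desc-∷ʳ D)

size≤ : ∀ {n} (D : Vec Bool n) → size D ≤ n
size≤ [] = z≤n
size≤ (true ∷ D) = s≤s (size≤ D)
size≤ (false ∷ D) = ≤-trans (size≤ D) (n≤1+n _)

length-desc : ∀ {n} (D : Vec Bool n) → length (desc D) ≡ size D
length-desc {n} D = cong length (sym (arr-desc D)) ∙ length-arr (dn 0 n) D (subst (size D ≤_) (sym (length-dn 0 n)) (size≤ D))

-- Adding a first column of height h; the tail z of extra zero rows models rows in which the
-- first column has no cell.
K : ∀ {n} → (ℤ → ℤ) → List ℕ → ℕ → List ℕ → Ser n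
K {n} φ z h μ e α = ∑ (bits n) λ C → (size C ≡ᵇ h) ▸ Φ φ μ (desc C ++ z) e (α ⊖ C)

++-[] : ∀ (v : List ℕ) → v ++ [] ≡ v
++-[] [] = refl
++-[] (x ∷ v) = cong (x ∷_) (++-[] v)

G-cons : ∀ {n} φ h μ e (α : Vec ℤ n) → G φ (h ∷ μ) e α ≡ K φ [] h μ e α
G-cons {n} φ h μ e α = ∑-cong (bits n) λ D → cong ((size D ≡ᵇ h) ▸_)
  (cong₂ (λ a c → Φ φ μ a c (α ⊖ D)) (arr-desc D ∙ sym (++-[] (desc D)))
    (cong (λ t → e - + t) (cst-desc (wt (h ∷ μ)) D) ∙ minus-0 e))

data Zeros : List ℕ → Set where
  znil : Zeros []
  zcons : ∀ {z} → Zeros z → Zeros (0 ∷ z)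

avoids-++ : ∀ {x v z} → Avoids (suc x) v → Zeros z → Avoids (suc x) (v ++ z)
avoids-++ [] znil = []
avoids-++ [] (zcons zs) = (λ ()) ∷ avoids-++ [] zs
avoids-++ (p ∷ a) zs = p ∷ avoids-++ a zs

good-++ : ∀ {i v z} → Good i v → Zeros z → Good i (v ++ z)
good-++ gnil znil = gnil
good-++ gnil (zcons zs) = gskip (λ ()) (λ ()) (good-++ gnil zs)
good-++ (gskip a b g) zs = gskip a b (good-++ g zs)
good-++ (gtop a) zs = gtop (avoids-++ a zs)

map-θ-++ : ∀ i v {z} → Zeros z → map (θ i) (v ++ z) ≡ map (θ i) v ++ z
map-θ-++ i [] znil = refl
map-θ-++ i [] (zcons zs) = cong (0 ∷_) (map-θ-++ i [] zs)
map-θ-++ i (x ∷ v) zs = cong (θ i x ∷_) (map-θ-++ i v zs)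

good-desc : ∀ {n} i (D : Vec Bool n) → bit i D ≡ false → Good i (desc D)
good-desc {n} i D h = subst (Good i) (arr-desc D) (good-arr i (dn 0 n) D h)

-- The pairing argument of `Φ-sym` for the first column. Appended entries 0 are fixed by `θ` and do
-- not disturb `Good`.
K-sym : ∀ {n} φ z h μ e → Zeros z → SymF {n} (K φ z h μ e)
K-sym {n} φ z h μ e zs i i<n α = ∑-pairs n i f g′ i<n same pair
  where
  j = suc i
  f g′ : Vec Bool n → ℤ
  f D = (size D ≡ᵇ h) ▸ Φ φ μ (desc D ++ z) e (swapAt i α ⊖ D)
  g′ D = (size D ≡ᵇ h) ▸ Φ φ μ (desc D ++ z) e (α ⊖ D)
  same : ∀ D → bit i D ≡ bit j D → f D ≡ g′ D
  same D eq = ▸-cong (size D ≡ᵇ h) λ _ →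
    trans (cong (Φ φ μ (desc D ++ z) e) (cong (swapAt i α ⊖_) (sym (swapAt-same i D eq)) ∙ sym (swapAt-⊖ i α D)))
      (Φ-sym i i<n φ μ (desc D ++ z) (good-++ good zs) e (α ⊖ D))
    where
    good : Good i (desc D)
    good with bit i D in p
    ... | false = good-desc i D p
    ... | true = subst (Good i) (arr-desc D) (proj₁ (arr-both i i<n (dn 0 n) D p (sym eq) (good-dn i n i<n)))
  pair : ∀ D → bit i D ≡ true → bit j D ≡ false → f D + f (swapAt i D) ≡ g′ D + g′ (swapAt i D)
  pair D p q = guard₂ (size D ≡ᵇ h) (cong (_≡ᵇ h) (size-swapAt i D)) goal
    where
    w = desc (swapAt i D) ++ z
    γ = α ⊖ clear i D
    gw : Good i w
    gw = good-++ (good-desc i (swapAt i D) (bit-swapAt i D i<n ∙ q)) zs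
    w'≡ : desc D ++ z ≡ map (θ i) w
    w'≡ = sym (map-θ-++ i (desc (swapAt i D)) zs ∙
            cong (_++ z) (cong (map (θ i)) (sym (arr-desc (swapAt i D))) ∙
              sym (arr-hi⁻ i i<n φ (dn 0 n) D p q (good-dn i n i<n)) ∙ arr-desc D))
    lo : ∀ (α' : Vec ℤ n) → α' ⊖ D ≡ dec i (α' ⊖ clear i D)
    lo α' = ⊖-dec i α' D p
    hi : ∀ (α' : Vec ℤ n) → α' ⊖ swapAt i D ≡ dec j (α' ⊖ clear i D)
    hi α' = ⊖-swap-dec i α' D p q i<n
    s-lo : swapAt i α ⊖ D ≡ swapAt i (dec j γ)
    s-lo = cong (swapAt i α ⊖_) (sym (swapAt-invol i D)) ∙ sym (swapAt-⊖ i α (swapAt i D)) ∙ cong (swapAt i) (hi α)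
    s-hi : swapAt i α ⊖ swapAt i D ≡ swapAt i (dec i γ)
    s-hi = sym (swapAt-⊖ i α D) ∙ cong (swapAt i) (lo α)
    goal : Φ φ μ (desc D ++ z) e (swapAt i α ⊖ D) + Φ φ μ w e (swapAt i α ⊖ swapAt i D)
         ≡ Φ φ μ (desc D ++ z) e (α ⊖ D) + Φ φ μ w e (α ⊖ swapAt i D)
    goal rewrite w'≡ | lo α | hi α | s-lo | s-hi | Φ-sym i i<n φ μ w gw e (dec i γ) =
      ℤₚ.+-comm (Φ φ μ (map (θ i) w) e (swapAt i (dec j γ))) _ ∙ Φ-rel i i<n φ μ w gw e γ

ones : ∀ {n} → ℕ → Vec Bool n
ones {zero} h = []
ones {suc n} zero = false ∷ ones zero
ones {suc n} (suc h) = true ∷ ones h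

Ascent : ∀ {n} → ℕ → Vec Bool n → Set
Ascent i D = bit i D ≡ false × bit (suc i) D ≡ true

bit-true-< : ∀ {n} j (D : Vec Bool n) → bit j D ≡ true → j < n
bit-true-< zero (d ∷ D) h = s≤s z≤n
bit-true-< (suc j) (d ∷ D) h = s≤s (bit-true-< j D h)

ascent? : ∀ {n} (D : Vec Bool n) → (∃ λ i → Ascent i D) ⊎ D ≡ ones (size D)
ascent? [] = inj₂ refl
ascent? (true ∷ D) with ascent? D
... | inj₁ (i , a) = inj₁ (suc i , a)
... | inj₂ e = inj₂ (cong (true ∷_) e)
ascent? (false ∷ D) with ascent? D
... | inj₁ (i , a) = inj₁ (suc i , a)
... | inj₂ e with size D in s
...   | zero = inj₂ (cong (false ∷_) e)
ascent? (false ∷ []) | inj₂ e | suc k = case s of λ ()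
ascent? (false ∷ _ ∷ D) | inj₂ refl | suc k = inj₁ (0 , refl , refl)

size-ones : ∀ n h → h ≤ n → size (ones {n} h) ≡ h
size-ones zero zero l = refl
size-ones (suc n) zero l = size-ones n zero z≤n
size-ones (suc n) (suc h) (s≤s l) = cong suc (size-ones n h l)

-- At an ascent of `C` the extra 1 subtracted in the second place makes up for the step of δ, so
-- both places are shifted by the same amount; by `alt-kill` such a `C` then cancels.
ρ⁻-sym : ∀ {n} i (γ : Vec ℤ n) C → bit i C ≡ false → bit (suc i) C ≡ true →
         ρ⁻ (swapAt i γ) ⊖ C ≡ swapAt i (ρ⁻ γ ⊖ C)
ρ⁻-sym zero (a ∷ b ∷ γ) (false ∷ true ∷ C) refl refl = cong₂ (λ x y → x ∷ y ∷ _) (lem b _) (sym (lem a _))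
  where
  lem : ∀ b n → (b - (1ℤ + n)) - 0ℤ ≡ (b - n) - 1ℤ
  lem = solve-∀
ρ⁻-sym (suc i) (a ∷ γ) (c ∷ C) p q = cong (_ ∷_) (ρ⁻-sym i γ C p q)
ρ⁻-sym zero (a ∷ []) (false ∷ []) p ()

∑-bits-only : ∀ {n} (C₀ : Vec Bool n) (g : Vec Bool n → ℤ) → (∀ C → C ≢ C₀ → g C ≡ 0ℤ) → ∑ (bits n) g ≡ g C₀
∑-bits-only [] g h = +-identityʳ _
∑-bits-only {suc n} (true ∷ C₀) g h = ∑-bits n g ∙
  cong₂ _+_ (∑-bits-only C₀ (g ∘ (true ∷_)) λ C ne → h _ λ { refl → ne refl }) (∑-zero (bits n) λ C → h _ λ ()) ∙
    +-identityʳ _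
∑-bits-only {suc n} (false ∷ C₀) g h = ∑-bits n g ∙
  cong₂ _+_ (∑-zero (bits n) λ C → h _ λ ()) (∑-bits-only C₀ (g ∘ (false ∷_)) λ C ne → h _ λ { refl → ne refl }) ∙
    +-identityˡ _

-- Only the columns {1,…,h} survive antisymmetrization.
alt-survive : ∀ {n} h (F : Vec Bool n → Vec ℤ n → ℤ) →
              (∀ C i → Ascent i C → ∀ β → alt (λ γ → F C (ρ⁻ γ ⊖ C)) β ≡ 0ℤ) → ∀ β →
              alt (λ γ → ∑ (bits n) λ C → (size C ≡ᵇ h) ▸ F C (ρ⁻ γ ⊖ C)) β
              ≡ (h ≤ᵇ n) ▸ alt (λ γ → F (ones h) (ρ⁻ γ ⊖ ones h)) β
alt-survive {n} h F kill β =
  alt-∑ (bits n) (λ C γ → (size C ≡ᵇ h) ▸ F C (ρ⁻ γ ⊖ C)) β ∙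
    (∑-cong (bits n) λ C → alt-▸ (size C ≡ᵇ h) (λ γ → F C (ρ⁻ γ ⊖ C)) β) ∙ split
  where
  g : Vec Bool n → ℤ
  g C = alt (λ γ → F C (ρ⁻ γ ⊖ C)) β
  split : ∑ (bits n) (λ C → (size C ≡ᵇ h) ▸ g C) ≡ (h ≤ᵇ n) ▸ g (ones h)
  split with h ≤ᵇ n in eq
  ... | true = ∑-bits-only (ones h) _ other ∙ cong (_▸ g (ones h)) (sz (size-ones n h (ℕₚ.≤ᵇ⇒≤ h n (subst T (sym eq) tt))))
    where
    sz : size (ones {n} h) ≡ h → (size (ones {n} h) ≡ᵇ h) ≡ true
    sz e with size (ones {n} h) ≡ᵇ h in e'
    ... | true = refl
    ... | false = ⊥-elim (subst T e' (ℕₚ.≡⇒≡ᵇ _ h e))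
    other : ∀ C → C ≢ ones h → (size C ≡ᵇ h) ▸ g C ≡ 0ℤ
    other C ne with size C ≡ᵇ h in e'
    ... | false = refl
    ... | true with ascent? C
    ...   | inj₁ (i , a) = kill C i a β
    ...   | inj₂ e = ⊥-elim (ne (e ∙ cong ones (≡ᵇ-true e')))
  ... | false = ∑-zero (bits n) none
    where
    none : ∀ C → (size C ≡ᵇ h) ▸ g C ≡ 0ℤ
    none C with size C ≡ᵇ h in e'
    ... | false = refl
    ... | true = ⊥-elim (subst T eq (ℕₚ.≤⇒≤ᵇ (subst (_≤ n) (≡ᵇ-true e') (size≤ C))))

Φ-big : ∀ {n} φ h μ v e (α : Vec ℤ n) → n < h → Φ φ (h ∷ μ) v e α ≡ 0ℤ
Φ-big {n} φ h μ v e α l = ∑-zero (bits n) go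
  where
  go : ∀ D → (size D ≡ᵇ h) ▸ _ ≡ 0ℤ
  go D with size D ≡ᵇ h in eq
  ... | false = refl
  ... | true = ⊥-elim (<⇒≱ l (subst (_≤ n) (≡ᵇ-true eq) (size≤ D)))

map-suc-dn : ∀ k h → map suc (dn k h) ≡ dn (suc k) h
map-suc-dn k zero = refl
map-suc-dn k (suc h) = cong (suc (k ℕ.+ suc h) ∷_) (map-suc-dn k h)

dn-suc : ∀ h → map suc (dn 0 h) ++ 1 ∷ [] ≡ dn 0 (suc h)
dn-suc h = cong (_++ 1 ∷ []) (map-suc-dn 0 h) ∙ sym (dn-split 1 h)

desc-ones : ∀ n h → h ≤ n → desc (ones {n} h) ≡ dn 0 h
desc-ones zero zero l = refl
desc-ones (suc n) zero l = cong (map suc) (desc-ones n zero z≤n)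
desc-ones (suc n) (suc h) (s≤s l) = cong (λ t → map suc t ++ 1 ∷ []) (desc-ones n h l) ∙ dn-suc h

tailSum-ones : ∀ {n} h (α : Vec ℤ n) → tailSum h (α ⊖ ones h) ≡ tailSum h α
tailSum-ones h [] = refl
tailSum-ones zero (a ∷ α) = cong₂ _+_ (+-identityʳ a) (tailSum-ones zero α)
tailSum-ones (suc h) (a ∷ α) = tailSum-ones h α

All≤-trans : ∀ {a b μ} → a ≤ b → All (_≤ a) μ → All (_≤ b) μ
All≤-trans l = All.map (λ x → ≤-trans x l)

pred-dn-zero : ∀ h → map pred (dn 0 (suc h)) ≡ dn 0 h ++ 0 ∷ []
pred-dn-zero zero = refl
pred-dn-zero (suc h) = cong (suc h ∷_) (pred-dn-zero h)

-- In the case `hole` later columns may be one cell taller than the first; the additional row has no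
-- cell in the first column and receives the left entry 0.
data Tail (h : ℕ) (μ : List ℕ) : List ℕ → Set where
  full : All (_≤ h) μ → Tail h μ []
  hole : All (_≤ suc h) μ → Tail h μ (0 ∷ [])

Tail-Zeros : ∀ {h μ z} → Tail h μ z → Zeros z
Tail-Zeros (full _) = znil
Tail-Zeros (hole _) = zcons znil

-- In the case `hole` one rotation backwards turns the entry 0 into the letter 1 and the column into
-- an interval of length `suc h`; returning the rotated variable gives the same substitution as in
-- the case `full`.
Φ-prefix : ∀ {n} φ μ h → h ≤ n → Dec≥ μ → ∀ {z} → Tail h μ z → ∀ e (α : Vec ℤ n) →
           Φ φ μ (dn 0 h ++ z) e α ≡ G φ μ (e - tailSum h α) α
Φ-prefix {n} φ μ h l dm (full bd) e α rewrite ++-[] (dn 0 h) =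
  Φ-interval φ μ 0 h (n ∸ h) (ℕₚ.m+[n∸m]≡n l) dm bd e α
Φ-prefix {n} φ μ h l dm (hole bd) e α with ℕₚ.m≤n⇒m<n∨m≡n l
Φ-prefix {suc n} φ μ h l dm (hole bd) e α | inj₁ (s≤s l') with ∷ʳ-view α
... | β , a , refl =
  cong (λ v → Φ φ μ v e (β ∷ʳ a)) (sym (pred-dn-zero h)) ∙
    sym (Φ-rotate φ μ (dn 0 (suc h)) e a β dm (subst (λ k → All (_≤ k) μ) (sym (length-dn 0 (suc h))) bd)
                  (positive-dn n 0 (suc h) (s≤s l'))) ∙
      Φ-interval φ μ 0 (suc h) (n ∸ h) (cong suc (ℕₚ.m+[n∸m]≡n l')) dm bd (e - a) (a ∷ β) ∙
        sym-rotate (G φ μ _) (G-sym φ μ _) a β ∙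
          cong (λ t → G φ μ t (β ∷ʳ a)) (minus-minus e a (tailSum h β) ∙ cong (λ t → e - t) (sym (tailSum-∷ʳ h β a l')))
Φ-prefix {n} φ [] h l dm (hole bd) e α | inj₂ refl rewrite tailSum-all α = cong (λ t → isZ α ▸ φ t) (minus-0⁻ e)
-- With `h` equal to `n` there is no variable left to rotate. Either the next column has height n +
-- 1 and both sides vanish, or the additional row is empty.
Φ-prefix {n} φ (x ∷ μ) h l dm (hole (b ∷ bd)) e α | inj₂ refl with ℕₚ.m≤n⇒m<n∨m≡n b
... | inj₂ refl = Φ-big φ (suc n) μ (dn 0 n ++ 0 ∷ []) e α ≤-refl ∙
                    sym (Φ-big φ (suc n) μ (dn 0 n) (e - tailSum n α) α ≤-refl)
... | inj₁ (s≤s b') rewrite tailSum-all α =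
  Φ-++ φ (x ∷ μ) (dn 0 n) (0 ∷ []) e α (subst (λ k → All (_≤ k) (x ∷ μ)) (sym (length-dn 0 n)) (b' ∷ All≤-trans b' (proj₁ dm))) ∙
    cong (λ t → G φ (x ∷ μ) t α) (minus-0⁻ e)

-- alt of x_1 ⋯ x_h g(x_1, …, x_h, t x_{h+1}, …, t x_n).
𝓑 : ∀ {n} → ℕ → Ser n → ℤ → Vec ℤ n → ℤ
𝓑 h g e β = alt (λ γ → g (e - tailSum h (ρ⁻ γ)) (ρ⁻ γ ⊖ ones h)) β

-- Of all first columns only {1,...,h} survives, and next to it the rest is `G` after a
-- substitution. Both kinds of tail give the same value, which is what makes columns of unsorted
-- heights comparable with sorted ones.
alt-K : ∀ {n} φ z h μ → Dec≥ μ → Tail h μ z → ∀ e (β : Vec ℤ n) →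
        alt (λ γ → K φ z h μ e (ρ⁻ γ)) β ≡ (h ≤ᵇ n) ▸ 𝓑 h (G φ μ) e β
alt-K {n} φ z h μ dm tl e β =
  alt-survive h (λ C → Φ φ μ (desc C ++ z) e) kill β ∙
    ▸-cong (h ≤ᵇ n) λ h≤ → let l = ℕₚ.≤ᵇ⇒≤ h n (subst T (sym h≤) tt) in alt-cong β λ γ →
      cong (λ v → Φ φ μ (v ++ z) e (ρ⁻ γ ⊖ ones h)) (desc-ones n h l) ∙
        Φ-prefix φ μ h l dm tl e (ρ⁻ γ ⊖ ones h) ∙
          cong (λ t → G φ μ (e - t) (ρ⁻ γ ⊖ ones h)) (tailSum-ones h (ρ⁻ γ))
  where
  kill : ∀ C i → Ascent i C → ∀ β → alt (λ γ → Φ φ μ (desc C ++ z) e (ρ⁻ γ ⊖ C)) β ≡ 0ℤ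
  kill C i (p , q) = alt-kill i _ i<n λ γ →
    trans (cong (Φ φ μ (desc C ++ z) e) (ρ⁻-sym i γ C p q))
      (Φ-sym i i<n φ μ (desc C ++ z) (good-++ (good-desc i C p) (Tail-Zeros tl)) e (ρ⁻ γ ⊖ C))
    where i<n = bit-true-< (suc i) C q

-- Exchanging columns of neighbouring heights.

rot₁ : ∀ {A : Set} {n} → Vec A (suc n) → Vec A (suc n)
rot₁ (x ∷ γ) = γ ∷ʳ x

-- Cyclic shift of the variables. In `commute` a shift by `a` brings x_{a+1} to the front, and one
-- by a + 1 brings it to the end, where the two sides can be compared by a rotation of the alphabet.
rotN : ∀ {A : Set} {n} → ℕ → Vec A (suc n) → Vec A (suc n)
rotN zero γ = γ
rotN (suc a) γ = rotN a (rot₁ γ)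

rotN-suc : ∀ {A : Set} {n} a (γ : Vec A (suc n)) → rotN (suc a) γ ≡ rot₁ (rotN a γ)
rotN-suc zero γ = refl
rotN-suc (suc a) γ = rotN-suc a (rot₁ γ)

rotN-surj : ∀ {A : Set} {n} a (C : Vec A (suc n)) → ∃ λ Ĉ → rotN a Ĉ ≡ C
rotN-surj zero C = C , refl
rotN-surj (suc a) C with rotN-surj a C
... | D , refl with ∷ʳ-view D
...   | β , x , refl = x ∷ β , refl

rotN-⊖ : ∀ {n} a (α : Vec ℤ (suc n)) D → rotN a (α ⊖ D) ≡ rotN a α ⊖ rotN a D
rotN-⊖ zero α D = refl
rotN-⊖ (suc a) (x ∷ α) (d ∷ D) = cong (rotN a) (sym (⊖-∷ʳ α x D d)) ∙ rotN-⊖ a (α ∷ʳ x) (D ∷ʳ d)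

rotN-sym : ∀ {n} (p : Vec ℤ (suc n) → ℤ) → SymF p → ∀ a γ → p (rotN a γ) ≡ p γ
rotN-sym p s zero γ = refl
rotN-sym p s (suc a) (x ∷ γ) = rotN-sym p s a (γ ∷ʳ x) ∙ sym (sym-rotate p s x γ)

bit-∷ʳ : ∀ {n} j (D : Vec Bool n) d → j < n → bit j (D ∷ʳ d) ≡ bit j D
bit-∷ʳ zero (x ∷ D) d l = refl
bit-∷ʳ (suc j) (x ∷ D) d (s≤s l) = bit-∷ʳ j D d l

bit-∷ʳ-last : ∀ {n} (D : Vec Bool n) d → bit n (D ∷ʳ d) ≡ d
bit-∷ʳ-last [] d = refl
bit-∷ʳ-last (x ∷ D) d = bit-∷ʳ-last D d

swapAt-∷ʳ : ∀ {A : Set} {n} i (γ : Vec A n) x → suc i < n → swapAt i (γ ∷ʳ x) ≡ swapAt i γ ∷ʳ x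
swapAt-∷ʳ zero (a ∷ b ∷ γ) x l = refl
swapAt-∷ʳ (suc i) (a ∷ γ) x (s≤s l) = cong (a ∷_) (swapAt-∷ʳ i γ x l)
swapAt-∷ʳ zero (a ∷ []) x (s≤s ())

swapAt-last : ∀ {A : Set} {n} (γ : Vec A n) x y → swapAt n ((γ ∷ʳ x) ∷ʳ y) ≡ (γ ∷ʳ y) ∷ʳ x
swapAt-last [] x y = refl
swapAt-last (a ∷ γ) x y = cong (a ∷_) (swapAt-last γ x y)

-- Two neighbours that are not separated by the cut after the first `a` places are still neighbours
-- after the shift.
record RotSwap (n a i : ℕ) : Set₁ where
  field
    i' : ℕ
    i'< : suc i' < suc n
    swaps : ∀ {A : Set} (v : Vec A (suc n)) → rotN a (swapAt i v) ≡ swapAt i' (rotN a v)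
    bits' : ∀ (D : Vec Bool (suc n)) → bit i' (rotN a D) ≡ bit i D

rotSwap : ∀ n a i → suc i < suc n → suc i ≢ a → a ≤ suc n → RotSwap n a i
rotSwap n zero i l ne la = record { i' = i ; i'< = l ; swaps = λ _ → refl ; bits' = λ _ → refl }
rotSwap n (suc a) (suc i) (s≤s l) ne la = record
  { i' = i' ; i'< = i'<
  ; swaps = λ { (x ∷ v) → trans (cong (rotN a) (sym (swapAt-∷ʳ i v x l))) (swaps (v ∷ʳ x)) }
  ; bits' = λ { (x ∷ D) → trans (bits' (D ∷ʳ x)) (bit-∷ʳ i D x (<-trans (n<1+n i) l)) } }
  where open RotSwap (rotSwap n a i (<-trans l (n<1+n n)) (ne ∘ cong suc) (≤-trans (n≤1+n a) la))
rotSwap n (suc zero) zero l ne la = ⊥-elim (ne refl)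
rotSwap (suc m) (suc (suc a)) zero l ne (s≤s (s≤s la)) = record
  { i' = i' ; i'< = i'<
  ; swaps = λ { (x ∷ y ∷ v) → trans (cong (rotN a) (sym (swapAt-last v x y))) (swaps ((v ∷ʳ x) ∷ʳ y)) }
  ; bits' = λ { (x ∷ y ∷ D) → trans (bits' ((D ∷ʳ x) ∷ʳ y)) (bit-∷ʳ m (D ∷ʳ x) y (n<1+n m) ∙ bit-∷ʳ-last D x) } }
  where open RotSwap (rotSwap (suc m) a m (s≤s ≤-refl) (λ e → ℕₚ.<-irrefl (sym e) (s≤s la))
                        (≤-trans la (≤-trans (n≤1+n m) (n≤1+n (suc m)))))

tailSum-ρ⁻ : ∀ {n} a (γ : Vec ℤ n) → tailSum a (ρ⁻ γ) ≡ tailSum a γ + tailSum a (ρ⁻ {n} (Vec.replicate n 0ℤ))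
tailSum-ρ⁻ a [] = refl
tailSum-ρ⁻ {suc n} zero (x ∷ γ) = +ˡ (x - + n) (tailSum-ρ⁻ 0 γ) ∙ lem x (+ n) (tailSum 0 γ) _
  where
  lem : ∀ x n a b → (x - n) + (a + b) ≡ (x + a) + ((0ℤ - n) + b)
  lem = solve-∀
tailSum-ρ⁻ (suc a) (x ∷ γ) = tailSum-ρ⁻ a γ

tailSum-swapAt : ∀ {n} a i (γ : Vec ℤ n) → suc i ≢ a → tailSum a (swapAt i γ) ≡ tailSum a γ
tailSum-swapAt a i [] ne = refl
tailSum-swapAt a zero (x ∷ []) ne = refl
tailSum-swapAt zero zero (x ∷ y ∷ γ) ne = +-swap y x (tailSum 0 γ)
tailSum-swapAt (suc zero) zero (x ∷ y ∷ γ) ne = ⊥-elim (ne refl)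
tailSum-swapAt (suc (suc a)) zero (x ∷ y ∷ γ) ne = refl
tailSum-swapAt zero (suc i) (x ∷ γ) ne = +ˡ x (tailSum-swapAt 0 i γ λ ())
tailSum-swapAt (suc a) (suc i) (x ∷ γ) ne = tailSum-swapAt a i γ (ne ∘ cong suc)

bit-ones : ∀ {n} a i → suc i < n → suc i ≢ a → bit i (ones {n} a) ≡ bit (suc i) (ones {n} a)
bit-ones {suc (suc n)} zero zero l ne = refl
bit-ones {suc n} zero (suc i) (s≤s l) ne = bit-ones zero i l λ ()
bit-ones (suc zero) zero l ne = ⊥-elim (ne refl)
bit-ones {suc (suc n)} (suc (suc a)) zero l ne = refl
bit-ones {suc n} (suc a) (suc i) (s≤s l) ne = bit-ones a i l (ne ∘ cong suc)
bit-ones {suc zero} zero zero (s≤s ()) ne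
bit-ones {suc zero} (suc (suc a)) zero (s≤s ()) ne

⊖-comm : ∀ {n} (α : Vec ℤ n) C D → α ⊖ C ⊖ D ≡ α ⊖ D ⊖ C
⊖-comm [] [] [] = refl
⊖-comm (a ∷ α) (c ∷ C) (d ∷ D) = cong₂ _∷_ (minus-comm a [ c ]ᵇ [ d ]ᵇ) (⊖-comm α C D)

block-sym : ∀ {n} a i (γ : Vec ℤ n) C → suc i ≢ a → Ascent i C →
            ρ⁻ (swapAt i γ) ⊖ ones a ⊖ C ≡ swapAt i (ρ⁻ γ ⊖ ones a ⊖ C)
block-sym a i γ C ne (p , q) =
  ⊖-comm _ (ones a) C ∙ cong (_⊖ ones a) (ρ⁻-sym i γ C p q) ∙
    cong (swapAt i (ρ⁻ γ ⊖ C) ⊖_) (sym (swapAt-same i (ones a) (bit-ones a i (bit-true-< (suc i) C q) ne))) ∙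
      sym (swapAt-⊖ i (ρ⁻ γ ⊖ C) (ones a)) ∙ cong (swapAt i) (⊖-comm (ρ⁻ γ) C (ones a))

-- The substitution t x_j for j > a respects exchanges only within the first `a` places or within
-- the others. An ascent inside one of these blocks still makes the column cancel; `suc i ≢ a`
-- excludes the border.
block-kill : ∀ {n} φ z μ a e (C Ĉ : Vec Bool (suc n)) i → Zeros z → rotN a Ĉ ≡ C → a ≤ suc n → suc i ≢ a → Ascent i Ĉ → ∀ β →
             alt (λ γ → Φ φ μ (desc C ++ z) (e - tailSum a (ρ⁻ γ)) (rotN a (ρ⁻ γ ⊖ ones a) ⊖ C)) β ≡ 0ℤ
block-kill {n} φ z μ a e _ Ĉ i zs refl la ne asc@(p , q) = alt-kill i _ l λ γ →
  trans (cong₂ (λ s t → Φ φ μ (desc C ++ z) (e - s) t) (inv γ)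
          (sym (rotN-⊖ a _ Ĉ) ∙ cong (rotN a) (block-sym a i γ Ĉ ne asc) ∙ swaps _))
    (Φ-sym i' i'< φ μ (desc C ++ z) (good-++ (good-desc i' C (bits' Ĉ ∙ p)) zs) _ (rotN a (ρ⁻ γ ⊖ ones a ⊖ Ĉ)) ∙
      cong (Φ φ μ (desc C ++ z) _) (rotN-⊖ a _ Ĉ))
  where
  C = rotN a Ĉ
  l = bit-true-< (suc i) Ĉ q
  open RotSwap (rotSwap n a i l ne la)
  inv : ∀ γ → tailSum a (ρ⁻ (swapAt i γ)) ≡ tailSum a (ρ⁻ γ)
  inv γ = tailSum-ρ⁻ a (swapAt i γ) ∙ cong (λ t → t + _) (tailSum-swapAt a i γ ne) ∙ sym (tailSum-ρ⁻ a γ)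

ascent-first : ∀ {n} (D : Vec Bool n) → 0 < size D → ∃ λ i → Ascent i (false ∷ D)
ascent-first (true ∷ D) l = 0 , refl , refl
ascent-first (false ∷ D) l with ascent-first D l
... | i , p = suc i , p

-- More than `a` elements without position `a` means that some element lies beyond it, and the gap
-- at `a` precedes that element.
ascent-beyond : ∀ {n} a (D : Vec Bool n) → a < n → bit a D ≡ false → a < size D → ∃ λ i → suc i ≢ a × Ascent i D
ascent-beyond zero (false ∷ D) la h l with ascent-first D l
... | i , p = i , (λ ()) , p
ascent-beyond (suc a) (true ∷ D) (s≤s la) h (s≤s l) with ascent-beyond a D la h l
... | i , ne , p = suc i , ne ∘ suc-injective , p
ascent-beyond (suc a) (false ∷ D) (s≤s la) h l with ascent-beyond a D la h (<-trans (n<1+n a) l)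
... | i , ne , p = suc i , ne ∘ suc-injective , p

ascent-upto : ∀ {n} a (D : Vec Bool n) → bit a D ≡ true → ∃ λ i → suc i ≤ suc a × Ascent i (false ∷ D)
ascent-upto a (true ∷ D) h = 0 , s≤s z≤n , refl , refl
ascent-upto (suc a) (false ∷ D) h with ascent-upto a D h
... | i , l , p = suc i , s≤s l , p

-- At most `a` elements including position `a` means that some position before it is free.
ascent-within : ∀ {n} a (D : Vec Bool n) → bit a D ≡ true → size D ≤ a → ∃ λ i → suc i ≤ a × Ascent i D
ascent-within zero (true ∷ D) h ()
ascent-within (suc a) (true ∷ D) h (s≤s l) with ascent-within a D h l
... | i , l' , p = suc i , s≤s l' , p
ascent-within (suc a) (false ∷ D) h l = ascent-upto a D h

size-rotN : ∀ {n} a (D : Vec Bool (suc n)) → size (rotN a D) ≡ size D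
size-rotN zero D = refl
size-rotN (suc a) (d ∷ D) = size-rotN a (D ∷ʳ d) ∙ size-∷ʳ D d

at : ∀ {n} → ℕ → Vec ℤ n → ℤ
at _ [] = 0ℤ
at zero (x ∷ γ) = x
at (suc a) (x ∷ γ) = at a γ

at-∷ʳ : ∀ {n} a (γ : Vec ℤ n) x → a < n → at a (γ ∷ʳ x) ≡ at a γ
at-∷ʳ zero (y ∷ γ) x l = refl
at-∷ʳ (suc a) (y ∷ γ) x (s≤s l) = at-∷ʳ a γ x l

rotN-head : ∀ {n} a (α : Vec ℤ (suc n)) → a < suc n → ∃ λ ω → rotN a α ≡ at a α ∷ ω
rotN-head zero (x ∷ α) l = α , refl
rotN-head (suc a) (x ∷ α) (s≤s l) with rotN-head a (α ∷ʳ x) (<-trans l (n<1+n _))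
... | ω , e = ω , trans e (cong (_∷ ω) (at-∷ʳ a α x l))

tailSum-at : ∀ {n} a (α : Vec ℤ n) → tailSum a α ≡ at a α + tailSum (suc a) α
tailSum-at a [] = refl
tailSum-at zero (x ∷ α) = refl
tailSum-at (suc a) (x ∷ α) = tailSum-at a α

data Differ : ∀ {n} → ℕ → Vec Bool n → Vec Bool n → Set where
  dzero : ∀ {n} {r : Vec Bool n} → Differ 0 (false ∷ r) (true ∷ r)
  dsuc : ∀ {n a x} {u u' : Vec Bool n} → Differ a u u' → Differ (suc a) (x ∷ u) (x ∷ u')

differ-∷ʳ : ∀ {n a x} {u u' : Vec Bool n} → Differ a u u' → Differ a (u ∷ʳ x) (u' ∷ʳ x)
differ-∷ʳ dzero = dzero
differ-∷ʳ (dsuc d) = dsuc (differ-∷ʳ d)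

differ-rotN : ∀ {n} a {u u' : Vec Bool (suc n)} → Differ a u u' → ∃ λ o → rotN a u ≡ false ∷ o × rotN a u' ≡ true ∷ o
differ-rotN zero dzero = _ , refl , refl
differ-rotN (suc a) (dsuc d) = differ-rotN a (differ-∷ʳ d)

differ-ones : ∀ {n} a → a < n → Differ a (ones {n} a) (ones {n} (suc a))
differ-ones {suc n} zero l = dzero
differ-ones {suc n} (suc a) (s≤s l) = dsuc (differ-ones a l)

pred-desc : ∀ {n} (E : Vec Bool n) → map pred (desc (true ∷ E) ++ []) ≡ desc (E ∷ʳ false) ++ 0 ∷ []
pred-desc E rewrite ++-[] (map suc (desc E) ++ 1 ∷ []) | desc-∷ʳ E = go (desc E)
  where
  go : ∀ u → map pred (map suc u ++ 1 ∷ []) ≡ u ++ 0 ∷ []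
  go [] = refl
  go (x ∷ u) = cong (x ∷_) (go u)

bit-rotN : ∀ {n} a (D : Vec Bool (suc n)) → a < suc n → bit 0 (rotN a D) ≡ bit a D
bit-rotN zero D l = refl
bit-rotN (suc a) (d ∷ D) (s≤s l) = bit-rotN a (D ∷ʳ d) (<-trans l (n<1+n _)) ∙ bit-∷ʳ a D d l

rot₁-last : ∀ {n} (D : Vec Bool (suc n)) → bit n (rot₁ D) ≡ bit 0 D
rot₁-last (d ∷ D) = bit-∷ʳ-last D d

-- Exchanging a column of height a with a column of height a + 1 costs a factor t.
commute : ∀ {n} φ μ a → a < n → Dec≥ μ → All (_≤ suc a) μ → ∀ e (β : Vec ℤ n) →
          𝓑 a (G φ (suc a ∷ μ)) e β ≡ 𝓑 (suc a) (K φ (0 ∷ []) a μ) (e - 1ℤ) β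
commute {suc n} φ μ a la dm bd e β =
  alt-cong β lhs ∙ alt-∑ (bits (suc n)) (λ C γ → (size C ≡ᵇ b) ▸ L C γ) β ∙ (∑-cong (bits (suc n)) λ C → alt-▸ (size C ≡ᵇ b) (L C) β) ∙
          ∑-bits n _ ∙ +ˡ (∑ (bits n) (λ E → (suc (size E) ≡ᵇ b) ▸ alt (L (true ∷ E)) β)) (∑-zero (bits n) deadL) ∙ +-identityʳ _ ∙
    (∑-cong (bits n) λ E → (▸-cong (size E ≡ᵇ a) λ sz → alt-cong β (match E (≡ᵇ-true sz))) ∙
                                       cong (λ s → (s ≡ᵇ a) ▸ alt (R (E ∷ʳ false)) β) (sym (size-∷ʳ E false))) ∙
      sym (alt-cong β rhs ∙ alt-∑ (bits (suc n)) (λ C γ → (size C ≡ᵇ a) ▸ R C γ) β ∙ (∑-cong (bits (suc n)) λ C → alt-▸ (size C ≡ᵇ a) (R C) β) ∙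
          ∑-bits-∷ʳ n _ ∙ +ʳ (∑ (bits n) (λ E → (size (E ∷ʳ false) ≡ᵇ a) ▸ alt (R (E ∷ʳ false)) β)) (∑-zero (bits n) deadR) ∙ +-identityˡ _)
  where
  b = suc a
  L R : Vec Bool (suc n) → Vec ℤ (suc n) → ℤ
  L C γ = Φ φ μ (desc C ++ []) (e - tailSum a (ρ⁻ γ)) (rotN a (ρ⁻ γ ⊖ ones a) ⊖ C)
  R C γ = Φ φ μ (desc C ++ 0 ∷ []) (e - 1ℤ - tailSum b (ρ⁻ γ)) (rotN b (ρ⁻ γ ⊖ ones b) ⊖ C)
  lhs : ∀ γ → G φ (b ∷ μ) (e - tailSum a (ρ⁻ γ)) (ρ⁻ γ ⊖ ones a) ≡ ∑ (bits (suc n)) (λ C → (size C ≡ᵇ b) ▸ L C γ)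
  lhs γ = G-cons φ b μ (e - tailSum a (ρ⁻ γ)) (ρ⁻ γ ⊖ ones a) ∙ sym (rotN-sym _ (K-sym φ [] b μ _ znil) a (ρ⁻ γ ⊖ ones a))
  rhs : ∀ γ → K φ (0 ∷ []) a μ (e - 1ℤ - tailSum b (ρ⁻ γ)) (ρ⁻ γ ⊖ ones b) ≡ ∑ (bits (suc n)) (λ C → (size C ≡ᵇ a) ▸ R C γ)
  rhs γ = sym (rotN-sym _ (K-sym φ (0 ∷ []) a μ _ (zcons znil)) b (ρ⁻ γ ⊖ ones b))
  -- A column of height a + 1 without x_{a+1} must use a later variable, which gives an ascent in
  -- the second block.
  deadL : ∀ E → (size E ≡ᵇ b) ▸ alt (L (false ∷ E)) β ≡ 0ℤ
  deadL E with size E ≡ᵇ b in eq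
  ... | false = refl
  ... | true with rotN-surj a (false ∷ E)
  ...   | Ĉ , r with ascent-beyond a Ĉ la (sym (bit-rotN a Ĉ la) ∙ cong (bit 0) r)
                       (subst (a <_) (sym (≡ᵇ-true eq) ∙ cong size (sym r) ∙ size-rotN a Ĉ) ≤-refl)
  ...     | i , ne , asc = block-kill φ [] μ a e (false ∷ E) Ĉ i znil r (<⇒≤ la) ne asc β
  -- A column of height `a` that contains x_{a+1} misses one of the variables before it, which gives
  -- an ascent in the first block of a + 1 places.
  deadR : ∀ E → (size (E ∷ʳ true) ≡ᵇ a) ▸ alt (R (E ∷ʳ true)) β ≡ 0ℤ
  deadR E with size (E ∷ʳ true) ≡ᵇ a in eq
  ... | false = refl
  ... | true with rotN-surj b (E ∷ʳ true)
  ...   | Ĉ , r with ascent-within a Ĉ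
                       (sym (bit-rotN a Ĉ la) ∙ sym (rot₁-last (rotN a Ĉ)) ∙ cong (bit n) (sym (rotN-suc a Ĉ) ∙ r) ∙ bit-∷ʳ-last E true)
                       (≤-reflexive (sym (size-rotN b Ĉ) ∙ cong size r ∙ ≡ᵇ-true eq))
  ...     | i , l , asc = block-kill φ (0 ∷ []) μ b (e - 1ℤ) (E ∷ʳ true) Ĉ i (zcons znil) r la (λ { refl → ℕₚ.<-irrefl refl l }) asc β
  -- The survivors correspond: on the left x_{a+1} is the first letter and belongs to the column, on
  -- the right it is the last letter and is missing. Rotation lowers the bottom entry 1 of the left
  -- column to the entry 0 appended on the right.
  match : ∀ E → size E ≡ a → ∀ γ → L (true ∷ E) γ ≡ R (E ∷ʳ false) γ
  match E sz γ with rotN-head a (ρ⁻ γ) la | differ-rotN a (differ-ones {suc n} a la)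
  ... | ω , eω | o , eo , eo' = cong₂ (Φ φ μ (desc (true ∷ E) ++ [])) eqe argL ∙
      Φ-rotate φ μ (desc (true ∷ E) ++ []) (e - 1ℤ - tailSum b (ρ⁻ γ)) ((x - 0ℤ) - 1ℤ) (ω ⊖ o ⊖ E) dm len pos ∙
        cong₂ (λ s t → Φ φ μ s (e - 1ℤ - tailSum b (ρ⁻ γ)) t) (pred-desc E) (sym argR)
    where
    x = at a (ρ⁻ γ)
    len : All (_≤ length (desc (true ∷ E) ++ [])) μ
    len = subst (λ k → All (_≤ k) μ)
            (sym (cong length (++-[] (desc (true ∷ E))) ∙ length-desc (true ∷ E) ∙ cong suc sz)) bd
    pos : Positive n (desc (true ∷ E) ++ [])
    pos = subst (Positive n) (arr-desc (true ∷ E) ∙ sym (++-[] (desc (true ∷ E)))) (arr-positive (dn 0 (suc n)) (true ∷ E))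
    argL : rotN a (ρ⁻ γ ⊖ ones a) ⊖ (true ∷ E) ≡ ((x - 0ℤ) - 1ℤ) ∷ (ω ⊖ o ⊖ E)
    argL rewrite rotN-⊖ a (ρ⁻ γ) (ones a) | eω | eo = refl
    argR : rotN b (ρ⁻ γ ⊖ ones b) ⊖ (E ∷ʳ false) ≡ (ω ⊖ o ⊖ E) ∷ʳ ((x - 0ℤ) - 1ℤ)
    argR rewrite rotN-suc a (ρ⁻ γ ⊖ ones b) | rotN-⊖ a (ρ⁻ γ) (ones b) | eω | eo' =
      ⊖-∷ʳ (ω ⊖ o) (x - 1ℤ) E false ∙ cong ((ω ⊖ o ⊖ E) ∷ʳ_) (lem x)
      where
      lem : ∀ x → (x - 1ℤ) - 0ℤ ≡ (x - 0ℤ) - 1ℤ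
      lem = solve-∀
    eqe : e - tailSum a (ρ⁻ γ) ≡ (e - 1ℤ - tailSum b (ρ⁻ γ)) - ((x - 0ℤ) - 1ℤ)
    eqe rewrite tailSum-at a (ρ⁻ γ) = lem e x (tailSum b (ρ⁻ γ))
      where
      lem : ∀ e x t → e - (x + t) ≡ (e - 1ℤ - t) - ((x - 0ℤ) - 1ℤ)
      lem = solve-∀

∈-⊖ : ∀ {n} x (γ : Vec ℤ n) D → x ∈ᵥ γ → ∃ λ b → (x - [ b ]ᵇ) ∈ᵥ (γ ⊖ D)
∈-⊖ x (_ ∷ γ) (b ∷ D) here = b , here
∈-⊖ x (_ ∷ γ) (b ∷ D) (there m) with ∈-⊖ x γ D m
... | b' , m' = b' , there m'

isZ-∈ : ∀ {n} x (γ : Vec ℤ n) → x ∈ᵥ γ → isZ γ ≡ true → x ≡ 0ℤ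
isZ-∈ x (_ ∷ γ) here h with x ℤₚ.≟ 0ℤ
... | yes e = e
isZ-∈ x (_ ∷ γ) here () | no _
isZ-∈ x (y ∷ γ) (there m) h with does (y ℤₚ.≟ 0ℤ)
... | true = isZ-∈ x γ m h

Φ-bounded : ∀ {n} φ μ L v e → length μ ≤ L → Bounded {n} (+ L) (Φ φ μ v e)
Φ-bounded φ [] L v e l j γ m with isZ γ in eq
... | false = refl
... | true = ⊥-elim (impossible (isZ-∈ _ γ m eq))
  where
  impossible : + (L ℕ.+ suc j) ≡ 0ℤ → ⊥
  impossible h rewrite ℕₚ.+-suc L j = case h of λ ()
Φ-bounded {n} φ (h ∷ μ) (suc L) v e (s≤s l) j γ m = ∑-zero (bits n) λ D →
  trans (cong ((size D ≡ᵇ h) ▸_) (go D (∈-⊖ _ γ D m))) (▸-zero _)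
  where
  go : ∀ D → (∃ λ b → ((+ suc L + + suc j) - [ b ]ᵇ) ∈ᵥ (γ ⊖ D)) → Φ φ μ (arr v D) (e - + cst (wt (h ∷ μ)) v D) (γ ⊖ D) ≡ 0ℤ
  go D (true , m') = Φ-bounded φ μ L _ _ l j _ (subst (_∈ᵥ (γ ⊖ D)) (suc+minus-1 (+ L) (+ suc j)) m')
  go D (false , m') = Φ-bounded φ μ L _ _ l (suc j) _ (subst (_∈ᵥ (γ ⊖ D)) (suc+minus-0 (+ L) (+ suc j)) m')

K-bounded : ∀ {n} φ z h μ L e → length μ ≤ L → Bounded {n} (+ suc L) (K φ z h μ e)
K-bounded {n} φ z h μ L e l j γ m = ∑-zero (bits n) λ C →
  trans (cong ((size C ≡ᵇ h) ▸_) (go C (∈-⊖ _ γ C m))) (▸-zero _)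
  where
  go : ∀ C → (∃ λ b → ((+ suc L + + suc j) - [ b ]ᵇ) ∈ᵥ (γ ⊖ C)) → Φ φ μ (desc C ++ z) e (γ ⊖ C) ≡ 0ℤ
  go C (true , m') = Φ-bounded φ μ L _ _ l j _ (subst (_∈ᵥ (γ ⊖ C)) (suc+minus-1 (+ L) (+ suc j)) m')
  go C (false , m') = Φ-bounded φ μ L _ _ l (suc j) _ (subst (_∈ᵥ (γ ⊖ C)) (suc+minus-0 (+ L) (+ suc j)) m')

-- The way in which identities of symmetric series are proved here: they are tested after
-- multiplication by a_δ, where few columns survive.
alt-unique : ∀ {n} (p q : Vec ℤ n → ℤ) B → Bounded B p → Bounded B q → SymF p → SymF q →
             (∀ β → alt (λ γ → p (ρ⁻ γ)) β ≡ alt (λ γ → q (ρ⁻ γ)) β) → ∀ γ → p γ ≡ q γ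
alt-unique p q B bp bq sp sq h γ =
  i-j≡0⇒i≡j (p γ) (q γ) (alt-cancel (λ γ → p γ - q γ) B
    (λ j γ m → cong₂ _-_ (bp j γ m) (bq j γ m))
    (λ i l γ → cong₂ _-_ (sp i l γ) (sq i l γ))
    (λ β → alt-+ (λ γ → p (ρ⁻ γ)) (λ γ → - q (ρ⁻ γ)) β ∙
      cong₂ _+_ (h β) (alt-neg (λ γ → q (ρ⁻ γ)) β) ∙ +-inverseʳ (alt (λ γ → q (ρ⁻ γ)) β)) γ)

-- Straightening of the column heights and branching in the first variable.

insert : ℕ → List ℕ → List ℕ
insert a [] = a ∷ []
insert a (h ∷ μ) = if a <ᵇ h then h ∷ insert a μ else a ∷ h ∷ μ

cnt : ℕ → List ℕ → ℕ
cnt k [] = 0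
cnt k (h ∷ μ) = (if h ≡ᵇ k then 1 else 0) ℕ.+ cnt k μ

All-insert : ∀ {P : ℕ → Set} a μ → P a → All P μ → All P (insert a μ)
All-insert a [] p [] = p ∷ []
All-insert a (h ∷ μ) p (q ∷ qs) with a <ᵇ h
... | true = q ∷ All-insert a μ p qs
... | false = p ∷ q ∷ qs

<ᵇ-false⁻ : ∀ {a h} → (a <ᵇ h) ≡ false → h ≤ a
<ᵇ-false⁻ {a} {h} e = ℕₚ.≮⇒≥ λ l → subst T e (ℕₚ.<⇒<ᵇ l)

<ᵇ-true⁻ : ∀ {a h} → (a <ᵇ h) ≡ true → a < h
<ᵇ-true⁻ {a} {h} e = ℕₚ.<ᵇ⇒< a h (subst T (sym e) tt)

Dec-insert : ∀ a μ → Dec≥ μ → Dec≥ (insert a μ)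
Dec-insert a [] d = [] , tt
Dec-insert a (h ∷ μ) (b , d) with a <ᵇ h in eq
... | true = All-insert a μ (<⇒≤ (<ᵇ-true⁻ eq)) b , Dec-insert a μ d
... | false = (<ᵇ-false⁻ eq ∷ All≤-trans (<ᵇ-false⁻ eq) b) , b , d

length-insert : ∀ a μ → length (insert a μ) ≡ suc (length μ)
length-insert a [] = refl
length-insert a (h ∷ μ) with a <ᵇ h
... | true = cong suc (length-insert a μ)
... | false = refl

≡ᵇ-refl : ∀ k → (k ≡ᵇ k) ≡ true
≡ᵇ-refl zero = refl
≡ᵇ-refl (suc k) = ≡ᵇ-refl k

≡ᵇ-false : ∀ {a b} → a ≢ b → (a ≡ᵇ b) ≡ false
≡ᵇ-false {a} {b} ne with a ≡ᵇ b in eq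
... | false = refl
... | true = ⊥-elim (ne (≡ᵇ-true eq))

cnt-< : ∀ k μ → All (_< k) μ → cnt k μ ≡ 0
cnt-< k [] [] = refl
cnt-< k (h ∷ μ) (l ∷ ls) rewrite ≡ᵇ-false (<⇒≢ l) = cnt-< k μ ls

-- The column of height `a` passes the columns of height a + 1 one at a time. Each passage gives one
-- t by `commute`, together `cnt (suc a) μ`.
straighten : ∀ {n} φ a μ → Dec≥ μ → All (_≤ suc a) μ → ∀ e (α : Vec ℤ n) →
             K φ (0 ∷ []) a μ e α ≡ G φ (insert a μ) (e - + cnt (suc a) μ) α
straighten {n} φ a [] dm bd e α =
  (∑-cong (bits n) λ C → refl) ∙ sym (G-cons φ a [] e α) ∙ cong (λ t → G φ (a ∷ []) t α) (minus-0⁻ e)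
straighten {n} φ a (h ∷ μ) (bm , dm) (l ∷ bd) e α with ℕₚ.m≤n⇒m<n∨m≡n l
... | inj₁ (s≤s l') rewrite <ᵇ-false {a} l' | cnt-< (suc a) (h ∷ μ) (s≤s l' ∷ All.map (λ x → s≤s (≤-trans x l')) bm) =
  ∑-cong (bits n) (λ C → ▸-cong (size C ≡ᵇ a) λ sz →
          Φ-++ φ (h ∷ μ) (desc C) (0 ∷ []) e (α ⊖ C)
                  (subst (λ k → All (_≤ k) (h ∷ μ)) (sym (length-desc C ∙ ≡ᵇ-true sz)) (l' ∷ All≤-trans l' bm)) ∙
            cong (λ v → Φ φ (h ∷ μ) v e (α ⊖ C)) (sym (++-[] (desc C)))) ∙
    sym (G-cons φ a (h ∷ μ) e α) ∙ cong (λ t → G φ (a ∷ h ∷ μ) t α) (minus-0⁻ e)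
... | inj₂ refl rewrite <ᵇ-true (n<1+n a) | ≡ᵇ-refl a with <-≤-connex a n
...   | inj₂ n≤a = (∑-zero (bits n) λ C → cong ((size C ≡ᵇ a) ▸_) (Φ-big φ (suc a) μ (desc C ++ 0 ∷ []) e (α ⊖ C) (s≤s n≤a)) ∙ ▸-zero _) ∙
                     sym (Φ-big φ (suc a) (insert a μ) (dn 0 n) (e - + suc (cnt (suc a) μ)) α (s≤s n≤a))
...   | inj₁ a<n = alt-unique (K φ (0 ∷ []) a (suc a ∷ μ) e) (G φ (suc a ∷ insert a μ) e') (+ suc (suc (length μ)))
          (K-bounded φ (0 ∷ []) a (suc a ∷ μ) (suc (length μ)) e ≤-refl)
          (Φ-bounded φ (suc a ∷ insert a μ) _ (dn 0 n) e' (s≤s (≤-reflexive (length-insert a μ))))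
          (K-sym φ (0 ∷ []) a (suc a ∷ μ) e (zcons znil)) (G-sym φ (suc a ∷ insert a μ) e') same α
  where
  c = cnt (suc a) μ
  e' = e - + suc c
  ≤-t : ∀ {k} → k ≤ n → (k ≤ᵇ n) ≡ true
  ≤-t {k} l with k ≤ᵇ n in eq
  ... | true = refl
  ... | false = ⊥-elim (subst T eq (ℕₚ.≤⇒≤ᵇ l))
  same : ∀ β → alt (λ γ → K φ (0 ∷ []) a (suc a ∷ μ) e (ρ⁻ γ)) β ≡ alt (λ γ → G φ (suc a ∷ insert a μ) e' (ρ⁻ γ)) β
  same β =
    alt-K φ (0 ∷ []) a (suc a ∷ μ) (bm , dm) (hole (≤-refl ∷ bm)) e β ∙
     cong (_▸ 𝓑 a (G φ (suc a ∷ μ)) e β) (≤-t (<⇒≤ a<n)) ∙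
      commute φ μ a a<n dm bm e β ∙
       (alt-cong β λ γ → straighten φ a μ dm bm _ (ρ⁻ γ ⊖ ones (suc a)) ∙
                 cong (λ t → G φ (insert a μ) t (ρ⁻ γ ⊖ ones (suc a))) (lem e (tailSum (suc a) (ρ⁻ γ)) (+ c))) ∙
        cong (_▸ 𝓑 (suc a) (G φ (insert a μ)) e' β) (sym (≤-t a<n)) ∙
         sym (alt-K φ [] (suc a) (insert a μ) (Dec-insert a μ dm) (full (All-insert a μ (n≤1+n a) bm)) e' β) ∙
          alt-cong β λ γ → sym (G-cons φ (suc a) (insert a μ) e' (ρ⁻ γ))
    where
    lem : ∀ e t c → (e - 1ℤ - t) - c ≡ (e - (1ℤ + c)) - t
    lem = solve-∀

-- The ways to delete the letter 1, as triples of a power of t, a number of deleted letters and the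
-- sorted remaining heights. A shortened column has to be moved behind those of its old height, and
-- `straighten` supplies the power of t.
br : List ℕ → List (ℕ × ℕ × List ℕ)
br [] = (0 , 0 , []) ∷ []
br (zero ∷ μ) = map (λ (w , k , ν) → (w , k , 0 ∷ ν)) (br μ)
br (suc h ∷ μ) = map (λ (w , k , ν) → (w , k , suc h ∷ ν)) (br μ)
              ++ map (λ (w , k , ν) → (w ℕ.+ cnt (suc h) ν , suc k , insert h ν)) (br μ)

infix 5 _==_
_==_ : ℤ → ℤ → Bool
x == y = does (x ℤₚ.≟ y)

==-cong : ∀ {x y x' y'} → (x ≡ y → x' ≡ y') → (x' ≡ y' → x ≡ y) → (x == y) ≡ (x' == y')
==-cong {x} {y} {x'} {y'} f g with x ℤₚ.≟ y | x' ℤₚ.≟ y'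
... | yes _ | yes _ = refl
... | no _ | no _ = refl
... | yes p | no q = ⊥-elim (q (f p))
... | no p | yes q = ⊥-elim (p (g q))

BrOK : ℕ → ℕ → (ℕ × ℕ × List ℕ) → Set
BrOK L b (w , k , ν) = Dec≥ ν × length ν ≡ L × All (_≤ b) ν

All-map⁺ : ∀ {A B : Set} {P : B → Set} (f : A → B) {xs} → All (P ∘ f) xs → All P (map f xs)
All-map⁺ f [] = []
All-map⁺ f (p ∷ ps) = p ∷ All-map⁺ f ps

All-++⁺ : ∀ {A : Set} {P : A → Set} {xs ys : List A} → All P xs → All P ys → All P (xs ++ ys)
All-++⁺ [] qs = qs
All-++⁺ (p ∷ ps) qs = p ∷ All-++⁺ ps qs

br-ok : ∀ b μ → Dec≥ μ → All (_≤ b) μ → All (BrOK (length μ) b) (br μ)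
br-ok b [] d bd = (tt , refl , []) ∷ []
br-ok b (zero ∷ μ) (bm , d) (l ∷ bd) =
  All-map⁺ _ (All.map (λ { (p , q , r) → (r , p) , cong suc q , z≤n ∷ All≤-trans z≤n r }) (br-ok 0 μ d bm))
br-ok b (suc h ∷ μ) (bm , d) (l ∷ bd) = All-++⁺
  (All-map⁺ _ (All.map (λ { (p , q , r) → (r , p) , cong suc q , l ∷ All≤-trans l r }) (br-ok (suc h) μ d bm)))
  (All-map⁺ _ (All.map (λ { {w , k , ν} (p , q , r) → Dec-insert h ν p , trans (length-insert h ν) (cong suc q) ,
                            All-insert h ν (≤-trans (n≤1+n h) l) (All≤-trans l r) }) (br-ok (suc h) μ d bm)))

∑-congA : ∀ {A : Set} {P : A → Set} {xs : List A} {f g : A → ℤ} → All P xs → (∀ x → P x → f x ≡ g x) → ∑ xs f ≡ ∑ xs g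
∑-congA [] h = refl
∑-congA {xs = x ∷ _} (p ∷ ps) h = cong₂ _+_ (h x p) (∑-congA ps h)

Br : ∀ {n} → (ℤ → ℤ) → List ℕ → ℤ → ℤ → Vec ℤ n → ℤ
Br φ μ e z α = ∑ (br μ) (λ (w , k , ν) → (z == + k) ▸ G φ ν (e - + w) α)

Φ-tail-kill : ∀ {n} φ μ c e z (C : Vec Bool n) i → Ascent i C → ∀ β →
              alt (λ γ → Φ φ μ (desc (c ∷ C) ++ []) e (z ∷ (ρ⁻ γ ⊖ C))) β ≡ 0ℤ
Φ-tail-kill φ μ c e z C i (p , q) = alt-kill i _ i<n λ γ →
  trans (cong (λ t → Φ φ μ (desc (c ∷ C) ++ []) e (z ∷ t)) (ρ⁻-sym i γ C p q))
    (Φ-sym (suc i) (s≤s i<n) φ μ (desc (c ∷ C) ++ []) (good-++ (good-desc (suc i) (c ∷ C) p) znil) e (z ∷ (ρ⁻ γ ⊖ C)))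
  where i<n = bit-true-< (suc i) C q

module _ {n} (φ : ℤ → ℤ) (μ : List ℕ) (dm : Dec≥ μ)
         (IH : ∀ e z (α : Vec ℤ n) → G φ μ e (z ∷ α) ≡ Br φ μ e z α) where

  -- The common value of the two sides of the branching rule after antisymmetrization: the lemmas
  -- `out-lo`, `out-hi` obtain it from the first column of `G`, the lemmas `in-lo`, `in-hi` from the
  -- branches.
  Out : ℕ → ℤ → ℤ → Vec ℤ n → ℤ
  Out h e z β = (h ≤ᵇ n) ▸ ∑ (br μ) (λ (w , k , ν) → (z == + k) ▸ 𝓑 h (G φ ν) (e - + w) β)

  absorb : ∀ h e z β → alt (λ γ → G φ μ (e - tailSum h (ρ⁻ γ ⊖ ones h)) (z ∷ (ρ⁻ γ ⊖ ones h))) β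
           ≡ ∑ (br μ) (λ (w , k , ν) → (z == + k) ▸ 𝓑 h (G φ ν) (e - + w) β)
  absorb h e z β =
    (alt-cong β λ γ → IH (e - tailSum h (ρ⁻ γ ⊖ ones h)) z (ρ⁻ γ ⊖ ones h)) ∙
      alt-∑ (br μ) ((λ (w , k , ν) γ → (z == + k) ▸ G φ ν ((e - tailSum h (ρ⁻ γ ⊖ ones h)) - + w) (ρ⁻ γ ⊖ ones h))) β ∙
        ∑-cong (br μ) (λ (w , k , ν) → alt-▸ (z == + k) (λ γ → G φ ν ((e - tailSum h (ρ⁻ γ ⊖ ones h)) - + w) (ρ⁻ γ ⊖ ones h)) β ∙
          cong ((z == + k) ▸_) (alt-cong β λ γ → cong (λ t → G φ ν t (ρ⁻ γ ⊖ ones h))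
            (minus-comm e (tailSum h (ρ⁻ γ ⊖ ones h)) (+ w) ∙ cong (λ t → (e - + w) - t) (tailSum-ones h (ρ⁻ γ)))))

  -- The first variable is left out of the antisymmetrization, so the surviving column without the
  -- letter 1 is {2,...,h+1}. It is an interval, hence `Φ-interval` reduces the sum to the branching
  -- rule for `μ`.
  out-lo : ∀ h → All (_≤ h) μ → ∀ e z β →
           alt (λ γ → ∑ (bits n) λ C → (size C ≡ᵇ h) ▸ Φ φ μ (desc (false ∷ C) ++ []) e (z ∷ (ρ⁻ γ ⊖ C))) β ≡ Out h e z β
  out-lo h bd e z β =
    alt-survive h (λ C α → Φ φ μ (desc (false ∷ C) ++ []) e (z ∷ α)) (Φ-tail-kill φ μ false e z) β ∙
      ▸-cong (h ≤ᵇ n) λ h≤ → alt-cong β (use (ℕₚ.≤ᵇ⇒≤ h n (subst T (sym h≤) tt))) ∙ absorb h e z β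
    where
    use : h ≤ n → ∀ (γ : Vec ℤ n) → Φ φ μ (desc (false ∷ ones {n} h) ++ []) e (z ∷ (ρ⁻ γ ⊖ ones h)) ≡ G φ μ (e - tailSum h (ρ⁻ γ ⊖ ones h)) (z ∷ (ρ⁻ γ ⊖ ones h))
    use l γ rewrite ++-[] (map suc (desc (ones {n} h))) | desc-ones n h l | map-suc-dn 0 h =
      Φ-interval φ μ 1 h (n ∸ h) (cong suc (ℕₚ.m+[n∸m]≡n l)) dm bd e (z ∷ (ρ⁻ γ ⊖ ones h))

  out-hi : ∀ h → All (_≤ suc h) μ → ∀ e z β →
           alt (λ γ → ∑ (bits n) λ C → (size C ≡ᵇ h) ▸ Φ φ μ (desc (true ∷ C) ++ []) e (z ∷ (ρ⁻ γ ⊖ C))) β ≡ Out h e z β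
  out-hi h bd e z β =
    alt-survive h (λ C α → Φ φ μ (desc (true ∷ C) ++ []) e (z ∷ α)) (Φ-tail-kill φ μ true e z) β ∙
      ▸-cong (h ≤ᵇ n) λ h≤ → alt-cong β (use (ℕₚ.≤ᵇ⇒≤ h n (subst T (sym h≤) tt))) ∙ absorb h e z β
    where
    use : h ≤ n → ∀ (γ : Vec ℤ n) → Φ φ μ (desc (true ∷ ones {n} h) ++ []) e (z ∷ (ρ⁻ γ ⊖ ones h)) ≡ G φ μ (e - tailSum h (ρ⁻ γ ⊖ ones h)) (z ∷ (ρ⁻ γ ⊖ ones h))
    use l γ rewrite ++-[] (map suc (desc (ones {n} h)) ++ 1 ∷ []) | desc-ones n h l | dn-suc h =
      Φ-interval φ μ 0 (suc h) (n ∸ h) (cong suc (ℕₚ.m+[n∸m]≡n l)) dm bd e (z ∷ (ρ⁻ γ ⊖ ones h))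

  in-lo : ∀ h → All (_≤ h) μ → ∀ e z β →
          alt (λ γ → ∑ (br μ) (λ (w , k , ν) → (z == + k) ▸ G φ (h ∷ ν) (e - + w) (ρ⁻ γ))) β ≡ Out h e z β
  in-lo h bd e z β =
    alt-∑ (br μ) ((λ (w , k , ν) γ → (z == + k) ▸ G φ (h ∷ ν) (e - + w) (ρ⁻ γ))) β ∙
      ∑-congA (br-ok h μ dm bd) (λ (w , k , ν) (dν , _ , bν) →
          alt-▸ (z == + k) (λ γ → G φ (h ∷ ν) (e - + w) (ρ⁻ γ)) β ∙
           cong ((z == + k) ▸_) ((alt-cong β λ γ → G-cons φ h ν (e - + w) (ρ⁻ γ)) ∙ alt-K φ [] h ν dν (full bν) (e - + w) β) ∙
             ▸-comm (z == + k) (h ≤ᵇ n) _) ∙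
        ∑-▸ (br μ) (h ≤ᵇ n) _

  in-hi : ∀ h → All (_≤ suc h) μ → ∀ e z β →
          alt (λ γ → ∑ (br μ) (λ (w , k , ν) → (z == + k) ▸ G φ (insert h ν) (e - + (w ℕ.+ cnt (suc h) ν)) (ρ⁻ γ))) β ≡ Out h e z β
  in-hi h bd e z β =
    alt-∑ (br μ) ((λ (w , k , ν) γ → (z == + k) ▸ G φ (insert h ν) (e - + (w ℕ.+ cnt (suc h) ν)) (ρ⁻ γ))) β ∙
      ∑-congA (br-ok (suc h) μ dm bd) (λ (w , k , ν) (dν , _ , bν) →
          alt-▸ (z == + k) (λ γ → G φ (insert h ν) (e - + (w ℕ.+ cnt (suc h) ν)) (ρ⁻ γ)) β ∙
           cong ((z == + k) ▸_) ((alt-cong β λ γ → cong (λ t → G φ (insert h ν) t (ρ⁻ γ)) (lem e w (cnt (suc h) ν)) ∙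
                        sym (straighten φ h ν dν bν (e - + w) (ρ⁻ γ))) ∙ alt-K φ (0 ∷ []) h ν dν (hole bν) (e - + w) β) ∙
             ▸-comm (z == + k) (h ≤ᵇ n) _) ∙
        ∑-▸ (br μ) (h ≤ᵇ n) _
    where
    lem : ∀ e w c → e - + (w ℕ.+ c) ≡ (e - + w) - + c
    lem e w c = cong (λ t → e - t) (pos-+ w c) ∙ minus-+ e (+ w) (+ c)

Br-sym : ∀ {n} φ μ e z → SymF {n} (Br φ μ e z)
Br-sym φ μ e z i l γ = ∑-cong (br μ) (λ (w , k , ν) → cong ((z == + k) ▸_) (G-sym φ ν (e - + w) i l γ))

Br-bounded : ∀ {n} φ μ e z → Dec≥ μ → ∀ b → All (_≤ b) μ → Bounded {n} (+ length μ) (Br φ μ e z)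
Br-bounded φ μ e z dm b bd j γ m =
  ∑-congA (br-ok b μ dm bd) (λ (w , k , ν) (_ , len , _) →
          cong ((z == + k) ▸_) (Φ-bounded φ ν (length μ) _ (e - + w) (≤-reflexive len) j γ m) ∙ ▸-zero _) ∙
    ∑-zero (br μ) λ _ → refl

-- Induction on the number of columns. The first column with or without the letter 1 matches the
-- branches that shorten or keep this column, each after antisymmetrization in the other variables.
branch : ∀ {n} φ μ → Dec≥ μ → ∀ e z (α : Vec ℤ n) → G φ μ e (z ∷ α) ≡ Br φ μ e z α
branch φ [] dm e z α = ▸-∧ (z == 0ℤ) (isZ α) (φ e) ∙ sym (+-identityʳ _ ∙
  cong (λ t → (z == 0ℤ) ▸ isZ α ▸ φ t) (minus-0 e))
branch {n} φ (h ∷ μ) (bm , dm) e z α =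
  alt-unique (λ α → G φ (h ∷ μ) e (z ∷ α)) (Br φ (h ∷ μ) e z) (+ suc (length μ))
    (λ j γ m → Φ-bounded φ (h ∷ μ) (suc (length μ)) (dn 0 (suc n)) e ≤-refl j (z ∷ γ) (there m))
    (Br-bounded φ (h ∷ μ) e z (bm , dm) h (≤-refl ∷ bm))
    (SymF-tail (G-sym φ (h ∷ μ) e) z) (Br-sym φ (h ∷ μ) e z) same α
  where
  IH = branch {n} φ μ dm
  split : ∀ γ → G φ (h ∷ μ) e (z ∷ ρ⁻ γ) ≡
          ∑ (bits n) (λ C → (suc (size C) ≡ᵇ h) ▸ Φ φ μ (desc (true ∷ C) ++ []) e ((z - 1ℤ) ∷ (ρ⁻ γ ⊖ C)))
        + ∑ (bits n) (λ C → (size C ≡ᵇ h) ▸ Φ φ μ (desc (false ∷ C) ++ []) e ((z - 0ℤ) ∷ (ρ⁻ γ ⊖ C)))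
  split γ = G-cons φ h μ e (z ∷ ρ⁻ γ) ∙ ∑-bits n _
  z0 : z - 0ℤ ≡ z
  z0 = +-identityʳ z
  lo : ∀ β → alt (λ γ → ∑ (bits n) λ C → (size C ≡ᵇ h) ▸ Φ φ μ (desc (false ∷ C) ++ []) e ((z - 0ℤ) ∷ (ρ⁻ γ ⊖ C))) β
           ≡ alt (λ γ → ∑ (br μ) (λ (w , k , ν) → (z == + k) ▸ G φ (h ∷ ν) (e - + w) (ρ⁻ γ))) β
  lo β rewrite z0 = out-lo φ μ dm IH h bm e z β ∙ sym (in-lo φ μ dm IH h bm e z β)
  same : ∀ β → alt (λ γ → G φ (h ∷ μ) e (z ∷ ρ⁻ γ)) β ≡ alt (λ γ → Br φ (h ∷ μ) e z (ρ⁻ γ)) β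
  same β = alt-cong β split ∙ alt-+ _ _ β ∙ finish h refl
    where
    A B : ℤ
    A = alt (λ γ → ∑ (bits n) (λ C → (suc (size C) ≡ᵇ h) ▸ Φ φ μ (desc (true ∷ C) ++ []) e ((z - 1ℤ) ∷ (ρ⁻ γ ⊖ C)))) β
    B = alt (λ γ → ∑ (bits n) (λ C → (size C ≡ᵇ h) ▸ Φ φ μ (desc (false ∷ C) ++ []) e ((z - 0ℤ) ∷ (ρ⁻ γ ⊖ C)))) β
    finish : ∀ h' → h' ≡ h → A + B ≡ alt (λ γ → Br φ (h ∷ μ) e z (ρ⁻ γ)) β
    finish zero refl = cong₂ _+_ (alt-zero β λ γ → ∑-zero (bits n) λ C → refl) (lo β) ∙
      +-identityˡ _ ∙ alt-cong β λ γ → sym (∑-map (br μ) _ _)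
    finish (suc h') refl = sym
      ((alt-cong β λ γ → ∑-++ (map _ (br μ)) _ _ ∙ cong₂ _+_ (∑-map (br μ) _ _) (∑-map (br μ) _ _) ∙ ℤₚ.+-comm (lo-part γ) (hi-part γ)) ∙
        alt-+ hi-part lo-part β ∙ cong₂ _+_ hi (sym (lo β)))
      where
      lo-part hi-part : Vec ℤ n → ℤ
      lo-part γ = ∑ (br μ) (λ (w , k , ν) → (z == + k) ▸ G φ (suc h' ∷ ν) (e - + w) (ρ⁻ γ))
      hi-part γ = ∑ (br μ) (λ (w , k , ν) → (z == + suc k) ▸ G φ (insert h' ν) (e - + (w ℕ.+ cnt (suc h') ν)) (ρ⁻ γ))
      lem₂ : ∀ k → k ≡ (1ℤ + k) - 1ℤ
      lem₂ = solve-∀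
      shift : ∀ k → (z == + suc k) ≡ (z - 1ℤ == + k)
      shift k = ==-cong {z} {+ suc k} {z - 1ℤ} {+ k} (λ p → cong (λ t → t - 1ℤ) p ∙ sym (lem₂ (+ k))) (λ p → one+minus-1 z ∙ cong (λ t → 1ℤ + t) p)
      hi : alt hi-part β ≡ A
      hi = (alt-cong β λ γ → ∑-cong (br μ) (λ (w , k , ν) → cong (_▸ G φ (insert h' ν) (e - + (w ℕ.+ cnt (suc h') ν)) (ρ⁻ γ)) (shift k))) ∙
        in-hi φ μ dm IH h' bm e (z - 1ℤ) β ∙ sym (out-hi φ μ dm IH h' bm e (z - 1ℤ) β)

-- Inversions, sorting, and branching for unsorted heights.

gt : ∀ {n} → ℕ → Vec ℕ n → ℕ
gt a [] = 0
gt a (b ∷ r) = (if a <ᵇ b then 1 else 0) ℕ.+ gt a r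

inv : ∀ {n} → Vec ℕ n → ℕ
inv [] = 0
inv (a ∷ r) = gt a r ℕ.+ inv r

AscV : ∀ {n} → ℕ → Vec ℕ n → Set
AscV _ [] = ⊥
AscV zero (a ∷ []) = ⊥
AscV zero (a ∷ b ∷ r) = a < b
AscV (suc i) (a ∷ r) = AscV i r

gt-swapAt : ∀ {n} a i (r : Vec ℕ n) → gt a (swapAt i r) ≡ gt a r
gt-swapAt a i [] = refl
gt-swapAt a zero (x ∷ []) = refl
gt-swapAt a zero (x ∷ y ∷ r) = lem (if a <ᵇ y then 1 else 0) (if a <ᵇ x then 1 else 0) (gt a r)
  where
  lem : ∀ a b c → a ℕ.+ (b ℕ.+ c) ≡ b ℕ.+ (a ℕ.+ c)
  lem a b c = sym (ℕₚ.+-assoc a b c) ∙ cong (ℕ._+ c) (ℕₚ.+-comm a b) ∙ ℕₚ.+-assoc b a c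
gt-swapAt a (suc i) (x ∷ r) = cong (_ ℕ.+_) (gt-swapAt a i r)

inv-swapAt : ∀ {n} i (r : Vec ℕ n) → AscV i r → inv r ≡ suc (inv (swapAt i r))
inv-swapAt zero (a ∷ b ∷ r) l rewrite <ᵇ-true l | <ᵇ-false (<⇒≤ l) = cong suc
  (sym (ℕₚ.+-assoc (gt a r) _ _) ∙ cong (ℕ._+ inv r) (ℕₚ.+-comm (gt a r) _) ∙ ℕₚ.+-assoc (gt b r) _ _)
inv-swapAt (suc i) (a ∷ r) l rewrite inv-swapAt i r l | gt-swapAt a i r = ℕₚ.+-suc (gt a r) _

Sorted : ∀ {n} → Vec ℕ n → Set
Sorted α = Dec≥ (toList α)

sorted? : ∀ {n} (α : Vec ℕ n) → (∃ λ i → AscV i α) ⊎ Sorted α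
sorted? [] = inj₂ tt
sorted? (a ∷ α) with sorted? α
... | inj₁ (i , p) = inj₁ (suc i , p)
sorted? (a ∷ []) | inj₂ s = inj₂ ([] , tt)
sorted? (a ∷ b ∷ α) | inj₂ (bd , s) with <-≤-connex a b
... | inj₁ l = inj₁ (0 , l)
... | inj₂ l = inj₂ ((l ∷ All≤-trans l bd) , bd , s)

-- Induction on the number of inversions: exchanging an ascent lowers it by exactly one.
bubble : ∀ {n} (P : Vec ℕ n → Set) → (∀ α → Sorted α → P α) →
         (∀ i α → AscV i α → P (swapAt i α) → P α) → ∀ α → P α
bubble P base step α = go (inv α) α refl
  where
  go : ∀ k α → inv α ≡ k → P α
  go k α e with sorted? α
  ... | inj₂ s = base α s
  go zero α e | inj₁ (i , p) = case trans (sym e) (inv-swapAt i α p) of λ ()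
  go (suc k) α e | inj₁ (i , p) = step i α p (go k (swapAt i α) (suc-injective (sym (inv-swapAt i α p) ∙ e)))

insertV : ∀ {n} → ℕ → Vec ℕ n → Vec ℕ (suc n)
insertV a [] = a ∷ []
insertV a (h ∷ μ) = if a <ᵇ h then h ∷ insertV a μ else a ∷ h ∷ μ

sortV : ∀ {n} → Vec ℕ n → Vec ℕ n
sortV [] = []
sortV (a ∷ α) = insertV a (sortV α)

toList-insertV : ∀ {n} a (v : Vec ℕ n) → toList (insertV a v) ≡ insert a (toList v)
toList-insertV a [] = refl
toList-insertV a (h ∷ v) with a <ᵇ h
... | true = cong (h ∷_) (toList-insertV a v)
... | false = refl

sortV-sorted : ∀ {n} (α : Vec ℕ n) → Sorted (sortV α)
sortV-sorted [] = tt
sortV-sorted (a ∷ α) = subst Dec≥ (sym (toList-insertV a (sortV α))) (Dec-insert a _ (sortV-sorted α))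

insertV-comm : ∀ {n} a b (v : Vec ℕ n) → a < b → insertV a (insertV b v) ≡ insertV b (insertV a v)
insertV-comm a b [] l rewrite <ᵇ-true l | <ᵇ-false (<⇒≤ l) = refl
insertV-comm a b (h ∷ v) l with b <ᵇ h in eb
... | true rewrite <ᵇ-true {a} {h} (<-trans l (<ᵇ-true⁻ {b} {h} eb)) | eb = cong (h ∷_) (insertV-comm a b v l)
... | false rewrite <ᵇ-true l with a <ᵇ h
...   | true rewrite eb = refl
...   | false rewrite <ᵇ-false (<⇒≤ l) = refl

sortV-swapAt : ∀ {n} i (α : Vec ℕ n) → AscV i α → sortV (swapAt i α) ≡ sortV α
sortV-swapAt zero (a ∷ b ∷ α) l = sym (insertV-comm a b (sortV α) l)
sortV-swapAt (suc i) (a ∷ α) l = cong (insertV a) (sortV-swapAt i α l)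

insertV-max : ∀ {n} a (v : Vec ℕ n) → All (_≤ a) (toList v) → insertV a v ≡ a ∷ v
insertV-max a [] _ = refl
insertV-max a (h ∷ v) (l ∷ _) rewrite <ᵇ-false l = refl

sortV-id : ∀ {n} (α : Vec ℕ n) → Sorted α → sortV α ≡ α
sortV-id [] s = refl
sortV-id (a ∷ α) (b , s) rewrite sortV-id α s = insertV-max a α b

All-sortV : ∀ {n} {P : ℕ → Set} (α : Vec ℕ n) → All P (toList α) → All P (toList (sortV α))
All-sortV [] [] = []
All-sortV {P = P} (a ∷ α) (p ∷ ps) = subst (All P) (sym (toList-insertV a (sortV α))) (All-insert a _ p (All-sortV α ps))

nb : Bool → ℕ
nb true = 1
nb false = 0

infixl 6 _⊟_ _⊞_
_⊟_ : ∀ {n} → Vec ℕ n → Vec Bool n → Vec ℕ n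
[] ⊟ [] = []
(a ∷ α) ⊟ (b ∷ S) = (a ∸ nb b) ∷ (α ⊟ S)

_⊞_ : ∀ {n} → Vec ℕ n → Vec Bool n → Vec ℕ n
[] ⊞ [] = []
(a ∷ α) ⊞ (b ∷ S) = (a ℕ.+ nb b) ∷ (α ⊞ S)

-- The vector 2α - S orders positions by α first and puts, among equal entries, the untouched ones
-- above the reduced ones. Its inversions give the power of t in the branching rule. Read as 2γ + S
-- with γ = α - S, they give that of the Pieri rule.
double : ∀ {n} → Vec ℕ n → Vec ℕ n
double = Vec.map (λ a → a ℕ.+ a)

valid : ∀ {n} → Vec ℕ n → Vec Bool n → Bool
valid [] [] = true
valid (a ∷ α) (b ∷ S) = (nb b ≤ᵇ a) ∧ valid α S

cntV : ∀ {n} → ℕ → Vec ℕ n → ℕ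
cntV k [] = 0
cntV k (a ∷ α) = (if a ≡ᵇ k then 1 else 0) ℕ.+ cntV k α

cnt-insert : ∀ k a μ → cnt k (insert a μ) ≡ (if a ≡ᵇ k then 1 else 0) ℕ.+ cnt k μ
cnt-insert k a [] = refl
cnt-insert k a (h ∷ μ) with a <ᵇ h
... | false = refl
... | true rewrite cnt-insert k a μ = lem (if h ≡ᵇ k then 1 else 0) (if a ≡ᵇ k then 1 else 0) (cnt k μ)
  where
  lem : ∀ a b c → a ℕ.+ (b ℕ.+ c) ≡ b ℕ.+ (a ℕ.+ c)
  lem a b c = sym (ℕₚ.+-assoc a b c) ∙ cong (ℕ._+ c) (ℕₚ.+-comm a b) ∙ ℕₚ.+-assoc b a c

cnt-sortV : ∀ {n} k (α : Vec ℕ n) → cnt k (toList (sortV α)) ≡ cntV k α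
cnt-sortV k [] = refl
cnt-sortV k (a ∷ α) rewrite toList-insertV a (sortV α) | cnt-insert k a (toList (sortV α)) = cong (_ ℕ.+_) (cnt-sortV k α)

All-⊟ : ∀ {n b} (α : Vec ℕ n) S → All (_≤ b) (toList α) → All (_≤ b) (toList (α ⊟ S))
All-⊟ [] [] [] = []
All-⊟ (a ∷ α) (s ∷ S) (l ∷ ls) = ≤-trans (ℕₚ.m∸n≤m a (nb s)) l ∷ All-⊟ α S ls

gt-double : ∀ {n} h (α : Vec ℕ n) S → All (_≤ h) (toList α) → gt (h ℕ.+ h) (double α ⊟ S) ≡ 0
gt-double h [] [] [] = refl
gt-double h (a ∷ α) (s ∷ S) (l ∷ ls)
  rewrite <ᵇ-false (≤-trans (ℕₚ.m∸n≤m (a ℕ.+ a) (nb s)) (ℕₚ.+-mono-≤ l l)) = gt-double h α S ls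

∧-true : ∀ {a b} → a ∧ b ≡ true → a ≡ true × b ≡ true
∧-true {true} {true} _ = refl , refl

-- The comparison of 2 α_j - S_j with 2 h - 1 detects the untouched entries equal to h.
gt-double-1 : ∀ {n} h (α : Vec ℕ n) S → All (_≤ suc h) (toList α) → valid α S ≡ true →
              gt (h ℕ.+ suc h) (double α ⊟ S) ≡ cntV (suc h) (α ⊟ S)
gt-double-1 h [] [] [] v = refl
gt-double-1 h (a ∷ α) (s ∷ S) (l ∷ ls) v = cong₂ ℕ._+_ (head s (proj₁ (∧-true {nb s ≤ᵇ a} v))) (gt-double-1 h α S ls (proj₂ (∧-true {nb s ≤ᵇ a} v)))
  where
  small : ∀ {x} b → x ≤ h → (if h ℕ.+ suc h <ᵇ (x ℕ.+ x ∸ b) then 1 else 0) ≡ 0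
  small {x} b p rewrite <ᵇ-false {h ℕ.+ suc h} {x ℕ.+ x ∸ b}
    (≤-trans (ℕₚ.m∸n≤m (x ℕ.+ x) b) (ℕₚ.+-mono-≤ p (≤-trans p (n≤1+n h)))) = refl
  head : ∀ s → (nb s ≤ᵇ a) ≡ true → (if h ℕ.+ suc h <ᵇ (a ℕ.+ a ∸ nb s) then 1 else 0) ≡ (if (a ∸ nb s) ≡ᵇ suc h then 1 else 0)
  head s vs with ℕₚ.m≤n⇒m<n∨m≡n l
  ... | inj₁ (s≤s l') rewrite small (nb s) l' | ≡ᵇ-false {a ∸ nb s} {suc h} (λ e → <⇒≢ (s≤s (≤-trans (ℕₚ.m∸n≤m a (nb s)) l')) e) = refl
  head true vs | inj₂ refl rewrite <ᵇ-false {h ℕ.+ suc h} {h ℕ.+ suc h} ≤-refl | ≡ᵇ-false {h} {suc h} (λ e → ℕₚ.1+n≢n (sym e)) = refl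
  head false vs | inj₂ refl rewrite <ᵇ-true {h ℕ.+ suc h} {suc (h ℕ.+ suc h)} ≤-refl | ≡ᵇ-refl h = refl

brV : ∀ {n} → Vec ℕ n → (ℕ × ℕ × List ℕ → ℤ) → ℤ
brV {n} α F = ∑ (bits n) λ S → valid α S ▸ F (inv (double α ⊟ S) , size S , toList (sortV (α ⊟ S)))

-- In a decreasing vector an untouched head has no inversions with later entries of 2α - S. A head
-- that is reduced from `suc h` has one for every later entry still equal to `suc h`, and this is
-- the factor in `br`.
br-sorted : ∀ {n} (α : Vec ℕ n) → Sorted α → ∀ F → ∑ (br (toList α)) F ≡ brV α F
br-sorted [] s F = refl
br-sorted {suc n} (zero ∷ α) (b , s) F =
  ∑-map (br (toList α)) _ F ∙
    br-sorted α s (λ (w , k , ν) → F (w , k , 0 ∷ ν)) ∙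
      sym (∑-bits n _ ∙ cong₂ _+_ (∑-zero (bits n) λ S → refl) (∑-cong (bits n) fa) ∙ +-identityˡ _)
  where
  fa : ∀ S → valid α S ▸ F (gt 0 (double α ⊟ S) ℕ.+ inv (double α ⊟ S) , size S , toList (insertV 0 (sortV (α ⊟ S))))
           ≡ valid α S ▸ F (inv (double α ⊟ S) , size S , 0 ∷ toList (sortV (α ⊟ S)))
  fa S rewrite gt-double 0 α S b | insertV-max 0 (sortV (α ⊟ S)) (All-sortV (α ⊟ S) (All-⊟ α S b)) = refl
br-sorted {suc n} (suc h ∷ α) (b , s) F =
  ∑-++ (map _ (br (toList α))) _ F ∙
    cong₂ _+_ (∑-map (br (toList α)) _ F ∙ br-sorted α s (λ (w , k , ν) → F (w , k , suc h ∷ ν)))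
                      (∑-map (br (toList α)) _ F ∙ br-sorted α s (λ (w , k , ν) → F (w ℕ.+ cnt (suc h) ν , suc k , insert h ν))) ∙
      ℤₚ.+-comm (brV α F₀) (brV α F₁) ∙ sym (∑-bits n _ ∙ cong₂ _+_ (∑-cong (bits n) tr) (∑-cong (bits n) fa))
  where
  F₀ F₁ : ℕ × ℕ × List ℕ → ℤ
  F₀ (w , k , ν) = F (w , k , suc h ∷ ν)
  F₁ (w , k , ν) = F (w ℕ.+ cnt (suc h) ν , suc k , insert h ν)
  fa : ∀ S → valid α S ▸ F (gt (suc h ℕ.+ suc h) (double α ⊟ S) ℕ.+ inv (double α ⊟ S) , size S , toList (insertV (suc h) (sortV (α ⊟ S))))
           ≡ valid α S ▸ F (inv (double α ⊟ S) , size S , suc h ∷ toList (sortV (α ⊟ S)))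
  fa S rewrite gt-double (suc h) α S b | insertV-max (suc h) (sortV (α ⊟ S)) (All-sortV (α ⊟ S) (All-⊟ α S b)) = refl
  tr : ∀ S → valid α S ▸ F (gt (h ℕ.+ suc h) (double α ⊟ S) ℕ.+ inv (double α ⊟ S) , suc (size S) , toList (insertV h (sortV (α ⊟ S))))
           ≡ valid α S ▸ F (inv (double α ⊟ S) ℕ.+ cnt (suc h) (toList (sortV (α ⊟ S))) , suc (size S) , insert h (toList (sortV (α ⊟ S))))
  tr S = ▸-cong (valid α S) λ v → cong₂ (λ x y → F (x , suc (size S) , y))
    (cong (ℕ._+ inv (double α ⊟ S)) (gt-double-1 h α S b v ∙ sym (cnt-sortV (suc h) (α ⊟ S))) ∙ ℕₚ.+-comm _ (inv (double α ⊟ S)))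
    (toList-insertV h (sortV (α ⊟ S)))

swapAt-⊟ : ∀ {n} i (α : Vec ℕ n) S → swapAt i α ⊟ swapAt i S ≡ swapAt i (α ⊟ S)
swapAt-⊟ i [] [] = refl
swapAt-⊟ zero (a ∷ []) (s ∷ []) = refl
swapAt-⊟ zero (a ∷ b ∷ α) (s ∷ t ∷ S) = refl
swapAt-⊟ (suc i) (a ∷ α) (s ∷ S) = cong (_ ∷_) (swapAt-⊟ i α S)

swapAt-⊞ : ∀ {n} i (α : Vec ℕ n) S → swapAt i α ⊞ swapAt i S ≡ swapAt i (α ⊞ S)
swapAt-⊞ i [] [] = refl
swapAt-⊞ zero (a ∷ []) (s ∷ []) = refl
swapAt-⊞ zero (a ∷ b ∷ α) (s ∷ t ∷ S) = refl
swapAt-⊞ (suc i) (a ∷ α) (s ∷ S) = cong (_ ∷_) (swapAt-⊞ i α S)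

double-swapAt : ∀ {n} i (α : Vec ℕ n) → double (swapAt i α) ≡ swapAt i (double α)
double-swapAt i [] = refl
double-swapAt zero (a ∷ []) = refl
double-swapAt zero (a ∷ b ∷ α) = refl
double-swapAt (suc i) (a ∷ α) = cong (_ ∷_) (double-swapAt i α)

valid-swapAt : ∀ {n} i (α : Vec ℕ n) S → valid (swapAt i α) (swapAt i S) ≡ valid α S
valid-swapAt i [] [] = refl
valid-swapAt zero (a ∷ []) (s ∷ []) = refl
valid-swapAt zero (a ∷ b ∷ α) (s ∷ t ∷ S) with nb s ≤ᵇ a | nb t ≤ᵇ b
... | true | true = refl
... | true | false = refl
... | false | true = refl
... | false | false = refl
valid-swapAt (suc i) (a ∷ α) (s ∷ S) = cong ((nb s ≤ᵇ a) ∧_) (valid-swapAt i α S)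

AscV-double-⊟ : ∀ {n} i (α : Vec ℕ n) S → AscV i α → AscV i (double α ⊟ S)
AscV-double-⊟ zero (a ∷ b ∷ α) (s ∷ t ∷ S) l = ≤-trans (s≤s (ℕₚ.m∸n≤m (a ℕ.+ a) (nb s))) (low t)
  where
  low : ∀ t → suc (a ℕ.+ a) ≤ (b ℕ.+ b ∸ nb t)
  low true = ≤-trans (≤-reflexive (sym (ℕₚ.+-suc a a))) (≤-trans (ℕₚ.∸-monoˡ-≤ 1 (ℕₚ.+-mono-≤ l l)) ≤-refl)
  low false = ≤-trans (ℕₚ.+-monoˡ-≤ a l) (ℕₚ.+-monoʳ-≤ b (<⇒≤ l))
AscV-double-⊟ (suc i) (a ∷ α) (s ∷ S) l = AscV-double-⊟ i α S l

-- AscV i (α ⊟ S) may fail, but sorting does not see the exchange of two equal entries.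
sortV-swapAt-any : ∀ {n} i (α : Vec ℕ n) → sortV (swapAt i α) ≡ sortV α
sortV-swapAt-any i [] = refl
sortV-swapAt-any zero (a ∷ []) = refl
sortV-swapAt-any zero (a ∷ b ∷ α) with ℕₚ.<-cmp a b
... | Rel.tri< l _ _ = sym (insertV-comm a b (sortV α) l)
... | Rel.tri≈ _ refl _ = refl
... | Rel.tri> _ _ l = insertV-comm b a (sortV α) l
sortV-swapAt-any (suc i) (a ∷ α) = cong (insertV a) (sortV-swapAt-any i α)

inv-sorted : ∀ {n} (α : Vec ℕ n) → Sorted α → inv α ≡ 0
inv-sorted [] s = refl
inv-sorted (a ∷ α) (b , s) = cong₂ ℕ._+_ (none α b) (inv-sorted α s)
  where
  none : ∀ {n} (α : Vec ℕ n) → All (_≤ a) (toList α) → gt a α ≡ 0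
  none [] [] = refl
  none (x ∷ α) (l ∷ ls) rewrite <ᵇ-false l = none α ls

-- An ascent of α is an ascent of 2α - S for every S, so an exchange changes both sides by the same
-- factor t and reduces the claim to sorted vectors.
br-any : ∀ {n} (α : Vec ℕ n) → ∀ F → ∑ (br (toList (sortV α))) (λ (w , r) → F (inv α ℕ.+ w , r)) ≡ brV α F
br-any {n} = bubble P (λ α s F → cong₂ (λ u v → ∑ (br (toList u)) (λ (w , r) → F (v ℕ.+ w , r))) (sortV-id α s) (inv-sorted α s) ∙ br-sorted α s F) step
  where
  P : Vec ℕ n → Set
  P α = ∀ F → ∑ (br (toList (sortV α))) (λ (w , r) → F (inv α ℕ.+ w , r)) ≡ brV α F
  step : ∀ i α → AscV i α → P (swapAt i α) → P α
  step i α l p F rewrite sym (sortV-swapAt i α l) | inv-swapAt i α l =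
    p (λ (w , r) → F (suc w , r)) ∙
      sym (∑-swapAt n i _) ∙ ∑-cong (bits n) λ S → go S
    where
    go : ∀ S → valid (swapAt i α) (swapAt i S) ▸ F (suc (inv (double (swapAt i α) ⊟ swapAt i S)) , size (swapAt i S) , toList (sortV (swapAt i α ⊟ swapAt i S)))
             ≡ valid α S ▸ F (inv (double α ⊟ S) , size S , toList (sortV (α ⊟ S)))
    go S rewrite valid-swapAt i α S | double-swapAt i α | swapAt-⊟ i (double α) S | size-swapAt i S | swapAt-⊟ i α S
               | sortV-swapAt-any i (α ⊟ S) | sym (inv-swapAt i (double α ⊟ S) (AscV-double-⊟ i α S l)) = refl

branch-any : ∀ {n N} φ (α : Vec ℕ N) e z (a : Vec ℤ n) →
  G φ (toList (sortV α)) (e - + inv α) (z ∷ a) ≡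
  ∑ (bits N) λ S → valid α S ▸ (z == + size S) ▸ G φ (toList (sortV (α ⊟ S))) (e - + inv (double α ⊟ S)) a
branch-any φ α e z a =
  branch φ (toList (sortV α)) (sortV-sorted α) (e - + inv α) z a ∙
    ∑-cong (br (toList (sortV α))) (λ (w , k , ν) → cong (λ t → (z == + k) ▸ G φ ν t a)
        (minus-minus e (+ inv α) (+ w) ∙ cong (λ t → e - t) (sym (pos-+ (inv α) w)))) ∙
      br-any α (λ (w , k , ν) → (z == + k) ▸ G φ ν (e - + w) a)

-- The Hall-Littlewood numerators: straightening and the Pieri rule.

sg : ℕ → ℤ
sg zero = 1ℤ
sg (suc k) = - sg k

-- Coefficients of ∏_{i<j} (x_i - t x_j), expanded in the first variable.
Dt : ∀ {n} → Ser n
Dt {zero} e [] = (e == 0ℤ) ▸ 1ℤ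
Dt {suc n} e (c ∷ γ) = ∑ (bits n) λ S → (c == + n - + size S) ▸ (sg (size S) * Dt (e - + size S) (γ ⊖ S))

-- Division of the product by its factor for the pair of neighbours at `i`: the quotient `Q` is
-- symmetric in these two variables.
Factor : ∀ {n} → ℕ → Set
Factor {n} i = Σ (Ser n) λ Q → (∀ e → SymAt i (Q e)) ×
  (∀ e ω → Dt e ω ≡ Q e (dec i ω) - Q (e - 1ℤ) (dec (suc i) ω))

∑-- : ∀ {A : Set} (xs : List A) (f g : A → ℤ) → ∑ xs (λ x → f x - g x) ≡ ∑ xs f - ∑ xs g
∑-- xs f g = ∑-+ xs f (λ x → - g x) ∙ +ˡ (∑ xs f) (∑-neg xs g)

factor : ∀ {n} i → suc i < n → Factor {n} i
factor {suc n} (suc i) (s≤s l) with factor {n} i l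
... | Q' , s' , eq' = Q , s , eq
  where
  Q : Ser (suc n)
  Q e (c ∷ γ) = ∑ (bits n) λ S → (c == + n - + size S) ▸ (sg (size S) * Q' (e - + size S) (γ ⊖ S))
  s : ∀ e → SymAt (suc i) (Q e)
  s e (c ∷ γ) = sym (∑-swapAt n i _) ∙ ∑-cong (bits n) λ S → go S
    where
    go : ∀ S → (c == + n - + size (swapAt i S)) ▸ (sg (size (swapAt i S)) * Q' (e - + size (swapAt i S)) (swapAt i γ ⊖ swapAt i S))
             ≡ (c == + n - + size S) ▸ (sg (size S) * Q' (e - + size S) (γ ⊖ S))
    go S rewrite size-swapAt i S | sym (swapAt-⊖ i γ S) | s' (e - + size S) (γ ⊖ S) = refl
  eq : ∀ e ω → Dt e ω ≡ Q e (dec (suc i) ω) - Q (e - 1ℤ) (dec (suc (suc i)) ω)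
  eq e (c ∷ γ) = ∑-cong (bits n) go ∙ ∑-- (bits n) _ _
    where
    dist : ∀ b s x y → b ▸ (s * (x - y)) ≡ b ▸ (s * x) - b ▸ (s * y)
    dist true s x y = lem s x y
      where
      lem : ∀ s x y → s * (x - y) ≡ s * x - s * y
      lem = solve-∀
    dist false s x y = refl
    lem' : ∀ e k → (e - k) - 1ℤ ≡ (e - 1ℤ) - k
    lem' = solve-∀
    go : ∀ S → (c == + n - + size S) ▸ (sg (size S) * Dt (e - + size S) (γ ⊖ S))
             ≡ (c == + n - + size S) ▸ (sg (size S) * Q' (e - + size S) (dec i γ ⊖ S))
             - (c == + n - + size S) ▸ (sg (size S) * Q' (e - 1ℤ - + size S) (dec (suc i) γ ⊖ S))
    go S rewrite eq' (e - + size S) (γ ⊖ S) | dec-⊖ i γ S | dec-⊖ (suc i) γ S | lem' e (+ size S) = dist _ (sg (size S)) _ _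
factor {suc zero} zero (s≤s ())
factor {suc (suc m)} zero l = Q , s , eq
  where
  -- The factors that join the first two variables to all the others, without the factor joining the
  -- two; `S` and `S'` record the chosen terms, and exchanging them gives the symmetry.
  term : ℤ → ℤ → ℤ → Vec ℤ m → Vec Bool m → Vec Bool m → ℤ
  term e c d γ S S' = (c == + m - + size S) ▸ (d == + m - + size S') ▸ (sg (size S) * (sg (size S') * Dt ((e - + size S) - + size S') (γ ⊖ S ⊖ S')))
  Q : Ser (suc (suc m))
  Q e (c ∷ d ∷ γ) = ∑ (bits m) λ S → ∑ (bits m) λ S' → term e c d γ S S'
  s : ∀ e → SymAt zero (Q e)
  s e (c ∷ d ∷ γ) = ∑-swap (bits m) (bits m) (term e d c γ) ∙ ∑-cong (bits m) λ S → ∑-cong (bits m) λ S' → go S S'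
    where
    go : ∀ S S' → term e d c γ S' S ≡ term e c d γ S S'
    go S S' rewrite ⊖-comm γ S' S | minus-comm e (+ size S') (+ size S) | *-swap (sg (size S')) (sg (size S)) (Dt ((e - + size S) - + size S') (γ ⊖ S ⊖ S')) =
      ▸-comm (d == + m - + size S') (c == + m - + size S) _
  eq : ∀ e ω → Dt e ω ≡ Q e (dec zero ω) - Q (e - 1ℤ) (dec 1 ω)
  eq e (c ∷ d ∷ γ) = ∑-bits m _ ∙ ℤₚ.+-comm _ (∑ (bits m) (λ S → f (false ∷ S))) ∙ cong₂ _+_ (∑-cong (bits m) fa) (∑-cong (bits m) tr ∙ ∑-neg (bits m) _)
    where
    f : Vec Bool (suc m) → ℤ
    f S = (c == + suc m - + size S) ▸ (sg (size S) * Dt (e - + size S) ((d ∷ γ) ⊖ S))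
    inner : ∀ b k (g : Vec Bool m → ℤ) → b ▸ (k * ∑ (bits m) g) ≡ ∑ (bits m) λ S' → b ▸ (k * g S')
    inner b k g = cong (b ▸_) (sym (∑-*ˡ (bits m) k g)) ∙ sym (∑-▸ (bits m) b _)
    shuf : ∀ b k x → k * (b ▸ x) ≡ b ▸ (k * x)
    shuf true k x = refl
    shuf false k x = *-zeroʳ k
    lem₁ : ∀ m s → ((1ℤ + m) - s) - 1ℤ ≡ m - s
    lem₁ = solve-∀
    lem₂ : ∀ m s → (1ℤ + (m - s)) ≡ (1ℤ + m) - s
    lem₂ = solve-∀
    fa : ∀ S → f (false ∷ S) ≡ ∑ (bits m) λ S' → term e (c - 1ℤ) d γ S S'
    fa S = inner _ (sg (size S)) _ ∙ ∑-cong (bits m) λ S' → cong₂ _▸_ hd (shuf _ (sg (size S)) _ ∙ cong (_▸ _) (cong (_== + m - + size S') (+-identityʳ d))) ∙ refl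
      where
      hd : (c == + suc m - + size S) ≡ (c - 1ℤ == + m - + size S)
      hd = ==-cong {c} {+ suc m - + size S} {c - 1ℤ} {+ m - + size S}
             (λ p → cong (λ t → t - 1ℤ) p ∙ lem₁ (+ m) (+ size S))
             (λ p → one+minus-1 c ∙ cong (λ t → 1ℤ + t) p ∙ lem₂ (+ m) (+ size S))
    lem₆ : ∀ e s → e - (1ℤ + s) ≡ (e - 1ℤ) - s
    lem₆ = solve-∀
    tr : ∀ S → f (true ∷ S) ≡ - ∑ (bits m) λ S' → term (e - 1ℤ) c (d - 1ℤ) γ S S'
    tr S rewrite suc-minus-suc (+ m) (+ size S) | lem₆ e (+ size S) =
      cong ((c == + m - + size S) ▸_) (neg-* (sg (size S)) _) ∙ ▸-neg (c == + m - + size S) _ ∙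
        cong -_ (inner _ (sg (size S)) _ ∙ ∑-cong (bits m) λ S' → cong ((c == + m - + size S) ▸_) (shuf _ (sg (size S)) _))

infixl 6 _⊝_
_⊝_ : ∀ {n} → Vec ℤ n → Vec ℕ n → Vec ℤ n
[] ⊝ [] = []
(c ∷ γ) ⊝ (b ∷ β) = (c - + b) ∷ (γ ⊝ β)

-- The numerator Σ_w sgn(w) w(x^β ∏_{i<j} (x_i - t x_j)), for an arbitrary exponent β.
R : ∀ {n} → Vec ℕ n → Ser n
R β e ξ = alt (λ γ → Dt e (γ ⊝ β)) ξ

GapAt : ∀ {n} → ℕ → Vec ℕ n → Set
GapAt _ [] = ⊥
GapAt zero (a ∷ []) = ⊥
GapAt zero (a ∷ b ∷ r) = b ≡ suc a
GapAt (suc i) (a ∷ r) = GapAt i r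

lower : ∀ {n} → ℕ → Vec ℕ n → Vec ℕ n
lower _ [] = []
lower zero (a ∷ []) = a ∷ []
lower zero (a ∷ b ∷ r) = a ∷ a ∷ r
lower (suc i) (a ∷ r) = a ∷ lower i r

⊝-lower : ∀ {n} i (γ : Vec ℤ n) β → GapAt i β → γ ⊝ β ≡ dec (suc i) (γ ⊝ lower i β)
⊝-lower zero (c ∷ d ∷ γ) (a ∷ _ ∷ β) refl = cong (λ t → _ ∷ t ∷ _) (minus-suc-split d (+ a))
⊝-lower (suc i) (c ∷ γ) (a ∷ β) g = cong (_ ∷_) (⊝-lower i γ β g)

⊝-swap-lower : ∀ {n} i (γ : Vec ℤ n) β → GapAt i β → γ ⊝ swapAt i β ≡ dec i (γ ⊝ lower i β)
⊝-swap-lower zero (c ∷ d ∷ γ) (a ∷ _ ∷ β) refl = cong (_∷ _) (minus-suc-split c (+ a))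
⊝-swap-lower (suc i) (c ∷ γ) (a ∷ β) g = cong (_ ∷_) (⊝-swap-lower i γ β g)

swapAt-lower : ∀ {n} i (γ : Vec ℤ n) β → GapAt i β → swapAt i γ ⊝ lower i β ≡ swapAt i (γ ⊝ lower i β)
swapAt-lower zero (c ∷ d ∷ γ) (a ∷ _ ∷ β) refl = refl
swapAt-lower (suc i) (c ∷ γ) (a ∷ β) g = cong (_ ∷_) (swapAt-lower i γ β g)

GapAt-< : ∀ {n} i (β : Vec ℕ n) → GapAt i β → suc i < n
GapAt-< zero (a ∷ b ∷ β) g = s≤s (s≤s z≤n)
GapAt-< (suc i) (a ∷ β) g = s≤s (GapAt-< i β g)

dec-swapAt : ∀ {n} i (ω : Vec ℤ n) → suc i < n → dec i (swapAt i ω) ≡ swapAt i (dec (suc i) ω)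
dec-swapAt zero (a ∷ b ∷ ω) l = refl
dec-swapAt (suc i) (a ∷ ω) (s≤s l) = cong (a ∷_) (dec-swapAt i ω l)
dec-swapAt zero (a ∷ []) (s≤s ())

dec-swapAt' : ∀ {n} i (ω : Vec ℤ n) → suc i < n → dec (suc i) (swapAt i ω) ≡ swapAt i (dec i ω)
dec-swapAt' zero (a ∷ b ∷ ω) l = refl
dec-swapAt' (suc i) (a ∷ ω) (s≤s l) = cong (a ∷_) (dec-swapAt' i ω l)
dec-swapAt' zero (a ∷ []) (s≤s ())

-- Write y, z for the two variables and x^β = m z with m symmetric in them. The difference of the
-- two sides antisymmetrizes m Q (z - t y)(y - t z), which is symmetric, and so vanishes.
R-gap : ∀ {n} i (β : Vec ℕ n) → GapAt i β → ∀ e ξ → R β e ξ ≡ R (swapAt i β) (e - 1ℤ) ξ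
R-gap {n} i β g e ξ = i-j≡0⇒i≡j (R β e ξ) (R (swapAt i β) (e - 1ℤ) ξ)
  (sym (alt-+ (λ γ → Dt e (γ ⊝ β)) (λ γ → - Dt (e - 1ℤ) (γ ⊝ swapAt i β)) ξ ∙ +ˡ (R β e ξ) (alt-neg _ ξ)) ∙
    alt-kill i f l kill ξ)
  where
  l = GapAt-< i β g
  j = suc i
  Q = proj₁ (factor i l)
  Qs = proj₁ (proj₂ (factor i l))
  Qe = proj₂ (proj₂ (factor i l))
  f : Vec ℤ n → ℤ
  f γ = Dt e (γ ⊝ β) - Dt (e - 1ℤ) (γ ⊝ swapAt i β)
  h : Vec ℤ n → ℤ
  h ω = (Q e (dec i (dec j ω)) - Q (e - 1ℤ) (dec j (dec j ω))) - (Q (e - 1ℤ) (dec i (dec i ω)) - Q (e - 1ℤ - 1ℤ) (dec j (dec i ω)))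
  f≡h : ∀ γ → f γ ≡ h (γ ⊝ lower i β)
  f≡h γ rewrite ⊝-lower i γ β g | ⊝-swap-lower i γ β g = cong₂ _-_ (Qe e _) (Qe (e - 1ℤ) _)
  h-sym : ∀ ω → h (swapAt i ω) ≡ h ω
  h-sym ω rewrite dec-swapAt' i ω l | dec-swapAt i ω l
                | dec-swapAt i (dec i ω) l | dec-swapAt' i (dec i ω) l | dec-swapAt i (dec j ω) l | dec-swapAt' i (dec j ω) l
                | Qs e (dec j (dec i ω)) | Qs (e - 1ℤ) (dec i (dec i ω)) | Qs (e - 1ℤ) (dec j (dec j ω)) | Qs (e - 1ℤ - 1ℤ) (dec i (dec j ω))
                | dec-comm j i ω = lem (Q e (dec i (dec j ω))) (Q (e - 1ℤ) (dec i (dec i ω))) (Q (e - 1ℤ) (dec j (dec j ω))) (Q (e - 1ℤ - 1ℤ) (dec i (dec j ω)))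
    where
    lem : ∀ a b c d → (a - b) - (c - d) ≡ (a - c) - (b - d)
    lem = solve-∀
  kill : SymAt i f
  kill γ = f≡h (swapAt i γ) ∙ cong h (swapAt-lower i γ β g) ∙ h-sym _ ∙ sym (f≡h γ)

-- Multiplication by the sum of those elementary symmetric polynomials e_k for which `h k` holds. A
-- predicate rather than a number lets inductions absorb a chosen variable into `h`.
E : ∀ {n} → (ℕ → Bool) → (Vec ℤ n → ℤ) → Vec ℤ n → ℤ
E {n} h f γ = ∑ (bits n) λ S → h (size S) ▸ f (γ ⊖ S)

-- The bit of `S` at the extracted entry is moved to the front; since `S` runs over all sets and `h`
-- sees only their size, the sum is unaffected.
E-pick : ∀ {n} (h : ℕ → Bool) (F : ℤ → Vec ℤ n → ℤ) ξ →
         E h (pickSum F) ξ ≡ pickSum (λ x r → ∑ (bits (suc n)) λ S → h (size S) ▸ F (x - [ Vec.head S ]ᵇ) (r ⊖ Vec.tail S)) ξ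
E-pick {zero} h F (a ∷ []) = refl
E-pick {suc n} h F (a ∷ c ∷ ξ) =
  ∑-cong (bits (suc (suc n))) expand ∙
    ∑-- (bits (suc (suc n))) first next ∙
      cong (λ t → ∑ (bits (suc (suc n))) first - t)
        (∑-bits (suc n) next ∙
          cong₂ _+_ (IH true) (IH false) ∙
            sym (pickSum-+ _ _ (c ∷ ξ)) ∙
              pickSum-cong (c ∷ ξ) regroup)
  where
  first next : Vec Bool (suc (suc n)) → ℤ
  first S = h (size S) ▸ F (a - [ Vec.head S ]ᵇ) ((c ∷ ξ) ⊖ Vec.tail S)
  next S = h (size S) ▸ pickSum (λ x r → F x ((a - [ Vec.head S ]ᵇ) ∷ r)) ((c ∷ ξ) ⊖ Vec.tail S)
  minus : ∀ b x y → b ▸ (x - y) ≡ b ▸ x - b ▸ y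
  minus true x y = refl
  minus false x y = refl
  expand : ∀ S → h (size S) ▸ pickSum F ((a ∷ c ∷ ξ) ⊖ S) ≡ first S - next S
  expand (s ∷ t ∷ S) = minus (h (size (s ∷ t ∷ S))) _ _
  IH : ∀ s → ∑ (bits (suc n)) (λ S → next (s ∷ S)) ≡
       pickSum (λ x r → ∑ (bits (suc n)) λ S → h (size (s ∷ S)) ▸ F (x - [ Vec.head S ]ᵇ) ((a - [ s ]ᵇ) ∷ (r ⊖ Vec.tail S))) (c ∷ ξ)
  IH true = E-pick (h ∘ suc) (λ x r → F x ((a - 1ℤ) ∷ r)) (c ∷ ξ)
  IH false = E-pick h (λ x r → F x ((a - 0ℤ) ∷ r)) (c ∷ ξ)
  regroup : ∀ x r → ∑ (bits (suc n)) (λ S → h (size (true ∷ S)) ▸ F (x - [ Vec.head S ]ᵇ) ((a - 1ℤ) ∷ (r ⊖ Vec.tail S)))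
                  + ∑ (bits (suc n)) (λ S → h (size (false ∷ S)) ▸ F (x - [ Vec.head S ]ᵇ) ((a - 0ℤ) ∷ (r ⊖ Vec.tail S)))
          ≡ ∑ (bits (suc (suc n))) (λ S → h (size S) ▸ F (x - [ Vec.head S ]ᵇ) ((a ∷ r) ⊖ Vec.tail S))
  regroup x r = sym (∑-bits (suc n) _ ∙ cong₂ _+_ (∑-bits n _) (∑-bits n _) ∙
    +-exchange (V₄ true true) (V₄ true false) (V₄ false true) (V₄ false false) ∙
      sym (cong₂ _+_ (∑-bits n _) (∑-bits n _)))
    where
    V₄ : Bool → Bool → ℤ
    V₄ s t = ∑ (bits n) λ S → h (size (s ∷ t ∷ S)) ▸ F (x - [ s ]ᵇ) ((a - [ t ]ᵇ) ∷ (r ⊖ S))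

E-alt : ∀ {n} (h : ℕ → Bool) (f : Vec ℤ n → ℤ) ξ → E h (alt f) ξ ≡ alt (E h f) ξ
E-alt {zero} h f [] = refl
E-alt {suc n} h f ξ = E-pick h (λ x r → alt (λ γ → f (x ∷ γ)) r) ξ ∙ pickSum-cong ξ λ x r →
  ∑-bits n _ ∙
    cong₂ _+_ (E-alt (h ∘ suc) (λ γ → f ((x - 1ℤ) ∷ γ)) r) (E-alt h (λ γ → f ((x - 0ℤ) ∷ γ)) r) ∙
      sym (alt-+ _ _ r) ∙ alt-cong r λ γ → sym (∑-bits n _)

⊖-⊝ : ∀ {n} (γ : Vec ℤ n) S β → (γ ⊖ S) ⊝ β ≡ γ ⊝ (β ⊞ S)
⊖-⊝ [] [] [] = refl
⊖-⊝ (c ∷ γ) (s ∷ S) (b ∷ β) = cong₂ _∷_ (go s) (⊖-⊝ γ S β)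
  where
  lem : ∀ c b s → (c - s) - b ≡ c - (b + s)
  lem = solve-∀
  go : ∀ s → (c - [ s ]ᵇ) - + b ≡ c - + (b ℕ.+ nb s)
  go true = lem c (+ b) 1ℤ ∙ cong (λ t → c - t) (sym (pos-+ b 1))
  go false = lem c (+ b) 0ℤ ∙ cong (λ t → c - t) (sym (pos-+ b 0))

E-R : ∀ {n} h (β : Vec ℕ n) e ξ → E h (R β e) ξ ≡ ∑ (bits n) λ S → h (size S) ▸ R (β ⊞ S) e ξ
E-R {n} h β e ξ = E-alt h (λ γ → Dt e (γ ⊝ β)) ξ ∙
  alt-∑ (bits n) (λ S γ → h (size S) ▸ Dt e ((γ ⊖ S) ⊝ β)) ξ ∙
    ∑-cong (bits n) λ S → alt-▸ (h (size S)) (λ γ → Dt e ((γ ⊖ S) ⊝ β)) ξ ∙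
      cong (h (size S) ▸_) (alt-cong ξ λ γ → cong (Dt e) (⊖-⊝ γ S β))

-- For decreasing γ, unequal entries give an inversion in neither vector, because S changes them by
-- at most one; for equal entries both vectors compare the bits of S.
inv-double : ∀ {n} (γ : Vec ℕ n) S → Sorted γ → inv (double γ ⊞ S) ≡ inv (γ ⊞ S)
inv-double [] [] s = refl
inv-double (a ∷ γ) (s ∷ S) (b , sd) = cong₂ ℕ._+_ (go γ S b) (inv-double γ S sd)
  where
  cmp : ∀ s t x → x ≤ a → (a ℕ.+ a ℕ.+ nb s <ᵇ x ℕ.+ x ℕ.+ nb t) ≡ (a ℕ.+ nb s <ᵇ x ℕ.+ nb t)
  cmp s t x l with ℕₚ.m≤n⇒m<n∨m≡n l
  ... | inj₂ refl = cancel (a ℕ.+ a) (nb s) (nb t) ∙ sym (cancel a (nb s) (nb t))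
    where
    cancel : ∀ a m n → (a ℕ.+ m <ᵇ a ℕ.+ n) ≡ (m <ᵇ n)
    cancel zero m n = refl
    cancel (suc a) m n = cancel a m n
  ... | inj₁ l' = <ᵇ-false {a ℕ.+ a ℕ.+ nb s} {x ℕ.+ x ℕ.+ nb t} big ∙ sym (<ᵇ-false {a ℕ.+ nb s} {x ℕ.+ nb t} small)
    where
    nb≤ : ∀ t → nb t ≤ 1
    nb≤ true = s≤s z≤n
    nb≤ false = z≤n
    small : x ℕ.+ nb t ≤ a ℕ.+ nb s
    small = ≤-trans (ℕₚ.+-monoʳ-≤ x (nb≤ t)) (≤-trans (≤-reflexive (ℕₚ.+-comm x 1)) (≤-trans l' (m≤m+n a (nb s))))
    big : x ℕ.+ x ℕ.+ nb t ≤ a ℕ.+ a ℕ.+ nb s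
    big = ≤-trans (ℕₚ.+-monoʳ-≤ (x ℕ.+ x) (nb≤ t)) (≤-trans (≤-reflexive (ℕₚ.+-comm (x ℕ.+ x) 1))
            (≤-trans (ℕₚ.+-mono-≤ l' (<⇒≤ l')) (m≤m+n (a ℕ.+ a) (nb s))))
  go : ∀ {n} (γ : Vec ℕ n) S → All (_≤ a) (toList γ) → gt (a ℕ.+ a ℕ.+ nb s) (double γ ⊞ S) ≡ gt (a ℕ.+ nb s) (γ ⊞ S)
  go [] [] [] = refl
  go (x ∷ γ) (t ∷ S) (l ∷ ls) rewrite cmp s t x l = cong (_ ℕ.+_) (go γ S ls)

-- An ascent of γ + S, with γ sorted, has height one and sits over two equal entries of γ.
⊞-asc : ∀ {n} i (γ : Vec ℕ n) S → Sorted γ → AscV i (γ ⊞ S) → GapAt i (γ ⊞ S) × swapAt i γ ≡ γ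
⊞-asc i [] [] _ ()
⊞-asc zero (a ∷ []) (s ∷ []) _ ()
⊞-asc zero (a ∷ b ∷ γ) (true ∷ true ∷ S) ((l ∷ _) , _) p = ⊥-elim (<⇒≱ p (ℕₚ.+-monoˡ-≤ 1 l))
⊞-asc zero (a ∷ b ∷ γ) (true ∷ false ∷ S) ((l ∷ _) , _) p = ⊥-elim (<⇒≱ p (ℕₚ.+-mono-≤ l z≤n))
⊞-asc zero (a ∷ b ∷ γ) (false ∷ false ∷ S) ((l ∷ _) , _) p = ⊥-elim (<⇒≱ p (ℕₚ.+-monoˡ-≤ 0 l))
⊞-asc zero (a ∷ b ∷ γ) (false ∷ true ∷ S) ((l ∷ _) , _) p
  rewrite ℕₚ.+-identityʳ a | ℕₚ.≤-antisym l (≤-pred (subst (suc a ≤_) (ℕₚ.+-comm b 1) p)) = ℕₚ.+-comm a 1 , refl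
⊞-asc (suc i) (a ∷ γ) (s ∷ S) (_ , sd) p with ⊞-asc i γ S sd p
... | g , e = g , cong (a ∷_) e

-- Every ascent met while sorting has height one and lies over equal entries of γ. So `R-gap`
-- applies with one t, and the exchange acts on `S` alone.
R-straighten : ∀ {n} (γ : Vec ℕ n) → Sorted γ → ∀ S e ξ → R (γ ⊞ S) e ξ ≡ R (sortV (γ ⊞ S)) (e - + inv (γ ⊞ S)) ξ
R-straighten {n} γ sd S = go (inv (γ ⊞ S)) S refl
  where
  go : ∀ k S → inv (γ ⊞ S) ≡ k → ∀ e ξ → R (γ ⊞ S) e ξ ≡ R (sortV (γ ⊞ S)) (e - + inv (γ ⊞ S)) ξ
  go k S eq e ξ with sorted? (γ ⊞ S)
  ... | inj₂ s rewrite sortV-id (γ ⊞ S) s | inv-sorted (γ ⊞ S) s = cong (λ t → R (γ ⊞ S) t ξ) (minus-0⁻ e)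
  go zero S eq e ξ | inj₁ (i , p) = case trans (sym eq) (inv-swapAt i (γ ⊞ S) p) of λ ()
  go (suc k) S eq e ξ | inj₁ (i , p) =
    R-gap i (γ ⊞ S) g e ξ ∙
      cong (λ b → R b (e - 1ℤ) ξ) sw ∙
        go k (swapAt i S) (suc-injective (cong suc (cong inv (sym sw)) ∙ sym (inv-swapAt i (γ ⊞ S) p) ∙ eq)) (e - 1ℤ) ξ ∙
          cong (λ b → R (sortV b) (e - 1ℤ - + inv b) ξ) (sym sw) ∙
            cong₂ (λ b t → R b t ξ) (sortV-swapAt i (γ ⊞ S) p)
              (minus-1-minus e (+ inv (swapAt i (γ ⊞ S))) ∙ cong (λ t → e - + t) (sym (inv-swapAt i (γ ⊞ S) p)))
    where
    g = proj₁ (⊞-asc i γ S sd p)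
    sw : swapAt i (γ ⊞ S) ≡ γ ⊞ swapAt i S
    sw = sym (swapAt-⊞ i γ S) ∙ cong (_⊞ swapAt i S) (proj₂ (⊞-asc i γ S sd p))

AscV-double-⊞ : ∀ {n} i (α : Vec ℕ n) S → AscV i α → AscV i (double α ⊞ S)
AscV-double-⊞ zero (a ∷ b ∷ α) (s ∷ t ∷ S) l =
  ≤-trans (s≤s (ℕₚ.+-monoʳ-≤ (a ℕ.+ a) (nb≤ s)))
    (≤-trans (≤-reflexive (cong suc (ℕₚ.+-comm (a ℕ.+ a) 1) ∙ cong suc (sym (ℕₚ.+-suc a a))))
      (≤-trans (ℕₚ.+-mono-≤ l l) (m≤m+n (b ℕ.+ b) (nb t))))
  where
  nb≤ : ∀ t → nb t ≤ 1
  nb≤ true = s≤s z≤n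
  nb≤ false = z≤n
AscV-double-⊞ (suc i) (a ∷ α) (s ∷ S) l = AscV-double-⊞ i α S l

-- The sorted case is `R-straighten`. In general an ascent of γ is an ascent of 2γ + S for every S,
-- so an exchange multiplies both sides by the same t.
pieri : ∀ {n} h (γ : Vec ℕ n) → ∀ e ξ → E h (R (sortV γ) (e - + inv γ)) ξ ≡
        ∑ (bits n) λ S → h (size S) ▸ R (sortV (γ ⊞ S)) (e - + inv (double γ ⊞ S)) ξ
pieri {n} h = bubble P base step
  where
  P : Vec ℕ n → Set
  P γ = ∀ e ξ → E h (R (sortV γ) (e - + inv γ)) ξ ≡ ∑ (bits n) λ S → h (size S) ▸ R (sortV (γ ⊞ S)) (e - + inv (double γ ⊞ S)) ξ
  base : ∀ γ → Sorted γ → P γ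
  base γ s e ξ rewrite sortV-id γ s | inv-sorted γ s | +-identityʳ e =
    E-R h γ e ξ ∙ ∑-cong (bits n) λ S → cong (h (size S) ▸_)
      (R-straighten γ s S e ξ ∙ cong (λ t → R (sortV (γ ⊞ S)) (e - + t) ξ) (sym (inv-double γ S s)))
  step : ∀ i γ → AscV i γ → P (swapAt i γ) → P γ
  step i γ l p e ξ rewrite sym (sortV-swapAt i γ l) | inv-swapAt i γ l | sym (minus-1-minus e (+ inv (swapAt i γ))) =
    p (e - 1ℤ) ξ ∙ sym (∑-swapAt n i _) ∙ ∑-cong (bits n) λ S → go S
    where
    go : ∀ S → h (size (swapAt i S)) ▸ R (sortV (swapAt i γ ⊞ swapAt i S)) (e - 1ℤ - + inv (double (swapAt i γ) ⊞ swapAt i S)) ξ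
             ≡ h (size S) ▸ R (sortV (γ ⊞ S)) (e - + inv (double γ ⊞ S)) ξ
    go S rewrite double-swapAt i γ | swapAt-⊞ i (double γ) S | size-swapAt i S | swapAt-⊞ i γ S
               | sortV-swapAt-any i (γ ⊞ S) | inv-swapAt i (double γ ⊞ S) (AscV-double-⊞ i γ S l)
               | minus-1-minus e (+ inv (swapAt i (double γ ⊞ S))) = refl

-- Highest weight fillings and the dual Cauchy identity.

infixl 6 _-ᵛ_
_-ᵛ_ : ∀ {n} → Vec ℤ n → Vec ℤ n → Vec ℤ n
[] -ᵛ [] = []
(a ∷ α) -ᵛ (b ∷ β) = (a - b) ∷ (α -ᵛ β)

ρ⁺ : ∀ {n} → Vec ℤ n → Vec ℤ n
ρ⁺ [] = []
ρ⁺ {suc n} (c ∷ γ) = (c + + n) ∷ ρ⁺ γ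

dom : ∀ {n} → Vec ℤ n → Bool
dom [] = true
dom (a ∷ []) = true
dom (a ∷ b ∷ κ) = does (b ℤₚ.≤? a) ∧ dom (b ∷ κ)

data EqAt : ∀ {n} → ℕ → Vec ℤ n → Set where
  ezero : ∀ {n a} {r : Vec ℤ n} → EqAt 0 (a ∷ a ∷ r)
  esuc : ∀ {n i a} {r : Vec ℤ n} → EqAt i r → EqAt (suc i) (a ∷ r)

-- Adding bits to integers in decreasing order can spoil the order only where two neighbours are
-- equal and just the second is raised.
dom-fail : ∀ {n} (κ : Vec ℤ n) D → dom κ ≡ true → dom (κ ∔ D) ≡ false → ∃ λ i → Ascent i D × EqAt i κ
dom-fail [] [] h ()
dom-fail (a ∷ []) (d ∷ []) h ()
dom-fail (a ∷ b ∷ κ) (d ∷ d' ∷ D) = step d d' (dom-fail (b ∷ κ) (d' ∷ D))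
  where
  a≤b : a + 0ℤ ℤ.< b + 1ℤ → a ℤ.≤ b
  a≤b l = subst₂ ℤ._≤_ (lem a) (lem' b) (ℤₚ.+-monoˡ-≤ (- 1ℤ) (ℤₚ.i<j⇒suc[i]≤j l))
    where
    lem : ∀ a → (1ℤ + (a + 0ℤ)) + - 1ℤ ≡ a
    lem = solve-∀
    lem' : ∀ b → (b + 1ℤ) + - 1ℤ ≡ b
    lem' = solve-∀
  step : ∀ d d' → (dom (b ∷ κ) ≡ true → dom ((b ∷ κ) ∔ (d' ∷ D)) ≡ false → ∃ λ i → Ascent i (d' ∷ D) × EqAt i (b ∷ κ)) →
         dom (a ∷ b ∷ κ) ≡ true → dom ((a ∷ b ∷ κ) ∔ (d ∷ d' ∷ D)) ≡ false → ∃ λ i → Ascent i (d ∷ d' ∷ D) × EqAt i (a ∷ b ∷ κ)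
  step d d' rec h f with b ℤₚ.≤? a
  ... | yes b≤a with (b + [ d' ]ᵇ) ℤₚ.≤? (a + [ d ]ᵇ)
  ...   | yes _ with rec h f
  ...     | i , p , q = suc i , p , esuc q
  step true true rec h f | yes b≤a | no ¬p = ⊥-elim (¬p (ℤₚ.+-monoˡ-≤ 1ℤ b≤a))
  step true false rec h f | yes b≤a | no ¬p = ⊥-elim (¬p (ℤₚ.+-mono-≤ b≤a (ℤ.+≤+ z≤n)))
  step false false rec h f | yes b≤a | no ¬p = ⊥-elim (¬p (ℤₚ.+-monoˡ-≤ 0ℤ b≤a))
  step false true rec h f | yes b≤a | no ¬p = 0 , (refl , refl) , subst (λ t → EqAt 0 (a ∷ t ∷ κ)) (ℤₚ.≤-antisym (a≤b (ℤₚ.≰⇒> ¬p)) b≤a) ezero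

ρ⁻-dom-sym : ∀ {n} i (γ κ : Vec ℤ n) D → Ascent i D → EqAt i κ →
             ρ⁻ (swapAt i γ) -ᵛ (κ ∔ D) ≡ swapAt i (ρ⁻ γ -ᵛ (κ ∔ D))
ρ⁻-dom-sym zero (c ∷ d ∷ γ) (a ∷ _ ∷ κ) (false ∷ true ∷ D) (refl , refl) ezero = cong₂ (λ x y → x ∷ y ∷ _) (lem d _ a) (sym (lem c _ a))
  where
  lem : ∀ d n a → (d - (1ℤ + n)) - (a + 0ℤ) ≡ (d - n) - (a + 1ℤ)
  lem = solve-∀
ρ⁻-dom-sym (suc i) (c ∷ γ) (a ∷ κ) (d ∷ D) asc (esuc e) = cong (_ ∷_) (ρ⁻-dom-sym i γ κ D asc e)

⊖-as-∔ : ∀ {n} (α κ : Vec ℤ n) D → (α -ᵛ κ) ⊖ D ≡ α -ᵛ (κ ∔ D)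
⊖-as-∔ [] [] [] = refl
⊖-as-∔ (a ∷ α) (k ∷ κ) (d ∷ D) = cong₂ _∷_ (minus-minus a k [ d ]ᵇ) (⊖-as-∔ α κ D)

data AllV (P : ℤ → Set) : ∀ {n} → Vec ℤ n → Set where
  [] : AllV P []
  _∷_ : ∀ {n x} {γ : Vec ℤ n} → P x → AllV P γ → AllV P (x ∷ γ)

pickSum-All : ∀ {P n} (F : ℤ → Vec ℤ n → ℤ) β → AllV P β → (∀ x r → P x → AllV P r → F x r ≡ 0ℤ) → pickSum F β ≡ 0ℤ
pickSum-All F (b ∷ []) (p ∷ []) h = h b [] p []
pickSum-All F (b ∷ c ∷ β) (p ∷ ps) h =
  cong₂ _-_ (h b (c ∷ β) p ps) (pickSum-All _ (c ∷ β) ps λ x r px pr → h x (b ∷ r) px (p ∷ pr))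

alt-All : ∀ {P n} (f : Vec ℤ n → ℤ) β → AllV P β → (∀ γ → AllV P γ → f γ ≡ 0ℤ) → alt f β ≡ 0ℤ
alt-All {n = zero} f [] [] h = h [] []
alt-All {n = suc n} f β ps h = pickSum-All _ β ps λ x r px pr → alt-All (λ γ → f (x ∷ γ)) r pr λ γ pγ → h (x ∷ γ) (px ∷ pγ)

StrictDec : ∀ {n} → Vec ℤ n → Set
StrictDec [] = ⊤
StrictDec (a ∷ α) = AllV (ℤ._< a) α × StrictDec α

isZ-sub-∈ : ∀ {n} b (γ c : Vec ℤ n) → isZ (γ -ᵛ c) ≡ true → b ∈ᵥ γ → b ∈ᵥ c
isZ-sub-∈ b (x ∷ γ) (y ∷ c) h m with (x - y) ℤₚ.≟ 0ℤ
isZ-sub-∈ b (x ∷ γ) (y ∷ c) h here | yes e = subst (_∈ᵥ (y ∷ c)) (sym (i-j≡0⇒i≡j x y e)) here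
isZ-sub-∈ b (x ∷ γ) (y ∷ c) h (there m) | yes e = there (isZ-sub-∈ b γ c h m)

∈-AllV : ∀ {P n b} {c : Vec ℤ n} → AllV P c → b ∈ᵥ c → P b
∈-AllV (p ∷ ps) here = p
∈-AllV (p ∷ ps) (there m) = ∈-AllV ps m

-- Two strictly decreasing sequences are rearrangements of each other only if they are equal, so
-- only the identity can contribute.
alt-delta : ∀ {n} (c β : Vec ℤ n) x → StrictDec c → StrictDec β → alt (λ γ → isZ (γ -ᵛ c) ▸ x) β ≡ isZ (β -ᵛ c) ▸ x
alt-delta [] [] x _ _ = refl
alt-delta {suc n} (c ∷ cs) (b ∷ β) x (cl , cd) (bl , bd) with b ℤₚ.<? c
... | yes b<c = alt-All _ (b ∷ β) (b<c ∷ all-trans bl) none ∙ sym (none (b ∷ β) (b<c ∷ all-trans bl))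
  where
  all-trans : ∀ {n} {γ : Vec ℤ n} → AllV (ℤ._< b) γ → AllV (ℤ._< c) γ
  all-trans [] = []
  all-trans (p ∷ ps) = ℤₚ.<-trans p b<c ∷ all-trans ps
  none : ∀ γ → AllV (ℤ._< c) γ → isZ (γ -ᵛ (c ∷ cs)) ▸ x ≡ 0ℤ
  none (g ∷ γ) (p ∷ _) with (g - c) ℤₚ.≟ 0ℤ
  ... | yes e = ⊥-elim (ℤₚ.<-irrefl (i-j≡0⇒i≡j g c e) p)
  ... | no _ = refl
... | no b≮c = first β bl bd
  where
    le = ℤₚ.≮⇒≥ b≮c
    vanish : ∀ y γ → b ∈ᵥ γ → isZ ((y ∷ γ) -ᵛ (c ∷ cs)) ▸ x ≡ 0ℤ
    vanish y γ m with (y - c) ℤₚ.≟ 0ℤ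
    ... | no _ = refl
    ... | yes _ with isZ (γ -ᵛ cs) in eq
    ...   | false = refl
    ...   | true = ⊥-elim (ℤₚ.<⇒≱ (∈-AllV cl (isZ-sub-∈ b γ cs eq m)) le)
    first : ∀ β → AllV (ℤ._< b) β → StrictDec β → alt (λ γ → isZ (γ -ᵛ (c ∷ cs)) ▸ x) (b ∷ β) ≡ isZ ((b ∷ β) -ᵛ (c ∷ cs)) ▸ x
    first [] _ _ = refl
    first β@(_ ∷ _) bl bd = cong₂ _-_ ((alt-cong β λ γ → ▸-∧ (b - c == 0ℤ) (isZ (γ -ᵛ cs)) x) ∙
            alt-▸ (b - c == 0ℤ) (λ γ → isZ (γ -ᵛ cs) ▸ x) β ∙
              cong ((b - c == 0ℤ) ▸_) (alt-delta cs β x cd bd) ∙ sym (▸-∧ (b - c == 0ℤ) (isZ (β -ᵛ cs)) x))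
          (pickSum-zero β λ y r → alt-∈ b _ (b ∷ r) here λ γ m → vanish y γ m) ∙ +-identityʳ _

ρ⁺-strict : ∀ {n} (κ : Vec ℤ n) → dom κ ≡ true → StrictDec (ρ⁺ κ)
ρ⁺-strict [] h = tt
ρ⁺-strict (a ∷ []) h = [] , tt
ρ⁺-strict {suc (suc n)} (a ∷ b ∷ κ) = step (ρ⁺-strict (b ∷ κ))
  where
  smaller : ∀ {m x y} {γ : Vec ℤ m} → x ℤ.< y → AllV (ℤ._< x) γ → AllV (ℤ._< y) γ
  smaller l [] = []
  smaller l (p ∷ ps) = ℤₚ.<-trans p l ∷ smaller l ps
  step : (dom (b ∷ κ) ≡ true → StrictDec (ρ⁺ (b ∷ κ))) → dom (a ∷ b ∷ κ) ≡ true → StrictDec (ρ⁺ (a ∷ b ∷ κ))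
  step rec h with b ℤₚ.≤? a
  ... | yes b≤a = (lt ∷ smaller lt (proj₁ (rec h))) , rec h
    where
    lt : b + + n ℤ.< a + + suc n
    lt = ℤₚ.+-mono-≤-< b≤a (ℤ.+<+ (n<1+n n))

ρ-move : ∀ {n} (γ κ : Vec ℤ n) → ρ⁻ γ -ᵛ κ ≡ γ -ᵛ ρ⁺ κ
ρ-move [] [] = refl
ρ-move {suc n} (c ∷ γ) (k ∷ κ) = cong₂ _∷_ (lem c (+ n) k) (ρ-move γ κ)
  where
  lem : ∀ c n k → (c - n) - k ≡ c - (k + n)
  lem = solve-∀

ρ⁺-cancel : ∀ {n} (κ L : Vec ℤ n) → isZ (ρ⁺ L -ᵛ ρ⁺ κ) ≡ isZ (κ -ᵛ L)
ρ⁺-cancel [] [] = refl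
ρ⁺-cancel {suc n} (k ∷ κ) (l ∷ L) = cong₂ _∧_
  (==-cong {(l + + n) - (k + + n)} {0ℤ} {k - l} {0ℤ}
    (λ h → lem₁ k l (+ n) ∙ cong -_ h) (λ h → lem₂ k l (+ n) ∙ cong -_ h))
  (ρ⁺-cancel κ L)
  where
  lem₁ : ∀ k l n → k - l ≡ - ((l + n) - (k + n))
  lem₁ = solve-∀
  lem₂ : ∀ k l n → (l + n) - (k + n) ≡ - (k - l)
  lem₂ = solve-∀

alt-base : ∀ {n} (κ L : Vec ℤ n) x → dom κ ≡ true → dom L ≡ true →
           alt (λ γ → isZ (ρ⁻ γ -ᵛ κ) ▸ x) (ρ⁺ L) ≡ isZ (κ -ᵛ L) ▸ x
alt-base κ L x hκ hL = (alt-cong (ρ⁺ L) λ γ → cong (λ t → isZ t ▸ x) (ρ-move γ κ)) ∙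
  alt-delta (ρ⁺ κ) (ρ⁺ L) x (ρ⁺-strict κ hκ) (ρ⁺-strict L hL) ∙ cong (_▸ x) (ρ⁺-cancel κ L)

-- The count of highest weight fillings of weight L, given columns of total weight κ to the left.
hw : ∀ {n} → Vec ℤ n → (ℤ → ℤ) → List ℕ → List ℕ → Vec ℤ n → ℤ → ℤ
hw L φ [] v κ e = isZ (κ -ᵛ L) ▸ φ e
hw {n} L φ (h ∷ μ) v κ e =
  ∑ (bits n) λ D → (size D ≡ᵇ h) ▸ dom (κ ∔ D) ▸ hw L φ μ (arr v D) (κ ∔ D) (e - + cst (wt (h ∷ μ)) v D)

-- If adding `D` leaves the dominant weights, the ascent of `D` lies over equal entries of κ; with
-- the step of δ this makes the summand symmetric in two places, and it cancels.
alt-dom : ∀ {n} (κ : Vec ℤ n) → dom κ ≡ true → ∀ L (F : Vec Bool n → Vec ℤ n → ℤ) →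
          (∀ D i → Ascent i D → SymAt i (F D)) →
          alt (λ γ → ∑ (bits n) λ D → F D ((ρ⁻ γ -ᵛ κ) ⊖ D)) L ≡
          ∑ (bits n) λ D → dom (κ ∔ D) ▸ alt (λ γ → F D (ρ⁻ γ -ᵛ (κ ∔ D))) L
alt-dom {n} κ hκ L F s = alt-∑ (bits n) (λ D γ → F D ((ρ⁻ γ -ᵛ κ) ⊖ D)) L ∙ ∑-cong (bits n) go
  where
  go : ∀ D → alt (λ γ → F D ((ρ⁻ γ -ᵛ κ) ⊖ D)) L ≡ dom (κ ∔ D) ▸ alt (λ γ → F D (ρ⁻ γ -ᵛ (κ ∔ D))) L
  go D with dom (κ ∔ D) in eq
  ... | true = alt-cong L λ γ → cong (F D) (⊖-as-∔ (ρ⁻ γ) κ D)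
  ... | false with dom-fail κ D hκ eq
  ...   | i , asc , q = (alt-cong L λ γ → cong (F D) (⊖-as-∔ (ρ⁻ γ) κ D)) ∙
    alt-kill i _ (bit-true-< (suc i) D (proj₂ asc))
      (λ γ → cong (F D) (ρ⁻-dom-sym i γ κ D asc q) ∙ s D i asc (ρ⁻ γ -ᵛ (κ ∔ D))) L

-- Columns are treated from left to right, so a sequence is discarded at its first prefix of
-- non-dominant weight; this is why `hw` tests every prefix and not only the total weight.
alt-hw : ∀ {n} (L : Vec ℤ n) → dom L ≡ true → ∀ φ μ v κ e → dom κ ≡ true →
         alt (λ γ → Φ φ μ v e (ρ⁻ γ -ᵛ κ)) (ρ⁺ L) ≡ hw L φ μ v κ e
alt-hw L hL φ [] v κ e hκ = alt-base κ L (φ e) hκ hL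
alt-hw {n} L hL φ (h ∷ μ) v κ e hκ =
  alt-dom κ hκ (ρ⁺ L) F sym-F ∙
    ∑-cong (bits n) λ D → cong (dom (κ ∔ D) ▸_) (alt-▸ (size D ≡ᵇ h) (λ γ → Φ φ μ (arr v D) (e' D) (ρ⁻ γ -ᵛ (κ ∔ D))) (ρ⁺ L)) ∙
      ▸-comm (dom (κ ∔ D)) (size D ≡ᵇ h) _ ∙
        cong ((size D ≡ᵇ h) ▸_) (▸-cong (dom (κ ∔ D)) λ d → alt-hw L hL φ μ (arr v D) (κ ∔ D) (e' D) d)
  where
  e' : Vec Bool n → ℤ
  e' D = e - + cst (wt (h ∷ μ)) v D
  F : Vec Bool n → Vec ℤ n → ℤ
  F D α = (size D ≡ᵇ h) ▸ Φ φ μ (arr v D) (e' D) α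
  sym-F : ∀ D i → Ascent i D → SymAt i (F D)
  sym-F D i (p , q) α = cong ((size D ≡ᵇ h) ▸_) (Φ-sym i (bit-true-< (suc i) D q) φ μ (arr v D) (good-arr i v D p) (e' D) α)

-- The action of a Schur polynomial on `p`, for κ = 0 and `L` the conjugate of its shape. Each
-- variable adds a horizontal strip; `D` is the set of columns that receive a cell, and its size is
-- the exponent of the variable.
ch : ∀ {n N} → Vec ℤ n → Vec ℤ n → (Vec ℤ N → ℤ) → Vec ℤ N → ℤ
ch L κ p [] = isZ (κ -ᵛ L) ▸ p []
ch {n} L κ p (x ∷ ξ) = ∑ (bits n) λ D → dom (κ ∔ D) ▸ ch L (κ ∔ D) (λ ω → p ((x - + size D) ∷ ω)) ξ

EE : ∀ {n N} → Vec ℤ n → (Vec ℤ N → ℤ) → Vec ℤ N → ℤ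
EE [] p = p
EE (s ∷ a) p = E (λ k → s == + k) (EE a p)

EE-cong : ∀ {n N} (a : Vec ℤ n) {p q : Vec ℤ N → ℤ} → (∀ ξ → p ξ ≡ q ξ) → ∀ ξ → EE a p ξ ≡ EE a q ξ
EE-cong [] h ξ = h ξ
EE-cong {N = N} (s ∷ a) h ξ = ∑-cong (bits N) λ S → cong ((s == + size S) ▸_) (EE-cong a h (ξ ⊖ S))

EE-[] : ∀ {n} (a : Vec ℤ n) (p : Vec ℤ 0 → ℤ) → EE a p [] ≡ isZ a ▸ p []
EE-[] [] p = refl
EE-[] (s ∷ a) p = +-identityʳ _ ∙ cong ((s == 0ℤ) ▸_) (EE-[] a p) ∙ sym (▸-∧ (s == 0ℤ) (isZ a) (p []))

size-∷ : ∀ {n} b (S : Vec Bool n) → size (b ∷ S) ≡ nb b ℕ.+ size S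
size-∷ true S = refl
size-∷ false S = refl

-- Each of the elementary factors uses the first variable or not; `D` is the set of factors that use
-- it.
EE-peel : ∀ {n N} (a : Vec ℤ n) (p : Vec ℤ (suc N) → ℤ) x ξ →
          EE a p (x ∷ ξ) ≡ ∑ (bits n) λ D → EE (a ⊖ D) (λ ω → p ((x - + size D) ∷ ω)) ξ
EE-peel [] p x ξ = cong (λ t → p (t ∷ ξ)) (sym (+-identityʳ x)) ∙ sym (+-identityʳ _)
EE-peel {suc n} {N} (s ∷ a) p x ξ =
  ∑-bits N _ ∙ cong₂ _+_ (half true 1ℤ refl tr) (half false 0ℤ refl fa) ∙ sym (∑-bits n _)
  where
  tr : ∀ k → (s == + suc k) ≡ (s - 1ℤ == + k)
  tr k = ==-cong {s} {+ suc k} {s - 1ℤ} {+ k} (λ h → cong (λ t → t - 1ℤ) h ∙ l₁ (+ k)) (λ h → one+minus-1 s ∙ cong (λ t → 1ℤ + t) h)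
    where
    l₁ : ∀ k → (1ℤ + k) - 1ℤ ≡ k
    l₁ = solve-∀
  fa : ∀ k → (s == + k) ≡ (s - 0ℤ == + k)
  fa k = cong (_== + k) (sym (+-identityʳ s))
  szb : ∀ b {m} (D : Vec Bool m) → + size (b ∷ D) ≡ [ b ]ᵇ + + size D
  szb true D = refl
  szb false D = refl
  half : ∀ b c → [ b ]ᵇ ≡ c → (∀ k → (s == + (nb b ℕ.+ k)) ≡ (s - c == + k)) →
         ∑ (bits N) (λ S → (s == + size (b ∷ S)) ▸ EE a p ((x - c) ∷ (ξ ⊖ S))) ≡
         ∑ (bits n) (λ D → EE ((s - c) ∷ (a ⊖ D)) (λ ω → p ((x - + size (b ∷ D)) ∷ ω)) ξ)
  half b c bc eq = (∑-cong (bits N) λ S → cong₂ _▸_ (cong (λ t → s == + t) (size-∷ b S) ∙ eq (size S))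
                      (EE-peel a p (x - c) (ξ ⊖ S)) ∙ sym (∑-▸ (bits n) (s - c == + size S) _)) ∙
        ∑-swap (bits N) (bits n) _ ∙ ∑-cong (bits n) λ D → ∑-cong (bits N) λ S → cong ((s - c == + size S) ▸_)
          (EE-cong (a ⊖ D) (λ ω → cong (λ t → p (t ∷ ω)) (minus-minus x c (+ size D) ∙ cong (λ t → x - t) (cong (λ t → t + + size D) (sym bc) ∙ sym (szb b D)))) (ξ ⊖ S))

E-comm : ∀ {n} h k (f : Vec ℤ n → ℤ) γ → E h (E k f) γ ≡ E k (E h f) γ
E-comm {n} h k f γ = (∑-cong (bits n) λ S → sym (∑-▸ (bits n) (h (size S)) _)) ∙
  ∑-swap (bits n) (bits n) _ ∙
    ∑-cong (bits n) λ S' → (∑-cong (bits n) λ S → ▸-comm (h (size S)) (k (size S')) _ ∙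
        cong (λ t → k (size S') ▸ h (size S) ▸ f t) (⊖-comm γ S S')) ∙
      ∑-▸ (bits n) (k (size S')) _

EE-sym : ∀ {n N} i (a : Vec ℤ n) (p : Vec ℤ N → ℤ) ξ → EE (swapAt i a) p ξ ≡ EE a p ξ
EE-sym i [] p ξ = refl
EE-sym zero (s ∷ []) p ξ = refl
EE-sym zero (s ∷ t ∷ a) p ξ = E-comm (λ k → t == + k) (λ k → s == + k) (EE a p) ξ
EE-sym {N = N} (suc i) (s ∷ a) p ξ = ∑-cong (bits N) λ S → cong ((s == + size S) ▸_) (EE-sym i a p (ξ ⊖ S))

-- For κ = 0 the left side is the determinant of the e_{λ'_j - j + i}. Peeling off one variable adds
-- a set `D` to κ, and `alt-dom` cancels the sets that lead out of the dominant weights.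
dual-cauchy : ∀ {n N} (L : Vec ℤ n) → dom L ≡ true → ∀ κ → dom κ ≡ true → (p : Vec ℤ N → ℤ) → ∀ ξ →
              alt (λ γ → EE (ρ⁻ γ -ᵛ κ) p ξ) (ρ⁺ L) ≡ ch L κ p ξ
dual-cauchy L hL κ hκ p [] = (alt-cong (ρ⁺ L) λ γ → EE-[] (ρ⁻ γ -ᵛ κ) p) ∙ alt-base κ L (p []) hκ hL
dual-cauchy {n} L hL κ hκ p (x ∷ ξ) =
  (alt-cong (ρ⁺ L) λ γ → EE-peel (ρ⁻ γ -ᵛ κ) p x ξ) ∙
    alt-dom κ hκ (ρ⁺ L) (λ D a → EE a (λ ω → p ((x - + size D) ∷ ω)) ξ) (λ D i _ a → EE-sym i a _ ξ) ∙
      ∑-cong (bits n) λ D → ▸-cong (dom (κ ∔ D)) λ d → dual-cauchy L hL (κ ∔ D) d _ ξ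

-- Expansion of s_λ R_0.

range : ℕ → List ℕ
range zero = []
range (suc k) = k ∷ range k

-- Sums over weak compositions are cut off at entries below `K`. For `K` large nothing is lost,
-- since columns taller than the alphabet contribute 0 by `G-big`.
boxV : ℕ → ∀ N → List (Vec ℕ N)
boxV K zero = [] ∷ []
boxV K (suc N) = concatMap (λ a → map (a ∷_) (boxV K N)) (range K)

∑-box : ∀ K N (f : Vec ℕ (suc N) → ℤ) → ∑ (boxV K (suc N)) f ≡ ∑ (range K) λ a → ∑ (boxV K N) λ α → f (a ∷ α)
∑-box K N f = ∑-concatMap (range K) _ f ∙ ∑-cong (range K) λ a → ∑-map (boxV K N) (a ∷_) f

infix 4 _∈ℕ_
data _∈ℕ_ (x : ℕ) : ∀ {n} → Vec ℕ n → Set where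
  here : ∀ {n} {γ : Vec ℕ n} → x ∈ℕ (x ∷ γ)
  there : ∀ {n} {y} {γ : Vec ℕ n} → x ∈ℕ γ → x ∈ℕ (y ∷ γ)

∑-range-shift : ∀ k (h : ℕ → ℤ) → h k ≡ 0ℤ → ∑ (range (suc k)) h ≡ ∑ (range (suc k)) λ a → (1 ≤ᵇ a) ▸ h (a ∸ 1)
∑-range-shift k h h0 = cong (λ t → t + ∑ (range k) h) h0 ∙ +-identityˡ _ ∙ sym (go k)
  where
  go : ∀ k → ∑ (range (suc k)) (λ a → (1 ≤ᵇ a) ▸ h (a ∸ 1)) ≡ ∑ (range k) h
  go zero = refl
  go (suc k) = +ˡ (h k) (go k)

-- The substitution γ = α - S. It would leave the box only at an entry `k` of γ that is raised, and
-- there the summand vanishes by hypothesis.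
reindex : ∀ k N (f : Vec ℕ N → Vec Bool N → ℤ) → (∀ γ S → k ∈ℕ γ → f γ S ≡ 0ℤ) →
          ∑ (boxV (suc k) N) (λ γ → ∑ (bits N) (f γ)) ≡
          ∑ (boxV (suc k) N) (λ α → ∑ (bits N) λ S → valid α S ▸ f (α ⊟ S) S)
reindex k zero f h = refl
reindex k (suc N) f h = ∑-box (suc k) N _ ∙ lhs ∙ +ʳ (∑ (range (suc k)) (g false)) (∑-range-shift k (g true) (top true)) ∙ sym rhs
  where
  B = boxV (suc k) N
  g : Bool → ℕ → ℤ
  g b a = ∑ B λ γ → ∑ (bits N) λ S → valid γ S ▸ f (a ∷ (γ ⊟ S)) (b ∷ S)
  top : ∀ b → g b k ≡ 0ℤ
  top b = ∑-zero B λ γ → ∑-zero (bits N) λ S → trans (cong (valid γ S ▸_) (h _ _ here)) (▸-zero (valid γ S))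
  lhs : ∑ (range (suc k)) (λ a → ∑ B λ γ → ∑ (bits (suc N)) (f (a ∷ γ))) ≡ ∑ (range (suc k)) (g true) + ∑ (range (suc k)) (g false)
  lhs = (∑-cong (range (suc k)) λ a → (∑-cong B λ γ → ∑-bits N (f (a ∷ γ))) ∙ ∑-+ B _ _ ∙
          cong₂ _+_ (reindex k N (λ γ S → f (a ∷ γ) (true ∷ S)) λ γ S m → h _ _ (there m))
                     (reindex k N (λ γ S → f (a ∷ γ) (false ∷ S)) λ γ S m → h _ _ (there m))) ∙
        ∑-+ (range (suc k)) (g true) (g false)
  rhs : ∑ (boxV (suc k) (suc N)) (λ α → ∑ (bits (suc N)) λ S → valid α S ▸ f (α ⊟ S) S) ≡
        ∑ (range (suc k)) (λ a → (1 ≤ᵇ a) ▸ g true (a ∸ 1)) + ∑ (range (suc k)) (g false)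
  rhs = ∑-box (suc k) N _ ∙ (∑-cong (range (suc k)) λ a → (∑-cong B λ γ → ∑-bits N _) ∙ ∑-+ B _ _ ∙
          cong₂ _+_ ((∑-cong B λ γ → (∑-cong (bits N) λ S → ▸-∧ (1 ≤ᵇ a) (valid γ S) _) ∙ ∑-▸ (bits N) (1 ≤ᵇ a) _) ∙ ∑-▸ B (1 ≤ᵇ a) _) refl) ∙
        ∑-+ (range (suc k)) (λ a → (1 ≤ᵇ a) ▸ g true (a ∸ 1)) (g false)

sort-head : ∀ {N} k (γ : Vec ℕ N) → k ∈ℕ γ → ∃ λ h → ∃ λ μ → toList (sortV γ) ≡ h ∷ μ × k ≤ h
sort-head k (a ∷ γ) m rewrite toList-insertV a (sortV γ) with toList (sortV γ) in eq
sort-head k (a ∷ γ) here | [] = a , [] , refl , ≤-refl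
sort-head k (a ∷ γ) (there m) | [] with sort-head k γ m
... | h , μ , e , _ = case trans (sym eq) e of λ ()
sort-head k (a ∷ γ) m | h ∷ μ with a <ᵇ h in lt
sort-head k (a ∷ γ) here | h ∷ μ | true = h , _ , refl , <⇒≤ (<ᵇ-true⁻ {a} {h} lt)
sort-head k (a ∷ γ) here | h ∷ μ | false = a , _ , refl , ≤-refl
sort-head k (a ∷ γ) (there m) | h ∷ μ | b with sort-head k γ m
sort-head k (a ∷ γ) (there m) | h ∷ μ | true | h' , μ' , e , l with trans (sym eq) e
... | refl = h , _ , refl , l
sort-head k (a ∷ γ) (there m) | h ∷ μ | false | h' , μ' , e , l with trans (sym eq) e
... | refl = a , _ , refl , ≤-trans l (<ᵇ-false⁻ {a} {h} lt)

G-big : ∀ {n N} φ k (γ : Vec ℕ N) → k ∈ℕ γ → n < k → ∀ e (a : Vec ℤ n) → G φ (toList (sortV γ)) e a ≡ 0ℤ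
G-big {n} φ k γ m l e a with sort-head k γ m
... | h , μ , eq , k≤h rewrite eq = Φ-big φ h μ (dn 0 n) e a (<-≤-trans l k≤h)

Φ-φcong : ∀ {n} {φ ψ : ℤ → ℤ} → (∀ k → φ k ≡ ψ k) → ∀ μ v e (α : Vec ℤ n) → Φ φ μ v e α ≡ Φ ψ μ v e α
Φ-φcong h [] v e α = cong (isZ α ▸_) (h e)
Φ-φcong {n} h (c ∷ μ) v e α = ∑-cong (bits n) λ D → cong ((size D ≡ᵇ c) ▸_) (Φ-φcong h μ _ _ _)

Φ-∑ : ∀ {n} {A : Set} (xs : List A) (f : A → ℤ → ℤ) μ v e (α : Vec ℤ n) →
      Φ (λ k → ∑ xs λ x → f x k) μ v e α ≡ ∑ xs λ x → Φ (f x) μ v e α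
Φ-∑ xs f [] v e α = sym (∑-▸ xs (isZ α) (λ x → f x e))
Φ-∑ {n} xs f (h ∷ μ) v e α =
  (∑-cong (bits n) λ D → cong ((size D ≡ᵇ h) ▸_) (Φ-∑ xs f μ _ _ _) ∙ sym (∑-▸ xs (size D ≡ᵇ h) _)) ∙ ∑-swap (bits n) xs _

Φ-null : ∀ {n} μ v e (α : Vec ℤ n) → Φ (λ _ → 0ℤ) μ v e α ≡ 0ℤ
Φ-null [] v e α = ▸-zero (isZ α)
Φ-null {n} (h ∷ μ) v e α = ∑-zero (bits n) λ D → trans (cong ((size D ≡ᵇ h) ▸_) (Φ-null μ _ _ _)) (▸-zero (size D ≡ᵇ h))

Φ-▸ : ∀ {n} b φ μ v e (α : Vec ℤ n) → Φ (λ k → b ▸ φ k) μ v e α ≡ b ▸ Φ φ μ v e α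
Φ-▸ true φ μ v e α = refl
Φ-▸ false φ μ v e α = Φ-null μ v e α

Φ-shift : ∀ {n} φ c μ v e (α : Vec ℤ n) → Φ (λ k → φ (k - c)) μ v e α ≡ Φ φ μ v (e - c) α
Φ-shift φ c [] v e α = refl
Φ-shift {n} φ c (h ∷ μ) v e α = ∑-cong (bits n) λ D → cong ((size D ≡ᵇ h) ▸_)
  (Φ-shift φ c μ (arr v D) _ (α ⊖ D) ∙ cong (λ t → Φ φ μ (arr v D) t (α ⊖ D)) (minus-comm e (+ cst (wt (h ∷ μ)) v D) c))

zerosV : ∀ {N} → Vec ℕ N
zerosV {N} = Vec.replicate N 0

⊟-⊞ : ∀ {N} (α : Vec ℕ N) S → valid α S ≡ true → (α ⊟ S) ⊞ S ≡ α
⊟-⊞ [] [] v = refl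
⊟-⊞ (a ∷ α) (s ∷ S) v = cong₂ _∷_ (ℕₚ.m∸n+n≡m (ℕₚ.≤ᵇ⇒≤ (nb s) a (subst T (sym (proj₁ (∧-true {nb s ≤ᵇ a} v))) tt))) (⊟-⊞ α S (proj₂ (∧-true {nb s ≤ᵇ a} v)))

double-⊟-⊞ : ∀ {N} (α : Vec ℕ N) S → valid α S ≡ true → double (α ⊟ S) ⊞ S ≡ double α ⊟ S
double-⊟-⊞ [] [] v = refl
double-⊟-⊞ (a ∷ α) (s ∷ S) v = cong₂ _∷_ (go s (ℕₚ.≤ᵇ⇒≤ (nb s) a (subst T (sym (proj₁ (∧-true {nb s ≤ᵇ a} v))) tt))) (double-⊟-⊞ α S (proj₂ (∧-true {nb s ≤ᵇ a} v)))
  where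
  go : ∀ s → nb s ≤ a → (a ∸ nb s) ℕ.+ (a ∸ nb s) ℕ.+ nb s ≡ a ℕ.+ a ∸ nb s
  go false _ = ℕₚ.+-identityʳ _
  go true (s≤s {n = a'} _) = ℕₚ.+-assoc a' a' 1 ∙ cong (a' ℕ.+_) (ℕₚ.+-comm a' 1)

∑-box-only : ∀ K N (f : Vec ℕ N → ℤ) → (∀ α a → suc a ∈ℕ α → f α ≡ 0ℤ) → ∑ (boxV (suc K) N) f ≡ f zerosV
∑-box-only K zero f h = +-identityʳ _
∑-box-only K (suc N) f h =
  ∑-box (suc K) N f ∙ (∑-cong (range (suc K)) λ a → ∑-box-only K N (λ α → f (a ∷ α)) λ α b m → h _ b (there m)) ∙ go K
  where
  go : ∀ K → ∑ (range (suc K)) (λ a → f (a ∷ zerosV)) ≡ f zerosV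
  go zero = +-identityʳ _
  go (suc K) = cong (λ t → t + ∑ (range (suc K)) (λ a → f (a ∷ zerosV))) (h _ K here) ∙ +-identityˡ _ ∙ go K

sortV-zeros : ∀ N → sortV (zerosV {N}) ≡ zerosV
sortV-zeros zero = refl
sortV-zeros (suc N) rewrite sortV-zeros N with N
... | zero = refl
... | suc _ = refl

inv-zeros : ∀ N → inv (zerosV {N}) ≡ 0
inv-zeros zero = refl
inv-zeros (suc N) = cong₂ ℕ._+_ (go N) (inv-zeros N)
  where
  go : ∀ N → gt 0 (zerosV {N}) ≡ 0
  go zero = refl
  go (suc N) = go N

Φ-zeros : ∀ N φ e → Φ φ (toList (zerosV {N})) [] e [] ≡ φ e
Φ-zeros zero φ e = refl
Φ-zeros (suc N) φ e = +-identityʳ _ ∙ Φ-zeros N φ (e - 0ℤ) ∙ cong φ (+-identityʳ e)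

-- Induction on the number of factors. Multiplying by one more e_z produces inversions of 2γ + S by
-- `pieri`, and branching one more variable off `G` produces those of 2α - S; for γ = α - S the
-- terms coincide.
expand-EE : ∀ {N} k n → n ≤ k → ∀ (a : Vec ℤ n) e (ξ : Vec ℤ N) →
            EE a (R zerosV e) ξ ≡
            ∑ (boxV (suc k) N) λ α → G (λ j → R (sortV α) j ξ) (toList (sortV α)) (e - + inv α) a
expand-EE {N} k zero l [] e ξ = sym ((∑-box-only k N _ λ α a m → G-big _ (suc a) α m (s≤s z≤n) _ []) ∙
  cong₂ (λ s i → Φ (λ j → R s j ξ) (toList s) [] (e - + i) []) (sortV-zeros N) (inv-zeros N) ∙
    Φ-zeros N _ (e - 0ℤ) ∙ cong (λ t → R zerosV t ξ) (+-identityʳ e))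
expand-EE {N} k (suc n) l (z ∷ a) e ξ =
  (∑-cong (bits N) λ S → cong ((z == + size S) ▸_) (expand-EE k n (<⇒≤ l) a e (ξ ⊖ S)) ∙ sym (∑-▸ box (z == + size S) _)) ∙
   ∑-swap (bits N) box _ ∙
    ∑-cong box inner ∙
     reindex k N f (λ γ S m → cong ((z == + size S) ▸_) (G-big _ k γ m l _ a) ∙ ▸-zero (z == + size S)) ∙
      ∑-cong box λ α → ∑-cong (bits N) (outer α) ∙ sym (branch-any (λ j → R (sortV α) j ξ) α e z a)
  where
  box = boxV (suc k) N
  f : Vec ℕ N → Vec Bool N → ℤ
  f γ S = (z == + size S) ▸ G (λ j → R (sortV (γ ⊞ S)) j ξ) (toList (sortV γ)) (e - + inv (double γ ⊞ S)) a
  inner : ∀ γ → ∑ (bits N) (λ S → (z == + size S) ▸ G (λ j → R (sortV γ) j (ξ ⊖ S)) (toList (sortV γ)) (e - + inv γ) a) ≡ ∑ (bits N) (f γ)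
  -- `G` is linear in its final factor, so the sum over `S` is taken inside `φ`, where the Pieri
  -- rule applies, and is brought out again.
  inner γ =
    (∑-cong (bits N) λ S → cong ((z == + size S) ▸_) (sym (Φ-shift (λ j → R (sortV γ) j (ξ ⊖ S)) (+ inv γ) μ v e a)) ∙
             sym (Φ-▸ (z == + size S) (λ j → R (sortV γ) (j - + inv γ) (ξ ⊖ S)) μ v e a)) ∙
     sym (Φ-∑ (bits N) (λ S j → (z == + size S) ▸ R (sortV γ) (j - + inv γ) (ξ ⊖ S)) μ v e a) ∙
      Φ-φcong (λ j → pieri (λ m → z == + m) γ j ξ) μ v e a ∙
       Φ-∑ (bits N) (λ S j → (z == + size S) ▸ R (sortV (γ ⊞ S)) (j - + inv (double γ ⊞ S)) ξ) μ v e a ∙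
        ∑-cong (bits N) λ S → Φ-▸ (z == + size S) (λ j → R (sortV (γ ⊞ S)) (j - + inv (double γ ⊞ S)) ξ) μ v e a ∙
           cong ((z == + size S) ▸_) (Φ-shift (λ j → R (sortV (γ ⊞ S)) j ξ) (+ inv (double γ ⊞ S)) μ v e a)
    where
    μ = toList (sortV γ)
    v = dn 0 n
  outer : ∀ α S → valid α S ▸ f (α ⊟ S) S ≡
          valid α S ▸ (z == + size S) ▸ G (λ j → R (sortV α) j ξ) (toList (sortV (α ⊟ S))) (e - + inv (double α ⊟ S)) a
  outer α S = ▸-cong (valid α S) λ vl → cong₂ (λ s d → (z == + size S) ▸ G (λ j → R (sortV s) j ξ) (toList (sortV (α ⊟ S))) (e - + inv d) a)
    (⊟-⊞ α S vl) (double-⊟-⊞ α S vl)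

0ᵛ : ∀ {n} → Vec ℤ n
0ᵛ {n} = Vec.replicate n 0ℤ

dom-0 : ∀ n → dom (0ᵛ {n}) ≡ true
dom-0 zero = refl
dom-0 (suc zero) = refl
dom-0 (suc (suc n)) = dom-0 (suc n)

-- s_λ R_0 as a combination of the R_α, with highest weight counts as coefficients (L = λ').
chains-hw : ∀ {n N} k → n ≤ k → (L : Vec ℤ n) → dom L ≡ true → ∀ e (ξ : Vec ℤ N) →
            ch L 0ᵛ (R zerosV e) ξ ≡
            ∑ (boxV (suc k) N) λ α → hw L (λ j → R (sortV α) j ξ) (toList (sortV α)) (dn 0 n) 0ᵛ (e - + inv α)
chains-hw {n} {N} k l L hL e ξ =
  sym (dual-cauchy L hL 0ᵛ (dom-0 n) (R zerosV e) ξ) ∙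
    (alt-cong (ρ⁺ L) λ γ → expand-EE k n l (ρ⁻ γ -ᵛ 0ᵛ) e ξ) ∙
      alt-∑ (boxV (suc k) N) (λ α γ → G (λ j → R (sortV α) j ξ) (toList (sortV α)) (e - + inv α) (ρ⁻ γ -ᵛ 0ᵛ)) (ρ⁺ L) ∙
        ∑-cong (boxV (suc k) N) λ α → alt-hw L hL (λ j → R (sortV α) j ξ) (toList (sortV α)) (dn 0 n) 0ᵛ (e - + inv α) (dom-0 n)

-- The Vandermonde determinant, R_0 and the leading term of R_β.

≤ᵇ-true : ∀ {k n} → k ≤ n → (k ≤ᵇ n) ≡ true
≤ᵇ-true {k} {n} l with k ≤ᵇ n in eq
... | true = refl
... | false = ⊥-elim (subst T eq (ℕₚ.≤⇒≤ᵇ l))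

δv : ∀ {n} → Vec ℤ n
δv {zero} = []
δv {suc n} = + n ∷ δv

ρ⁻-δv : ∀ {n} (γ : Vec ℤ n) → ρ⁻ γ ≡ γ -ᵛ δv
ρ⁻-δv [] = refl
ρ⁻-δv (c ∷ γ) = cong (_ ∷_) (ρ⁻-δv γ)

ind : ∀ {n} → Vec ℤ n → Vec ℤ n → ℤ
ind c γ = isZ (γ -ᵛ c) ▸ 1ℤ

-- Coefficients of the alternant with exponent vector `c`, the signed sum of all rearrangements of
-- the monomial x^c.
aind : ∀ {n} → Vec ℤ n → Vec ℤ n → ℤ
aind c = alt (ind c)

sub-==0 : ∀ x c → (x - c == 0ℤ) ≡ (x == c)
sub-==0 x c = ==-cong {x - c} {0ℤ} {x} {c} (i-j≡0⇒i≡j x c) (λ { refl → +-inverseʳ x })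

ind-∷ : ∀ {n} c (h : Vec ℤ n) x γ → ind (c ∷ h) (x ∷ γ) ≡ (x == c) ▸ ind h γ
ind-∷ c h x γ = ▸-∧ (x - c == 0ℤ) (isZ (γ -ᵛ h)) 1ℤ ∙ cong (_▸ ind h γ) (sub-==0 x c)

aind-∷ : ∀ {n} c (h : Vec ℤ n) ξ → aind (c ∷ h) ξ ≡ pickSum (λ x r → (x == c) ▸ aind h r) ξ
aind-∷ c h ξ = pickSum-cong ξ λ x r → trans (alt-cong r λ γ → ind-∷ c h x γ) (alt-▸ (x == c) (ind h) r)

pickSum-neg : ∀ {n} (F : ℤ → Vec ℤ n → ℤ) β → pickSum (λ x r → - F x r) β ≡ - pickSum F β
pickSum-neg F β = (pickSum-cong β λ x r → sym (ℤₚ.-1*i≡-i (F x r))) ∙ pickSum-* (- 1ℤ) F β ∙ ℤₚ.-1*i≡-i _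

pickSum-▸ : ∀ {n} b (F : ℤ → Vec ℤ n → ℤ) β → pickSum (λ x r → b ▸ F x r) β ≡ b ▸ pickSum F β
pickSum-▸ true F β = refl
pickSum-▸ false F β = pickSum-zero β λ _ _ → refl

pickSum-pickSum : ∀ {n m} (H : ℤ → Vec ℤ n → ℤ → Vec ℤ m → ℤ) γ g →
  pickSum (λ x r → pickSum (H x r) g) γ ≡ pickSum (λ y h → pickSum (λ x r → H x r y h) γ) g
pickSum-pickSum H γ (a ∷ []) = refl
pickSum-pickSum H γ (a ∷ b ∷ g) =
  pickSum-+ (λ x r → H x r a (b ∷ g)) (λ x r → - pickSum (λ y h → H x r y (a ∷ h)) (b ∷ g)) γ ∙
    +ˡ (pickSum (λ x r → H x r a (b ∷ g)) γ)
      (pickSum-neg _ γ ∙ cong -_ (pickSum-pickSum (λ x r y h → H x r y (a ∷ h)) γ (b ∷ g)))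

-- Laplace expansion along the other direction.
aind-expand : ∀ {n} (g : Vec ℤ (suc n)) c γ → aind g (c ∷ γ) ≡ pickSum (λ x h → (c == x) ▸ aind h γ) g
aind-expand (x ∷ []) c [] = aind-∷ x [] (c ∷ [])
aind-expand {suc n} (x ∷ y ∷ g) c (d ∷ γ) =
  aind-∷ x (y ∷ g) (c ∷ d ∷ γ) ∙
    cong (λ t → (c == x) ▸ aind (y ∷ g) (d ∷ γ) - t)
      ((pickSum-cong (d ∷ γ) λ z r → cong ((z == x) ▸_) (aind-expand (y ∷ g) c r) ∙ sym (pickSum-▸ (z == x) _ (y ∷ g))) ∙
        pickSum-pickSum (λ z r w h → (z == x) ▸ (c == w) ▸ aind h r) (d ∷ γ) (y ∷ g) ∙
          pickSum-cong (y ∷ g) λ w h → (pickSum-cong (d ∷ γ) λ z r → ▸-comm (z == x) (c == w) (aind h r)) ∙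
            pickSum-▸ (c == w) _ (d ∷ γ) ∙ cong ((c == w) ▸_) (sym (aind-∷ x h (d ∷ γ))))

∑-cong-range : ∀ k {f g : ℕ → ℤ} → (∀ j → j < k → f j ≡ g j) → ∑ (range k) f ≡ ∑ (range k) g
∑-cong-range zero h = refl
∑-cong-range (suc k) h = cong₂ _+_ (h k (n<1+n k)) (∑-cong-range k λ j l → h j (<-trans l (n<1+n k)))

∑-range-bot : ∀ k (f : ℕ → ℤ) → ∑ (range (suc k)) f ≡ f 0 + ∑ (range k) (f ∘ suc)
∑-range-bot zero f = refl
∑-range-bot (suc k) f = +ˡ (f (suc k)) (∑-range-bot k f) ∙ +-swap (f (suc k)) (f 0) _

∔-ones-0 : ∀ {n} (α : Vec ℤ n) → α ∔ ones 0 ≡ α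
∔-ones-0 [] = refl
∔-ones-0 (a ∷ α) = cong₂ _∷_ (+-identityʳ a) (∔-ones-0 α)

pickSum-δv : ∀ n (F : ℤ → Vec ℤ n → ℤ) →
             pickSum F δv ≡ ∑ (range (suc n)) λ j → sg j * F (+ n - + j) (δv ∔ ones j)
pickSum-δv zero F = 1*+0 (F 0ℤ [])
pickSum-δv (suc n) F =
  cong (λ t → F (+ suc n) δv - t) (pickSum-δv n (λ x r → F x (+ suc n ∷ r))) ∙
    cong (λ a → a - ∑ (range (suc n)) (λ j → sg j * F (+ n - + j) (+ suc n ∷ (δv ∔ ones j)))) first ∙
      sym (∑-range-bot (suc n) (λ j → sg j * F (+ suc n - + j) (δv ∔ ones j)) ∙ +ˡ (1ℤ * F (+ suc n - 0ℤ) (δv ∔ ones 0))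
        (∑-cong (range (suc n)) step ∙ ∑-neg (range (suc n)) (λ j → sg j * F (+ n - + j) (+ suc n ∷ (δv ∔ ones j)))))
  where
  first : F (+ suc n) δv ≡ 1ℤ * F (+ suc n - 0ℤ) (δv ∔ ones 0)
  first = sym (*-identityˡ _) ∙ cong (1ℤ *_) (cong₂ F (sym (+-identityʳ _)) (sym (∔-ones-0 δv)))
  step : ∀ j → sg (suc j) * F (+ suc n - + suc j) (δv ∔ ones (suc j)) ≡ - (sg j * F (+ n - + j) (+ suc n ∷ (δv ∔ ones j)))
  step j = neg-* (sg j) _ ∙ cong (λ t → - (sg j * t)) (cong₂ F (suc-minus-suc (+ n) (+ j)) (cong (λ t → t ∷ (δv ∔ ones j)) (ℤₚ.+-comm (+ n) 1ℤ)))

∑-range-none : ∀ k s (f : ℕ → ℤ) → k ≤ s → ∑ (range k) (λ j → (s ≡ᵇ j) ▸ f j) ≡ 0ℤ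
∑-range-none zero s f l = refl
∑-range-none (suc k) s f l rewrite ≡ᵇ-false {s} {k} (λ e → <⇒≢ l (sym e)) = +-identityˡ _ ∙ ∑-range-none k s f (<⇒≤ l)

∑-range-only : ∀ k s (f : ℕ → ℤ) → s < k → ∑ (range k) (λ j → (s ≡ᵇ j) ▸ f j) ≡ f s
∑-range-only (suc k) s f (s≤s l) with s ℕₚ.≟ k
... | yes refl rewrite ≡ᵇ-refl s = +ˡ (f s) (∑-range-none s s f ≤-refl) ∙ +-identityʳ _
... | no ne rewrite ≡ᵇ-false ne = +-identityˡ _ ∙ ∑-range-only k s f (≤∧≢⇒< l ne)

∑-by-size : ∀ n (g : ℕ → Vec Bool n → ℤ) →
            ∑ (bits n) (λ S → g (size S) S) ≡ ∑ (range (suc n)) λ j → ∑ (bits n) λ S → (size S ≡ᵇ j) ▸ g j S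
∑-by-size n g = (∑-cong (bits n) λ S → sym (∑-range-only (suc n) (size S) (λ j → g j S) (s≤s (size≤ S)))) ∙ ∑-swap (bits n) (range (suc n)) _

-- The case of the Pieri rule without t: a set other than the initial one has an ascent, where two
-- exponents of δ + C coincide and the alternant vanishes.
E-aind : ∀ n j → j ≤ n → ∀ (γ : Vec ℤ n) → E (_≡ᵇ j) (aind δv) γ ≡ aind (δv ∔ ones j) γ
E-aind n j l γ =
  E-alt (_≡ᵇ j) (ind δv) γ ∙
    (alt-cong γ λ ω → ∑-cong (bits n) λ S → cong (λ t → (size S ≡ᵇ j) ▸ isZ t ▸ 1ℤ) (to ω S)) ∙
      alt-survive j (λ C α → isZ α ▸ 1ℤ) kill γ ∙
        cong (_▸ alt (λ ω → isZ (ρ⁻ ω ⊖ ones j) ▸ 1ℤ) γ) (≤ᵇ-true l) ∙ alt-cong γ λ ω → cong (λ t → isZ t ▸ 1ℤ) (cong (_⊖ ones j) (ρ⁻-δv ω) ∙ ⊖-as-∔ ω δv (ones j))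
  where
  ⊖-sub : ∀ {n} (ω c : Vec ℤ n) S → (ω ⊖ S) -ᵛ c ≡ (ω -ᵛ c) ⊖ S
  ⊖-sub [] [] [] = refl
  ⊖-sub (w ∷ ω) (c ∷ cs) (s ∷ S) = cong₂ _∷_ (minus-comm w [ s ]ᵇ c) (⊖-sub ω cs S)
  to : ∀ ω S → (ω ⊖ S) -ᵛ δv ≡ ρ⁻ ω ⊖ S
  to ω S = ⊖-sub ω δv S ∙ cong (_⊖ S) (sym (ρ⁻-δv ω))
  kill : ∀ C i → Ascent i C → ∀ β → alt (λ γ → isZ (ρ⁻ γ ⊖ C) ▸ 1ℤ) β ≡ 0ℤ
  kill C i (p , q) = alt-kill i _ (bit-true-< (suc i) C q) λ γ →
    cong (_▸ 1ℤ) (cong isZ (ρ⁻-sym i γ C p q) ∙ isZ-swapAt i (ρ⁻ γ ⊖ C))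

-- Coefficients of ∏_{i<j} (x_i - x_j).
Dv : ∀ {n} → Vec ℤ n → ℤ
Dv [] = 1ℤ
Dv {suc n} (c ∷ γ) = ∑ (bits n) λ S → (c == + n - + size S) ▸ (sg (size S) * Dv (γ ⊖ S))

-- Both sides obey one recursion in the first variable: the factors with it expand into signed e_j,
-- `E-aind` evaluates e_j a_δ, and the same terms make up the Laplace expansion.
vandermonde : ∀ {n} (γ : Vec ℤ n) → Dv γ ≡ aind δv γ
vandermonde [] = refl
vandermonde {suc n} (c ∷ γ) =
  ∑-by-size n (λ j S → (c == + n - + j) ▸ (sg j * Dv (γ ⊖ S))) ∙
    ∑-cong-range (suc n) step ∙ sym (aind-expand δv c γ ∙ pickSum-δv n (λ x h → (c == x) ▸ aind h γ))
  where
  step : ∀ j → j < suc n → ∑ (bits n) (λ S → (size S ≡ᵇ j) ▸ (c == + n - + j) ▸ (sg j * Dv (γ ⊖ S))) ≡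
               sg j * ((c == + n - + j) ▸ aind (δv ∔ ones j) γ)
  step j (s≤s l) = (∑-cong (bits n) λ S → ▸-comm (size S ≡ᵇ j) (c == + n - + j) _ ∙
                      cong ((c == + n - + j) ▸_) (▸-* (size S ≡ᵇ j) (sg j) _ ∙ cong (λ t → sg j * ((size S ≡ᵇ j) ▸ t)) (vandermonde (γ ⊖ S)))) ∙
                    ∑-▸ (bits n) (c == + n - + j) _ ∙
                      cong ((c == + n - + j) ▸_) (∑-*ˡ (bits n) (sg j) _ ∙ cong (sg j *_) (E-aind n j l γ)) ∙ ▸-* (c == + n - + j) (sg j) _

aind-swap : ∀ {n} i (g : Vec ℤ n) → suc i < n → ∀ ξ → aind (swapAt i g) ξ ≡ - aind g ξ
aind-swap i g l ξ = (alt-cong ξ λ γ → cong (_▸ 1ℤ) (sym (isZ-swapAt i (γ -ᵛ swapAt i g)) ∙ cong isZ (swap-sub i γ g))) ∙ alt-swap i (ind g) l ξ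
  where
  swap-sub : ∀ {n} i (γ g : Vec ℤ n) → swapAt i (γ -ᵛ swapAt i g) ≡ swapAt i γ -ᵛ g
  swap-sub i [] [] = refl
  swap-sub zero (a ∷ []) (b ∷ []) = refl
  swap-sub zero (a ∷ c ∷ γ) (b ∷ d ∷ g) = refl
  swap-sub (suc i) (a ∷ γ) (b ∷ g) = cong (_ ∷_) (swap-sub i γ g)

-- The front entry n - j belongs behind the `j` entries that were raised by one; moving it there
-- takes `j` exchanges.
aind-front : ∀ n j → j ≤ n → ∀ ξ → aind ((+ n - + j) ∷ (δv {n} ∔ ones j)) ξ ≡ sg j * aind (δv {suc n}) ξ
aind-front n zero l ξ = cong (λ t → aind t ξ) (cong₂ _∷_ (+-identityʳ (+ n)) (∔-ones-0 δv)) ∙ sym (*-identityˡ _)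
aind-front (suc m) (suc j) (s≤s l) ξ =
  cong (λ t → aind t ξ) (cong₂ (λ a b → a ∷ b ∷ (δv ∔ ones j)) (suc-minus-suc (+ m) (+ j)) (ℤₚ.+-comm (+ m) 1ℤ)) ∙
    aind-swap 0 (+ suc m ∷ (+ m - + j) ∷ (δv ∔ ones j)) (s≤s (s≤s z≤n)) ξ ∙
      cong -_ (aind-∷ (+ suc m) ((+ m - + j) ∷ (δv ∔ ones j)) ξ ∙
                (pickSum-cong ξ λ x r → cong ((x == + suc m) ▸_) (aind-front m j l r) ∙ ▸-* (x == + suc m) (sg j) _) ∙
                  pickSum-* (sg j) _ ξ ∙ cong (sg j *_) (sym (aind-∷ (+ suc m) δv ξ))) ∙
        lem₂ (sg j) _
  where
  lem₂ : ∀ a b → - (a * b) ≡ (- a) * b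
  lem₂ = solve-∀

-- Multiplication of a series in t by [j] = 1 + t + ... + t^{j-1}; `QF` then multiplies by the
-- t-factorial.
q : ℕ → (ℤ → ℤ) → ℤ → ℤ
q j f e = ∑ (range j) λ i → f (e - + i)

QF : ℕ → (ℤ → ℤ) → ℤ → ℤ
QF zero f = f
QF (suc k) f = q (suc k) (QF k f)

unit : ℤ → ℤ
unit e = (e == 0ℤ) ▸ 1ℤ

sg-sq : ∀ j → sg j * sg j ≡ 1ℤ
sg-sq zero = refl
sg-sq (suc j) = lem (sg j) ∙ sg-sq j
  where
  lem : ∀ a → (- a) * (- a) ≡ a * a
  lem = solve-∀

pickSum-∑ : ∀ {A : Set} {n} (xs : List A) (F : A → ℤ → Vec ℤ n → ℤ) β → pickSum (λ x r → ∑ xs λ y → F y x r) β ≡ ∑ xs λ y → pickSum (F y) β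
pickSum-∑ [] F β = pickSum-zero β λ _ _ → refl
pickSum-∑ (y ∷ ys) F β = pickSum-+ (F y) _ β ∙ +ˡ (pickSum (F y) β) (pickSum-∑ ys F β)

-- Σ_w sgn(w) w(∏_{i<j} (x_i - t x_j)) = [n]! a_δ.
alt-Dt : ∀ n e (ξ : Vec ℤ n) → alt (Dt e) ξ ≡ QF n unit e * aind δv ξ
alt-Dt zero e [] = sym (*-identityʳ _)
alt-Dt (suc n) e ξ =
  (pickSum-cong ξ λ x r → (alt-cong r λ γ → ∑-by-size n (λ j S → (x == + n - + j) ▸ (sg j * Dt (e - + j) (γ ⊖ S)))) ∙
           alt-∑ (range (suc n)) (λ j γ → ∑ (bits n) λ S → (size S ≡ᵇ j) ▸ (x == + n - + j) ▸ (sg j * Dt (e - + j) (γ ⊖ S))) r ∙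
             ∑-cong-range (suc n) (λ j l → inner x r j l)) ∙
    pickSum-∑ (range (suc n)) _ ξ ∙
      ∑-cong-range (suc n) outer ∙ (∑-cong (range (suc n)) λ j → ℤₚ.*-comm (QF n unit (e - + j)) (aind δv ξ)) ∙
        ∑-*ˡ (range (suc n)) (aind δv ξ) (λ j → QF n unit (e - + j)) ∙ ℤₚ.*-comm (aind δv ξ) (QF (suc n) unit e)
  where
  c : ℕ → ℤ
  c j = sg j * QF n unit (e - + j)
  inner : ∀ x r j → j < suc n → alt (λ γ → ∑ (bits n) λ S → (size S ≡ᵇ j) ▸ (x == + n - + j) ▸ (sg j * Dt (e - + j) (γ ⊖ S))) r ≡
          c j * ((x == + n - + j) ▸ aind (δv ∔ ones j) r)
  inner x r j (s≤s l) =
    (alt-cong r λ γ → (∑-cong (bits n) λ S → ▸-comm (size S ≡ᵇ j) (x == + n - + j) _ ∙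
              cong ((x == + n - + j) ▸_) (▸-* (size S ≡ᵇ j) (sg j) _)) ∙
            ∑-▸ (bits n) (x == + n - + j) _ ∙ cong ((x == + n - + j) ▸_) (∑-*ˡ (bits n) (sg j) _)) ∙
      alt-▸ (x == + n - + j) (λ γ → sg j * E (_≡ᵇ j) (Dt (e - + j)) γ) r ∙
        cong ((x == + n - + j) ▸_) (alt-* (sg j) (E (_≡ᵇ j) (Dt (e - + j))) r ∙
            cong (sg j *_) (sym (E-alt (_≡ᵇ j) (Dt (e - + j)) r) ∙
                (∑-cong (bits n) λ S → cong ((size S ≡ᵇ j) ▸_) (alt-Dt n (e - + j) (r ⊖ S)) ∙ ▸-* (size S ≡ᵇ j) (QF n unit (e - + j)) _) ∙
                  ∑-*ˡ (bits n) (QF n unit (e - + j)) _ ∙ cong (QF n unit (e - + j) *_) (E-aind n j l r)) ∙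
              sym (ℤₚ.*-assoc (sg j) _ _)) ∙
          ▸-* (x == + n - + j) (c j) _
  -- The sign of the expansion and the sign of the rearrangement cancel, so the terms add up with
  -- powers t^j to the factor [n + 1].
  outer : ∀ j → j < suc n → pickSum (λ x r → c j * ((x == + n - + j) ▸ aind (δv ∔ ones j) r)) ξ ≡ QF n unit (e - + j) * aind δv ξ
  outer j (s≤s l) = pickSum-* (c j) _ ξ ∙
    cong (c j *_) (sym (aind-∷ (+ n - + j) (δv ∔ ones j) ξ) ∙ aind-front n j l ξ) ∙
      lem (sg j) (QF n unit (e - + j)) (aind δv ξ) ∙ cong (_* (QF n unit (e - + j) * aind δv ξ)) (sg-sq j) ∙ *-identityˡ _
    where
    lem : ∀ s q a → (s * q) * (s * a) ≡ (s * s) * (q * a)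
    lem = solve-∀

⊝-zeros : ∀ {n} (γ : Vec ℤ n) → γ ⊝ zerosV ≡ γ
⊝-zeros [] = refl
⊝-zeros (c ∷ γ) = cong₂ _∷_ (+-identityʳ c) (⊝-zeros γ)

R-zeros : ∀ {n} e (ξ : Vec ℤ n) → R zerosV e ξ ≡ QF n unit e * Dv ξ
R-zeros {n} e ξ = (alt-cong ξ λ γ → cong (Dt e) (⊝-zeros γ)) ∙ alt-Dt n e ξ ∙ cong (QF n unit e *_) (sym (vandermonde ξ))

Dt-neg : ∀ {n} k (γ : Vec ℤ n) → Dt -[1+ k ] γ ≡ 0ℤ
Dt-neg k [] = refl
Dt-neg {suc n} k (c ∷ γ) = ∑-zero (bits n) λ S → trans (cong (λ t → (c == + n - + size S) ▸ (sg (size S) * t)) (neg (size S) (γ ⊖ S)))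
  (cong ((c == + n - + size S) ▸_) (*-zeroʳ (sg (size S))) ∙ ▸-zero (c == + n - + size S))
  where
  neg : ∀ s γ → Dt (-[1+ k ] - + s) γ ≡ 0ℤ
  neg zero γ = Dt-neg k γ
  neg (suc s) γ = Dt-neg (suc (k ℕ.+ s)) γ

size-0 : ∀ {n} (S : Vec Bool n) → size S ≡ 0 → S ≡ ones 0
size-0 [] h = refl
size-0 (false ∷ S) h = cong (false ∷_) (size-0 S h)

Dt-0 : ∀ {n} (γ : Vec ℤ n) → Dt 0ℤ γ ≡ ind δv γ
Dt-0 [] = refl
Dt-0 {suc n} (c ∷ γ) = ∑-bits-only (ones 0) _ other ∙
  cong₂ (λ s t → (c == + n - + s) ▸ (sg s * Dt (0ℤ - + s) t)) (size-ones n 0 z≤n) (⊖-ones-0 γ) ∙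
    cong₂ (λ a b → (c == a) ▸ b) (+-identityʳ (+ n)) (*-identityˡ _ ∙ Dt-0 γ) ∙ sym (ind-∷ (+ n) δv c γ)
  where
  ⊖-ones-0 : ∀ {n} (α : Vec ℤ n) → α ⊖ ones 0 ≡ α
  ⊖-ones-0 [] = refl
  ⊖-ones-0 (a ∷ α) = cong₂ _∷_ (+-identityʳ a) (⊖-ones-0 α)
  other : ∀ S → S ≢ ones 0 → (c == + n - + size S) ▸ (sg (size S) * Dt (0ℤ - + size S) (γ ⊖ S)) ≡ 0ℤ
  other S ne with size S in eq
  ... | zero = ⊥-elim (ne (size-0 S eq))
  ... | suc k = cong (λ t → (c == + n - + suc k) ▸ (sg (suc k) * t)) (Dt-neg k (γ ⊖ S)) ∙
                  cong ((c == + n - + suc k) ▸_) (*-zeroʳ (sg (suc k))) ∙ ▸-zero (c == + n - + suc k)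

+ᵛ : ∀ {n} → Vec ℕ n → Vec ℤ n
+ᵛ = Vec.map (λ a → + a)

dom-+ᵛ : ∀ {n} (β : Vec ℕ n) → Sorted β → dom (+ᵛ β) ≡ true
dom-+ᵛ [] s = refl
dom-+ᵛ (a ∷ []) s = refl
dom-+ᵛ (a ∷ b ∷ β) ((l ∷ _) , s) = cong (_∧ dom (+ᵛ (b ∷ β))) (≤ᵇ-true l) ∙ dom-+ᵛ (b ∷ β) s

-- At t = 0 the product of the x_i - t x_j is x^δ, so the constant term of R_β is the alternant of β
-- + δ. This triangularity yields the uniqueness of coefficients at the end.
R-lead : ∀ {n} (β : Vec ℕ n) → Sorted β → (L : Vec ℤ n) → dom L ≡ true → R β 0ℤ (ρ⁺ L) ≡ isZ (+ᵛ β -ᵛ L) ▸ 1ℤ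
R-lead β s L hL = (alt-cong (ρ⁺ L) λ γ → Dt-0 (γ ⊝ β) ∙ cong (λ t → isZ t ▸ 1ℤ) (move γ β)) ∙ alt-base (+ᵛ β) L 1ℤ (dom-+ᵛ β s) hL
  where
  move : ∀ {n} (γ : Vec ℤ n) β → (γ ⊝ β) -ᵛ δv ≡ ρ⁻ γ -ᵛ +ᵛ β
  move [] [] = refl
  move {suc n} (c ∷ γ) (b ∷ β) = cong₂ _∷_ (minus-comm c (+ b) (+ n)) (move γ β)

-- Rearrangements of a partition and the t-multinomial identity.

eqN : ∀ {n} → Vec ℕ n → Vec ℕ n → Bool
eqN [] [] = true
eqN (a ∷ α) (b ∷ β) = (a ≡ᵇ b) ∧ eqN α β

eqN-true : ∀ {n} (α β : Vec ℕ n) → eqN α β ≡ true → α ≡ β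
eqN-true [] [] h = refl
eqN-true (a ∷ α) (b ∷ β) h = cong₂ _∷_ (≡ᵇ-true (proj₁ (∧-true {a ≡ᵇ b} h))) (eqN-true α β (proj₂ (∧-true {a ≡ᵇ b} h)))

eqN-refl : ∀ {n} (α : Vec ℕ n) → eqN α α ≡ true
eqN-refl [] = refl
eqN-refl (a ∷ α) rewrite ≡ᵇ-refl a = eqN-refl α

rm : ∀ {n} → ℕ → Vec ℕ (suc n) → Vec ℕ n
rm a (x ∷ []) = []
rm a (x ∷ y ∷ r) = if x ≡ᵇ a then y ∷ r else x ∷ rm a (y ∷ r)

rm-head : ∀ {n} a (r : Vec ℕ n) → rm a (a ∷ r) ≡ r
rm-head a [] = refl
rm-head a (y ∷ r) rewrite ≡ᵇ-refl a = refl

rm-skip : ∀ {n} a h (r : Vec ℕ (suc n)) → h ≢ a → rm a (h ∷ r) ≡ h ∷ rm a r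
rm-skip a h (y ∷ r) ne rewrite ≡ᵇ-false ne = refl

rm-insertV : ∀ {n} a (σ : Vec ℕ n) → rm a (insertV a σ) ≡ σ
rm-insertV a [] = refl
rm-insertV a (h ∷ σ) with a <ᵇ h in eq
... | true = rm-skip a h (insertV a σ) (λ e → <⇒≢ (<ᵇ-true⁻ {a} {h} eq) (sym e)) ∙ cong (h ∷_) (rm-insertV a σ)
... | false = rm-head a (h ∷ σ)

∈-All : ∀ {P : ℕ → Set} {n a} {γ : Vec ℕ n} → All P (toList γ) → a ∈ℕ γ → P a
∈-All (p ∷ ps) here = p
∈-All (p ∷ ps) (there m) = ∈-All ps m

insertV-rm : ∀ {n} a (β : Vec ℕ (suc n)) → Sorted β → a ∈ℕ β → insertV a (rm a β) ≡ β
insertV-rm a (a ∷ []) s here = refl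
insertV-rm a (x ∷ y ∷ β) (bd , s) m with x ℕₚ.≟ a
... | yes refl rewrite ≡ᵇ-refl x = insertV-max x (y ∷ β) bd
insertV-rm a (x ∷ y ∷ β) (bd , s) here | no ne = ⊥-elim (ne refl)
insertV-rm a (x ∷ y ∷ β) (bd , s) (there m) | no ne
  rewrite ≡ᵇ-false ne | <ᵇ-true {a} {x} (≤∧≢⇒< (∈-All bd m) (ne ∘ sym)) = cong (x ∷_) (insertV-rm a (y ∷ β) s m)

∈-insertV : ∀ {n} a (σ : Vec ℕ n) → a ∈ℕ insertV a σ
∈-insertV a [] = here
∈-insertV a (h ∷ σ) with a <ᵇ h
... | true = there (∈-insertV a σ)
... | false = here

All-rm : ∀ {P : ℕ → Set} {n} a (β : Vec ℕ (suc n)) → All P (toList β) → All P (toList (rm a β))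
All-rm a (x ∷ []) ps = []
All-rm a (x ∷ y ∷ β) (p ∷ ps) with x ≡ᵇ a
... | true = ps
... | false = p ∷ All-rm a (y ∷ β) ps

Sorted-rm : ∀ {n} a (β : Vec ℕ (suc n)) → Sorted β → Sorted (rm a β)
Sorted-rm a (x ∷ []) s = tt
Sorted-rm a (x ∷ y ∷ β) (bd , s) with x ≡ᵇ a
... | true = s
... | false = All-rm a (y ∷ β) bd , Sorted-rm a (y ∷ β) s

cntV-insertV : ∀ {n} k a (σ : Vec ℕ n) → cntV k (insertV a σ) ≡ (if a ≡ᵇ k then 1 else 0) ℕ.+ cntV k σ
cntV-insertV k a [] = refl
cntV-insertV k a (h ∷ σ) with a <ᵇ h
... | false = refl
... | true rewrite cntV-insertV k a σ = lem (if h ≡ᵇ k then 1 else 0) (if a ≡ᵇ k then 1 else 0) (cntV k σ)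
  where
  lem : ∀ a b c → a ℕ.+ (b ℕ.+ c) ≡ b ℕ.+ (a ℕ.+ c)
  lem a b c = sym (ℕₚ.+-assoc a b c) ∙ cong (ℕ._+ c) (ℕₚ.+-comm a b) ∙ ℕₚ.+-assoc b a c

gt-insertV : ∀ {n} k a (σ : Vec ℕ n) → gt k (insertV a σ) ≡ (if k <ᵇ a then 1 else 0) ℕ.+ gt k σ
gt-insertV k a [] = refl
gt-insertV k a (h ∷ σ) with a <ᵇ h
... | false = refl
... | true rewrite gt-insertV k a σ = lem (if k <ᵇ h then 1 else 0) (if k <ᵇ a then 1 else 0) (gt k σ)
  where
  lem : ∀ a b c → a ℕ.+ (b ℕ.+ c) ≡ b ℕ.+ (a ℕ.+ c)
  lem a b c = sym (ℕₚ.+-assoc a b c) ∙ cong (ℕ._+ c) (ℕₚ.+-comm a b) ∙ ℕₚ.+-assoc b a c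

gt-sortV : ∀ {n} k (α : Vec ℕ n) → gt k (sortV α) ≡ gt k α
gt-sortV k [] = refl
gt-sortV k (a ∷ α) = gt-insertV k a (sortV α) ∙ cong (_ ℕ.+_) (gt-sortV k α)

∈? : ∀ {n} a (β : Vec ℕ n) → (a ∈ℕ β) ⊎ (cntV a β ≡ 0)
∈? a [] = inj₂ refl
∈? a (x ∷ β) with x ℕₚ.≟ a
... | yes refl = inj₁ here
... | no ne with ∈? a β
...   | inj₁ m = inj₁ (there m)
...   | inj₂ e rewrite ≡ᵇ-false ne = inj₂ e

cnt-∈ : ∀ {n a} {β : Vec ℕ n} → a ∈ℕ β → cntV a β ≢ 0
cnt-∈ {a = a} here e rewrite ≡ᵇ-refl a = case e of λ ()
cnt-∈ {a = a} (there {y = y} {γ = γ} m) e = cnt-∈ m (ℕₚ.m+n≡0⇒n≡0 (if y ≡ᵇ a then 1 else 0) e)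

q-cong : ∀ j {f g : ℤ → ℤ} → (∀ e → f e ≡ g e) → ∀ e → q j f e ≡ q j g e
q-cong j h e = ∑-cong (range j) λ i → h (e - + i)

QF-cong : ∀ k {f g : ℤ → ℤ} → (∀ e → f e ≡ g e) → ∀ e → QF k f e ≡ QF k g e
QF-cong zero h e = h e
QF-cong (suc k) h e = q-cong (suc k) (QF-cong k h) e

q-comm : ∀ i j f e → q i (q j f) e ≡ q j (q i f) e
q-comm i j f e = ∑-swap (range i) (range j) (λ a b → f (e - + a - + b)) ∙
  ∑-cong (range j) λ b → ∑-cong (range i) λ a → cong f (minus-comm e (+ a) (+ b))

q-QF : ∀ j k f e → q j (QF k f) e ≡ QF k (q j f) e
q-QF j zero f e = refl
q-QF j (suc k) f e = q-comm j (suc k) (QF k f) e ∙ q-cong (suc k) (q-QF j k f) e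

q-+ : ∀ m n f e → q (m ℕ.+ n) f e ≡ q m f e + q n f (e - + m)
q-+ m zero f e rewrite ℕₚ.+-identityʳ m = sym (+-identityʳ _)
q-+ m (suc n) f e rewrite ℕₚ.+-suc m n =
  cong₂ _+_ (cong f (cong (λ t → e - t) (pos-+ m n) ∙ minus-+ e (+ m) (+ n))) (q-+ m n f e) ∙ +-swap (f (e - + m - + n)) (q m f e) _

-- Multiplication by v_β, the product of the factorials of the multiplicities in β of the values
-- listed in `ss`.
vOp : ∀ {N} → List ℕ → Vec ℕ N → (ℤ → ℤ) → ℤ → ℤ
vOp [] β f = f
vOp (s ∷ ss) β f = QF (cntV s β) (vOp ss β f)

vOp-cong-β : ∀ {M N} ss (β : Vec ℕ M) (β' : Vec ℕ N) → All (λ s → cntV s β ≡ cntV s β') ss → ∀ f e → vOp ss β f e ≡ vOp ss β' f e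
vOp-cong-β [] β β' [] f e = refl
vOp-cong-β (s ∷ ss) β β' (p ∷ ps) f e rewrite p = QF-cong (cntV s β') (vOp-cong-β ss β β' ps f) e

range-All : ∀ k → All (_< k) (range k)
range-All zero = []
range-All (suc k) = n<1+n k ∷ All.map (λ l → <-trans l (n<1+n k)) (range-All k)

-- Deleting one entry `a` lowers only the multiplicity of `a`, so v_β loses the single factor [m_a].
vOp-remove : ∀ {N} K (β : Vec ℕ (suc N)) (β' : Vec ℕ N) a → a < K →
             cntV a β ≡ suc (cntV a β') → (∀ s → s ≢ a → cntV s β ≡ cntV s β') → ∀ f e →
             vOp (range K) β f e ≡ q (cntV a β) (vOp (range K) β' f) e
vOp-remove (suc k) β β' a (s≤s l) ca co f e with k ℕₚ.≟ a
... | yes refl rewrite ca = q-cong (suc (cntV k β')) (QF-cong (cntV k β')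
      (vOp-cong-β (range k) β β' (All.map (λ {s} l' → co s (<⇒≢ l')) (range-All k)) f)) e
... | no ne = cong (λ c → QF c (vOp (range k) β f) e) (co k ne) ∙
    QF-cong (cntV k β') (vOp-remove k β β' a (≤∧≢⇒< l (ne ∘ sym)) ca co f) e ∙ sym (q-QF (cntV a β) (cntV k β') _ e)

ltV : ∀ {n} → ℕ → Vec ℕ n → ℕ
ltV k [] = 0
ltV k (x ∷ β) = (if x <ᵇ k then 1 else 0) ℕ.+ ltV k β

gtV≥ : ∀ {n} → ℕ → Vec ℕ n → ℕ
gtV≥ k [] = 0
gtV≥ k (x ∷ β) = (if x <ᵇ k then 0 else 1) ℕ.+ gtV≥ k β

+-shuffle : ∀ a b c d → (a ℕ.+ b) ℕ.+ (c ℕ.+ d) ≡ (a ℕ.+ c) ℕ.+ (b ℕ.+ d)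
+-shuffle a b c d = ℕₚ.+-assoc a b (c ℕ.+ d) ∙ cong (a ℕ.+_) (sym (ℕₚ.+-assoc b c d) ∙ cong (ℕ._+ d) (ℕₚ.+-comm b c) ∙ ℕₚ.+-assoc c b d) ∙ sym (ℕₚ.+-assoc a c (b ℕ.+ d))

trich : ∀ k x → ((if x ≡ᵇ k then 1 else 0) ℕ.+ (if x <ᵇ k then 1 else 0) ≡ (if x <ᵇ suc k then 1 else 0)) ×
                ((if k <ᵇ x then 1 else 0) ℕ.+ (if x ≡ᵇ k then 1 else 0) ≡ (if x <ᵇ k then 0 else 1)) ×
                ((if x <ᵇ suc k then 0 else 1) ≡ (if k <ᵇ x then 1 else 0))
trich k x with ℕₚ.<-cmp x k
... | Rel.tri< l ne _ rewrite <ᵇ-true l | ≡ᵇ-false ne | <ᵇ-true {x} {suc k} (<-trans l (n<1+n k)) | <ᵇ-false (<⇒≤ l) = refl , refl , refl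
... | Rel.tri≈ _ refl _ rewrite ≡ᵇ-refl x | <ᵇ-false {x} {x} ≤-refl | <ᵇ-true (n<1+n x) = refl , refl , refl
... | Rel.tri> _ ne l rewrite <ᵇ-false (<⇒≤ l) | ≡ᵇ-false ne | <ᵇ-false {x} {suc k} l | <ᵇ-true l = refl , refl , refl

ltV-suc : ∀ {n} k (β : Vec ℕ n) → cntV k β ℕ.+ ltV k β ≡ ltV (suc k) β
ltV-suc k [] = refl
ltV-suc k (x ∷ β) = +-shuffle (if x ≡ᵇ k then 1 else 0) (cntV k β) _ _ ∙ cong₂ ℕ._+_ (proj₁ (trich k x)) (ltV-suc k β)

gtV≥-split : ∀ {n} k (β : Vec ℕ n) → gt k β ℕ.+ cntV k β ≡ gtV≥ k β
gtV≥-split k [] = refl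
gtV≥-split k (x ∷ β) = +-shuffle (if k <ᵇ x then 1 else 0) (gt k β) _ _ ∙ cong₂ ℕ._+_ (proj₁ (proj₂ (trich k x))) (gtV≥-split k β)

gtV≥-suc : ∀ {n} k (β : Vec ℕ n) → gtV≥ (suc k) β ≡ gt k β
gtV≥-suc k [] = refl
gtV≥-suc k (x ∷ β) = cong₂ ℕ._+_ (proj₂ (proj₂ (trich k x))) (gtV≥-suc k β)

ltV-0 : ∀ {n} (β : Vec ℕ n) → ltV 0 β ≡ 0
ltV-0 [] = refl
ltV-0 (x ∷ β) = ltV-0 β

-- The exponents in t^{gt a}[m_a] form an interval of length m_a starting at the number of entries
-- larger than `a`. These intervals follow one another without gap or overlap.
telescope : ∀ {n} k (β : Vec ℕ n) g e → ∑ (range k) (λ a → q (cntV a β) g (e - + gt a β)) ≡ q (ltV k β) g (e - + gtV≥ k β)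
telescope zero β g e rewrite ltV-0 β = refl
telescope (suc k) β g e rewrite telescope k β g e | sym (ltV-suc k β) | gtV≥-suc k β =
  cong (λ t → q (cntV k β) g (e - + gt k β) + q (ltV k β) g t)
          (cong (λ t → e - + t) (sym (gtV≥-split k β)) ∙ cong (λ t → e - t) (pos-+ (gt k β) (cntV k β)) ∙ minus-+ e (+ gt k β) (+ cntV k β)) ∙
    sym (q-+ (cntV k β) (ltV k β) g (e - + gt k β))

ltV-all : ∀ {n} K (β : Vec ℕ n) → All (_< K) (toList β) → ltV K β ≡ n × gtV≥ K β ≡ 0
ltV-all K [] [] = refl , refl
ltV-all K (x ∷ β) (l ∷ ls) rewrite <ᵇ-true l = cong suc (proj₁ (ltV-all K β ls)) , proj₂ (ltV-all K β ls)

-- Σ_{α ∼ β} t^{inv α} · v_β = [N]!.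
multinomial : ∀ K N (β : Vec ℕ N) → Sorted β → All (_< K) (toList β) → ∀ f e →
              ∑ (boxV K N) (λ α → eqN (sortV α) β ▸ vOp (range K) β f (e - + inv α)) ≡ QF N f e
multinomial K zero [] s bd f e = +-identityʳ _ ∙ vOp-id (range K) (e - 0ℤ) ∙ cong f (+-identityʳ e)
  where
  vOp-id : ∀ ss e → vOp ss [] f e ≡ f e
  vOp-id [] e = refl
  vOp-id (s ∷ ss) e = vOp-id ss e
multinomial K (suc N) β s bd f e =
  ∑-box K N _ ∙
    go K bd' ∙
      telescope K β (QF N f) e ∙
        cong₂ (λ a b → q a (QF N f) (e - + b)) (proj₁ (ltV-all K β bd)) (proj₂ (ltV-all K β bd)) ∙
          cong (q (suc N) (QF N f)) (+-identityʳ e)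
  where
  bd' = range-All K
  -- A rearrangement that starts with `a` has at this place one inversion for each entry of β larger
  -- than `a`, in whatever order the rest follows.
  inner : ∀ a → a < K → ∑ (boxV K N) (λ α → eqN (insertV a (sortV α)) β ▸ vOp (range K) β f (e - + (gt a α ℕ.+ inv α))) ≡ q (cntV a β) (QF N f) (e - + gt a β)
  inner a a<K with ∈? a β
  ... | inj₂ c0 rewrite c0 = ∑-zero (boxV K N) λ α → cong (_▸ vOp (range K) β f (e - + (gt a α ℕ.+ inv α))) (absent α)
    where
    absent : ∀ α → eqN (insertV a (sortV α)) β ≡ false
    absent α with eqN (insertV a (sortV α)) β in eq
    ... | false = refl
    ... | true = ⊥-elim (cnt-∈ (subst (a ∈ℕ_) (eqN-true (insertV a (sortV α)) β eq) (∈-insertV a (sortV α))) c0)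
  ... | inj₁ m =
    ∑-cong (boxV K N) step ∙
      ∑-swap (boxV K N) (range (cntV a β)) _ ∙
        ∑-cong (range (cntV a β)) λ i → multinomial K N β' (Sorted-rm a β s) (All-rm a β bd) f (e - + gt a β - + i)
    where
    β' = rm a β
    ins : insertV a β' ≡ β
    ins = insertV-rm a β s m
    ca : cntV a β ≡ suc (cntV a β')
    ca = cong (cntV a) (sym ins) ∙ cntV-insertV a a β' ∙ cong (λ b → (if b then 1 else 0) ℕ.+ cntV a β') (≡ᵇ-refl a)
    co : ∀ s → s ≢ a → cntV s β ≡ cntV s β'
    co s ne = cong (cntV s) (sym ins) ∙ cntV-insertV s a β' ∙ cong (λ b → (if b then 1 else 0) ℕ.+ cntV s β') (≡ᵇ-false (ne ∘ sym))
    eq↔ : ∀ σ → eqN (insertV a σ) β ≡ eqN σ β'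
    eq↔ σ with eqN (insertV a σ) β in p | eqN σ β' in p'
    ... | true | true = refl
    ... | false | false = refl
    ... | true | false = sym (eqN-refl β') ∙ cong (λ t → eqN t β') (cong (rm a) (sym (eqN-true (insertV a σ) β p)) ∙ rm-insertV a σ) ∙ p'
    ... | false | true = sym p ∙ cong (λ t → eqN (insertV a t) β) (eqN-true σ β' p') ∙ cong (λ t → eqN t β) ins ∙ eqN-refl β
    gts : ∀ α → eqN (sortV α) β' ≡ true → gt a α ≡ gt a β
    gts α h = sym (gt-sortV a α) ∙ cong (gt a) (eqN-true (sortV α) β' h) ∙
      sym (cong (gt a) (sym ins) ∙ gt-insertV a a β' ∙ cong (λ b → (if b then 1 else 0) ℕ.+ gt a β') (<ᵇ-false {a} {a} ≤-refl))
    lem : ∀ e g v i → e - (g + v) - i ≡ (e - g - i) - v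
    lem = solve-∀
    step : ∀ α → eqN (insertV a (sortV α)) β ▸ vOp (range K) β f (e - + (gt a α ℕ.+ inv α)) ≡
           ∑ (range (cntV a β)) λ i → eqN (sortV α) β' ▸ vOp (range K) β' f (e - + gt a β - + i - + inv α)
    step α rewrite eq↔ (sortV α) = (▸-cong (eqN (sortV α) β') λ h →
        vOp-remove K β β' a a<K ca co f _ ∙ ∑-cong (range (cntV a β)) λ i → cong (vOp (range K) β' f)
          (cong (λ t → e - t - + i) (pos-+ (gt a α) (inv α) ∙ cong (λ t → + t + + inv α) (gts α h)) ∙ lem e (+ gt a β) (+ inv α) (+ i))) ∙
      sym (∑-▸ (range (cntV a β)) (eqN (sortV α) β') _)
  go : ∀ k → All (_< K) (range k) → ∑ (range k) (λ a → ∑ (boxV K N) λ α → eqN (insertV a (sortV α)) β ▸ vOp (range K) β f (e - + (gt a α ℕ.+ inv α))) ≡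
       ∑ (range k) λ a → q (cntV a β) (QF N f) (e - + gt a β)
  go k ps = ∑-congA ps inner

-- Polynomials as operators on coefficient series.

δ₀ : ∀ {N} → Ser N
δ₀ e ξ = (e == 0ℤ) ▸ isZ ξ ▸ 1ℤ

-- A polynomial acts on series by multiplication.
Op : ∀ {N} → Poly N → Ser N → Ser N
Op p φ e ξ = ∑ p λ t → proj₁ t * φ (e - + Vec.head (proj₂ t)) (ξ ⊝ Vec.tail (proj₂ t))

Op-cong : ∀ {N} (p : Poly N) {φ ψ : Ser N} → (∀ e ξ → φ e ξ ≡ ψ e ξ) → ∀ e ξ → Op p φ e ξ ≡ Op p ψ e ξ
Op-cong p h e ξ = ∑-cong p λ t → cong (proj₁ t *_) (h _ _)

Op-∔ : ∀ {N} (p r : Poly N) φ e ξ → Op (p ⊕ r) φ e ξ ≡ Op p φ e ξ + Op r φ e ξ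
Op-∔ p r φ e ξ = ∑-++ p r _

Op-neg : ∀ {N} (p : Poly N) φ e ξ → Op (negP p) φ e ξ ≡ - Op p φ e ξ
Op-neg p φ e ξ = ∑-map p _ _ ∙ (∑-cong p λ t → sym (ℤₚ.neg-distribˡ-* (proj₁ t) _)) ∙ ∑-neg p _

⊝-+ : ∀ {N} (ξ : Vec ℤ N) f g → ξ ⊝ Vec.zipWith ℕ._+_ f g ≡ (ξ ⊝ f) ⊝ g
⊝-+ [] [] [] = refl
⊝-+ (x ∷ ξ) (a ∷ f) (b ∷ g) = cong₂ _∷_ (cong (λ t → x - t) (pos-+ a b) ∙ minus-+ x (+ a) (+ b)) (⊝-+ ξ f g)

Op-⊗ : ∀ {N} (p r : Poly N) φ e ξ → Op (p ⊗ r) φ e ξ ≡ Op p (Op r φ) e ξ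
Op-⊗ p r φ e ξ = ∑-concatMap p _ _ ∙ ∑-cong p λ { (a , f₀ ∷ f) → trans (∑-map r _ _)
  ((∑-cong r λ { (c , g₀ ∷ g) → trans (ℤₚ.*-assoc a c _) (cong (λ t → a * (c * t)) (cong₂ φ
      (cong (λ t → e - t) (pos-+ f₀ g₀) ∙ minus-+ e (+ f₀) (+ g₀)) (⊝-+ ξ f g))) }) ∙ ∑-*ˡ r a _) }

⊝-comm : ∀ {N} (ξ : Vec ℤ N) f g → (ξ ⊝ f) ⊝ g ≡ (ξ ⊝ g) ⊝ f
⊝-comm [] [] [] = refl
⊝-comm (x ∷ ξ) (a ∷ f) (b ∷ g) = cong₂ _∷_ (minus-comm x (+ a) (+ b)) (⊝-comm ξ f g)

Op-comm : ∀ {N} (p r : Poly N) φ e ξ → Op p (Op r φ) e ξ ≡ Op r (Op p φ) e ξ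
Op-comm p r φ e ξ =
  (∑-cong p λ s → sym (∑-*ˡ r (proj₁ s) _)) ∙
    ∑-swap p r _ ∙ ∑-cong r λ t → (∑-cong p λ s → *-swap (proj₁ s) (proj₁ t) _ ∙
        cong (λ w → proj₁ t * (proj₁ s * w)) (cong₂ φ (minus-comm e (+ Vec.head (proj₂ s)) (+ Vec.head (proj₂ t))) (⊝-comm ξ _ _))) ∙ ∑-*ˡ p (proj₁ t) _

Op-∑ : ∀ {A : Set} {N} (p : Poly N) (xs : List A) (φ : A → Ser N) e ξ → Op p (λ e ξ → ∑ xs λ x → φ x e ξ) e ξ ≡ ∑ xs λ x → Op p (φ x) e ξ
Op-∑ p xs φ e ξ = (∑-cong p λ t → sym (∑-*ˡ xs (proj₁ t) _)) ∙ ∑-swap p xs _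

⊝-0 : ∀ {N} (ξ : Vec ℤ N) → ξ ⊝ Vec.replicate N 0 ≡ ξ
⊝-0 = ⊝-zeros

Op-one : ∀ {N} φ e (ξ : Vec ℤ N) → Op oneP φ e ξ ≡ φ e ξ
Op-one φ e ξ = +-identityʳ _ ∙ *-identityˡ _ ∙ cong₂ φ (+-identityʳ e) (⊝-0 ξ)

Op-prod : ∀ {N} (ps : List (Poly N)) φ e ξ → Op (prodP ps) φ e ξ ≡ List.foldr Op φ ps e ξ
Op-prod [] φ e ξ = Op-one φ e ξ
Op-prod (p ∷ ps) φ e ξ = Op-⊗ p (prodP ps) φ e ξ ∙ Op-cong p (Op-prod ps φ) e ξ

Op-sum : ∀ {A : Set} {N} (xs : List A) (g : A → Poly N) φ e ξ → Op (sumP (map g xs)) φ e ξ ≡ ∑ xs λ x → Op (g x) φ e ξ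
Op-sum [] g φ e ξ = refl
Op-sum (x ∷ xs) g φ e ξ = Op-∔ (g x) (sumP (map g xs)) φ e ξ ∙ +ˡ (Op (g x) φ e ξ) (Op-sum xs g φ e ξ)

Op-tPow : ∀ {N} k φ e (ξ : Vec ℤ N) → Op (tPow k) φ e ξ ≡ φ (e - + k) ξ
Op-tPow k φ e ξ = +-identityʳ _ ∙ *-identityˡ _ ∙ cong (φ (e - + k)) (⊝-0 ξ)

unitE : ∀ {N} → ℕ → Vec ℕ N
unitE i = Vec.tabulate λ j → if i ≡ᵇ toℕ j then 1 else 0

⊝-const0 : ∀ {N} (ξ : Vec ℤ N) (f : Fin N → ℕ) → (∀ j → f j ≡ 0) → ξ ⊝ Vec.tabulate f ≡ ξ
⊝-const0 [] f h = refl
⊝-const0 (x ∷ ξ) f h = cong₂ _∷_ (cong (λ t → x - + t) (h zero) ∙ +-identityʳ x) (⊝-const0 ξ (f ∘ suc) (h ∘ suc))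

⊝-unitE : ∀ {N} i (ξ : Vec ℤ N) → ξ ⊝ unitE i ≡ dec i ξ
⊝-unitE i [] = refl
⊝-unitE zero (x ∷ ξ) = cong (_ ∷_) (⊝-const0 ξ _ λ _ → refl)
⊝-unitE (suc i) (x ∷ ξ) = cong₂ _∷_ (+-identityʳ x) (⊝-unitE i ξ)

Op-xVar : ∀ {N} (i : Fin N) φ e ξ → Op (xVar i) φ e ξ ≡ φ e (dec (toℕ i) ξ)
Op-xVar i φ e ξ = +-identityʳ _ ∙ *-identityˡ _ ∙ cong₂ φ (+-identityʳ e) (⊝-unitE (toℕ i) ξ)

-- Multiplication by x_i - t^c x_j.
fac : ∀ {N} → ℤ → ℕ → ℕ → Ser N → Ser N
fac c i j φ e ξ = φ e (dec i ξ) - φ (e - c) (dec j ξ)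

fac-cong : ∀ {N} c i j {φ ψ : Ser N} → (∀ e ξ → φ e ξ ≡ ψ e ξ) → ∀ e ξ → fac c i j φ e ξ ≡ fac c i j ψ e ξ
fac-cong c i j h e ξ = cong₂ _-_ (h e _) (h _ _)

facs : ∀ {N} → ℤ → List (ℕ × ℕ) → Ser N → Ser N
facs c ps φ = List.foldr (λ p → fac c (proj₁ p) (proj₂ p)) φ ps

pairsℕ : ℕ → List (ℕ × ℕ)
pairsℕ zero = []
pairsℕ (suc n) = map (λ j → 0 , suc j) (List.tabulate {n = n} toℕ) ++ map (λ p → suc (proj₁ p) , suc (proj₂ p)) (pairsℕ n)

toℕ² : ∀ {N} → Fin N × Fin N → ℕ × ℕ
toℕ² p = toℕ (proj₁ p) , toℕ (proj₂ p)

module _ {A B : Set} where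
  concatMap-cong : (xs : List A) {f g : A → List B} → (∀ x → f x ≡ g x) → concatMap f xs ≡ concatMap g xs
  concatMap-cong [] h = refl
  concatMap-cong (x ∷ xs) h = cong₂ _++_ (h x) (concatMap-cong xs h)

  concatMap-[_] : (xs : List A) (f : A → B) → concatMap (λ x → f x ∷ []) xs ≡ map f xs
  concatMap-[ [] ] f = refl
  concatMap-[ x ∷ xs ] f = cong (f x ∷_) (concatMap-[ xs ] f)

  map-concatMap : {C : Set} (g : B → C) (f : A → List B) (xs : List A) → map g (concatMap f xs) ≡ concatMap (map g ∘ f) xs
  map-concatMap g f [] = refl
  map-concatMap g f (x ∷ xs) = Listₚ.map-++ g (f x) _ ∙ cong (map g (f x) ++_) (map-concatMap g f xs)

  concatMap-map : {C : Set} (f : B → List C) (g : A → B) (xs : List A) → concatMap f (map g xs) ≡ concatMap (f ∘ g) xs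
  concatMap-map f g [] = refl
  concatMap-map f g (x ∷ xs) = cong (f (g x) ++_) (concatMap-map f g xs)

allFin-suc : ∀ n → List.allFin (suc n) ≡ zero ∷ map suc (List.allFin n)
allFin-suc n = cong (zero ∷_) (sym (Listₚ.map-tabulate id suc))

pairsLt-suc : ∀ n → pairsLt (suc n) ≡ map (λ j → zero , suc j) (List.allFin n) ++ map (λ p → suc (proj₁ p) , suc (proj₂ p)) (pairsLt n)
pairsLt-suc n = cong (λ l → concatMap (λ i → concatMap (λ j → if toℕ i <ᵇ toℕ j then (i , j) ∷ [] else []) l) l) (allFin-suc n) ∙ cong₂ _++_ first rest
  where
  first : concatMap (λ j → if 0 <ᵇ toℕ j then (zero , j) ∷ [] else []) (map suc (List.allFin n)) ≡ map (λ j → zero , suc j) (List.allFin n)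
  first = concatMap-map _ suc (List.allFin n) ∙ concatMap-[ List.allFin n ] _
  rest : concatMap (λ i → concatMap (λ j → if toℕ i <ᵇ toℕ j then (i , j) ∷ [] else []) (zero ∷ map suc (List.allFin n))) (map suc (List.allFin n))
       ≡ map (λ p → suc (proj₁ p) , suc (proj₂ p)) (pairsLt n)
  rest = concatMap-map _ suc (List.allFin n) ∙ sym (map-concatMap _ _ (List.allFin n) ∙
    concatMap-cong (List.allFin n) λ i → map-concatMap _ _ (List.allFin n) ∙ sym (concatMap-map _ suc (List.allFin n) ∙
      concatMap-cong (List.allFin n) λ j → go i j))
    where
    go : ∀ (i j : Fin n) → (if toℕ i <ᵇ toℕ j then (Fin.suc i , Fin.suc j) ∷ [] else []) ≡ map (λ p → suc (proj₁ p) , suc (proj₂ p)) (if toℕ i <ᵇ toℕ j then (i , j) ∷ [] else [])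
    go i j with toℕ i <ᵇ toℕ j
    ... | true = refl
    ... | false = refl

pairs-toℕ : ∀ n → map toℕ² (pairsLt n) ≡ pairsℕ n
pairs-toℕ zero = refl
pairs-toℕ (suc n) = cong (map toℕ²) (pairsLt-suc n) ∙ Listₚ.map-++ toℕ² (map (λ j → zero , suc j) (List.allFin n)) _ ∙
  cong₂ _++_ (sym (Listₚ.map-∘ (List.allFin n)) ∙ Listₚ.map-∘ (List.allFin n) ∙ cong (map (λ j → 0 , suc j)) (Listₚ.map-tabulate id toℕ))
    (sym (Listₚ.map-∘ (pairsLt n)) ∙ Listₚ.map-∘ (pairsLt n) ∙ cong (map (λ p → suc (proj₁ p) , suc (proj₂ p))) (pairs-toℕ n))

Op-pairs : ∀ {N} c (g : Fin N × Fin N → Poly N) → (∀ p φ e ξ → Op (g p) φ e ξ ≡ fac c (toℕ (proj₁ p)) (toℕ (proj₂ p)) φ e ξ) →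
           ∀ ps φ e ξ → Op (prodP (map g ps)) φ e ξ ≡ facs c (map toℕ² ps) φ e ξ
Op-pairs c g h [] φ e ξ = Op-one φ e ξ
Op-pairs c g h (p ∷ ps) φ e ξ = Op-⊗ (g p) (prodP (map g ps)) φ e ξ ∙ h p (Op (prodP (map g ps)) φ) e ξ ∙ fac-cong c (toℕ (proj₁ p)) (toℕ (proj₂ p)) (Op-pairs c g h ps φ) e ξ

facs-++ : ∀ {N} c ps qs (φ : Ser N) e ξ → facs c (ps ++ qs) φ e ξ ≡ facs c ps (facs c qs φ) e ξ
facs-++ c [] qs φ e ξ = refl
facs-++ c (p ∷ ps) qs φ e ξ = fac-cong c _ _ (facs-++ c ps qs φ) e ξ

facs-cong : ∀ {N} c ps {φ ψ : Ser N} → (∀ e ξ → φ e ξ ≡ ψ e ξ) → ∀ e ξ → facs c ps φ e ξ ≡ facs c ps ψ e ξ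
facs-cong c [] h e ξ = h e ξ
facs-cong c (p ∷ ps) h e ξ = fac-cong c _ _ (facs-cong c ps h) e ξ

facs-tail : ∀ {N} c ps (φ : Ser (suc N)) e x ξ → facs c (map (λ p → suc (proj₁ p) , suc (proj₂ p)) ps) φ e (x ∷ ξ) ≡ facs c ps (λ e ξ → φ e (x ∷ ξ)) e ξ
facs-tail c [] φ e x ξ = refl
facs-tail c (p ∷ ps) φ e x ξ = cong₂ _-_ (facs-tail c ps φ e x _) (facs-tail c ps φ _ x _)

-- Expansion of the factors that involve the first variable: `S` collects the other variables whose
-- term, with its factor t^c, is chosen instead of the first variable.
facs-row : ∀ n c (φ : Ser (suc n)) e x γ → facs c (map (λ j → 0 , suc j) (List.tabulate {n = n} toℕ)) φ e (x ∷ γ) ≡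
           ∑ (bits n) λ S → sg (size S) * φ (e - + size S * c) ((x - (+ n - + size S)) ∷ (γ ⊖ S))
facs-row zero c φ e x [] = cong₂ (λ a b → φ a (b ∷ [])) (lem₁ e c) (sym (+-identityʳ x)) ∙ 1*+0 (φ (e - 0ℤ * c) ((x - 0ℤ) ∷ []))
  where
  lem₁ : ∀ e c → e ≡ e - 0ℤ * c
  lem₁ = solve-∀
facs-row (suc n) c φ e x (g ∷ γ) = cong₂ _-_ (step e (x - 1ℤ) g) (step (e - c) x (g - 1ℤ)) ∙
  sym (∑-bits n _ ∙ ℤₚ.+-comm (∑ (bits n) λ S → sg (suc (size S)) * φ (e - + suc (size S) * c) ((x - (+ suc n - + suc (size S))) ∷ ((g ∷ γ) ⊖ (true ∷ S)))) _ ∙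
    cong₂ _+_ (∑-cong (bits n) λ S → cong (sg (size S) *_) (cong₂ (λ a b → φ (e - + size S * c) (a ∷ b ∷ (γ ⊖ S))) (lem₁ x (+ n) (+ size S)) (+-identityʳ g)))
      ((∑-cong (bits n) λ S → neg-* (sg (size S)) _ ∙ cong (λ t → - (sg (size S) * t)) (cong₂ (λ a b → φ a (b ∷ (g - 1ℤ) ∷ (γ ⊖ S))) (lem₂ e c (+ size S)) (lem₃ x (+ n) (+ size S)))) ∙
        ∑-neg (bits n) _))
  where
  lem₁ : ∀ x n s → x - ((1ℤ + n) - s) ≡ (x - 1ℤ) - (n - s)
  lem₁ = solve-∀
  lem₂ : ∀ e c s → e - (1ℤ + s) * c ≡ (e - c) - s * c
  lem₂ = solve-∀
  lem₃ : ∀ x n s → x - ((1ℤ + n) - (1ℤ + s)) ≡ x - (n - s)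
  lem₃ = solve-∀
  shift : ∀ (ps : List ℕ) (φ : Ser (suc (suc n))) e x g γ → facs c (map (λ j → 0 , suc j) (map suc ps)) φ e (x ∷ g ∷ γ) ≡
          facs c (map (λ j → 0 , suc j) ps) (λ e ξ → φ e (Vec.head ξ ∷ g ∷ Vec.tail ξ)) e (x ∷ γ)
  shift [] φ e x g γ = refl
  shift (p ∷ ps) φ e x g γ = cong₂ _-_ (shift ps φ e _ g γ) (shift ps φ _ x g _)
  step : ∀ e x g → facs c (map (λ j → 0 , suc j) (List.tabulate {n = n} (toℕ ∘ suc))) φ e (x ∷ g ∷ γ) ≡
         ∑ (bits n) λ S → sg (size S) * φ (e - + size S * c) ((x - (+ n - + size S)) ∷ g ∷ (γ ⊖ S))
  step e x g = cong (λ l → facs c (map (λ j → 0 , suc j) l) φ e (x ∷ g ∷ γ)) (sym (Listₚ.map-tabulate {n = n} toℕ suc)) ∙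
    shift (List.tabulate {n = n} toℕ) φ e x g γ ∙ facs-row n c (λ e ξ → φ e (Vec.head ξ ∷ g ∷ Vec.tail ξ)) e x γ

δ₀-∷ : ∀ {N} e x (ξ : Vec ℤ N) → δ₀ e (x ∷ ξ) ≡ (x == 0ℤ) ▸ δ₀ e ξ
δ₀-∷ e x ξ = cong ((e == 0ℤ) ▸_) (▸-∧ (x == 0ℤ) (isZ ξ) 1ℤ) ∙ ▸-comm (e == 0ℤ) (x == 0ℤ) _

facs-▸ : ∀ {N} c ps b (φ : Ser N) e ξ → facs c ps (λ e ξ → b ▸ φ e ξ) e ξ ≡ b ▸ facs c ps φ e ξ
facs-▸ c ps true φ e ξ = refl
facs-▸ c ps false φ e ξ = go ps e ξ
  where
  go : ∀ ps e ξ → facs c ps (λ _ _ → 0ℤ) e ξ ≡ 0ℤ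
  go [] e ξ = refl
  go (p ∷ ps) e ξ = cong₂ _-_ (go ps e _) (go ps _ _)

-- Serves both products over pairs: c = 1 for the Hall-Littlewood product `Dt`, c = 0 for the
-- Vandermonde product `Dv`.
facs-pairs : ∀ n c (D : ∀ {n} → Ser n) → (∀ e → D e [] ≡ δ₀ e []) →
             (∀ {n} e x γ → D {suc n} e (x ∷ γ) ≡ ∑ (bits n) λ S → (x == + n - + size S) ▸ (sg (size S) * D (e - + size S * c) (γ ⊖ S))) →
             ∀ e ξ → facs c (pairsℕ n) δ₀ e ξ ≡ D {n} e ξ
facs-pairs zero c D h₀ h e [] = sym (h₀ e)
facs-pairs (suc n) c D h₀ h e (x ∷ γ) =
  facs-++ c (map (λ j → 0 , suc j) (List.tabulate {n = n} toℕ)) _ δ₀ e (x ∷ γ) ∙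
    facs-cong c (map (λ j → 0 , suc j) (List.tabulate {n = n} toℕ)) inner e (x ∷ γ) ∙
      facs-row n c _ e x γ ∙ (∑-cong (bits n) λ S → cong (sg (size S) *_) (cong (_▸ D (e - + size S * c) (γ ⊖ S)) (sub-==0 x (+ n - + size S))) ∙
          sym (▸-* (x == + n - + size S) (sg (size S)) _)) ∙ sym (h e x γ)
  where
  inner : ∀ e ξ → facs c (map (λ p → suc (proj₁ p) , suc (proj₂ p)) (pairsℕ n)) δ₀ e ξ ≡ (Vec.head ξ == 0ℤ) ▸ D e (Vec.tail ξ)
  inner e (x ∷ ξ) = facs-tail c (pairsℕ n) δ₀ e x ξ ∙ facs-cong c (pairsℕ n) (λ e ξ → δ₀-∷ e x ξ) e ξ ∙
    facs-▸ c (pairsℕ n) (x == 0ℤ) δ₀ e ξ ∙ cong ((x == 0ℤ) ▸_) (facs-pairs n c D h₀ h e ξ)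

Op-hlProd : ∀ N (g : Fin N × Fin N → Poly N) → (∀ p → g p ≡ xVar (proj₁ p) ⊕ negP (tPow 1 ⊗ xVar (proj₂ p))) →
            ∀ e (ξ : Vec ℤ N) → Op (prodP (map g (pairsLt N))) δ₀ e ξ ≡ Dt e ξ
Op-hlProd N g g≡ e ξ = Op-pairs 1ℤ g one (pairsLt N) δ₀ e ξ ∙ cong (λ l → facs 1ℤ l δ₀ e ξ) (pairs-toℕ N) ∙
  facs-pairs N 1ℤ Dt (λ e → refl) (λ {n} e x γ → ∑-cong (bits n) λ S → cong (λ t → (x == + n - + size S) ▸ (sg (size S) * Dt (e - t) (γ ⊖ S))) (sym (*-identityʳ (+ size S)))) e ξ
  where
  one : ∀ p φ e ξ → Op (g p) φ e ξ ≡ fac 1ℤ (toℕ (proj₁ p)) (toℕ (proj₂ p)) φ e ξ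
  one p@(i , j) φ e ξ = cong (λ t → Op t φ e ξ) (g≡ p) ∙ Op-∔ (xVar i) (negP (tPow 1 ⊗ xVar j)) φ e ξ ∙ cong₂ _+_ (Op-xVar i φ e ξ) (Op-neg (tPow 1 ⊗ xVar j) φ e ξ ∙ cong -_
    (Op-⊗ (tPow 1) (xVar j) φ e ξ ∙ Op-tPow 1 (Op (xVar j) φ) e ξ ∙ Op-xVar j φ (e - 1ℤ) ξ))

Op-aDelta : ∀ N e (ξ : Vec ℤ N) → Op (aDelta N) δ₀ e ξ ≡ unit e * Dv ξ
Op-aDelta N e ξ = Op-pairs 0ℤ _ one (pairsLt N) δ₀ e ξ ∙ cong (λ l → facs 0ℤ l δ₀ e ξ) (pairs-toℕ N) ∙
  facs-pairs N 0ℤ (λ e ξ → unit e * Dv ξ) (λ e → *-identityʳ (unit e))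
    (λ {n} e x γ → sym (∑-*ˡ (bits n) (unit e) _) ∙ ∑-cong (bits n) λ S → sym (▸-* (x == + n - + size S) (unit e) _) ∙
       cong ((x == + n - + size S) ▸_) (*-swap (unit e) (sg (size S)) (Dv (γ ⊖ S)) ∙ cong (λ t → sg (size S) * (unit t * Dv (γ ⊖ S))) (lem e (+ size S)))) e ξ
  where
  lem : ∀ e s → e ≡ e - s * 0ℤ
  lem = solve-∀
  one : ∀ p φ e ξ → Op (xVar (proj₁ p) ⊕ negP (xVar (proj₂ p))) φ e ξ ≡ fac 0ℤ (toℕ (proj₁ p)) (toℕ (proj₂ p)) φ e ξ
  one (i , j) φ e ξ = Op-∔ (xVar i) (negP (xVar j)) φ e ξ ∙ cong₂ _+_ (Op-xVar i φ e ξ) (Op-neg (xVar j) φ e ξ ∙ cong -_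
    (Op-xVar j φ e ξ ∙ cong (λ t → φ t (dec (toℕ j) ξ)) (sym (+-identityʳ e))))

isZ-⊝ : ∀ {N} (ξ : Vec ℤ N) f → isZ (ξ ⊝ f) ≡ true → ξ ≡ +ᵛ f
isZ-⊝ [] [] h = refl
isZ-⊝ (x ∷ ξ) (a ∷ f) h with (x - + a) ℤₚ.≟ 0ℤ
... | yes p = cong₂ _∷_ (i-j≡0⇒i≡j x (+ a) p) (isZ-⊝ ξ f h)

+ᵛ-injective : ∀ {N} (f g : Vec ℕ N) → +ᵛ f ≡ +ᵛ g → f ≡ g
+ᵛ-injective [] [] h = refl
+ᵛ-injective (a ∷ f) (b ∷ g) h = cong₂ _∷_ (+-injective (Vecₚ.∷-injectiveˡ h)) (+ᵛ-injective f g (Vecₚ.∷-injectiveʳ h))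

δ₀-off : ∀ {N} e (ξ : Vec ℤ N) (g : Vec ℕ (suc N)) → ¬ (e ≡ + Vec.head g × ξ ≡ +ᵛ (Vec.tail g)) → δ₀ (e - + Vec.head g) (ξ ⊝ Vec.tail g) ≡ 0ℤ
δ₀-off e ξ (g₀ ∷ g) h with (e - + g₀) ℤₚ.≟ 0ℤ | isZ (ξ ⊝ g) in z
... | no _ | _ = refl
... | yes p | false = refl
... | yes p | true = ⊥-elim (h (i-j≡0⇒i≡j e (+ g₀) p , isZ-⊝ ξ g z))

isZ-self : ∀ {N} (ns : Vec ℕ N) → isZ (+ᵛ ns ⊝ ns) ≡ true
isZ-self [] = refl
isZ-self (a ∷ ns) rewrite +-inverseʳ (+ a) = isZ-self ns

δ₀-on : ∀ {N} n (ns : Vec ℕ N) → δ₀ (+ n - + n) (+ᵛ ns ⊝ ns) ≡ 1ℤ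
δ₀-on n ns rewrite +-inverseʳ (+ n) | isZ-self ns = refl

-- `δ₀` is the series of the constant 1, so a polynomial is recovered from its action on it.
coeff-Op : ∀ {N} (p : Poly N) n (ns : Vec ℕ N) → coeff p (n ∷ ns) ≡ Op p δ₀ (+ n) (+ᵛ ns)
coeff-Op [] n ns = refl
coeff-Op ((a , g₀ ∷ g) ∷ p) n ns with Vecₚ.≡-dec ℕ._≟_ (g₀ ∷ g) (n ∷ ns)
... | yes refl = cong₂ _+_ (sym (cong (a *_) (δ₀-on n ns) ∙ *-identityʳ a)) (coeff-Op p n ns)
... | no ne = coeff-Op p n ns ∙ sym (cong (λ t → a * t + Op p δ₀ (+ n) (+ᵛ ns))
    (δ₀-off (+ n) (+ᵛ ns) (g₀ ∷ g) λ { (h , h') → ne (sym (cong₂ _∷_ (+-injective h) (+ᵛ-injective ns g h'))) }) ∙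
    cong (_+ Op p δ₀ (+ n) (+ᵛ ns)) (*-zeroʳ a) ∙ +-identityˡ _)

nonneg? : ∀ {N} (ξ : Vec ℤ N) → (∃ λ ns → ξ ≡ +ᵛ ns) ⊎ (∀ f → ξ ≢ +ᵛ f)
nonneg? [] = inj₁ ([] , refl)
nonneg? (-[1+ k ] ∷ ξ) = inj₂ λ { (a ∷ f) h → case Vecₚ.∷-injectiveˡ h of λ () }
nonneg? (+ x ∷ ξ) with nonneg? ξ
... | inj₁ (ns , h) = inj₁ (x ∷ ns , cong (+ x ∷_) h)
... | inj₂ h = inj₂ λ { (a ∷ f) h' → h f (Vecₚ.∷-injectiveʳ h') }

Op-off : ∀ {N} (p : Poly N) e ξ → (∀ g → ¬ (e ≡ + Vec.head g × ξ ≡ +ᵛ (Vec.tail g))) → Op p δ₀ e ξ ≡ 0ℤ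
Op-off p e ξ h = ∑-zero p λ t → trans (cong (proj₁ t *_) (δ₀-off e ξ (proj₂ t) (h (proj₂ t)))) (*-zeroʳ (proj₁ t))

Op-neg-exponent : ∀ {N} (p : Poly N) k ξ → Op p δ₀ -[1+ k ] ξ ≡ 0ℤ
Op-neg-exponent p k ξ = Op-off p -[1+ k ] ξ λ { g (() , _) }

-- Coefficients are compared at natural exponents only; at all other integer exponents both series
-- are 0.
Op-≈ : ∀ {N} {p r : Poly N} → p ≈P r → ∀ e ξ → Op p δ₀ e ξ ≡ Op r δ₀ e ξ
Op-≈ {p = p} {r} h -[1+ k ] ξ = Op-neg-exponent p k ξ ∙ sym (Op-neg-exponent r k ξ)
Op-≈ {p = p} {r} h (+ n) ξ with nonneg? ξ
... | inj₁ (ns , refl) = sym (coeff-Op p n ns) ∙ h (n ∷ ns) ∙ coeff-Op r n ns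
... | inj₂ ne = (Op-off p (+ n) ξ λ g z → ne (Vec.tail g) (proj₂ z)) ∙ sym (Op-off r (+ n) ξ λ g z → ne (Vec.tail g) (proj₂ z))

count-∑ : ∀ {A : Set} (p : A → Bool) xs → + countᵇ p xs ≡ ∑ xs λ x → p x ▸ 1ℤ
count-∑ p [] = refl
count-∑ p (x ∷ xs) with p x
... | true = +ˡ 1ℤ (count-∑ p xs)
... | false = count-∑ p xs ∙ sym (+-identityˡ _)

-- Antisymmetrization over the list of permutations.

sg-+ : ∀ a b → sg (a ℕ.+ b) ≡ sg a * sg b
sg-+ zero b = sym (*-identityˡ (sg b))
sg-+ (suc a) b = cong -_ (sg-+ a b) ∙ ℤₚ.neg-distribˡ-* (sg a) (sg b)

sg-isEven : ∀ k → (if isEven k then + 1 else - (+ 1)) ≡ sg k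
sg-isEven zero = refl
sg-isEven (suc k) with isEven k | sg-isEven k
... | true | h = cong -_ h
... | false | h = cong -_ h

All-concatMap : ∀ {A B : Set} {P : B → Set} {Q : A → Set} {f : A → List B} → (∀ a → Q a → All P (f a)) → ∀ {xs} → All Q xs → All P (concatMap f xs)
All-concatMap h [] = []
All-concatMap h (p ∷ ps) = All-++⁺ (h _ p) (All-concatMap h ps)

module _ {M : ℕ} where

  less : ∀ {k} → Fin M → Vec (Fin M) k → ℕ
  less x [] = 0
  less x (y ∷ w) = (if toℕ y <ᵇ toℕ x then 1 else 0) ℕ.+ less x w

  invF : ∀ {k} → Vec (Fin M) k → ℕ
  invF [] = 0
  invF (x ∷ w) = less x w ℕ.+ invF w

  invF-∑ : ∀ {k} (σ : Vec (Fin M) k) → ∑ (pairsLt k) (λ p → (toℕ (Vec.lookup σ (proj₂ p)) <ᵇ toℕ (Vec.lookup σ (proj₁ p))) ▸ 1ℤ) ≡ + invF σ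
  invF-∑ [] = refl
  invF-∑ {suc k} (x ∷ w) = cong (λ l → ∑ l f) (pairsLt-suc k) ∙
    ∑-++ (map (λ j → zero , suc j) (List.allFin k)) _ f ∙
      cong₂ _+_ (∑-map (List.allFin k) (λ j → zero , suc j) f ∙ less-∑ w) (∑-map (pairsLt k) _ f ∙ invF-∑ w) ∙ sym (pos-+ (less x w) (invF w))
    where
    f : Fin (suc k) × Fin (suc k) → ℤ
    f p = (toℕ (Vec.lookup (x ∷ w) (proj₂ p)) <ᵇ toℕ (Vec.lookup (x ∷ w) (proj₁ p))) ▸ 1ℤ
    less-∑ : ∀ {k} (w : Vec (Fin M) k) → ∑ (List.allFin k) (λ j → (toℕ (Vec.lookup w j) <ᵇ toℕ x) ▸ 1ℤ) ≡ + less x w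
    less-∑ [] = refl
    less-∑ {suc k} (y ∷ w) = cong (λ l → ∑ l (λ j → (toℕ (Vec.lookup (y ∷ w) j) <ᵇ toℕ x) ▸ 1ℤ)) (allFin-suc k) ∙
      cong₂ _+_ (b2 (toℕ y <ᵇ toℕ x)) (∑-map (List.allFin k) suc _ ∙ less-∑ w) ∙ sym (pos-+ (if toℕ y <ᵇ toℕ x then 1 else 0) (less x w))
      where
      b2 : ∀ b → b ▸ 1ℤ ≡ + (if b then 1 else 0)
      b2 true = refl
      b2 false = refl

  Below : ∀ {k} → Fin M → Vec (Fin M) k → Set
  Below x [] = ⊤
  Below x (y ∷ w) = toℕ x < toℕ y × Below x w

  Inc : ∀ {k} → Vec (Fin M) k → Set
  Inc [] = ⊤
  Inc (x ∷ w) = Below x w × Inc w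

  less-Below : ∀ {k} x (w : Vec (Fin M) k) → Below x w → less x w ≡ 0
  less-Below x [] b = refl
  less-Below x (y ∷ w) (l , b) rewrite <ᵇ-false (<⇒≤ l) = less-Below x w b

  less-insAll : ∀ {k} x y (w : Vec (Fin M) k) → toℕ x < toℕ y → All (λ u → less y u ≡ suc (less y w)) (insAll x w)
  less-insAll x y [] l = cong (λ b → (if b then 1 else 0) ℕ.+ 0) (<ᵇ-true l) ∷ []
  less-insAll x y (z ∷ w) l = cong (λ b → (if b then 1 else 0) ℕ.+ less y (z ∷ w)) (<ᵇ-true l) ∷
    All-map⁺ _ (All.map (λ h → cong ((if toℕ z <ᵇ toℕ y then 1 else 0) ℕ.+_) h ∙ ℕₚ.+-suc _ _) (less-insAll x y w l))

  Below-insAll : ∀ {k} z x (w : Vec (Fin M) k) → toℕ z < toℕ x → Below z w → All (Below z) (insAll x w)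
  Below-insAll z x [] l b = (l , tt) ∷ []
  Below-insAll z x (y ∷ w) l (l' , b) = (l , l' , b) ∷ All-map⁺ _ (All.map (l' ,_) (Below-insAll z x w l b))

  Below-perms : ∀ {k} z (w : Vec (Fin M) k) → Below z w → All (Below z) (perms w)
  Below-perms z [] b = tt ∷ []
  Below-perms z (x ∷ w) (l , b) = All-concatMap (λ u → Below-insAll z x u l) (Below-perms z w b)

  module _ (c : Fin M → ℤ) where

    -- The inserted letter is smaller than all others, so each entry in front of it is one
    -- inversion; the insertions therefore carry the alternating signs of `pickSum`.
    ∑-insAll : ∀ {k} x (w : Vec (Fin M) k) → Below x w → ∀ ξ →
               ∑ (insAll x w) (λ u → sg (invF u) * ind (Vec.map c u) ξ) ≡ sg (invF w) * pickSum (λ y r → (y == c x) ▸ ind (Vec.map c w) r) ξ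
    ∑-insAll x [] b (a ∷ []) = +-identityʳ _ ∙ cong (1ℤ *_) (ind-∷ (c x) [] a [])
    ∑-insAll x (y ∷ w) (l , b) (a ∷ a' ∷ ξ) = cong₂ _+_ head tail ∙ lem (sg (invF (y ∷ w))) ((a == c x) ▸ ind (Vec.map c (y ∷ w)) (a' ∷ ξ)) _
      where
      lem : ∀ s p r → s * p + - (s * r) ≡ s * (p - r)
      lem = solve-∀
      head : sg (invF (x ∷ y ∷ w)) * ind (Vec.map c (x ∷ y ∷ w)) (a ∷ a' ∷ ξ) ≡ sg (invF (y ∷ w)) * ((a == c x) ▸ ind (Vec.map c (y ∷ w)) (a' ∷ ξ))
      head = cong₂ (λ s t → sg (s ℕ.+ invF (y ∷ w)) * t) (less-Below x (y ∷ w) (l , b)) (ind-∷ (c x) (Vec.map c (y ∷ w)) a (a' ∷ ξ))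
      tail : ∑ (map (y ∷_) (insAll x w)) (λ u → sg (invF u) * ind (Vec.map c u) (a ∷ a' ∷ ξ)) ≡
             - (sg (invF (y ∷ w)) * pickSum (λ z r → (z == c x) ▸ ind (Vec.map c (y ∷ w)) (a ∷ r)) (a' ∷ ξ))
      tail = ∑-map (insAll x w) (y ∷_) _ ∙
        (∑-congA (less-insAll x y w l) λ u h → cong₂ _*_ (cong (λ t → sg (t ℕ.+ invF u)) h ∙ cong -_ (sg-+ (less y w) (invF u))) (ind-∷ (c y) (Vec.map c u) a (a' ∷ ξ)) ∙
            cong (- (sg (less y w) * sg (invF u)) *_) (▸-1 (a == c y) _) ∙ shuf (sg (less y w)) (sg (invF u)) ((a == c y) ▸ 1ℤ) (ind (Vec.map c u) (a' ∷ ξ))) ∙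
        ∑-*ˡ (insAll x w) (- (sg (less y w) * ((a == c y) ▸ 1ℤ))) _ ∙
        cong (- (sg (less y w) * ((a == c y) ▸ 1ℤ)) *_) (∑-insAll x w b (a' ∷ ξ)) ∙
        shuf₂ (sg (less y w)) ((a == c y) ▸ 1ℤ) (sg (invF w)) _ ∙
          cong -_ (cong₂ _*_ (sym (sg-+ (less y w) (invF w)))
            (sym (▸-1 (a == c y) _) ∙ sym (pickSum-▸ (a == c y) _ (a' ∷ ξ)) ∙ pickSum-cong (a' ∷ ξ) λ z r →
               ▸-comm (a == c y) (z == c x) _ ∙ cong ((z == c x) ▸_) (sym (ind-∷ (c y) (Vec.map c w) a r)))) 
        where
        ▸-1 : ∀ b z → b ▸ z ≡ (b ▸ 1ℤ) * z
        ▸-1 true z = sym (*-identityˡ z)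
        ▸-1 false z = refl
        shuf : ∀ p s t r → (- (p * s)) * (t * r) ≡ (- (p * t)) * (s * r)
        shuf = solve-∀
        shuf₂ : ∀ p t s r → (- (p * t)) * (s * r) ≡ - ((p * s) * (t * r))
        shuf₂ = solve-∀

    ∑-perms : ∀ {k} (v : Vec (Fin M) k) → Inc v → ∀ ξ → ∑ (perms v) (λ σ → sg (invF σ) * ind (Vec.map c σ) ξ) ≡ aind (Vec.map c v) ξ
    ∑-perms [] inc [] = refl
    ∑-perms (x ∷ v) (b , inc) ξ = ∑-concatMap (perms v) (insAll x) _ ∙
      (∑-congA (Below-perms x v b) λ w b' → ∑-insAll x w b' ξ ∙ sym (pickSum-* (sg (invF w)) _ ξ)) ∙
        sym (pickSum-∑ (perms v) (λ w y r → sg (invF w) * ((y == c x) ▸ ind (Vec.map c w) r)) ξ) ∙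
          (pickSum-cong ξ λ y r → (∑-cong (perms v) λ w → sym (▸-* (y == c x) (sg (invF w)) _)) ∙ ∑-▸ (perms v) (y == c x) _ ∙ cong ((y == c x) ▸_) (∑-perms v inc r)) ∙
            sym (aind-∷ (c x) (Vec.map c v) ξ)

sgn-sg : ∀ {N} (σ : Vec (Fin N) N) → sgn σ ≡ sg (invF σ)
sgn-sg {N} σ = sg-isEven (countᵇ _ (pairsLt N)) ∙ cong sg (+-injective (count-∑ _ (pairsLt N) ∙ invF-∑ σ))

Inc-allFin : ∀ N → Inc (Vec.allFin N)
Inc-allFin N = go id λ i j l → l
  where
  Below-tab : ∀ {M k} (x : Fin M) (f : Fin k → Fin M) → (∀ i → toℕ x < toℕ (f i)) → Below x (Vec.tabulate f)
  Below-tab {k = zero} x f h = tt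
  Below-tab {k = suc k} x f h = h zero , Below-tab x (f ∘ suc) (h ∘ suc)
  go : ∀ {M k} (f : Fin k → Fin M) → (∀ i j → toℕ i < toℕ j → toℕ (f i) < toℕ (f j)) → Inc (Vec.tabulate f)
  go {k = zero} f h = tt
  go {k = suc k} f h = Below-tab (f zero) (f ∘ suc) (λ i → h zero (suc i) (s≤s z≤n)) , go (f ∘ suc) λ i j l → h (suc i) (suc j) (s≤s l)

δ₀-ind : ∀ {N} e (γ : Vec ℤ N) f → δ₀ e (γ ⊝ f) ≡ (e == 0ℤ) ▸ ind (+ᵛ f) γ
δ₀-ind e γ f = cong (λ t → (e == 0ℤ) ▸ isZ t ▸ 1ℤ) (go γ f)
  where
  go : ∀ {N} (γ : Vec ℤ N) f → γ ⊝ f ≡ γ -ᵛ +ᵛ f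
  go [] [] = refl
  go (c ∷ γ) (a ∷ f) = cong (_ ∷_) (go γ f)

Op-antisym : ∀ N (p : Poly N) e ξ → Op (antisym N p) δ₀ e ξ ≡ alt (Op p δ₀ e) ξ
Op-antisym N p e ξ = ∑-concatMap (symGroup N) _ _ ∙
  (∑-cong (symGroup N) λ σ → ∑-map p _ _ ∙ ∑-cong p {g = term σ} λ { (a , f₀ ∷ f) → one σ a f₀ f }) ∙
    ∑-swap (symGroup N) p term ∙ (∑-cong p {g = λ t → alt (λ γ → proj₁ t * δ₀ (e - + Vec.head (proj₂ t)) (γ ⊝ Vec.tail (proj₂ t))) ξ} λ { (a , f₀ ∷ f) → two a f₀ f }) ∙
      sym (alt-∑ p (λ t γ → proj₁ t * δ₀ (e - + Vec.head (proj₂ t)) (γ ⊝ Vec.tail (proj₂ t))) ξ)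
  where
  term : Vec (Fin N) N → ℤ × Exp N → ℤ
  term σ t = proj₁ t * ((e - + Vec.head (proj₂ t) == 0ℤ) ▸ (sg (invF σ) * ind (Vec.map (λ i → + Vec.lookup (Vec.tail (proj₂ t)) i) σ) ξ))
  act : ∀ σ (f : Vec ℕ N) → +ᵛ (Vec.tabulate λ j → Vec.lookup f (Vec.lookup σ j)) ≡ Vec.map (λ i → + Vec.lookup f i) σ
  act σ f = cong +ᵛ (Vecₚ.tabulate-∘ (Vec.lookup f) (Vec.lookup σ) ∙ cong (Vec.map (Vec.lookup f)) (Vecₚ.tabulate∘lookup σ)) ∙ sym (Vecₚ.map-∘ _ _ σ)
  one : ∀ σ a f₀ f → (sgn σ * a) * δ₀ (e - + f₀) (ξ ⊝ Vec.tabulate λ j → Vec.lookup f (Vec.lookup σ j)) ≡ term σ (a , f₀ ∷ f)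
  one σ a f₀ f = cong₂ (λ s t → (s * a) * t) (sgn-sg σ) (δ₀-ind (e - + f₀) ξ _ ∙ cong (λ t → (e - + f₀ == 0ℤ) ▸ ind t ξ) (act σ f)) ∙
    shuf (sg (invF σ)) a _ ∙ cong (a *_) (sym (▸-* (e - + f₀ == 0ℤ) (sg (invF σ)) _))
    where
    shuf : ∀ s a t → (s * a) * t ≡ a * (s * t)
    shuf = solve-∀
  two : ∀ a f₀ f → ∑ (symGroup N) (λ σ → term σ (a , f₀ ∷ f)) ≡ alt (λ γ → a * δ₀ (e - + f₀) (γ ⊝ f)) ξ
  two a f₀ f = ∑-*ˡ (symGroup N) a _ ∙ cong (a *_) (∑-▸ (symGroup N) (e - + f₀ == 0ℤ) _ ∙ cong ((e - + f₀ == 0ℤ) ▸_)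
      (∑-perms (λ i → + Vec.lookup f i) (Vec.allFin N) (Inc-allFin N) ξ ∙ cong (λ t → aind t ξ) (Vecₚ.map-∘ (λ a → + a) (Vec.lookup f) (Vec.allFin N) ∙ cong +ᵛ (Vecₚ.map-lookup-allFin f))) ∙
        sym (alt-▸ (e - + f₀ == 0ℤ) (ind (+ᵛ f)) ξ) ∙ alt-cong ξ λ γ → sym (δ₀-ind (e - + f₀) γ f)) ∙ sym (alt-* a _ ξ)

padV : ∀ N → List ℕ → Vec ℕ N
padV N α = Vec.tabulate λ j → nthD 0 α (toℕ j)

Op-hlNum : ∀ N ν e (ξ : Vec ℤ N) → Op (hlNum N ν) δ₀ e ξ ≡ R (padV N ν) e ξ
Op-hlNum N ν e ξ = Op-antisym N _ e ξ ∙ alt-cong ξ λ γ → Op-⊗ (xMono ν) (prodP (map _ (pairsLt N))) δ₀ e γ ∙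
  +-identityʳ _ ∙ *-identityˡ _ ∙ Op-hlProd N _ (λ { (i , j) → refl }) (e - 0ℤ) (γ ⊝ padV N ν) ∙ cong (λ t → Dt t (γ ⊝ padV N ν)) (+-identityʳ e)

∑-applyUpTo : ∀ {A : Set} k (g : ℕ → A) (f : A → ℤ) → ∑ (List.applyUpTo g k) f ≡ ∑ (range k) (f ∘ g)
∑-applyUpTo zero g f = refl
∑-applyUpTo (suc k) g f = +ˡ (f (g 0)) (∑-applyUpTo k (g ∘ suc) f) ∙ sym (∑-range-bot k (f ∘ g))

QF-comm : ∀ a b f e → QF a (QF b f) e ≡ QF b (QF a f) e
QF-comm zero b f e = refl
QF-comm (suc a) b f e = q-cong (suc a) (QF-comm a b f) e ∙ q-QF (suc a) b (QF a f) e

upTo-snoc : ∀ k → upTo (suc k) ≡ upTo k ++ k ∷ []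
upTo-snoc k = sym (Listₚ.applyUpTo-∷ʳ id k)

Op-vm : ∀ {N} m (φ : Ser N) e ξ → Op (vm m) φ e ξ ≡ QF m (λ k → φ k ξ) e
Op-vm {N} m φ e ξ = Op-prod (map qInt (from1 m)) φ e ξ ∙ fold (from1 m) e ∙ QF-fold m e
  where
  Q : List ℕ → ℤ → ℤ
  Q l = List.foldr q (λ k → φ k ξ) l
  Op-qInt : ∀ j (ψ : Ser N) e ξ → Op (qInt j) ψ e ξ ≡ q j (λ k → ψ k ξ) e
  Op-qInt j ψ e ξ = Op-sum (upTo j) tPow ψ e ξ ∙ (∑-cong (upTo j) λ i → Op-tPow i ψ e ξ) ∙ ∑-applyUpTo j id _
  fold : ∀ l e → List.foldr Op φ (map qInt l) e ξ ≡ Q l e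
  fold [] e = refl
  fold (j ∷ l) e = Op-qInt j (List.foldr Op φ (map qInt l)) e ξ ∙ q-cong j (fold l) e
  snoc : ∀ l x e → Q (l ++ x ∷ []) e ≡ q x (Q l) e
  snoc [] x e = refl
  snoc (j ∷ l) x e = q-cong j (snoc l x) e ∙ q-comm j x (Q l) e
  QF-fold : ∀ m e → Q (from1 m) e ≡ QF m (λ k → φ k ξ) e
  QF-fold zero e = refl
  QF-fold (suc m) e = cong (λ l → Q l e) (cong (map suc) (upTo-snoc m) ∙ Listₚ.map-++ suc (upTo m) _) ∙
    snoc (from1 m) (suc m) e ∙ q-cong (suc m) (QF-fold m) e

toList-padV : ∀ N ν → length ν ≤ N → toList (padV N ν) ≡ padTo N ν
toList-padV zero [] l = refl
toList-padV (suc N) [] l = cong (0 ∷_) (toList-padV N [] z≤n)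
toList-padV (suc N) (a ∷ ν) (s≤s l) = cong (a ∷_) (toList-padV N ν l)

countᵇ-cntV : ∀ {N} k (β : Vec ℕ N) → countᵇ (λ x → x ≡ᵇ k) (toList β) ≡ cntV k β
countᵇ-cntV k [] = refl
countᵇ-cntV k (a ∷ β) with a ≡ᵇ k
... | true = cong suc (countᵇ-cntV k β)
... | false = countᵇ-cntV k β

Op-vPoly : ∀ N ν → length ν ≤ N → ∀ (φ : Ser N) e ξ → Op (vPoly N ν) φ e ξ ≡ vOp (range (suc N)) (padV N ν) (λ k → φ k ξ) e
Op-vPoly N ν l φ e ξ = Op-prod (map (vm ∘ c) (range0 N)) φ e ξ ∙ fold (range0 N) e ∙ unfold (suc N) e
  where
  c : ℕ → ℕ
  c k = countᵇ (λ x → x ≡ᵇ k) (padTo N ν)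
  Q : List ℕ → ℤ → ℤ
  Q l = List.foldr (QF ∘ c) (λ k → φ k ξ) l
  fold : ∀ l e → List.foldr Op φ (map (vm ∘ c) l) e ξ ≡ Q l e
  fold [] e = refl
  fold (j ∷ l) e = Op-vm (c j) (List.foldr Op φ (map (vm ∘ c) l)) e ξ ∙ QF-cong (c j) (fold l) e
  snoc : ∀ l x e → Q (l ++ x ∷ []) e ≡ QF (c x) (Q l) e
  snoc [] x e = refl
  snoc (j ∷ l) x e = QF-cong (c j) (snoc l x) e ∙ QF-comm (c j) (c x) (Q l) e
  unfold : ∀ K e → Q (upTo K) e ≡ vOp (range K) (padV N ν) (λ k → φ k ξ) e
  unfold zero e = refl
  unfold (suc K) e = cong (λ l → Q l e) (upTo-snoc K) ∙ snoc (upTo K) K e ∙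
    QF-cong (c K) (unfold K) e ∙ cong (λ t → QF t (vOp (range K) (padV N ν) (λ k → φ k ξ)) e) (cong (countᵇ (λ x → x ≡ᵇ K)) (sym (toList-padV N ν l)) ∙ countᵇ-cntV K (padV N ν))

-- The tabloid conditions as a greedy choice of entries.

coinv : ℕ → ℕ → ℕ → Bool
coinv i j k = ((i <ᵇ j) ∧ (j <ᵇ k)) ∨ ((j <ᵇ k) ∧ (k <ᵇ i)) ∨ ((k <ᵇ i) ∧ (i <ᵇ j))

NoCoinv : ℕ → ℕ → ℕ → Set
NoCoinv i j k = ¬ (i < j × j < k) × ¬ (j < k × k < i) × ¬ (k < i × i < j)

coinv-false : ∀ i j k → NoCoinv i j k → coinv i j k ≡ false
coinv-false i j k (f , g , h) with i <ᵇ j in a | j <ᵇ k in b | k <ᵇ i in c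
... | true | true | _ = ⊥-elim (f (<ᵇ-true⁻ a , <ᵇ-true⁻ b))
... | false | true | true = ⊥-elim (g (<ᵇ-true⁻ b , <ᵇ-true⁻ c))
... | true | false | true = ⊥-elim (h (<ᵇ-true⁻ c , <ᵇ-true⁻ a))
... | true | false | false = refl
... | false | true | false = refl
... | false | false | true = refl
... | false | false | false = refl

<ᵇ-false-≮ : ∀ {a b} → (a <ᵇ b) ≡ false → ¬ a < b
<ᵇ-false-≮ e l = <⇒≱ l (<ᵇ-false⁻ e)

coinv-false⁻ : ∀ i j k → coinv i j k ≡ false → NoCoinv i j k
coinv-false⁻ i j k e with i <ᵇ j in a | j <ᵇ k in b | k <ᵇ i in c
... | true | false | false = <ᵇ-false-≮ b ∘ proj₂ , <ᵇ-false-≮ b ∘ proj₁ , <ᵇ-false-≮ c ∘ proj₁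
... | false | true | false = <ᵇ-false-≮ a ∘ proj₁ , <ᵇ-false-≮ c ∘ proj₂ , <ᵇ-false-≮ c ∘ proj₁
... | false | false | _ = <ᵇ-false-≮ a ∘ proj₁ , <ᵇ-false-≮ b ∘ proj₁ , <ᵇ-false-≮ a ∘ proj₂

-- Neighbours x, y in a row and an entry z below y in its column: z must differ from y in the same
-- column and from x, which lies higher in the column to the left, and the three must not form a
-- co-inversion triple.
free : ℕ → ℕ → ℕ → Bool
free x y z = not (z ≡ᵇ y) ∧ not (z ≡ᵇ x) ∧ not (coinv x y z)

Free : ℕ → ℕ → ℕ → Set
Free x y z = z ≢ y × z ≢ x × NoCoinv x y z

free-true : ∀ x y z → Free x y z → free x y z ≡ true
free-true x y z (a , b , c) rewrite ≡ᵇ-false a | ≡ᵇ-false b | coinv-false x y z c = refl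

free-true⁻ : ∀ x y z → free x y z ≡ true → Free x y z
free-true⁻ x y z e with z ≡ᵇ y in a | z ≡ᵇ x in b | coinv x y z in c
... | false | false | false = (λ { refl → case trans (sym (≡ᵇ-refl z)) a of λ () }) , (λ { refl → case trans (sym (≡ᵇ-refl z)) b of λ () }) , coinv-false⁻ x y z c

-- Whether w may stand to the right of v, both columns read from the top.
ok : List ℕ → List ℕ → Bool
ok v [] = true
ok [] (y ∷ w) = false
ok (x ∷ v) (y ∷ w) = all (free x y) w ∧ ok v w

allB : ∀ {n} → (ℕ → Bool) → Vec Bool n → Bool
allB P [] = true
allB P (b ∷ D) = (if b then P 0 else true) ∧ allB (P ∘ suc) D

∧-swap : ∀ a b c → a ∧ (b ∧ c) ≡ b ∧ (a ∧ c)
∧-swap true b c = refl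
∧-swap false true c = refl
∧-swap false false c = refl

allB-clear : ∀ {n} P j (D : Vec Bool n) → bit j D ≡ true → allB P D ≡ P j ∧ allB P (clear j D)
allB-clear P zero (true ∷ D) refl = refl
allB-clear P (suc j) (b ∷ D) h = cong ((if b then P 0 else true) ∧_) (allB-clear (P ∘ suc) j D h) ∙ ∧-swap (if b then P 0 else true) (P (suc j)) _

allB-empty : ∀ {n} P (D : Vec Bool n) → size D ≡ 0 → allB P D ≡ true
allB-empty P [] h = refl
allB-empty P (false ∷ D) h = allB-empty (P ∘ suc) D h

allB-intro : ∀ {n} P (D : Vec Bool n) → (∀ k → bit k D ≡ true → P k ≡ true) → allB P D ≡ true
allB-intro P [] h = refl
allB-intro P (true ∷ D) h rewrite h 0 refl = allB-intro (P ∘ suc) D (h ∘ suc)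
allB-intro P (false ∷ D) h = allB-intro (P ∘ suc) D (h ∘ suc)

allB-elim : ∀ {n} P (D : Vec Bool n) → allB P D ≡ true → ∀ k → bit k D ≡ true → P k ≡ true
allB-elim P (true ∷ D) e zero h = proj₁ (∧-true {P 0} e)
allB-elim P (b ∷ D) e (suc k) h = allB-elim (P ∘ suc) D (proj₂ (∧-true {if b then P 0 else true} e)) k h

all-arr : ∀ {n} P v (D : Vec Bool n) → size D ≤ length v → all P (arr v D) ≡ allB (P ∘ suc) D
all-arr P [] D l = sym (allB-empty _ D (n≤0⇒n≡0 l))
all-arr P (x ∷ v) D l with pick x D in eq
... | nothing = sym (allB-empty _ D (pick-nothing x D eq))
... | just (f , j) = cong (P (suc j) ∧_) (all-arr P v (clear j D) (≤-pred (subst (_≤ suc (length v)) (size-clear j D (pick-true x D eq)) l))) ∙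
    sym (allB-clear (P ∘ suc) j D (pick-true x D eq))

below-none : ∀ {n} x (D : Vec Bool n) → below x D ≡ nothing → ∀ k → k < x → bit k D ≡ false
below-none (suc x) [] h k l = refl
below-none (suc x) (b ∷ D) h k l with below x D in eq
below-none (suc x) (b ∷ D) () k l | just _
below-none (suc x) (true ∷ D) () k l | nothing
below-none (suc x) (false ∷ D) h zero l | nothing = refl
below-none (suc x) (false ∷ D) h (suc k) (s≤s l) | nothing = below-none x D eq k l

pick-spec : ∀ {n} x (D : Vec Bool n) {f k} → pick x D ≡ just (f , k) →
  (f ≡ false × k < x × (∀ l → k < l → l < x → bit l D ≡ false)) ⊎
  (f ≡ true × x ≤ k × (∀ l → l < x → bit l D ≡ false) × (∀ l → k < l → bit l D ≡ false))
pick-spec {n} x D h with below x D in eq | below n D in eq'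
pick-spec x D refl | just k | _ = inj₁ (refl , below-< x D eq , below-max x D eq)
pick-spec {n} x D refl | nothing | just k = inj₂ (refl
  , ℕₚ.≮⇒≥ (λ l → case trans (sym (below-true n D eq')) (below-none x D eq k l) of λ ())
  , below-none x D eq , λ l kl → case <-≤-connex l n of λ
      { (inj₁ ln) → below-max n D eq' l kl ln ; (inj₂ nl) → bit-≥ D l nl })

hit : Maybe (Bool × ℕ) → ℕ → Bool
hit (just (f , k)) j = k ≡ᵇ j
hit nothing j = false

size-bit : ∀ {n} j (D : Vec Bool n) → size D ≡ 0 → bit j D ≡ false
size-bit j [] h = refl
size-bit zero (false ∷ D) h = refl
size-bit (suc j) (false ∷ D) h = size-bit j D h

-- A letter lying strictly between `x` and the chosen one on the cyclic way down would complete a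
-- co-inversion triple, and a remaining letter equal to `x` would attack; hence only the first
-- letter met is possible.
free-hit : ∀ {n} x j (D : Vec Bool n) → bit j D ≡ true → allB (free x (suc j) ∘ suc) (clear j D) ≡ hit (pick x D) j
free-hit x j D h with pick x D in eq
... | nothing = ⊥-elim (case trans (sym h) (size-bit j D (pick-nothing x D eq)) of λ ())
... | just (f , k) with k ℕₚ.≟ j
...   | yes refl rewrite ≡ᵇ-refl k = allB-intro _ (clear k D) λ l b → free-true x (suc k) (suc l) (good l b (λ { refl → case trans (sym b) (bit-clear k D) of λ () }))
  where
  good : ∀ l → bit l (clear k D) ≡ true → l ≢ k → Free x (suc k) (suc l)
  good l b' ne with trans (sym (bit-clear-≢ l k D ne)) b' | pick-spec x D eq
  ... | b | inj₁ (_ , kx , gap) = (ne ∘ suc-injective)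
    , (λ { refl → gap⊥ (≤∧≢⇒< (≤-pred kx) (ne ∘ sym)) ≤-refl })
    , (λ { (xk , _) → <⇒≱ xk kx }) , (λ { (s≤s kl , lx) → gap⊥ kl (<-trans (n<1+n l) lx) }) , λ { (_ , xk) → <⇒≱ xk kx }
    where
    gap⊥ : k < l → l < x → ⊥
    gap⊥ kl lx = case trans (sym b) (gap l kl lx) of λ ()
  ... | b | inj₂ (_ , xk , lo , hi) = (ne ∘ suc-injective) , (λ { refl → nlo ≤-refl })
    , (λ { (_ , s≤s kl) → nhi kl }) , (λ { (s≤s kl , _) → nhi kl }) , λ { (lx , _) → nlo (<-trans (n<1+n l) lx) }
    where
    nlo : ¬ (l < x)
    nlo lx = case trans (sym b) (lo l lx) of λ ()
    nhi : ¬ (k < l)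
    nhi kl = case trans (sym b) (hi l kl) of λ ()
...   | no ne rewrite ≡ᵇ-false ne with allB (free x (suc j) ∘ suc) (clear j D) in al
...     | false = refl
...     | true = ⊥-elim (bad (free-true⁻ x (suc j) (suc k) (allB-elim _ (clear j D) al k (bit-clear-≢ k j D ne ∙ pick-true x D eq))))
  where
  bad : ¬ Free x (suc j) (suc k)
  bad (_ , kx≢ , c₁ , c₂ , c₃) with pick-spec x D eq
  ... | inj₁ (_ , kx , gap) with <-≤-connex j x
  ...   | inj₂ xj = c₃ (≤∧≢⇒< kx kx≢ , s≤s xj)
  ...   | inj₁ jx with <-≤-connex k j
  ...     | inj₁ kj = case trans (sym h) (gap j kj jx) of λ ()
  ...     | inj₂ jk = c₂ (s≤s (≤∧≢⇒< jk (ne ∘ sym)) , ≤∧≢⇒< kx kx≢)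
  bad (_ , kx≢ , c₁ , c₂ , c₃) | inj₂ (_ , xk , lo , hi) with <-≤-connex j x
  ...   | inj₁ jx = case trans (sym h) (lo j jx) of λ ()
  ...   | inj₂ xj with <-≤-connex k j
  ...     | inj₁ kj = case trans (sym h) (hi j kj) of λ ()
  ...     | inj₂ jk = c₁ (s≤s xj , s≤s (≤∧≢⇒< jk (ne ∘ sym)))

∑-bit-clear : ∀ n j → j < n → (g : Vec Bool n → ℤ) → ∑ (bits n) (λ D → not (bit j D) ▸ g D) ≡ ∑ (bits n) λ D → bit j D ▸ g (clear j D)
∑-bit-clear (suc n) zero l g = ∑-bits n _ ∙ cong (λ t → t + ∑ (bits n) (g ∘ (false ∷_))) (∑-zero (bits n) λ _ → refl) ∙
  ℤₚ.+-comm 0ℤ (∑ (bits n) (g ∘ (false ∷_))) ∙ sym (∑-bits n _ ∙ +ˡ (∑ (bits n) (g ∘ (false ∷_))) (∑-zero (bits n) λ _ → refl))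
∑-bit-clear (suc n) (suc j) (s≤s l) g = ∑-bits n _ ∙ cong₂ _+_ (∑-bit-clear n j l (g ∘ (true ∷_))) (∑-bit-clear n j l (g ∘ (false ∷_))) ∙ sym (∑-bits n _)

∑-words : ∀ k n (F : List ℕ → ℤ) → ∑ (words (suc k) n) F ≡ ∑ (range n) λ j → ∑ (words k n) λ w → F (suc j ∷ w)
∑-words k n F = ∑-concatMap (from1 n) _ F ∙ ∑-map (upTo n) suc _ ∙ ∑-applyUpTo n id _ ∙ ∑-cong (range n) λ j → ∑-map (words k n) (suc j ∷_) F

-- An admissible column is the arrangement of its set of letters: the top entry is the one hit by
-- `pick`, and the rest is admissible for the remaining set.
reindexW : ∀ n v h → h ≤ length v → (F : List ℕ → ℤ) → ∑ (words h n) (λ w → ok v w ▸ F w) ≡ ∑ (bits n) λ D → (size D ≡ᵇ h) ▸ F (arr v D)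
reindexW n v zero l F = +-identityʳ _ ∙ sym (∑-bits-only (ones {n} 0) _ other ∙
    cong₂ (λ s w → (s ≡ᵇ 0) ▸ F w) (size-ones n 0 z≤n) (arr-empty v (ones {n} 0) (size-ones n 0 z≤n)))
  where
  other : ∀ S → S ≢ ones 0 → (size S ≡ᵇ 0) ▸ F (arr v S) ≡ 0ℤ
  other S ne with size S in eq
  ... | zero = ⊥-elim (ne (size-0 S eq))
  ... | suc _ = refl
reindexW n (x ∷ v) (suc h) (s≤s l) F = ∑-words h n _ ∙ ∑-cong-range n step ∙ ∑-swap (range n) (bits n) _ ∙ ∑-cong (bits n) last
  where
  G′ : ℕ → Vec Bool n → ℤ
  G′ j D = F (suc j ∷ arr v (clear j D))
  step : ∀ j → j < n → ∑ (words h n) (λ w → (all (free x (suc j)) w ∧ ok v w) ▸ F (suc j ∷ w)) ≡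
         ∑ (bits n) λ D → (size D ≡ᵇ suc h) ▸ bit j D ▸ hit (pick x D) j ▸ G′ j D
  step j jn = (∑-cong (words h n) λ w → ▸-∧ (all (free x (suc j)) w) (ok v w) _ ∙ ▸-comm (all (free x (suc j)) w) (ok v w) _) ∙
    reindexW n v h l (λ w → all (free x (suc j)) w ▸ F (suc j ∷ w)) ∙
    ∑-cong (bits n) one ∙ ∑-bit-clear n j jn _ ∙ ∑-cong (bits n) two
    where
    one : ∀ D → (size D ≡ᵇ h) ▸ all (free x (suc j)) (arr v D) ▸ F (suc j ∷ arr v D) ≡
          not (bit j D) ▸ (size D ≡ᵇ h) ▸ allB (free x (suc j) ∘ suc) D ▸ F (suc j ∷ arr v D)
    one D with size D ≡ᵇ h in sz
    ... | false = sym (▸-zero (not (bit j D)))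
    ... | true rewrite all-arr (free x (suc j)) v D (subst (_≤ length v) (sym (≡ᵇ-true sz)) l) with bit j D in b
    ...   | false = refl
    ...   | true rewrite allB-clear (free x (suc j) ∘ suc) j D b | ≡ᵇ-refl j = refl
    two : ∀ D → bit j D ▸ (size (clear j D) ≡ᵇ h) ▸ allB (free x (suc j) ∘ suc) (clear j D) ▸ G′ j D ≡ (size D ≡ᵇ suc h) ▸ bit j D ▸ hit (pick x D) j ▸ G′ j D
    two D = (▸-cong (bit j D) λ b → cong₂ (λ s t → s ▸ t ▸ G′ j D) (cong (_≡ᵇ suc h) (sym (size-clear j D b))) (free-hit x j D b)) ∙ ▸-comm (bit j D) (size D ≡ᵇ suc h) _
  last : ∀ D → ∑ (range n) (λ j → (size D ≡ᵇ suc h) ▸ bit j D ▸ hit (pick x D) j ▸ G′ j D) ≡ (size D ≡ᵇ suc h) ▸ F (arr (x ∷ v) D)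
  last D with size D ≡ᵇ suc h in sz
  ... | false = ∑-zero (range n) λ _ → refl
  ... | true with pick x D in eq
  ...   | nothing = ⊥-elim (case trans (sym (≡ᵇ-true {size D} {suc h} sz)) (pick-nothing x D eq) of λ ())
  ...   | just (f , k) = (∑-cong (range n) λ j → ▸-comm (bit j D) (k ≡ᵇ j) (G′ j D)) ∙
            ∑-range-only n k (λ j → bit j D ▸ G′ j D) (bit-true-< k D (pick-true x D eq)) ∙ cong (_▸ G′ k D) (pick-true x D eq)

-- Fillings by rows and by columns.

∑-fillings : ∀ k ks n (F : List (List ℕ) → ℤ) → ∑ (fillings (k ∷ ks) n) F ≡ ∑ (words k n) λ w → ∑ (fillings ks n) λ T → F (w ∷ T)
∑-fillings k ks n F = ∑-concatMap (words k n) _ F ∙ ∑-cong (words k n) λ w → ∑-map (fillings ks n) (w ∷_) F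

∑-fillings-snoc : ∀ ks k n (F : List (List ℕ) → ℤ) → ∑ (fillings (ks ++ k ∷ []) n) F ≡ ∑ (fillings ks n) λ T → ∑ (words k n) λ w → F (T ++ w ∷ [])
∑-fillings-snoc [] k n F = ∑-fillings k [] n F ∙ (∑-cong (words k n) λ w → +-identityʳ (F (w ∷ []))) ∙ sym (+-identityʳ _)
∑-fillings-snoc (a ∷ ks) k n F = ∑-fillings a (ks ++ k ∷ []) n F ∙ (∑-cong (words a n) λ u → ∑-fillings-snoc ks k n (F ∘ (u ∷_))) ∙ sym (∑-fillings a ks n _)

∑-fillings-reverse : ∀ ks n (F : List (List ℕ) → ℤ) → ∑ (fillings (reverse ks) n) F ≡ ∑ (fillings ks n) (F ∘ reverse)
∑-fillings-reverse [] n F = refl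
∑-fillings-reverse (k ∷ ks) n F = cong (λ l → ∑ (fillings l n) F) (Listₚ.unfold-reverse k ks) ∙
  ∑-fillings-snoc (reverse ks) k n F ∙ ∑-fillings-reverse ks n _ ∙
    (∑-cong (fillings ks n) λ T → ∑-cong (words k n) λ w → cong F (sym (Listₚ.unfold-reverse w T))) ∙ ∑-swap (fillings ks n) (words k n) _ ∙ sym (∑-fillings k ks n _)

incFirst : ℕ → List ℕ → List ℕ
incFirst zero ℓ = ℓ
incFirst (suc h) [] = []
incFirst (suc h) (a ∷ ℓ) = suc a ∷ incFirst h ℓ

addCol : List ℕ → List (List ℕ) → List (List ℕ)
addCol [] T = T
addCol (x ∷ w) [] = []
addCol (x ∷ w) (R ∷ T) = (x ∷ R) ∷ addCol w T

∑-addCol : ∀ h ℓ n → h ≤ length ℓ → (F : List (List ℕ) → ℤ) → ∑ (fillings (incFirst h ℓ) n) F ≡ ∑ (words h n) λ w → ∑ (fillings ℓ n) λ T → F (addCol w T)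
∑-addCol zero ℓ n l F = sym (+-identityʳ _)
∑-addCol (suc h) (a ∷ ℓ) n (s≤s l) F = ∑-fillings (suc a) (incFirst h ℓ) n F ∙ ∑-words a n _ ∙ (∑-cong (range n) λ j →
    (∑-cong (words a n) λ u → ∑-addCol h ℓ n l (λ T → F ((suc j ∷ u) ∷ T))) ∙
      ∑-swap (words a n) (words h n) _ ∙ ∑-cong (words h n) λ w → sym (∑-fillings a ℓ n λ T → F (addCol (suc j ∷ w) T))) ∙ sym (∑-words h n _)

-- The rows, from the top, of the diagram with columns μ.
toT : ℕ → List (List ℕ) → List (List ℕ)
toT n [] = replicate n []
toT n (w ∷ C) = addCol w (toT n C)

incFirst-applyUpTo : ∀ h n f → incFirst h (applyUpTo f n) ≡ applyUpTo (λ i → (if i <ᵇ h then 1 else 0) ℕ.+ f i) n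
incFirst-applyUpTo zero n f = refl
incFirst-applyUpTo (suc h) zero f = refl
incFirst-applyUpTo (suc h) (suc n) f = cong (suc (f 0) ∷_) (incFirst-applyUpTo h n (f ∘ suc))

∑-toT : ∀ n N μ → All (_≤ n) μ → (F : List (List ℕ) → ℤ) → ∑ (fillings (applyUpTo (wt μ) n) N) F ≡ ∑ (fillings μ N) (F ∘ toT n)
∑-toT n N [] [] F = go n F
  where
  go : ∀ n (F : List (List ℕ) → ℤ) → ∑ (fillings (applyUpTo (λ _ → 0) n) N) F ≡ F (replicate n []) + 0ℤ
  go zero F = refl
  go (suc n) F = ∑-fillings 0 (applyUpTo (λ _ → 0) n) N F ∙ +-identityʳ _ ∙ go n (F ∘ ([] ∷_))
∑-toT n N (h ∷ μ) (l ∷ ls) F = cong (λ ℓ → ∑ (fillings ℓ N) F) (sym (incFirst-applyUpTo h n (wt μ))) ∙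
  ∑-addCol h (applyUpTo (wt μ) n) N (subst (h ≤_) (sym (Listₚ.length-applyUpTo (wt μ) n)) l) F ∙
    (∑-cong (words h N) λ w → ∑-toT n N μ ls (F ∘ addCol w)) ∙ sym (∑-fillings h μ N _)

conj-applyUpTo : ∀ μ → conj μ ≡ applyUpTo (wt μ) (head0 μ)
conj-applyUpTo μ = sym (Listₚ.map-∘ (upTo (head0 μ))) ∙ Listₚ.map-upTo _ (head0 μ) ∙ cong-applyUpTo (head0 μ) (λ i → go μ i)
  where
  go : ∀ μ i → countᵇ (λ x → suc i ≤ᵇ x) μ ≡ wt μ i
  go [] i = refl
  go (h ∷ μ) i with i <ᵇ h
  ... | true = cong suc (go μ i)
  ... | false = go μ i
  cong-applyUpTo : ∀ {f g : ℕ → ℕ} n → (∀ i → f i ≡ g i) → applyUpTo f n ≡ applyUpTo g n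
  cong-applyUpTo zero h = refl
  cong-applyUpTo (suc n) h = cong₂ _∷_ (h 0) (cong-applyUpTo n (h ∘ suc))

Partition-Dec : ∀ μ → IsPartition μ → Dec≥ μ
Partition-Dec [] p = tt
Partition-Dec (x ∷ []) p = [] , tt
Partition-Dec (x ∷ y ∷ μ) (l , p) = (l ∷ All≤-trans l (proj₁ (Partition-Dec (y ∷ μ) p))) , Partition-Dec (y ∷ μ) p

Partition-≤ : ∀ μ → IsPartition μ → All (_≤ head0 μ) μ
Partition-≤ [] p = []
Partition-≤ (x ∷ μ) p = ≤-refl ∷ proj₁ (Partition-Dec (x ∷ μ) p)

Partition-pos : ∀ μ → IsPartition μ → All (1 ≤_) μ
Partition-pos [] p = []
Partition-pos (x ∷ []) p = p ∷ []
Partition-pos (x ∷ y ∷ μ) (l , p) with Partition-pos (y ∷ μ) p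
... | q ∷ qs = ≤-trans q l ∷ q ∷ qs

-- The m leading zeros of b are the rows below the first column: counted from the top, row `i` has
-- length `wt μ i`, and this is 0 from the largest part of μ on.
bComp-rows : ∀ m μ → IsPartition μ → bComp m μ ≡ reverse (applyUpTo (wt μ) (nLen m μ))
bComp-rows m μ p = cong (λ l → replicate m 0 ++ reverse l) (conj-applyUpTo μ) ∙ sym (cong (λ k → reverse (applyUpTo (wt μ) k)) (ℕₚ.+-comm m (head0 μ)) ∙
  cong reverse (split (head0 μ) m (wt μ) λ i l → wt-zero μ i (All≤-trans l (Partition-≤ μ p))) ∙ Listₚ.reverse-++ (applyUpTo (wt μ) (head0 μ)) (replicate m 0) ∙ cong (_++ reverse (applyUpTo (wt μ) (head0 μ))) (rev0 m))
  where
  split : ∀ a m f → (∀ i → a ≤ i → f i ≡ 0) → applyUpTo f (a ℕ.+ m) ≡ applyUpTo f a ++ replicate m 0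
  split zero zero f h = refl
  split zero (suc m) f h = cong₂ _∷_ (h 0 z≤n) (split zero m (f ∘ suc) λ i l → h (suc i) z≤n)
  split (suc a) m f h = cong (f 0 ∷_) (split a m (f ∘ suc) λ i l → h (suc i) (s≤s l))
  snoc0 : ∀ m → replicate m 0 ++ 0 ∷ [] ≡ 0 ∷ replicate m 0
  snoc0 zero = refl
  snoc0 (suc m) = cong (0 ∷_) (snoc0 m)
  rev0 : ∀ m → reverse (replicate m 0) ≡ replicate m 0
  rev0 zero = refl
  rev0 (suc m) = Listₚ.unfold-reverse 0 (replicate m 0) ∙ cong (_++ 0 ∷ []) (rev0 m) ∙ snoc0 m

-- Non-attacking fillings without co-inversion triples as chains of columns.

Bool-ext : ∀ {a b} → (a ≡ true → b ≡ true) → (b ≡ true → a ≡ true) → a ≡ b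
Bool-ext {true} f g = sym (f refl)
Bool-ext {false} {false} f g = refl
Bool-ext {false} {true} f g = g refl

∧-intro : ∀ {a b} → a ≡ true → b ≡ true → a ∧ b ≡ true
∧-intro refl refl = refl

∧-exchange : ∀ x y u w → (x ∧ y) ∧ (u ∧ w) ≡ (x ∧ u) ∧ (y ∧ w)
∧-exchange true true u w = refl
∧-exchange true false true w = refl
∧-exchange true false false w = refl
∧-exchange false y u w = refl

nand⁺ : ∀ {a b} → (a ≡ true → b ≡ true → ⊥) → not a ∨ not b ≡ true
nand⁺ {true} {true} h = ⊥-elim (h refl refl)
nand⁺ {true} {false} h = refl
nand⁺ {false} h = refl

nand⁻ : ∀ {a b} → not a ∨ not b ≡ true → a ≡ true → b ≡ true → ⊥
nand⁻ () refl refl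

≤ᵇ-true⁻ : ∀ {a b} → (a ≤ᵇ b) ≡ true → a ≤ b
≤ᵇ-true⁻ {a} {b} e = ℕₚ.≤ᵇ⇒≤ a b (subst T (sym e) tt)

module _ {A : Set} where
  all-up⁺ : ∀ k {g : ℕ → A} {f} → (∀ i → i < k → f (g i) ≡ true) → all f (applyUpTo g k) ≡ true
  all-up⁺ zero h = refl
  all-up⁺ (suc k) h = ∧-intro (h 0 (s≤s z≤n)) (all-up⁺ k λ i l → h (suc i) (s≤s l))

  all-up⁻ : ∀ k {g : ℕ → A} {f} → all f (applyUpTo g k) ≡ true → ∀ i → i < k → f (g i) ≡ true
  all-up⁻ (suc k) {g} {f} h zero l = proj₁ (∧-true {f (g 0)} h)
  all-up⁻ (suc k) {g} {f} h (suc i) (s≤s l) = all-up⁻ k (proj₂ (∧-true {f (g 0)} h)) i l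

  any-up⁺ : ∀ k {g : ℕ → A} {f} i → i < k → f (g i) ≡ true → any f (applyUpTo g k) ≡ true
  any-up⁺ (suc k) zero l h rewrite h = refl
  any-up⁺ (suc k) {g} {f} (suc i) (s≤s l) h with f (g 0)
  ... | true = refl
  ... | false = any-up⁺ k {f = f} i l h

  any-up⁻ : ∀ k {g : ℕ → A} {f} → any f (applyUpTo g k) ≡ true → ∃ λ i → i < k × f (g i) ≡ true
  any-up⁻ (suc k) {g} {f} h with f (g 0) in eq
  ... | true = 0 , s≤s z≤n , eq
  ... | false with any-up⁻ k {f = f} h
  ...   | i , l , e = suc i , s≤s l , e

  all-++ : ∀ (f : A → Bool) xs ys → all f (xs ++ ys) ≡ all f xs ∧ all f ys
  all-++ f [] ys = refl
  all-++ f (x ∷ xs) ys with f x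
  ... | true = all-++ f xs ys
  ... | false = refl

  applyUpTo-cong : ∀ k {f g : ℕ → A} → (∀ i → i < k → f i ≡ g i) → applyUpTo f k ≡ applyUpTo g k
  applyUpTo-cong zero h = refl
  applyUpTo-cong (suc k) h = cong₂ _∷_ (h 0 (s≤s z≤n)) (applyUpTo-cong k λ i l → h (suc i) (s≤s l))

  list-up : ∀ (d : A) xs → xs ≡ applyUpTo (nthD d xs) (length xs)
  list-up d [] = refl
  list-up d (x ∷ xs) = cong (x ∷_) (list-up d xs)

  nthD-++ : ∀ (d : A) xs ys k → k < length xs → nthD d (xs ++ ys) k ≡ nthD d xs k
  nthD-++ d (x ∷ xs) ys zero l = refl
  nthD-++ d (x ∷ xs) ys (suc k) (s≤s l) = nthD-++ d xs ys k l

  nthD-last : ∀ (d : A) xs y → nthD d (xs ++ y ∷ []) (length xs) ≡ y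
  nthD-last d [] y = refl
  nthD-last d (x ∷ xs) y = nthD-last d xs y

  nthD-reverse : ∀ (d : A) xs k → k < length xs → nthD d (reverse xs) k ≡ nthD d xs (length xs ∸ suc k)
  nthD-reverse d (x ∷ xs) k (s≤s l) with k ℕₚ.≟ length xs
  ... | yes refl = cong (λ t → nthD d t (length xs)) (Listₚ.unfold-reverse x xs) ∙
          cong (nthD d (reverse xs ++ x ∷ [])) (sym (Listₚ.length-reverse xs)) ∙ nthD-last d (reverse xs) x ∙ sym (cong (nthD d (x ∷ xs)) (ℕₚ.n∸n≡0 (length xs)))
  ... | no ne = cong (λ t → nthD d t k) (Listₚ.unfold-reverse x xs) ∙
          nthD-++ d (reverse xs) (x ∷ []) k (subst (k <_) (sym (Listₚ.length-reverse xs)) k<) ∙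
            nthD-reverse d xs k k< ∙ cong (nthD d (x ∷ xs)) (sym (ℕₚ.+-∸-assoc 1 k<))
    where
    k< : k < length xs
    k< = ≤∧≢⇒< l ne

  nthD-up : ∀ (d : A) n f i → i < n → nthD d (applyUpTo f n) i ≡ f i
  nthD-up d (suc n) f zero l = refl
  nthD-up d (suc n) f (suc i) (s≤s l) = nthD-up d n (f ∘ suc) i l

module _ {A B : Set} where
  all-map : ∀ (f : B → Bool) (g : A → B) xs → all f (map g xs) ≡ all (f ∘ g) xs
  all-map f g [] = refl
  all-map f g (x ∷ xs) = cong (f (g x) ∧_) (all-map f g xs)

  all-concatMap : ∀ (f : B → Bool) (g : A → List B) xs → all f (concatMap g xs) ≡ all (λ x → all f (g x)) xs
  all-concatMap f g [] = refl
  all-concatMap f g (x ∷ xs) = all-++ f (g x) _ ∙ cong (all f (g x) ∧_) (all-concatMap f g xs)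

  any-map : ∀ (f : B → Bool) (g : A → B) xs → any f (map g xs) ≡ any (f ∘ g) xs
  any-map f g [] = refl
  any-map f g (x ∷ xs) = cong (f (g x) ∨_) (any-map f g xs)

nthD-length : ∀ (T : List (List ℕ)) k → nthD 0 (map length T) k ≡ length (nthD [] T k)
nthD-length [] k = refl
nthD-length (R ∷ T) zero = refl
nthD-length (R ∷ T) (suc k) = nthD-length T k

nthD-All : ∀ {P : ℕ → Set} {μ} → P 0 → All P μ → ∀ c → P (nthD 0 μ c)
nthD-All p [] c = p
nthD-All p (x ∷ xs) zero = x
nthD-All p (x ∷ xs) (suc c) = nthD-All p xs c

-- A cell lies in both its row and its column. The basement counts as a column of height n at index
-- 0, whence the list `n ∷ μ`.
wt-col : ∀ n μ i c → Dec≥ μ → i < n → (c ≤ wt μ i → i < nthD 0 (n ∷ μ) c) × (i < nthD 0 (n ∷ μ) c → c ≤ wt μ i)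
wt-col n μ i zero d l = (λ _ → l) , λ _ → z≤n
wt-col n [] i (suc c) d l = (λ ()) , λ ()
wt-col n (h ∷ μ) i (suc c) (b , d) l with i <ᵇ h in eq
... | true = (λ { (s≤s x) → proj₁ (wt-col h μ i c d (<ᵇ-true⁻ eq)) x }) , λ x → s≤s (proj₂ (wt-col h μ i c d (<ᵇ-true⁻ eq)) x)
... | false rewrite wt-zero μ i (All≤-trans (<ᵇ-false⁻ {i} {h} eq) b) =
  (λ ()) , λ x → ⊥-elim (<⇒≱ x (≤-trans (nthD-All {_≤h} z≤n (≤-refl ∷ b) c) (<ᵇ-false⁻ {i} {h} eq)))
  where
  _≤h : ℕ → Set
  x ≤h = x ≤ h

length-addCol : ∀ w T → map length (addCol w T) ≡ incFirst (length w) (map length T)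
length-addCol [] T = refl
length-addCol (x ∷ w) [] = refl
length-addCol (x ∷ w) (R ∷ T) = cong (_ ∷_) (length-addCol w T)

length-toT : ∀ n C → map length (toT n C) ≡ applyUpTo (wt (map length C)) n
length-toT n [] = go n
  where
  go : ∀ n → map length (replicate n []) ≡ applyUpTo (λ _ → 0) n
  go zero = refl
  go (suc n) = cong (0 ∷_) (go n)
length-toT n (w ∷ C) = length-addCol w (toT n C) ∙ cong (incFirst (length w)) (length-toT n C) ∙ incFirst-applyUpTo (length w) n (wt (map length C))

length-toT′ : ∀ n C → length (toT n C) ≡ n
length-toT′ n C = sym (Listₚ.length-map length (toT n C)) ∙ cong length (length-toT n C) ∙ Listₚ.length-applyUpTo _ n

nthD-addCol : ∀ w T i → i < length w → length w ≤ length T → nthD [] (addCol w T) i ≡ nthD 0 w i ∷ nthD [] T i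
nthD-addCol (x ∷ w) (R ∷ T) zero l l' = refl
nthD-addCol (x ∷ w) (R ∷ T) (suc i) (s≤s l) (s≤s l') = nthD-addCol w T i l l'

row-entry : ∀ n C → Dec≥ (map length C) → All (_≤ n) (map length C) → ∀ c i → i < length (nthD [] C c) →
            nthD 0 (nthD [] (toT n C) i) c ≡ nthD 0 (nthD [] C c) i
row-entry n (w ∷ C) (b , d) (l ∷ ls) c i li with <-≤-trans li (≤-trans (≤-reflexive (sym (nthD-length (w ∷ C) c))) (nthD-All {λ x → x ≤ length w} z≤n (≤-refl ∷ b) c))
... | lw rewrite nthD-addCol w (toT n C) i lw (subst (length w ≤_) (sym (length-toT′ n C)) l) = go c li
  where
  go : ∀ c → i < length (nthD [] (w ∷ C) c) → nthD 0 (nthD 0 w i ∷ nthD [] (toT n C) i) c ≡ nthD 0 (nthD [] (w ∷ C) c) i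
  go zero li = refl
  go (suc c) li = row-entry n C d ls c i li

length-dn₀ : ∀ n → length (dn 0 n) ≡ n
length-dn₀ zero = refl
length-dn₀ (suc n) = cong suc (length-dn₀ n)

nthD-dn : ∀ n i → i < n → nthD 0 (dn 0 n) i ≡ n ∸ i
nthD-dn (suc n) zero l = refl
nthD-dn (suc n) (suc i) (s≤s l) = nthD-dn n i l

ok-elim : ∀ v w → ok v w ≡ true → ∀ i j → i < j → j < length w → Free (nthD 0 v i) (nthD 0 w i) (nthD 0 w j)
ok-elim (x ∷ v) (y ∷ w) h zero (suc j) l (s≤s l') = free-true⁻ x y _ (all-up⁻ (length w) (subst (λ t → all (free x y) t ≡ true) (list-up 0 w) (proj₁ (∧-true {all (free x y) w} h))) j l')
ok-elim (x ∷ v) (y ∷ w) h (suc i) (suc j) (s≤s l) (s≤s l') = ok-elim v w (proj₂ (∧-true {all (free x y) w} h)) i j l l'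

ok-intro : ∀ v w → length w ≤ length v → (∀ i j → i < j → j < length w → Free (nthD 0 v i) (nthD 0 w i) (nthD 0 w j)) → ok v w ≡ true
ok-intro v [] l h = refl
ok-intro (x ∷ v) (y ∷ w) (s≤s l) h = ∧-intro
  (subst (λ t → all (free x y) t ≡ true) (sym (list-up 0 w)) (all-up⁺ (length w) λ j l' → free-true x y _ (h 0 (suc j) (s≤s z≤n) (s≤s l'))))
  (ok-intro v w l λ i j a b → h (suc i) (suc j) (s≤s a) (s≤s b))

chain : List ℕ → List (List ℕ) → Bool
chain v [] = true
chain v (w ∷ C) = ok v w ∧ chain w C

chain-elim : ∀ v C → chain v C ≡ true → ∀ c i j → i < j → j < length (nthD [] C c) →
             Free (nthD 0 (nthD [] (v ∷ C) c) i) (nthD 0 (nthD [] C c) i) (nthD 0 (nthD [] C c) j)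
chain-elim v (w ∷ C) h zero i j l l' = ok-elim v w (proj₁ (∧-true {ok v w} h)) i j l l'
chain-elim v (w ∷ C) h (suc c) i j l l' = chain-elim w C (proj₂ (∧-true {ok v w} h)) c i j l l'

chain-intro : ∀ v C → All (_≤ length v) (map length C) → Dec≥ (map length C) →
              (∀ c i j → i < j → j < length (nthD [] C c) → Free (nthD 0 (nthD [] (v ∷ C) c) i) (nthD 0 (nthD [] C c) i) (nthD 0 (nthD [] C c) j)) →
              chain v C ≡ true
chain-intro v [] b d h = refl
chain-intro v (w ∷ C) (l ∷ _) (b , d) h = ∧-intro (ok-intro v w l (h 0)) (chain-intro w C b d (h ∘ suc))

flip-< : ∀ n i → i < n → n ∸ suc i < n
flip-< (suc n) i l = s≤s (ℕₚ.m∸n≤m n i)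

flip-suc : ∀ n i → i < n → suc (n ∸ suc i) ≡ n ∸ i
flip-suc n i l = sym (ℕₚ.+-∸-assoc 1 l)

flip-flip : ∀ n i → i < n → n ∸ suc (n ∸ suc i) ≡ i
flip-flip n i l = cong (n ∸_) (flip-suc n i l) ∙ ℕₚ.m∸[m∸n]≡n (<⇒≤ l)

flip-mono : ∀ {n i j} → i < j → j < n → n ∸ suc j < n ∸ suc i
flip-mono {suc n} (s≤s l) (s≤s l') = ℕₚ.∸-monoʳ-< (s≤s l) l'

-- Row r of the tabloid is row n ∸ r from the top.
module Columns (n : ℕ) (C : List (List ℕ)) (dec : Dec≥ (map length C)) (bd : All (_≤ n) (map length C)) where

  rows : List (List ℕ)
  rows = reverse (toT n C)

  open Tabloid (map length rows) n rows hiding (coinv; wt)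

  private
    module Tab = Tabloid (map length rows) n rows

  g : ℕ → ℕ → ℕ
  g c i = nthD 0 (nthD [] (dn 0 n ∷ C) c) i

  len : ℕ → ℕ
  len c = length (nthD [] (dn 0 n ∷ C) c)

  nth-row : ∀ r → r < n → nthD [] rows r ≡ nthD [] (toT n C) (n ∸ suc r)
  nth-row r l = nthD-reverse [] (toT n C) r (subst (r <_) (sym (length-toT′ n C)) l) ∙ cong (λ t → nthD [] (toT n C) (t ∸ suc r)) (length-toT′ n C)

  rowLen-wt : ∀ r → r < n → rowLen (suc r) ≡ wt (map length C) (n ∸ suc r)
  rowLen-wt r l = nthD-length rows r ∙ cong length (nth-row r l) ∙ sym (nthD-length (toT n C) (n ∸ suc r)) ∙
    cong (λ t → nthD 0 t (n ∸ suc r)) (length-toT n C) ∙ nthD-up 0 n _ _ (flip-< n r l)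

  len-nth : ∀ c → len c ≡ nthD 0 (n ∷ map length C) c
  len-nth zero = length-dn₀ n
  len-nth (suc c) = sym (nthD-length C c)

  rowLen-len : ∀ r c → r < n → c ≤ rowLen (suc r) → n ∸ suc r < len c
  rowLen-len r c l h = subst (n ∸ suc r <_) (sym (len-nth c)) (proj₁ (wt-col n _ _ c dec (flip-< n r l)) (subst (c ≤_) (rowLen-wt r l) h))

  len-rowLen : ∀ r c → r < n → n ∸ suc r < len c → c ≤ rowLen (suc r)
  len-rowLen r c l h = subst (c ≤_) (sym (rowLen-wt r l)) (proj₂ (wt-col n _ _ c dec (flip-< n r l)) (subst (n ∸ suc r <_) (len-nth c) h))

  ent-g : ∀ r c → r < n → c ≤ rowLen (suc r) → ent (suc r , c) ≡ g c (n ∸ suc r)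
  ent-g r zero l h = sym (nthD-dn n (n ∸ suc r) (flip-< n r l) ∙ ℕₚ.m∸[m∸n]≡n l)
  ent-g r (suc c) l h = cong (λ t → nthD 0 t c) (nth-row r l) ∙ row-entry n C dec bd c (n ∸ suc r) (rowLen-len r (suc c) l h)

  all-cells⁻ : ∀ f → all f cells ≡ true → ∀ r c → r < n → c ≤ rowLen (suc r) → f (suc r , c) ≡ true
  all-cells⁻ f h r c l l' = all-up⁻ (suc (rowLen (suc r))) {g = id} {f = λ c → f (suc r , c)}
    (sym (all-map f (λ c → suc r , c) (range0 (rowLen (suc r)))) ∙
      all-up⁻ n {g = id} {f = λ r → all f (map (λ c → suc r , c) (range0 (rowLen (suc r))))} (sym (all-concatMap f _ (from1 n) ∙ all-map (λ r → all f (map (λ c → r , c) (range0 (rowLen r)))) suc (upTo n)) ∙ h) r l) c (s≤s l')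

  all-cells⁺ : ∀ f → (∀ r c → r < n → c ≤ rowLen (suc r) → f (suc r , c) ≡ true) → all f cells ≡ true
  all-cells⁺ f h = all-concatMap f _ (from1 n) ∙ all-map (λ r → all f (map (λ c → r , c) (range0 (rowLen r)))) suc (upTo n) ∙
    all-up⁺ n {g = id} {f = λ r → all f (map (λ c → suc r , c) (range0 (rowLen (suc r))))} λ r l → all-map f (λ c → suc r , c) (range0 (rowLen (suc r))) ∙ all-up⁺ (suc (rowLen (suc r))) {g = id} {f = λ c → f (suc r , c)} λ c l' → h r c l (≤-pred l')

  rowLen-mono : ∀ r s → r ≤ s → s < n → rowLen (suc r) ≤ rowLen (suc s)
  rowLen-mono r s rs l = len-rowLen s _ l (≤-<-trans (ℕₚ.∸-monoʳ-≤ n (s≤s rs)) (rowLen-len r _ (≤-<-trans rs l) ≤-refl))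

  NA : Set
  NA = ∀ r c s d → r < n → c ≤ rowLen (suc r) → s < n → d ≤ rowLen (suc s) → attacksDir (suc r , c) (suc s , d) ≡ true → ent (suc r , c) ≢ ent (suc s , d)

  -- Row lengths weakly increase upwards, so a triple has its third cell below, in the column of the
  -- right-hand cell.
  NC : Set
  NC = ∀ r s c → r < n → s < r → suc c ≤ rowLen (suc s) → NoCoinv (ent (suc r , c)) (ent (suc r , suc c)) (ent (suc s , suc c))

  COK : Set
  COK = ∀ c i j → i < j → j < len (suc c) → Free (g c i) (g (suc c) i) (g (suc c) j)

  na⁻ : nonAttacking ≡ true → NA
  na⁻ h r c s d lr lc ls ld at e = nand⁻ (all-cells⁻ _ (all-cells⁻ _ h r c lr lc) s d ls ld) at (subst (λ t → (ent (suc r , c) ≡ᵇ t) ≡ true) e (≡ᵇ-refl (ent (suc r , c))))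

  na⁺ : NA → nonAttacking ≡ true
  na⁺ h = all-cells⁺ _ λ r c lr lc → all-cells⁺ _ λ s d ls ld → nand⁺ λ at e → h r c s d lr lc ls ld at (≡ᵇ-true e)

  nc⁻ : noCoinv ≡ true → NC
  nc⁻ h r s c lr ls lc = coinv-false⁻ _ _ _ (not-true (λ e → nand⁻ triple (∧-intro (<ᵇ-true (s≤s ls)) (∧-intro (≤ᵇ-true (rowLen-mono s r (<⇒≤ ls) lr)) (≤ᵇ-true lc))) e))
    where
    lc' : suc c ≤ rowLen (suc r)
    lc' = ≤-trans lc (rowLen-mono s r (<⇒≤ ls) lr)
    not-true : ∀ {b} → (b ≡ true → ⊥) → b ≡ false
    not-true {true} k = ⊥-elim (k refl)
    not-true {false} k = refl
    both : noCoinvAt (suc r , c) ≡ true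
    both = all-cells⁻ _ h r c lr (<⇒≤ lc')
    strip : ∀ {a b} → a ≡ true → not a ∨ b ≡ true → b ≡ true
    strip refl e = e
    P : ℕ → Bool
    P s = not ((s <ᵇ suc r) ∧ (rowLen s ≤ᵇ rowLen (suc r)) ∧ (suc c ≤ᵇ rowLen s)) ∨ not (coinv (ent (suc r , c)) (ent (suc r , suc c)) (ent (s , suc c)))
    triple : P (suc s) ≡ true
    triple = all-up⁻ n (sym (all-map P suc (upTo n)) ∙ proj₂ (∧-true {all _ (from1 n)} (strip {suc c ≤ᵇ rowLen (suc r)} (≤ᵇ-true lc') both))) s (<-trans ls lr)

  nc⁺ : NC → noCoinv ≡ true
  nc⁺ h = all-cells⁺ _ λ r c lr lc → noCoinvAt⁺ r c lr
    where
    noCoinvAt⁺ : ∀ r c → r < n → noCoinvAt (suc r , c) ≡ true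
    noCoinvAt⁺ r c lr with suc c ≤ᵇ rowLen (suc r)
    ... | false = refl
    ... | true = ∧-intro
      (all-map P₁ suc (upTo n) ∙ all-up⁺ n λ s ls → nand⁺ λ hyp _ → let q₁ = ∧-true {suc r <ᵇ suc s} hyp ; q₂ = ∧-true {rowLen (suc s) <ᵇ rowLen (suc r)} (proj₂ q₁) in
        <⇒≱ (<ᵇ-true⁻ (proj₁ q₂)) (rowLen-mono r s (<⇒≤ (≤-pred (<ᵇ-true⁻ (proj₁ q₁)))) ls))
      (all-map P₂ suc (upTo n) ∙ all-up⁺ n λ s ls → nand⁺ λ hyp e → let q₁ = ∧-true {suc s <ᵇ suc r} hyp ; q₂ = ∧-true {rowLen (suc s) ≤ᵇ rowLen (suc r)} (proj₂ q₁) in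
        case trans (sym e) (coinv-false _ _ _ (h r s c lr (≤-pred (<ᵇ-true⁻ (proj₁ q₁))) (≤ᵇ-true⁻ (proj₂ q₂)))) of λ ())
      where
      P₁ P₂ : ℕ → Bool
      P₁ s = not ((suc r <ᵇ s) ∧ (rowLen s <ᵇ rowLen (suc r)) ∧ (c ≤ᵇ rowLen s)) ∨ not (coinv (ent (suc r , c)) (ent (suc r , suc c)) (ent (s , c)))
      P₂ s = not ((s <ᵇ suc r) ∧ (rowLen s ≤ᵇ rowLen (suc r)) ∧ (suc c ≤ᵇ rowLen s)) ∨ not (coinv (ent (suc r , c)) (ent (suc r , suc c)) (ent (s , suc c)))

  len≤n : ∀ c → len c ≤ n
  len≤n c = subst (_≤ n) (sym (len-nth c)) (nthD-All {λ x → x ≤ n} z≤n (≤-refl ∷ bd) c)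

  to-COK : NA → NC → COK
  to-COK na nc c i j ij lj = same , diag , tri
    where
    j<n : j < n
    j<n = <-≤-trans lj (len≤n (suc c))
    i<n : i < n
    i<n = <-trans ij j<n
    r s : ℕ
    r = n ∸ suc i
    s = n ∸ suc j
    r<n : r < n
    r<n = flip-< n i i<n
    s<n : s < n
    s<n = flip-< n j j<n
    s<r : s < r
    s<r = flip-mono ij j<n
    ls : suc c ≤ rowLen (suc s)
    ls = len-rowLen s (suc c) s<n (subst (_< len (suc c)) (sym (flip-flip n j j<n)) lj)
    lr : suc c ≤ rowLen (suc r)
    lr = ≤-trans ls (rowLen-mono s r (<⇒≤ s<r) r<n)
    e₁ : ent (suc r , c) ≡ g c i
    e₁ = ent-g r c r<n (<⇒≤ lr) ∙ cong (g c) (flip-flip n i i<n)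
    e₂ : ent (suc r , suc c) ≡ g (suc c) i
    e₂ = ent-g r (suc c) r<n lr ∙ cong (g (suc c)) (flip-flip n i i<n)
    e₃ : ent (suc s , suc c) ≡ g (suc c) j
    e₃ = ent-g s (suc c) s<n ls ∙ cong (g (suc c)) (flip-flip n j j<n)
    same : g (suc c) j ≢ g (suc c) i
    same e = na r (suc c) s (suc c) r<n lr s<n ls (cong₂ (λ a b → (a ∧ not b) ∨ ((c ≡ᵇ suc c) ∧ (suc s <ᵇ suc r))) (≡ᵇ-refl c) (≡ᵇ-false (λ q → <⇒≢ s<r (sym q)))) (e₂ ∙ sym e ∙ sym e₃)
    diag : g (suc c) j ≢ g c i
    diag e = na r c s (suc c) r<n (<⇒≤ lr) s<n ls (cong₂ (λ a b → (a ∧ not (r ≡ᵇ s)) ∨ (b ∧ (suc s <ᵇ suc r))) (≡ᵇ-false {c} {suc c} (λ q → <⇒≢ (n<1+n c) q)) (≡ᵇ-refl c) ∙ <ᵇ-true s<r) (e₁ ∙ sym e ∙ sym e₃)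
    tri : NoCoinv (g c i) (g (suc c) i) (g (suc c) j)
    tri = subst (λ (x , y , z) → NoCoinv x y z) (cong₂ _,_ e₁ (cong₂ _,_ e₂ e₃)) (nc r s c r<n s<r ls)

  from-COK-na : COK → NA
  from-COK-na h r c s d lr lc ls ld at e with (c ≡ᵇ d) ∧ not (r ≡ᵇ s) in same
  from-COK-na h r c s d lr lc ls ld at e | true with ∧-true {c ≡ᵇ d} same
  ... | cd , rs with ≡ᵇ-true {c} {d} cd
  from-COK-na h r zero s .zero lr lc ls ld at e | true | cd , rs | refl = case trans (sym rs) (cong not (subst (λ t → (r ≡ᵇ t) ≡ true) (suc-injective e) (≡ᵇ-refl r))) of λ ()
  from-COK-na h r (suc c) s .(suc c) lr lc ls ld at e | true | cd , rs | refl with ℕₚ.<-cmp r s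
  ... | Rel.tri≈ _ refl _ = case trans (sym rs) (cong not (≡ᵇ-refl r)) of λ ()
  ... | Rel.tri< l _ _ = proj₁ (h c (n ∸ suc s) (n ∸ suc r) (flip-mono l ls) (rowLen-len r (suc c) lr lc)) (sym (ent-g r (suc c) lr lc) ∙ e ∙ ent-g s (suc c) ls ld)
  ... | Rel.tri> _ _ l = proj₁ (h c (n ∸ suc r) (n ∸ suc s) (flip-mono l lr) (rowLen-len s (suc c) ls ld)) (sym (ent-g s (suc c) ls ld) ∙ sym e ∙ ent-g r (suc c) lr lc)
  from-COK-na h r c s d lr lc ls ld at e | false with ∧-true {d ≡ᵇ suc c} at
  ... | cd , sr with ≡ᵇ-true {d} {suc c} cd
  ... | refl = proj₁ (proj₂ (h c (n ∸ suc r) (n ∸ suc s) (flip-mono (<ᵇ-true⁻ {s} sr) lr) (rowLen-len s (suc c) ls ld))) (sym (ent-g s (suc c) ls ld) ∙ sym e ∙ ent-g r c lr lc)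

  from-COK-nc : COK → NC
  from-COK-nc h r s c lr sr ls = subst (λ (x , y , z) → NoCoinv x y z) (sym (cong₂ _,_ (ent-g r c lr (<⇒≤ lc)) (cong₂ _,_ (ent-g r (suc c) lr lc) (ent-g s (suc c) (<-trans sr lr) ls))))
    (proj₂ (proj₂ (h c (n ∸ suc r) (n ∸ suc s) (flip-mono sr lr) (rowLen-len s (suc c) (<-trans sr lr) ls))))
    where
    lc : suc c ≤ rowLen (suc r)
    lc = ≤-trans ls (rowLen-mono s r (<⇒≤ sr) lr)

  chain-tabloid : nonAttacking ∧ noCoinv ≡ chain (dn 0 n) C
  chain-tabloid = Bool-ext
    (λ h → let q = ∧-true {nonAttacking} h in chain-intro (dn 0 n) C (subst (λ t → All (_≤ t) (map length C)) (sym (length-dn₀ n)) bd) dec (to-COK (na⁻ (proj₁ q)) (nc⁻ (proj₂ q))))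
    λ h → ∧-intro (na⁺ (from-COK-na (chain-elim (dn 0 n) C h))) (nc⁺ (from-COK-nc (chain-elim (dn 0 n) C h)))

-- Weight, maj and the raising operators in terms of columns.

module _ {A : Set} where
  ∑-reverse : (xs : List A) (f : A → ℤ) → ∑ (reverse xs) f ≡ ∑ xs f
  ∑-reverse [] f = refl
  ∑-reverse (x ∷ xs) f = cong (λ l → ∑ l f) (Listₚ.unfold-reverse x xs) ∙ ∑-++ (reverse xs) _ f ∙
    cong₂ _+_ (∑-reverse xs f) (+-identityʳ (f x)) ∙ ℤₚ.+-comm (∑ xs f) (f x)

  ∑-concat : (T : List (List A)) (f : A → ℤ) → ∑ (concat T) f ≡ ∑ T λ R → ∑ R f
  ∑-concat [] f = refl
  ∑-concat (R ∷ T) f = ∑-++ R (concat T) f ∙ +ˡ (∑ R f) (∑-concat T f)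

  sum-∑ : (f : A → ℕ) → ∀ xs → + sum (map f xs) ≡ ∑ xs λ x → + f x
  sum-∑ f [] = refl
  sum-∑ f (x ∷ xs) = pos-+ (f x) _ ∙ +ˡ (+ f x) (sum-∑ f xs)

  map-up : {B : Set} (d : A) (f : A → B) (xs : List A) → map f xs ≡ applyUpTo (λ i → f (nthD d xs i)) (length xs)
  map-up d f [] = refl
  map-up d f (x ∷ xs) = cong (f x ∷_) (map-up d f xs)

∑-toT-rows : ∀ n C → All (_≤ n) (map length C) → (f : ℕ → ℤ) → ∑ (toT n C) (λ R → ∑ R f) ≡ ∑ (concat C) f
∑-toT-rows n [] b f = go n
  where
  go : ∀ n → ∑ (replicate n []) (λ R → ∑ R f) ≡ 0ℤ
  go zero = refl
  go (suc n) = +-identityˡ _ ∙ go n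
∑-toT-rows n (w ∷ C) (l ∷ b) f = go w (toT n C) (subst (length w ≤_) (sym (length-toT′ n C)) l) ∙
  +ˡ (∑ w f) (∑-toT-rows n C b f) ∙ sym (∑-++ w (concat C) f)
  where
  go : ∀ w T → length w ≤ length T → ∑ (addCol w T) (λ R → ∑ R f) ≡ ∑ w f + ∑ T λ R → ∑ R f
  go [] T l = sym (+-identityˡ _)
  go (x ∷ w) (R ∷ T) (s≤s l) = +ˡ (f x + ∑ R f) (go w T l) ∙ +-exchange (f x) (∑ R f) (∑ w f) _

hd : ℕ → List ℕ → ℕ
hd x [] = 0
hd x (y ∷ R) = if x <ᵇ y then suc (length R) else 0

majR : List ℕ → ℕ
majR [] = 0
majR (x ∷ R) = hd x R ℕ.+ majR R

rowMaj : ℕ → List ℕ → ℕ → ℕ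
rowMaj L R zero = 0
rowMaj L R (suc c) = if (suc (suc c) ≤ᵇ L) ∧ (nthD 0 R c <ᵇ nthD 0 R (suc c)) then L ∸ suc c else 0

∑-rowMaj : ∀ R → ∑ (range0 (length R)) (λ c → + rowMaj (length R) R c) ≡ + majR R
∑-rowMaj R = +-identityˡ _ ∙ ∑-applyUpTo (length R) suc _ ∙ go R
  where
  go : ∀ R → ∑ (range (length R)) (λ c → + rowMaj (length R) R (suc c)) ≡ + majR R
  go [] = refl
  go (x ∷ []) = refl
  go (x ∷ y ∷ R) = ∑-range-bot (suc (length R)) (λ c → + rowMaj (suc (suc (length R))) (x ∷ y ∷ R) (suc c)) ∙
    +ˡ (+ hd x (y ∷ R)) (go (y ∷ R)) ∙ sym (pos-+ (hd x (y ∷ R)) _)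

hds : List ℕ → List (List ℕ) → ℕ
hds [] T = 0
hds (x ∷ w) [] = 0
hds (x ∷ w) (R ∷ T) = hd x R ℕ.+ hds w T

∑-majR-addCol : ∀ w T → length w ≤ length T → ∑ (addCol w T) (λ R → + majR R) ≡ + hds w T + ∑ T λ R → + majR R
∑-majR-addCol [] T l = sym (+-identityˡ _)
∑-majR-addCol (x ∷ w) (R ∷ T) (s≤s l) = cong₂ _+_ (pos-+ (hd x R) (majR R)) (∑-majR-addCol w T l) ∙
  +-exchange (+ hd x R) (+ majR R) (+ hds w T) (∑ T λ R → + majR R) ∙ +ʳ (+ majR R + ∑ T λ R → + majR R) (sym (pos-+ (hd x R) (hds w T)))

tcost : (ℕ → ℕ) → List ℕ → List ℕ → ℕ
tcost f [] w = 0
tcost f (x ∷ v) [] = 0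
tcost f (x ∷ v) (y ∷ w) = (if x <ᵇ y then f 0 else 0) ℕ.+ tcost (f ∘ suc) v w

-- maj regrouped by pairs of neighbouring columns: in each row with an ascent between them, the
-- cells from the right-hand column on are counted.
cost : List ℕ → List (List ℕ) → ℕ
cost v [] = 0
cost v (w ∷ C) = tcost (wt (map length (w ∷ C))) v w ℕ.+ cost w C

hds-addCol : ∀ f w w' T → length w' ≤ length w → length w' ≤ length T →
             (∀ i → i < length w' → f i ≡ suc (length (nthD [] T i))) → (∀ i → length w' ≤ i → nthD [] T i ≡ []) →
             hds w (addCol w' T) ≡ tcost f w w'
hds-addCol f [] [] T l l' h h' = refl
hds-addCol f (x ∷ w) [] T l l' h h' = go (x ∷ w) T (λ i → h' i z≤n)
  where
  go : ∀ w T → (∀ i → nthD [] T i ≡ []) → hds w T ≡ 0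
  go [] T h = refl
  go (x ∷ w) [] h = refl
  go (x ∷ w) (R ∷ T) h rewrite h 0 = go w T (h ∘ suc)
hds-addCol f (x ∷ w) (y ∷ w') (R ∷ T) (s≤s l) (s≤s l') h h' = cong₂ ℕ._+_ (cong (if x <ᵇ y then_else 0) (sym (h 0 (s≤s z≤n))))
  (hds-addCol (f ∘ suc) w w' T l l' (λ i a → h (suc i) (s≤s a)) (λ i a → h' (suc i) (s≤s a)))

nthD-up-0 : ∀ n f i → f i ≡ 0 → nthD 0 (applyUpTo f n) i ≡ 0
nthD-up-0 zero f i h = refl
nthD-up-0 (suc n) f zero h = h
nthD-up-0 (suc n) f (suc i) h = nthD-up-0 n (f ∘ suc) i h

length-0 : ∀ (R : List ℕ) → length R ≡ 0 → R ≡ []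
length-0 [] h = refl

maj-cost : ∀ n w C → Dec≥ (map length (w ∷ C)) → All (_≤ n) (map length (w ∷ C)) → ∑ (toT n (w ∷ C)) (λ R → + majR R) ≡ + cost w C
maj-cost n w [] d (l ∷ b) = ∑-majR-addCol w (replicate n []) (subst (length w ≤_) (sym (length-toT′ n [])) l) ∙
  cong₂ (λ a b → + a + b) (go₁ w n) (go₂ n) ∙ refl
  where
  go₁ : ∀ w n → hds w (replicate n []) ≡ 0
  go₁ [] n = refl
  go₁ (x ∷ w) zero = refl
  go₁ (x ∷ w) (suc n) = go₁ w n
  go₂ : ∀ n → ∑ (replicate n []) (λ R → + majR R) ≡ 0ℤ
  go₂ zero = refl
  go₂ (suc n) = +-identityˡ _ ∙ go₂ n
maj-cost n w (w' ∷ C) ((l₀ ∷ _) , b₁ , d) (l ∷ l₁ ∷ b) =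
  ∑-majR-addCol w (toT n (w' ∷ C)) (subst (length w ≤_) (sym (length-toT′ n (w' ∷ C))) l) ∙
    cong₂ (λ a b → + a + b) (hds-addCol (wt (map length (w' ∷ C))) w w' (toT n C) l₀ (subst (length w' ≤_) (sym (length-toT′ n C)) l₁) inside outside)
        (maj-cost n w' C (b₁ , d) (l₁ ∷ b)) ∙
      sym (pos-+ (tcost (wt (map length (w' ∷ C))) w w') _)
  where
  row : ∀ i → length (nthD [] (toT n C) i) ≡ nthD 0 (applyUpTo (wt (map length C)) n) i
  row i = sym (nthD-length (toT n C) i) ∙ cong (λ t → nthD 0 t i) (length-toT n C)
  inside : ∀ i → i < length w' → wt (map length (w' ∷ C)) i ≡ suc (length (nthD [] (toT n C) i))
  inside i a rewrite <ᵇ-true a = cong suc (sym (row i ∙ nthD-up 0 n _ i (<-≤-trans a l₁)))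
  outside : ∀ i → length w' ≤ i → nthD [] (toT n C) i ≡ []
  outside i a = length-0 _ (row i ∙ nthD-up-0 n (wt (map length C)) i (wt-zero (map length C) i (All≤-trans a b₁)))

colsMaj : List (List ℕ) → ℕ
colsMaj [] = 0
colsMaj (w ∷ C) = cost w C

has : ℕ → List ℕ → Bool
has i w = any (λ x → x ≡ᵇ i) w

-- Dominance of the i-th over the (i+1)-st weight along the prefixes.
ok2 : ℤ → ℤ → List (Bool × Bool) → Bool
ok2 a b [] = true
ok2 a b ((p , q) ∷ l) = does (b + [ q ]ᵇ ℤₚ.≤? a + [ p ]ᵇ) ∧ ok2 (a + [ p ]ᵇ) (b + [ q ]ᵇ) l

does-≤ : ∀ {a b} → a ℤ.≤ b → does (a ℤₚ.≤? b) ≡ true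
does-≤ {a} {b} l with a ℤₚ.≤? b
... | yes _ = refl
... | no h = ⊥-elim (h l)

does-≰ : ∀ {a b} → ¬ a ℤ.≤ b → does (a ℤₚ.≤? b) ≡ false
does-≰ {a} {b} h with a ℤₚ.≤? b
... | yes l = ⊥-elim (h l)
... | no _ = refl

+-1-swap : ∀ b k → b + (1ℤ + k) ≡ (b + k) + 1ℤ
+-1-swap = solve-∀

-- The number of unpaired letters i is the surplus of i over i + 1 in the prefix read so far. An
-- unpaired i + 1 appears precisely when this surplus would become negative.
scan-ok2 : ∀ {bc n T} l k b → not (Tabloid.scan bc n T l k) ≡ ok2 (b + + k) b l
scan-ok2 [] k b = refl
scan-ok2 {bc} {n} {T} ((true , true) ∷ l) k b rewrite does-≤ {b + 1ℤ} {b + + k + 1ℤ} (ℤₚ.+-monoˡ-≤ 1ℤ (ℤₚ.i≤i+j b (+ k))) =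
  scan-ok2 {bc} {n} {T} l k (b + 1ℤ) ∙ cong (λ t → ok2 t (b + 1ℤ) l) (+-1-shift b (+ k))
scan-ok2 {bc} {n} {T} ((true , false) ∷ l) k b rewrite does-≤ {b + 0ℤ} {b + + k + 1ℤ} (subst (b + 0ℤ ℤ.≤_) (+-1-swap b (+ k)) (ℤₚ.+-monoʳ-≤ b (ℤ.+≤+ z≤n))) =
  scan-ok2 {bc} {n} {T} l (suc k) b ∙ cong₂ (λ s t → ok2 s t l) (lem b (+ k)) (sym (+-identityʳ b))
  where
  lem : ∀ b k → b + (1ℤ + k) ≡ (b + k) + 1ℤ
  lem = solve-∀
scan-ok2 {bc} {n} {T} ((false , true) ∷ l) zero b rewrite does-≰ {b + 1ℤ} {b + 0ℤ + 0ℤ} (λ h → ℤₚ.<⇒≱ (ℤₚ.+-monoʳ-< b (ℤ.+<+ (s≤s z≤n))) (subst (b + 1ℤ ℤ.≤_) (+-identityʳ (b + 0ℤ)) h)) = refl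
scan-ok2 {bc} {n} {T} ((false , true) ∷ l) (suc k) b rewrite does-≤ {b + 1ℤ} {b + + suc k + 0ℤ} (subst (b + 1ℤ ℤ.≤_) (sym (+-identityʳ (b + + suc k))) (ℤₚ.+-monoʳ-≤ b (ℤ.+≤+ (s≤s z≤n)))) =
  scan-ok2 {bc} {n} {T} l k (b + 1ℤ) ∙ cong (λ t → ok2 t (b + 1ℤ) l) (+-1-shift-0 b (+ k))
scan-ok2 {bc} {n} {T} ((false , false) ∷ l) k b rewrite does-≤ {b + 0ℤ} {b + + k + 0ℤ} (ℤₚ.+-monoˡ-≤ 0ℤ (ℤₚ.i≤i+j b (+ k))) =
  scan-ok2 {bc} {n} {T} l k b ∙ cong₂ (λ s t → ok2 s t l) (sym (+-identityʳ (b + + k))) (sym (+-identityʳ b))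

max-≤ : ∀ K l → (∀ k → nthD 0 l k ≤ K) → foldr ℕ._⊔_ 0 l ≤ K
max-≤ K [] h = z≤n
max-≤ K (x ∷ l) h = ℕₚ.⊔-lub (h 0) (max-≤ K l (h ∘ suc))

nth≤max : ∀ l k → nthD 0 l k ≤ foldr ℕ._⊔_ 0 l
nth≤max [] k = z≤n
nth≤max (x ∷ l) zero = ℕₚ.m≤m⊔n x _
nth≤max (x ∷ l) (suc k) = ≤-trans (nth≤max l k) (ℕₚ.m≤n⊔m x _)

wt≤ : ∀ μ i → wt μ i ≤ length μ
wt≤ [] i = z≤n
wt≤ (h ∷ μ) i = ℕₚ.+-mono-≤ (one (i <ᵇ h)) (wt≤ μ i)
  where
  one : ∀ b → (if b then 1 else 0) ≤ 1
  one true = s≤s z≤n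
  one false = z≤n

wt-all : ∀ μ → All (1 ≤_) μ → wt μ 0 ≡ length μ
wt-all [] [] = refl
wt-all (suc h ∷ μ) (p ∷ ps) = cong suc (wt-all μ ps)

module Statistics (n : ℕ) (C : List (List ℕ)) (dec : Dec≥ (map length C)) (bd : All (_≤ n) (map length C)) (pos : All (1 ≤_) (map length C)) where

  open Columns n C dec bd
  private
    module Tab = Tabloid (map length rows) n rows

  wt-tabloid : Tab.wt ≡ map (λ p → countᵇ (λ x → x ≡ᵇ p) (concat C)) (from1 n)
  wt-tabloid = Listₚ.map-cong (λ p → +-injective (count-∑ _ (concat rows) ∙ ∑-concat rows _ ∙ ∑-reverse (toT n C) _ ∙
    ∑-toT-rows n C bd _ ∙ sym (count-∑ _ (concat C)))) (from1 n)

  length-rows : length rows ≡ n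
  length-rows = Listₚ.length-reverse (toT n C) ∙ length-toT′ n C

  ∑-cells : (F : Cell → ℕ) → (∀ r c → F (suc r , c) ≡ rowMaj (Tab.rowLen (suc r)) (nthD [] rows r) c) → ∑ Tab.cells (λ u → + F u) ≡ ∑ rows λ R → + majR R
  ∑-cells F h = ∑-concatMap (from1 n) _ _ ∙ ∑-map (upTo n) suc _ ∙ ∑-cong (upTo n) row ∙
    ∑-applyUpTo n id _ ∙ cong (λ k → ∑ (range k) (λ r → + majR (nthD [] rows r))) (sym length-rows) ∙ sym (∑-applyUpTo (length rows) (nthD [] rows) _) ∙ cong (λ t → ∑ t (λ R → + majR R)) (sym (list-up [] rows))
    where
    row : ∀ r → ∑ (map (λ c → suc r , c) (range0 (Tab.rowLen (suc r)))) (λ u → + F u) ≡ + majR (nthD [] rows r)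
    row r = ∑-map (range0 (Tab.rowLen (suc r))) (λ c → suc r , c) (λ u → + F u) ∙ (∑-cong (range0 (Tab.rowLen (suc r))) λ c → cong (λ t → + t) (h r c)) ∙
        cong (λ L → ∑ (range0 L) (λ c → + rowMaj L (nthD [] rows r) c)) (nthD-length rows r) ∙ ∑-rowMaj (nthD [] rows r)

  maj-tabloid : Tab.maj ≡ colsMaj C
  maj-tabloid = +-injective (sum-∑ _ Tab.cells ∙ (∑-cells _ λ { r zero → refl ; r (suc c) → refl }) ∙ ∑-reverse (toT n C) _ ∙ go C dec bd)
    where
    go : ∀ C → Dec≥ (map length C) → All (_≤ n) (map length C) → ∑ (toT n C) (λ R → + majR R) ≡ + colsMaj C
    go [] d b = zeros n
      where
      zeros : ∀ n → ∑ (replicate n []) (λ R → + majR R) ≡ 0ℤ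
      zeros zero = refl
      zeros (suc n) = +-identityˡ _ ∙ zeros n
    go (w ∷ C) d b = maj-cost n w C d b

  -- All heights are positive, so the top row meets every column.
  maxLen-length : Tab.maxLen ≡ length C
  maxLen-length = ℕₚ.≤-antisym (max-≤ (length C) (map length rows) bound) (top C refl)
    where
    bound : ∀ r → nthD 0 (map length rows) r ≤ length C
    bound r with <-≤-connex r n
    ... | inj₁ l = subst (_≤ length C) (sym (rowLen-wt r l)) (subst (wt (map length C) (n ∸ suc r) ≤_) (Listₚ.length-map length C) (wt≤ (map length C) _))
    ... | inj₂ l = subst (_≤ length C) (sym (beyond (map length rows) r (subst (_≤ r) (sym (Listₚ.length-map length rows ∙ length-rows)) l))) z≤n
      where
      beyond : ∀ l r → length l ≤ r → nthD 0 l r ≡ 0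
      beyond [] r h = refl
      beyond (x ∷ l) (suc r) (s≤s h) = beyond l r h
    top : ∀ C' → C' ≡ C → length C ≤ Tab.maxLen
    top [] refl = z≤n
    top (w ∷ C') refl = subst (_≤ Tab.maxLen) (rowLen-wt (n ∸ 1) lt ∙ cong (wt (map length C)) (cong (n ∸_) (flip-suc n 0 n>0) ∙ ℕₚ.n∸n≡0 n) ∙
        wt-all (map length C) pos ∙ Listₚ.length-map length C) (nth≤max (map length rows) (n ∸ 1))
      where
      n>0 : 0 < n
      n>0 = ≤-trans (All.head pos) (All.head bd)
      lt : n ∸ 1 < n
      lt = flip-< n 0 n>0

  colHas-has : ∀ c i → Tab.colHas (suc c) i ≡ has i (nthD [] C c)
  colHas-has c i = Bool-ext to from
    where
    col : List ℕ
    col = nthD [] C c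
    to : Tab.colHas (suc c) i ≡ true → has i col ≡ true
    to h with any-up⁻ n {g = id} {f = λ r → (suc c ≤ᵇ Tab.rowLen (suc r)) ∧ (Tab.ent (suc r , suc c) ≡ᵇ i)} (sym (any-map (λ r → (suc c ≤ᵇ Tab.rowLen r) ∧ (Tab.ent (r , suc c) ≡ᵇ i)) suc (upTo n)) ∙ h)
    ... | r , l , e = let q = ∧-true {suc c ≤ᵇ Tab.rowLen (suc r)} e ; lc = ≤ᵇ-true⁻ {suc c} {Tab.rowLen (suc r)} (proj₁ q) in
      trans (cong (any (λ x → x ≡ᵇ i)) (list-up 0 col)) (any-up⁺ (length col) {f = λ x → x ≡ᵇ i} (n ∸ suc r) (rowLen-len r (suc c) l lc)
        (cong (_≡ᵇ i) (sym (ent-g r (suc c) l lc)) ∙ proj₂ q))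
    from : has i col ≡ true → Tab.colHas (suc c) i ≡ true
    from h with any-up⁻ (length col) {g = nthD 0 col} {f = λ x → x ≡ᵇ i} (sym (cong (any (λ x → x ≡ᵇ i)) (list-up 0 col)) ∙ h)
    ... | j , l , e = any-map (λ r → (suc c ≤ᵇ Tab.rowLen r) ∧ (Tab.ent (r , suc c) ≡ᵇ i)) suc (upTo n) ∙
          any-up⁺ n {g = id} (n ∸ suc j) (flip-< n j j<n) (∧-intro (≤ᵇ-true lc) (cong (_≡ᵇ i) (ent-g (n ∸ suc j) (suc c) (flip-< n j j<n) lc ∙ cong (g (suc c)) (flip-flip n j j<n)) ∙ e))
      where
      j<n : j < n
      j<n = <-≤-trans l (len≤n (suc c))
      lc : suc c ≤ Tab.rowLen (suc (n ∸ suc j))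
      lc = len-rowLen (n ∸ suc j) (suc c) (flip-< n j j<n) (subst (_< len (suc c)) (sym (flip-flip n j j<n)) l)

  eZero-ok2 : ∀ i → Tab.eZero i ≡ ok2 0ℤ 0ℤ (map (λ w → has i w , has (suc i) w) C)
  eZero-ok2 i = cong (λ l → not (Tab.scan l 0)) lists ∙ scan-ok2 {map length rows} {n} {rows} (map (λ w → has i w , has (suc i) w) C) 0 0ℤ
    where
    lists : map (λ c → (Tab.colHas c i , Tab.colHas c (suc i))) (from1 Tab.maxLen) ≡ map (λ w → has i w , has (suc i) w) C
    lists = cong (λ k → map (λ c → (Tab.colHas c i , Tab.colHas c (suc i))) (from1 k)) maxLen-length ∙
      sym (Listₚ.map-∘ (upTo (length C))) ∙ Listₚ.map-upTo _ (length C) ∙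
        (applyUpTo-cong (length C) λ c _ → cong₂ _,_ (colHas-has c i) (colHas-has c (suc i))) ∙ sym (map-up [] (λ w → has i w , has (suc i) w) C)

-- The tabloid sum as a highest weight count.

dseq : ∀ n → ℕ → List (List (Vec Bool n))
dseq n zero = [] ∷ []
dseq n (suc k) = concatMap (λ D → map (D ∷_) (dseq n k)) (bits n)

∑-dseq : ∀ n k (F : List (Vec Bool n) → ℤ) → ∑ (dseq n (suc k)) F ≡ ∑ (bits n) λ D → ∑ (dseq n k) λ Ds → F (D ∷ Ds)
∑-dseq n k F = ∑-concatMap (bits n) _ F ∙ ∑-cong (bits n) λ D → ∑-map (dseq n k) (D ∷_) F

sizes : ∀ {n} → List ℕ → List (Vec Bool n) → Bool
sizes [] [] = true
sizes [] (D ∷ Ds) = false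
sizes (h ∷ μ) [] = false
sizes (h ∷ μ) (D ∷ Ds) = (size D ≡ᵇ h) ∧ sizes μ Ds

colsOf : ∀ {n} → List ℕ → List (Vec Bool n) → List (List ℕ)
colsOf v [] = []
colsOf v (D ∷ Ds) = arr v D ∷ colsOf (arr v D) Ds

length-arr-≡ : ∀ {n} v (D : Vec Bool n) h → h ≤ length v → (size D ≡ᵇ h) ≡ true → length (arr v D) ≡ h
length-arr-≡ v D h l sz = length-arr v D (subst (_≤ length v) (sym (≡ᵇ-true sz)) l) ∙ ≡ᵇ-true sz

chain-sum : ∀ n v μ → All (_≤ length v) μ → Dec≥ μ → (F : List (List ℕ) → ℤ) →
            ∑ (fillings μ n) (λ C → chain v C ▸ F C) ≡ ∑ (dseq n (length μ)) λ Ds → sizes μ Ds ▸ F (colsOf v Ds)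
chain-sum n v [] b d F = refl
chain-sum n v (h ∷ μ) (l ∷ _) (b , d) F = ∑-fillings h μ n _ ∙
  (∑-cong (words h n) λ w → (∑-cong (fillings μ n) λ C → ▸-∧ (ok v w) (chain w C) _) ∙ ∑-▸ (fillings μ n) (ok v w) _) ∙
  reindexW n v h l (λ w → ∑ (fillings μ n) λ C → chain w C ▸ F (w ∷ C)) ∙
  (∑-cong (bits n) λ D → (▸-cong (size D ≡ᵇ h) λ sz → chain-sum n (arr v D) μ (subst (λ k → All (_≤ k) μ) (sym (length-arr-≡ v D h l sz)) b) d (F ∘ (arr v D ∷_))) ∙
      sym (∑-▸ (dseq n (length μ)) (size D ≡ᵇ h) _) ∙ ∑-cong (dseq n (length μ)) λ Ds → sym (▸-∧ (size D ≡ᵇ h) (sizes μ Ds) _)) ∙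
    sym (∑-dseq n (length μ) _)

domsD : ∀ {n} → Vec ℤ n → List (Vec Bool n) → Bool
domsD κ [] = true
domsD κ (D ∷ Ds) = dom (κ ∔ D) ∧ domsD (κ ∔ D) Ds

addD : ∀ {n} → Vec ℤ n → List (Vec Bool n) → Vec ℤ n
addD κ [] = κ
addD κ (D ∷ Ds) = addD (κ ∔ D) Ds

costD : ∀ {n} → List ℕ → List ℕ → List (Vec Bool n) → ℕ
costD v μ [] = 0
costD v [] (D ∷ Ds) = 0
costD v (h ∷ μ) (D ∷ Ds) = cst (wt (h ∷ μ)) v D ℕ.+ costD (arr v D) μ Ds

hw-dseq : ∀ {n} (L : Vec ℤ n) φ μ v κ e → hw L φ μ v κ e ≡
          ∑ (dseq n (length μ)) λ Ds → sizes μ Ds ▸ domsD κ Ds ▸ isZ (addD κ Ds -ᵛ L) ▸ φ (e - + costD v μ Ds)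
hw-dseq L φ [] v κ e = sym (+-identityʳ _ ∙ cong (λ t → isZ (κ -ᵛ L) ▸ φ t) (+-identityʳ e))
hw-dseq {n} L φ (h ∷ μ) v κ e = ∑-cong (bits n) step ∙ sym (∑-dseq n (length μ) _)
  where
  step : ∀ D → (size D ≡ᵇ h) ▸ dom (κ ∔ D) ▸ hw L φ μ (arr v D) (κ ∔ D) (e - + cst (wt (h ∷ μ)) v D) ≡
         ∑ (dseq n (length μ)) λ Ds → ((size D ≡ᵇ h) ∧ sizes μ Ds) ▸ (dom (κ ∔ D) ∧ domsD (κ ∔ D) Ds) ▸ isZ (addD (κ ∔ D) Ds -ᵛ L) ▸ φ (e - + costD v (h ∷ μ) (D ∷ Ds))
  step D = cong (λ t → (size D ≡ᵇ h) ▸ dom (κ ∔ D) ▸ t) (hw-dseq L φ μ (arr v D) (κ ∔ D) (e - + cst (wt (h ∷ μ)) v D)) ∙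
    cong ((size D ≡ᵇ h) ▸_) (sym (∑-▸ (dseq n (length μ)) (dom (κ ∔ D)) _)) ∙ sym (∑-▸ (dseq n (length μ)) (size D ≡ᵇ h) _) ∙
      ∑-cong (dseq n (length μ)) λ Ds → sym (▸-∧ (size D ≡ᵇ h) (sizes μ Ds) _ ∙ cong ((size D ≡ᵇ h) ▸_)
        (cong (sizes μ Ds ▸_) (▸-∧ (dom (κ ∔ D)) (domsD (κ ∔ D) Ds) _) ∙ ▸-comm (sizes μ Ds) (dom (κ ∔ D)) _ ∙
          cong (λ t → dom (κ ∔ D) ▸ sizes μ Ds ▸ domsD (κ ∔ D) Ds ▸ isZ (addD (κ ∔ D) Ds -ᵛ L) ▸ φ t)
            (sym (minus-minus e (+ cst (wt (h ∷ μ)) v D) (+ costD (arr v D) μ Ds) ∙ cong (λ t → e - t) (sym (pos-+ (cst (wt (h ∷ μ)) v D) _))))))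

has-arr : ∀ {n} v (D : Vec Bool n) i → size D ≤ length v → has (suc i) (arr v D) ≡ bit i D
has-arr [] D i l = sym (size-bit i D (n≤0⇒n≡0 l))
has-arr (x ∷ v) D i l with pick x D in eq
... | nothing = sym (size-bit i D (pick-nothing x D eq))
... | just (f , j) with has-arr v (clear j D) i (≤-pred (subst (_≤ suc (length v)) (size-clear j D (pick-true x D eq)) l)) | j ℕₚ.≟ i
...   | ih | yes refl rewrite ≡ᵇ-refl j = sym (pick-true x D eq)
...   | ih | no ne rewrite ≡ᵇ-false ne = ih ∙ bit-clear-≢ i j D (ne ∘ sym)

count-arr : ∀ {n} v (D : Vec Bool n) i → size D ≤ length v → countᵇ (λ x → x ≡ᵇ suc i) (arr v D) ≡ (if bit i D then 1 else 0)
count-arr [] D i l = cong (if_then 1 else 0) (sym (size-bit i D (n≤0⇒n≡0 l)))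
count-arr (x ∷ v) D i l with pick x D in eq
... | nothing = cong (if_then 1 else 0) (sym (size-bit i D (pick-nothing x D eq)))
... | just (f , j) with count-arr v (clear j D) i (≤-pred (subst (_≤ suc (length v)) (size-clear j D (pick-true x D eq)) l)) | j ℕₚ.≟ i
...   | ih | yes refl rewrite ≡ᵇ-refl j | bit-clear j D | pick-true x D eq = cong suc ih
...   | ih | no ne rewrite ≡ᵇ-false ne = ih ∙ cong (if_then 1 else 0) (bit-clear-≢ i j D (ne ∘ sym))

tcost-arr : ∀ {n} f v (D : Vec Bool n) → tcost f v (arr v D) ≡ cst f v D
tcost-arr f [] D = refl
tcost-arr f (x ∷ v) D with pick x D in eq
... | nothing = refl
... | just (b , k) = cong₂ (λ b m → (if b then f 0 else 0) ℕ.+ m) flag (tcost-arr (f ∘ suc) v (clear k D))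
  where
  flag : (x <ᵇ suc k) ≡ b
  flag with pick-spec x D eq
  ... | inj₁ (refl , kx , _) = <ᵇ-false kx
  ... | inj₂ (refl , xk , _) = <ᵇ-true (s≤s xk)

domsD-small : ∀ {n} → n ≤ 1 → (κ : Vec ℤ n) → ∀ Ds → domsD κ Ds ≡ true
domsD-small l κ [] = refl
domsD-small l [] ([] ∷ Ds) = domsD-small l [] Ds
domsD-small l (a ∷ []) ((b ∷ []) ∷ Ds) = domsD-small l ((a + [ b ]ᵇ) ∷ []) Ds
domsD-small (s≤s ()) (a ∷ b ∷ κ) (D ∷ Ds)

-- Dominance of a prefix is a condition on each pair of neighbouring letters. Collected over all
-- prefixes, the condition for one pair is the vanishing of one raising operator.
domsD-split : ∀ {n} a b (κ : Vec ℤ n) Ds → domsD (a ∷ b ∷ κ) Ds ≡ ok2 a b (map (λ D → bit 0 D , bit 1 D) Ds) ∧ domsD (b ∷ κ) (map Vec.tail Ds)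
domsD-split a b κ [] = refl
domsD-split a b κ ((p ∷ q ∷ D) ∷ Ds) = cong (dom ((a ∷ b ∷ κ) ∔ (p ∷ q ∷ D)) ∧_) (domsD-split (a + [ p ]ᵇ) (b + [ q ]ᵇ) (κ ∔ D) Ds) ∙
  ∧-exchange (does (b + [ q ]ᵇ ℤₚ.≤? a + [ p ]ᵇ)) (dom ((b ∷ κ) ∔ (q ∷ D))) _ _

pairAt : ∀ {n} → ℕ → Vec Bool n → Bool × Bool
pairAt i D = bit i D , bit (suc i) D

domsD-ok2 : ∀ n (Ds : List (Vec Bool n)) → domsD (0ᵛ {n}) Ds ≡ all (λ i → ok2 0ℤ 0ℤ (map (pairAt i) Ds)) (upTo (n ∸ 1))
domsD-ok2 zero Ds = domsD-small z≤n [] Ds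
domsD-ok2 (suc zero) Ds = domsD-small (s≤s z≤n) (0ℤ ∷ []) Ds
domsD-ok2 (suc (suc n)) Ds = domsD-split 0ℤ 0ℤ 0ᵛ Ds ∙ cong (ok2 0ℤ 0ℤ (map (pairAt 0) Ds) ∧_)
  (domsD-ok2 (suc n) (map Vec.tail Ds) ∙ go (upTo n) ∙ sym (cong (all P) (sym (Listₚ.map-upTo suc n)) ∙ all-map P suc (upTo n)))
  where
  P : ℕ → Bool
  P i = ok2 0ℤ 0ℤ (map (pairAt i) Ds)
  tl : ∀ (Ds : List (Vec Bool (suc (suc n)))) i → map (pairAt i) (map Vec.tail Ds) ≡ map (pairAt (suc i)) Ds
  tl [] i = refl
  tl ((b ∷ D) ∷ Ds) i = cong (pairAt i D ∷_) (tl Ds i)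
  go : ∀ l → all (λ i → ok2 0ℤ 0ℤ (map (pairAt i) (map Vec.tail Ds))) l ≡ all (P ∘ suc) l
  go [] = refl
  go (i ∷ l) = cong₂ _∧_ (cong (ok2 0ℤ 0ℤ) (tl Ds i)) (go l)

countᵇ-++ : ∀ {A : Set} (p : A → Bool) xs ys → countᵇ p (xs ++ ys) ≡ countᵇ p xs ℕ.+ countᵇ p ys
countᵇ-++ p [] ys = refl
countᵇ-++ p (x ∷ xs) ys with p x
... | true = cong suc (countᵇ-++ p xs ys)
... | false = countᵇ-++ p xs ys

+ᵛ-∔ : ∀ {n} (f : Fin n → ℕ) (D : Vec Bool n) → +ᵛ (Vec.tabulate f) ∔ D ≡ +ᵛ (Vec.tabulate λ i → f i ℕ.+ (if bit (toℕ i) D then 1 else 0))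
+ᵛ-∔ f [] = refl
+ᵛ-∔ f (b ∷ D) = cong₂ _∷_ (cong (λ t → + f zero + t) (go b) ∙ sym (pos-+ (f zero) (if b then 1 else 0))) (+ᵛ-∔ (f ∘ suc) D)
  where
  go : ∀ b → [ b ]ᵇ ≡ + (if b then 1 else 0)
  go true = refl
  go false = refl

eqList-isZ : ∀ {n} (α β : Vec ℕ n) → eqListᵇ (toList α) (toList β) ≡ isZ (+ᵛ α -ᵛ +ᵛ β)
eqList-isZ [] [] = refl
eqList-isZ (a ∷ α) (b ∷ β) = cong₂ _∧_ (sym (sub-==0 (+ a) (+ b) ∙ refl)) (eqList-isZ α β)

toList-tabulate : ∀ n (F : ℕ → ℕ) → toList (Vec.tabulate {n = n} (F ∘ toℕ)) ≡ applyUpTo F n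
toList-tabulate zero F = refl
toList-tabulate (suc n) F = cong (F 0 ∷_) (toList-tabulate n (F ∘ suc))

module _ {n : ℕ} where

  cols-length : ∀ v μ (Ds : List (Vec Bool n)) → All (_≤ length v) μ → Dec≥ μ → sizes μ Ds ≡ true → map length (colsOf v Ds) ≡ μ
  cols-length v [] [] b d s = refl
  cols-length v (h ∷ μ) (D ∷ Ds) (l ∷ _) (b , d) s = let q = ∧-true {size D ≡ᵇ h} s ; e = length-arr-≡ v D h l (proj₁ q) in
    cong₂ _∷_ e (cols-length (arr v D) μ Ds (subst (λ k → All (_≤ k) μ) (sym e) b) d (proj₂ q))

  cost-cols : ∀ v μ (Ds : List (Vec Bool n)) → All (_≤ length v) μ → Dec≥ μ → sizes μ Ds ≡ true → cost v (colsOf v Ds) ≡ costD v μ Ds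
  cost-cols v [] [] b d s = refl
  cost-cols v (h ∷ μ) (D ∷ Ds) (l ∷ b') (b , d) s = let q = ∧-true {size D ≡ᵇ h} s ; e = length-arr-≡ v D h l (proj₁ q) in
    cong₂ ℕ._+_ (cong (λ t → tcost (wt t) v (arr v D)) (cols-length v (h ∷ μ) (D ∷ Ds) (l ∷ b') (b , d) s) ∙ tcost-arr (wt (h ∷ μ)) v D)
      (cost-cols (arr v D) μ Ds (subst (λ k → All (_≤ k) μ) (sym e) b) d (proj₂ q))

  -- maj does not count steps from the basement, and there are none to count: next to the basement
  -- every arrangement is free of ascents. So the cost may be started there.
  colsMaj-cols : ∀ μ (Ds : List (Vec Bool n)) → All (_≤ n) μ → Dec≥ μ → sizes μ Ds ≡ true → colsMaj (colsOf (dn 0 n) Ds) ≡ costD (dn 0 n) μ Ds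
  colsMaj-cols [] [] b d s = refl
  colsMaj-cols (h ∷ μ) (D ∷ Ds) (l ∷ _) (b , d) s = let q = ∧-true {size D ≡ᵇ h} s ; e = length-arr-≡ (dn 0 n) D h (subst (h ≤_) (sym (length-dn₀ n)) l) (proj₁ q) in
    trans (cost-cols (arr (dn 0 n) D) μ Ds (subst (λ k → All (_≤ k) μ) (sym e) b) d (proj₂ q)) (cong (ℕ._+ costD (arr (dn 0 n) D) μ Ds) (sym (cst-desc (wt (h ∷ μ)) D)))

  pairs-cols : ∀ i v μ (Ds : List (Vec Bool n)) → All (_≤ length v) μ → Dec≥ μ → sizes μ Ds ≡ true →
               map (λ w → has (suc i) w , has (suc (suc i)) w) (colsOf v Ds) ≡ map (pairAt i) Ds
  pairs-cols i v [] [] b d s = refl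
  pairs-cols i v (h ∷ μ) (D ∷ Ds) (l ∷ _) (b , d) s = let q = ∧-true {size D ≡ᵇ h} s ; e = length-arr-≡ v D h l (proj₁ q) ; l' = subst (_≤ length v) (sym (≡ᵇ-true (proj₁ q))) l in
    cong₂ _∷_ (cong₂ _,_ (has-arr v D i l') (has-arr v D (suc i) l')) (pairs-cols i (arr v D) μ Ds (subst (λ k → All (_≤ k) μ) (sym e) b) d (proj₂ q))

  addD-cols : ∀ (f : Fin n → ℕ) v μ (Ds : List (Vec Bool n)) → All (_≤ length v) μ → Dec≥ μ → sizes μ Ds ≡ true →
              addD (+ᵛ (Vec.tabulate f)) Ds ≡ +ᵛ (Vec.tabulate λ i → f i ℕ.+ countᵇ (λ x → x ≡ᵇ suc (toℕ i)) (concat (colsOf v Ds)))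
  addD-cols f v [] [] b d s = cong +ᵛ (Vecₚ.tabulate-cong λ i → sym (ℕₚ.+-identityʳ (f i)))
  addD-cols f v (h ∷ μ) (D ∷ Ds) (l ∷ _) (b , d) s = let q = ∧-true {size D ≡ᵇ h} s ; e = length-arr-≡ v D h l (proj₁ q) ; l' = subst (_≤ length v) (sym (≡ᵇ-true (proj₁ q))) l in
    trans (cong (λ t → addD t Ds) (+ᵛ-∔ f D)) (addD-cols _ (arr v D) μ Ds (subst (λ k → All (_≤ k) μ) (sym e) b) d (proj₂ q) ∙
      cong +ᵛ (Vecₚ.tabulate-cong λ i → ℕₚ.+-assoc (f i) _ _ ∙ cong (f i ℕ.+_)
        (cong (ℕ._+ countᵇ (λ x → x ≡ᵇ suc (toℕ i)) (concat (colsOf (arr v D) Ds))) (sym (count-arr v D (toℕ i) l')) ∙ sym (countᵇ-++ (λ x → x ≡ᵇ suc (toℕ i)) (arr v D) _))))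

stats : ℕ → List ℕ → ℕ → List (List ℕ) → Bool
stats n tgt k C = eqListᵇ (map (λ p → countᵇ (λ x → x ≡ᵇ p) (concat C)) (from1 n)) tgt
                  ∧ all (λ i → ok2 0ℤ 0ℤ (map (λ w → has i w , has (suc i) w) C)) (from1 (n ∸ 1)) ∧ (colsMaj C ≡ᵇ k)

stats-cols : ∀ n l k μ (Ds : List (Vec Bool n)) → length l ≤ n → All (_≤ n) μ → Dec≥ μ → sizes μ Ds ≡ true →
             stats n (padTo n l) k (colsOf (dn 0 n) Ds) ▸ 1ℤ ≡ domsD 0ᵛ Ds ▸ isZ (addD 0ᵛ Ds -ᵛ +ᵛ (padV n l)) ▸ unit (+ k - + costD (dn 0 n) μ Ds)
stats-cols n l k μ Ds ll b d s = ▸-∧ (eqListᵇ (map cnt# (from1 n)) (padTo n l)) _ 1ℤ ∙ cong (λ t → t ▸ (all (λ i → ok2 0ℤ 0ℤ (map (λ w → has i w , has (suc i) w) C)) (from1 (n ∸ 1)) ∧ (colsMaj C ≡ᵇ k)) ▸ 1ℤ) weights ∙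
    cong (isZ (addD 0ᵛ Ds -ᵛ +ᵛ (padV n l)) ▸_) (▸-∧ (all (λ i → ok2 0ℤ 0ℤ (map (λ w → has i w , has (suc i) w) C)) (from1 (n ∸ 1))) (colsMaj C ≡ᵇ k) 1ℤ ∙ cong₂ _▸_ doms costs) ∙ ▸-comm (isZ (addD 0ᵛ Ds -ᵛ +ᵛ (padV n l))) (domsD 0ᵛ Ds) _
  where
  C : List (List ℕ)
  C = colsOf (dn 0 n) Ds
  b' : All (_≤ length (dn 0 n)) μ
  b' = subst (λ t → All (_≤ t) μ) (sym (length-dn₀ n)) b
  cnt# : ℕ → ℕ
  cnt# p = countᵇ (λ x → x ≡ᵇ p) (concat C)
  zeros : ∀ n → +ᵛ (Vec.tabulate {n = n} λ _ → 0) ≡ 0ᵛ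
  zeros zero = refl
  zeros (suc n) = cong (0ℤ ∷_) (zeros n)
  weights : eqListᵇ (map cnt# (from1 n)) (padTo n l) ≡ isZ (addD 0ᵛ Ds -ᵛ +ᵛ (padV n l))
  weights = cong₂ eqListᵇ (sym (Listₚ.map-∘ (upTo n)) ∙ Listₚ.map-upTo (cnt# ∘ suc) n ∙ sym (toList-tabulate n (cnt# ∘ suc))) (sym (toList-padV n l ll)) ∙
    eqList-isZ (Vec.tabulate (cnt# ∘ suc ∘ toℕ)) (padV n l) ∙ cong (λ t → isZ (t -ᵛ +ᵛ (padV n l))) (sym (cong (λ t → addD t Ds) (sym (zeros n)) ∙ addD-cols (λ _ → 0) (dn 0 n) μ Ds b' d s))
  doms : all (λ i → ok2 0ℤ 0ℤ (map (λ w → has i w , has (suc i) w) C)) (from1 (n ∸ 1)) ≡ domsD 0ᵛ Ds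
  doms = all-map (λ i → ok2 0ℤ 0ℤ (map (λ w → has i w , has (suc i) w) C)) suc (upTo (n ∸ 1)) ∙ go (upTo (n ∸ 1)) ∙ sym (domsD-ok2 n Ds)
    where
    go : ∀ l → all (λ i → ok2 0ℤ 0ℤ (map (λ w → has (suc i) w , has (suc (suc i)) w) C)) l ≡ all (λ i → ok2 0ℤ 0ℤ (map (pairAt i) Ds)) l
    go [] = refl
    go (i ∷ l) = cong₂ _∧_ (cong (ok2 0ℤ 0ℤ) (pairs-cols i (dn 0 n) μ Ds b' d s)) (go l)
  costs : (colsMaj C ≡ᵇ k) ▸ 1ℤ ≡ unit (+ k - + costD (dn 0 n) μ Ds)
  costs = cong (_▸ 1ℤ) (cong (_≡ᵇ k) (colsMaj-cols μ Ds b d s) ∙ Bool-ext {costD (dn 0 n) μ Ds ≡ᵇ k} {k ≡ᵇ costD (dn 0 n) μ Ds} (λ h → subst (λ t → (k ≡ᵇ t) ≡ true) (sym (≡ᵇ-true {costD (dn 0 n) μ Ds} {k} h)) (≡ᵇ-refl k)) (λ h → subst (λ t → (t ≡ᵇ k) ≡ true) (≡ᵇ-true {k} {costD (dn 0 n) μ Ds} h) (≡ᵇ-refl k)) ∙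
    sym (sub-==0 (+ k) (+ costD (dn 0 n) μ Ds)))

tabGood : List ℕ → ℕ → List ℕ → ℕ → Filling → Bool
tabGood b n tgt k T = (nonAttacking ∧ noCoinv ∧ eqListᵇ (Tabloid.wt b n T) tgt ∧ all eZero (from1 (n ∸ 1))) ∧ (maj ≡ᵇ k)
  where open Tabloid b n T using (nonAttacking; noCoinv; eZero; maj)

tabGood-cols : ∀ n tgt k C → Dec≥ (map length C) → All (_≤ n) (map length C) → All (1 ≤_) (map length C) →
               tabGood (map length (reverse (toT n C))) n tgt k (reverse (toT n C)) ≡ chain (dn 0 n) C ∧ stats n tgt k C
tabGood-cols n tgt k C d b p = shuf Tab.nonAttacking Tab.noCoinv (eqListᵇ Tab.wt tgt) (all Tab.eZero (from1 (n ∸ 1))) (Tab.maj ≡ᵇ k) ∙ cong₂ _∧_ (Columns.chain-tabloid n C d b)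
    (cong₂ _∧_ (cong (λ t → eqListᵇ t tgt) St.wt-tabloid) (cong₂ _∧_ (go (from1 (n ∸ 1))) (cong (_≡ᵇ k) St.maj-tabloid)))
  where
  module Tab = Tabloid (map length (reverse (toT n C))) n (reverse (toT n C))
  module St = Statistics n C d b p
  shuf : ∀ a b c d e → (a ∧ b ∧ c ∧ d) ∧ e ≡ (a ∧ b) ∧ (c ∧ d ∧ e)
  shuf false b c d e = refl
  shuf true false c d e = refl
  shuf true true false d e = refl
  shuf true true true d e = refl
  go : ∀ l → all Tab.eZero l ≡ all (λ i → ok2 0ℤ 0ℤ (map (λ w → has i w , has (suc i) w) C)) l
  go [] = refl
  go (i ∷ l) = cong₂ _∧_ (St.eZero-ok2 i) (go l)

All-fillings : ∀ μ n → All (λ C → map length C ≡ μ) (fillings μ n)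
All-fillings [] n = refl ∷ []
All-fillings (h ∷ μ) n = All-concatMap (λ w lw → All-map⁺ (w ∷_) (All.map (λ e → cong₂ _∷_ lw e) (All-fillings μ n))) (All-words h)
  where
  All-words : ∀ h → All (λ w → length w ≡ h) (words h n)
  All-words zero = refl ∷ []
  All-words (suc h) = All-concatMap {Q = λ _ → ⊤} (λ a _ → All-map⁺ (a ∷_) (All.map (cong suc) (All-words h))) (All.universal (λ _ → tt) (from1 n))

head-≤-nLen : ∀ m μ → IsPartition μ → All (_≤ nLen m μ) μ
head-≤-nLen m μ p = All.map (λ l → ≤-trans l (m≤n+m (head0 μ) m)) (Partition-≤ μ p)

kfGen-dseq : ∀ lam μ m k → IsPartition μ → + kfGen lam μ m k ≡
  ∑ (dseq (nLen m μ) (length μ)) λ Ds → sizes μ Ds ▸ stats (nLen m μ) (padTo (nLen m μ) (conj lam)) k (colsOf (dn 0 (nLen m μ)) Ds) ▸ 1ℤ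
kfGen-dseq lam μ m k p = count-∑ (tabGood (bComp m μ) n tgt k) (fillings (bComp m μ) n) ∙ cong (λ b → ∑ (fillings b n) F) (bComp-rows m μ p) ∙
  ∑-fillings-reverse (applyUpTo (wt μ) n) n F ∙ ∑-toT n n μ bd (F ∘ reverse) ∙ ∑-congA (All-fillings μ n) point ∙
    chain-sum n (dn 0 n) μ (subst (λ t → All (_≤ t) μ) (sym (length-dn₀ n)) bd) (Partition-Dec μ p) (λ C → stats n tgt k C ▸ 1ℤ)
  where
  n : ℕ
  n = nLen m μ
  tgt : List ℕ
  tgt = padTo n (conj lam)
  bd : All (_≤ n) μ
  bd = head-≤-nLen m μ p
  F : Filling → ℤ
  F T = tabGood (bComp m μ) n tgt k T ▸ 1ℤ
  point : ∀ C → map length C ≡ μ → F (reverse (toT n C)) ≡ chain (dn 0 n) C ▸ stats n tgt k C ▸ 1ℤ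
  point C e = cong (_▸ 1ℤ) (cong (λ b → tabGood b n tgt k (reverse (toT n C))) b≡ ∙ tabGood-cols n tgt k C (subst Dec≥ (sym e) (Partition-Dec μ p)) (subst (All (_≤ n)) (sym e) bd) (subst (All (1 ≤_)) (sym e) (Partition-pos μ p))) ∙
    ▸-∧ (chain (dn 0 n) C) (stats n tgt k C) 1ℤ
    where
    b≡ : bComp m μ ≡ map length (reverse (toT n C))
    b≡ = bComp-rows m μ p ∙ cong (λ t → reverse (applyUpTo (wt t) n)) (sym e) ∙ cong reverse (sym (length-toT n C)) ∙ sym (Listₚ.reverse-map length (toT n C))

kfGen-hw : ∀ lam μ m k → IsPartition μ → length (conj lam) ≤ nLen m μ →
           + kfGen lam μ m k ≡ hw (+ᵛ (padV (nLen m μ) (conj lam))) unit μ (dn 0 (nLen m μ)) 0ᵛ (+ k)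
kfGen-hw lam μ m k p l = kfGen-dseq lam μ m k p ∙ (∑-cong (dseq (nLen m μ) (length μ)) λ Ds → ▸-cong (sizes μ Ds) λ s →
    stats-cols (nLen m μ) (conj lam) k μ Ds l (head-≤-nLen m μ p) (Partition-Dec μ p) s) ∙
  sym (hw-dseq (+ᵛ (padV (nLen m μ) (conj lam))) unit μ (dn 0 (nLen m μ)) 0ᵛ (+ k))

-- `padTo` does not shorten a list, so a target with more than n entries differs in length from
-- every weight.
kfGen-long : ∀ lam μ m k → IsPartition μ → nLen m μ < length (conj lam) → kfGen lam μ m k ≡ 0
kfGen-long lam μ m k p l = +-injective (kfGen-dseq lam μ m k p ∙ ∑-zero (dseq n (length μ)) λ Ds → cong (λ t → sizes μ Ds ▸ t ▸ 1ℤ) (∧-falseˡ (unequal (map (cnt# Ds) (from1 n)) (padTo n (conj lam)) (differ Ds))) ∙ ▸-zero (sizes μ Ds))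
  where
  ∧-falseˡ : ∀ {a b} → a ≡ false → a ∧ b ≡ false
  ∧-falseˡ refl = refl
  n : ℕ
  n = nLen m μ
  cnt# : List (Vec Bool n) → ℕ → ℕ
  cnt# Ds p = countᵇ (λ x → x ≡ᵇ p) (concat (colsOf (dn 0 n) Ds))
  differ : ∀ Ds → length (map (cnt# Ds) (from1 n)) ≢ length (padTo n (conj lam))
  differ Ds e = ℕₚ.<-irrefl (sym (Listₚ.length-map (cnt# Ds) (from1 n) ∙ Listₚ.length-map suc (upTo n) ∙ Listₚ.length-upTo n) ∙ e)
    (<-≤-trans l (subst (length (conj lam) ≤_) (sym (Listₚ.length-++ (conj lam))) (m≤m+n (length (conj lam)) _)))
  unequal : ∀ xs ys → length xs ≢ length ys → eqListᵇ xs ys ≡ false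
  unequal [] [] h = ⊥-elim (h refl)
  unequal [] (y ∷ ys) h = refl
  unequal (x ∷ xs) [] h = refl
  unequal (x ∷ xs) (y ∷ ys) h with x ≡ᵇ y
  ... | false = refl
  ... | true = unequal xs ys (h ∘ cong suc)

sumᵛ : ∀ {n} → Vec ℤ n → ℤ
sumᵛ [] = 0ℤ
sumᵛ (a ∷ α) = a + sumᵛ α

sumᵛ-0 : ∀ n → sumᵛ (0ᵛ {n}) ≡ 0ℤ
sumᵛ-0 zero = refl
sumᵛ-0 (suc n) = +-identityˡ _ ∙ sumᵛ-0 n

hw-size : ∀ {n} (L : Vec ℤ n) φ μ v κ e → sumᵛ κ + + sum μ ≢ sumᵛ L → hw L φ μ v κ e ≡ 0ℤ
hw-size L φ [] v κ e ne with isZ (κ -ᵛ L) in z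
... | false = refl
... | true = ⊥-elim (ne (+-identityʳ (sumᵛ κ) ∙ cong sumᵛ (eq κ L z)))
  where
  eq : ∀ {n} (κ L : Vec ℤ n) → isZ (κ -ᵛ L) ≡ true → κ ≡ L
  eq [] [] z = refl
  eq (a ∷ κ) (b ∷ L) z with (a - b) ℤₚ.≟ 0ℤ
  ... | yes p = cong₂ _∷_ (i-j≡0⇒i≡j a b p) (eq κ L z)
hw-size {n} L φ (h ∷ μ) v κ e ne = ∑-zero (bits n) λ D → trans (▸-cong (size D ≡ᵇ h) λ sz →
    cong (dom (κ ∔ D) ▸_) (hw-size L φ μ (arr v D) (κ ∔ D) _ λ q → ne (cong (λ t → sumᵛ κ + t) (pos-+ h (sum μ) ∙ cong (λ t → + t + + sum μ) (sym (≡ᵇ-true {size D} {h} sz))) ∙ lem (sumᵛ κ) (+ size D) (+ sum μ) ∙ cong (_+ + sum μ) (sym (sum-∔ κ D)) ∙ q)) ∙ ▸-zero (dom (κ ∔ D)))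
    (▸-zero (size D ≡ᵇ h))
  where
  lem : ∀ a b c → a + (b + c) ≡ (a + b) + c
  lem = solve-∀
  sum-∔ : ∀ {n} (κ : Vec ℤ n) D → sumᵛ (κ ∔ D) ≡ sumᵛ κ + + size D
  sum-∔ [] [] = refl
  sum-∔ (a ∷ κ) (true ∷ D) = +ˡ (a + 1ℤ) (sum-∔ κ D) ∙ +-exchange a 1ℤ (sumᵛ κ) (+ size D)
  sum-∔ (a ∷ κ) (false ∷ D) = +ˡ (a + 0ℤ) (sum-∔ κ D) ∙ +-exchange a 0ℤ (sumᵛ κ) (+ size D) ∙ +ˡ (a + sumᵛ κ) (+-identityˡ (+ size D))

-- An empty column leaves only the empty set, which changes neither weight nor cost. This identifies
-- a partition with its exponent vector padded to N entries.
hw-zeros : ∀ {n} (L : Vec ℤ n) φ μ j v κ e → dom κ ≡ true → hw L φ (μ ++ replicate j 0) v κ e ≡ hw L φ μ v κ e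
hw-zeros L φ [] zero v κ e d = refl
hw-zeros {n} L φ [] (suc j) v κ e d = ∑-bits-only (ones {n} 0) _ other ∙ cong (λ t → (t ≡ᵇ 0) ▸ dom (κ ∔ ones {n} 0) ▸ hw L φ (replicate j 0) (arr v (ones {n} 0)) (κ ∔ ones {n} 0) e') s0 ∙
    cong (λ t → dom t ▸ hw L φ (replicate j 0) (arr v (ones {n} 0)) t e') (∔-ones-0 κ) ∙ cong (_▸ hw L φ (replicate j 0) (arr v (ones {n} 0)) κ e') d ∙
      hw-zeros L φ [] j (arr v (ones {n} 0)) κ e' d ∙ cong (λ t → isZ (κ -ᵛ L) ▸ φ t) (cong (λ t → e - + t) (cst-empty (wt (0 ∷ replicate j 0)) v (ones {n} 0) s0) ∙ +-identityʳ e)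
  where
  s0 : size (ones {n} 0) ≡ 0
  s0 = size-ones n 0 z≤n
  e' : ℤ
  e' = e - + cst (wt (0 ∷ replicate j 0)) v (ones {n} 0)
  other : ∀ S → S ≢ ones 0 → (size S ≡ᵇ 0) ▸ dom (κ ∔ S) ▸ hw L φ (replicate j 0) (arr v S) (κ ∔ S) (e - + cst (wt (0 ∷ replicate j 0)) v S) ≡ 0ℤ
  other S ne with size S in eq
  ... | zero = ⊥-elim (ne (size-0 S eq))
  ... | suc _ = refl
hw-zeros {n} L φ (h ∷ μ) j v κ e d = ∑-cong (bits n) λ D → cong ((size D ≡ᵇ h) ▸_) (▸-cong (dom (κ ∔ D)) λ d' →
    hw-zeros L φ μ j (arr v D) (κ ∔ D) _ d' ∙ cong (λ t → hw L φ μ (arr v D) (κ ∔ D) (e - + t)) (cst-cong v D (wt-++ (h ∷ μ))))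
  where
  wt-++ : ∀ μ r → wt (μ ++ replicate j 0) r ≡ wt μ r
  wt-++ [] r = go j
    where
    go : ∀ j → wt (replicate j 0) r ≡ 0
    go zero = refl
    go (suc j) = go j
  wt-++ (h ∷ μ) r = cong (_ ℕ.+_) (wt-++ μ r)
  cst-cong : ∀ {n f f'} v (D : Vec Bool n) → (∀ r → f r ≡ f' r) → cst f v D ≡ cst f' v D
  cst-cong [] D h = refl
  cst-cong (x ∷ v) D h with pick x D
  ... | nothing = refl
  ... | just (b , j) = cong₂ (λ s t → (if b then s else 0) ℕ.+ t) (h 0) (cst-cong v (clear j D) (h ∘ suc))

sum-wt : ∀ μ n → All (_≤ n) μ → sum (applyUpTo (wt μ) n) ≡ sum μ
sum-wt [] n [] = go n
  where
  go : ∀ n → sum (applyUpTo (λ _ → 0) n) ≡ 0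
  go zero = refl
  go (suc n) = go n
sum-wt (h ∷ μ) n (l ∷ ls) = cong sum (sym (incFirst-applyUpTo h n (wt μ))) ∙ go h _ (subst (h ≤_) (sym (Listₚ.length-applyUpTo (wt μ) n)) l) ∙ cong (h ℕ.+_) (sum-wt μ n ls)
  where
  go : ∀ h ℓ → h ≤ length ℓ → sum (incFirst h ℓ) ≡ h ℕ.+ sum ℓ
  go zero ℓ l = refl
  go (suc h) (a ∷ ℓ) (s≤s l) = cong suc (cong (a ℕ.+_) (go h ℓ l) ∙ sym (ℕₚ.+-assoc a h _) ∙ cong (ℕ._+ sum ℓ) (ℕₚ.+-comm a h) ∙ ℕₚ.+-assoc h a _)

sum-conj : ∀ λ′ → IsPartition λ′ → sum (conj λ′) ≡ sum λ′
sum-conj λ′ p = cong sum (conj-applyUpTo λ′) ∙ (sum-wt λ′ (head0 λ′) (Partition-≤ λ′ p))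

sumᵛ-padV : ∀ n l → length l ≤ n → sumᵛ (+ᵛ (padV n l)) ≡ + sum l
sumᵛ-padV zero [] h = refl
sumᵛ-padV (suc n) [] h = +-identityˡ _ ∙ sumᵛ-padV n [] z≤n
sumᵛ-padV (suc n) (a ∷ l) (s≤s h) = +ˡ (+ a) (sumᵛ-padV n l h) ∙ sym (pos-+ a (sum l))

kfGen-size : ∀ lam μ m k → IsPartition lam → IsPartition μ → sum μ ≢ sum lam → kfGen lam μ m k ≡ 0
kfGen-size lam μ m k pl p ne with <-≤-connex (nLen m μ) (length (conj lam))
... | inj₁ l = kfGen-long lam μ m k p l
... | inj₂ l = +-injective (kfGen-hw lam μ m k p l ∙ hw-size (+ᵛ (padV n (conj lam))) unit μ (dn 0 n) 0ᵛ (+ k)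
    λ h → ne (+-injective (sym (cong (_+ + sum μ) (sumᵛ-0 n) ∙ +-identityˡ (+ sum μ)) ∙ h ∙ sumᵛ-padV n (conj lam) l ∙ cong (λ t → + t) (sum-conj lam pl))))
  where
  n : ℕ
  n = nLen m μ

-- Schur polynomials: semistandard tableaux as chains of weights.

sFrom : ℕ → List ℕ → Bool
sFrom k [] = true
sFrom k (y ∷ w) = (k <ᵇ y) ∧ sFrom y w

sInc : List ℕ → Bool
sInc [] = true
sInc (x ∷ w) = sFrom x w

leL : List ℕ → List ℕ → Bool
leL v [] = true
leL [] (y ∷ w) = false
leL (x ∷ v) (y ∷ w) = (x ≤ᵇ y) ∧ leL v w

cchain : List ℕ → List (List ℕ) → Bool
cchain v [] = true
cchain v (w ∷ C) = sInc w ∧ leL v w ∧ cchain w C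

cchain₀ : List (List ℕ) → Bool
cchain₀ [] = true
cchain₀ (w ∷ C) = sInc w ∧ cchain w C

headOK : List ℕ → List (List ℕ) → Bool
headOK [] T = true
headOK (x ∷ w) [] = true
headOK (x ∷ w) ([] ∷ T) = headOK w T
headOK (x ∷ w) ((y ∷ R) ∷ T) = (x ≤ᵇ y) ∧ headOK w T

Beyond : ℕ → List (List ℕ) → Set
Beyond h T = ∀ i → h ≤ i → nthD [] T i ≡ []

weakInc-addCol : ∀ w T → length w ≤ length T → all weakInc (addCol w T) ≡ headOK w T ∧ all weakInc T
weakInc-addCol [] T l = refl
weakInc-addCol (x ∷ w) ([] ∷ T) (s≤s l) = weakInc-addCol w T l
weakInc-addCol (x ∷ w) ((y ∷ R) ∷ T) (s≤s l) = cong (((x ≤ᵇ y) ∧ weakInc (y ∷ R)) ∧_) (weakInc-addCol w T l) ∙ ∧-exchange (x ≤ᵇ y) (weakInc (y ∷ R)) _ _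

headOK-addCol : ∀ w w' T → length w' ≤ length w → length w' ≤ length T → Beyond (length w') T → headOK w (addCol w' T) ≡ leL w w'
headOK-addCol [] [] T l l' h = refl
headOK-addCol (x ∷ w) [] T l l' h = go (x ∷ w) T (λ i → h i z≤n)
  where
  go : ∀ w T → (∀ i → nthD [] T i ≡ []) → headOK w T ≡ true
  go [] T h = refl
  go (x ∷ w) [] h = refl
  go (x ∷ w) (R ∷ T) h with R | h 0
  ... | .[] | refl = go w T (h ∘ suc)
headOK-addCol (x ∷ w) (y ∷ w') (R ∷ T) (s≤s l) (s≤s l') h = cong ((x ≤ᵇ y) ∧_) (headOK-addCol w w' T l l' λ i a → h (suc i) (s≤s a))

colStrict-addCol : ∀ w T → length w ≤ length T → Beyond (length w) T → colStrict (addCol w T) ≡ sInc w ∧ colStrict T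
colStrict-addCol [] T l h = refl
colStrict-addCol (x ∷ []) (R ∷ []) l h = refl
colStrict-addCol (x ∷ []) (R ∷ R' ∷ T) l h with R' | h 1 (s≤s z≤n)
colStrict-addCol (x ∷ []) ([] ∷ R' ∷ T) l h | .[] | refl = refl
colStrict-addCol (x ∷ []) ((_ ∷ _) ∷ R' ∷ T) l h | .[] | refl = refl
colStrict-addCol (x ∷ y ∷ w) (R ∷ R' ∷ T) (s≤s l) h = cong (((x <ᵇ y) ∧ strictBelow R R') ∧_) (colStrict-addCol (y ∷ w) (R' ∷ T) l λ i a → h (suc i) (s≤s a)) ∙
  ∧-exchange (x <ᵇ y) (strictBelow R R') _ _

toT-beyond : ∀ n C h → All (_≤ h) (map length C) → Beyond h (toT n C)
toT-beyond n C h b i l = length-0 _ (sym (nthD-length (toT n C) i) ∙ cong (λ t → nthD 0 t i) (length-toT n C) ∙ nthD-up-0 n (wt (map length C)) i (wt-zero (map length C) i (All≤-trans l b)))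

isSSYT-cols : ∀ n C → Dec≥ (map length C) → All (_≤ n) (map length C) → isSSYT (toT n C) ≡ cchain₀ C
isSSYT-cols n [] d b = cong₂ _∧_ (go₁ n) (go₂ n)
  where
  go₁ : ∀ n → all weakInc (replicate n []) ≡ true
  go₁ zero = refl
  go₁ (suc n) = go₁ n
  go₂ : ∀ n → colStrict (replicate n []) ≡ true
  go₂ zero = refl
  go₂ (suc zero) = refl
  go₂ (suc (suc n)) = go₂ (suc n)
isSSYT-cols n (w ∷ C) (bw , d) (l ∷ b) = cong₂ _∧_ (weakInc-addCol w (toT n C) lT) (colStrict-addCol w (toT n C) lT (toT-beyond n C (length w) bw)) ∙
  shuf (headOK w (toT n C)) (all weakInc (toT n C)) (sInc w) (colStrict (toT n C)) ∙ cong (sInc w ∧_) (cong (headOK w (toT n C) ∧_) (isSSYT-cols n C d b) ∙ go C d bw b)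
  where
  lT : length w ≤ length (toT n C)
  lT = subst (length w ≤_) (sym (length-toT′ n C)) l
  shuf : ∀ x y u w → (x ∧ y) ∧ (u ∧ w) ≡ u ∧ (x ∧ (y ∧ w))
  shuf true true u w = refl
  shuf true false true w = refl
  shuf true false false w = refl
  shuf false y true w = refl
  shuf false y false w = refl
  go : ∀ C → Dec≥ (map length C) → All (_≤ length w) (map length C) → All (_≤ n) (map length C) → headOK w (toT n C) ∧ cchain₀ C ≡ cchain w C
  go [] d bw b = cong (_∧ true) (blank w n) ∙ refl
    where
    blank : ∀ w n → headOK w (replicate n []) ≡ true
    blank [] n = refl
    blank (x ∷ w) zero = refl
    blank (x ∷ w) (suc n) = blank w n
  go (w' ∷ C) (b' , d) (lw ∷ bw) (l' ∷ b) = cong (_∧ (sInc w' ∧ cchain w' C)) (headOK-addCol w w' (toT n C) lw (subst (length w' ≤_) (sym (length-toT′ n C)) l') (toT-beyond n C (length w') b')) ∙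
    ∧-swap (leL w w') (sInc w') (cchain w' C)

ascFrom : ∀ {n} → ℕ → Vec Bool n → List ℕ
ascFrom k [] = []
ascFrom k (true ∷ B) = suc k ∷ ascFrom (suc k) B
ascFrom k (false ∷ B) = ascFrom (suc k) B

-- A strictly increasing word amounts to a set of letters above `k`; the split is by whether it
-- begins with the smallest of these, `suc k`.
∑-sFrom : ∀ n k h (F : List ℕ → ℤ) → ∑ (words h (k ℕ.+ n)) (λ w → sFrom k w ▸ F w) ≡ ∑ (bits n) λ B → (size B ≡ᵇ h) ▸ F (ascFrom k B)
∑-sFrom zero k zero F = refl
∑-sFrom zero k (suc h) F = ∑-words h (k ℕ.+ 0) _ ∙ cong (λ m → ∑ (range m) (λ j → ∑ (words h (k ℕ.+ 0)) λ w → ((k <ᵇ suc j) ∧ sFrom (suc j) w) ▸ F (suc j ∷ w))) (ℕₚ.+-identityʳ k) ∙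
  (∑-cong-range k λ j l → ∑-zero (words h (k ℕ.+ 0)) λ w → cong (λ t → (t ∧ sFrom (suc j) w) ▸ F (suc j ∷ w)) (<ᵇ-false l)) ∙ ∑-zero (range k) λ _ → refl
∑-sFrom (suc n) k zero F = sym (∑-bits n _ ∙ cong₂ _+_ (∑-zero (bits n) λ _ → refl) (sym (∑-sFrom n (suc k) zero F)) ∙ +-identityˡ _)
∑-sFrom (suc n) k (suc h) F rewrite ℕₚ.+-suc k n =
  ∑-words h (suc (k ℕ.+ n)) _ ∙ ∑-cong (range (suc (k ℕ.+ n))) split ∙
    ∑-+ (range (suc (k ℕ.+ n))) (λ j → (k ≡ᵇ j) ▸ S j) (λ j → (suc k <ᵇ suc j) ▸ S j) ∙
      sym (∑-bits n _ ∙ cong₂ _+_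
        (sym (∑-sFrom n (suc k) h (λ w → F (suc k ∷ w))) ∙ sym (∑-range-only (suc (k ℕ.+ n)) k S (s≤s (m≤m+n k n))))
        (sym (∑-sFrom n (suc k) (suc h) F) ∙ ∑-words h (suc (k ℕ.+ n)) _ ∙ ∑-cong (range (suc (k ℕ.+ n))) λ j →
          (∑-cong (words h (suc (k ℕ.+ n))) λ w → ▸-∧ (suc k <ᵇ suc j) (sFrom (suc j) w) _) ∙ ∑-▸ (words h (suc (k ℕ.+ n))) (suc k <ᵇ suc j) _))
  where
  S : ℕ → ℤ
  S j = ∑ (words h (suc (k ℕ.+ n))) λ w → sFrom (suc j) w ▸ F (suc j ∷ w)
  cut : ∀ j z → (k <ᵇ suc j) ▸ z ≡ (k ≡ᵇ j) ▸ z + (suc k <ᵇ suc j) ▸ z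
  cut j z with ℕₚ.<-cmp k j
  ... | Rel.tri< l ne _ rewrite <ᵇ-true l | ≡ᵇ-false ne | <ᵇ-true {k} {suc j} (<-trans l (n<1+n j)) = sym (+-identityˡ z)
  ... | Rel.tri≈ _ refl _ rewrite ≡ᵇ-refl k | <ᵇ-false {k} {k} ≤-refl | <ᵇ-true (n<1+n k) = sym (+-identityʳ z)
  ... | Rel.tri> _ ne l rewrite <ᵇ-false (<⇒≤ l) | ≡ᵇ-false ne | <ᵇ-false {k} {suc j} l = refl
  split : ∀ j → ∑ (words h (suc (k ℕ.+ n))) (λ w → ((k <ᵇ suc j) ∧ sFrom (suc j) w) ▸ F (suc j ∷ w)) ≡ (k ≡ᵇ j) ▸ S j + (suc k <ᵇ suc j) ▸ S j
  split j = (∑-cong (words h (suc (k ℕ.+ n))) λ w → ▸-∧ (k <ᵇ suc j) (sFrom (suc j) w) _) ∙ ∑-▸ (words h (suc (k ℕ.+ n))) (k <ᵇ suc j) _ ∙ cut j (S j)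

∑-sInc : ∀ N h (F : List ℕ → ℤ) → ∑ (words h N) (λ w → sInc w ▸ F w) ≡ ∑ (bits N) λ B → (size B ≡ᵇ h) ▸ F (ascFrom 0 B)
∑-sInc N zero F = ∑-sFrom N 0 zero F
∑-sInc N (suc h) F = ∑-words h N _ ∙ sym (∑-words h N _) ∙ ∑-sFrom N 0 (suc h) F

zipB : ∀ {N} → Vec Bool N → Vec Bool N → List (Bool × Bool)
zipB [] [] = []
zipB (b ∷ B) (c ∷ C) = (b , c) ∷ zipB B C

-- The list pre holds the entries of the left column not yet matched.
leL-ok2 : ∀ {N} pre k (B C : Vec Bool N) b → All (_≤ k) pre → leL (pre ++ ascFrom k B) (ascFrom k C) ≡ ok2 (b + + length pre) b (zipB B C)
leL-ok2 pre k [] [] b ps = refl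
leL-ok2 [] k (true ∷ B) (true ∷ C) b ps rewrite does-≤ {b + 1ℤ} {b + 0ℤ + 1ℤ} (ℤₚ.≤-reflexive (cong (_+ 1ℤ) (sym (+-identityʳ b)))) | <ᵇ-true (n<1+n k) =
  leL-ok2 [] (suc k) B C (b + 1ℤ) [] ∙ cong (λ t → ok2 t (b + 1ℤ) (zipB B C)) (lem b)
  where
  lem : ∀ b → (b + 1ℤ) + 0ℤ ≡ (b + 0ℤ) + 1ℤ
  lem = solve-∀
leL-ok2 (p ∷ pre) k (true ∷ B) (true ∷ C) b (l ∷ ps) rewrite does-≤ {b + 1ℤ} {b + + suc (length pre) + 1ℤ} (ℤₚ.+-monoˡ-≤ 1ℤ (ℤₚ.i≤i+j b (+ suc (length pre)))) | ≤ᵇ-true (≤-trans l (n≤1+n k)) =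
  cong (λ t → leL t (ascFrom (suc k) C)) (sym (Listₚ.++-assoc pre (suc k ∷ []) _)) ∙ leL-ok2 (pre ++ suc k ∷ []) (suc k) B C (b + 1ℤ) (All-++⁺ (All.map (λ x → ≤-trans x (n≤1+n k)) ps) (≤-refl ∷ [])) ∙
    cong (λ t → ok2 t (b + 1ℤ) (zipB B C)) (cong (λ t → b + 1ℤ + + t) (Listₚ.length-++ pre ∙ ℕₚ.+-comm (length pre) 1) ∙ +-1-shift b (+ suc (length pre)))
leL-ok2 pre k (true ∷ B) (false ∷ C) b ps rewrite does-≤ {b + 0ℤ} {b + + length pre + 1ℤ} (subst (b + 0ℤ ℤ.≤_) (+-1-swap b (+ length pre)) (ℤₚ.+-monoʳ-≤ b (ℤ.+≤+ z≤n))) =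
  cong (λ t → leL t (ascFrom (suc k) C)) (sym (Listₚ.++-assoc pre (suc k ∷ []) _)) ∙ leL-ok2 (pre ++ suc k ∷ []) (suc k) B C b (All-++⁺ (All.map (λ x → ≤-trans x (n≤1+n k)) ps) (≤-refl ∷ [])) ∙
    cong₂ (λ s t → ok2 s t (zipB B C)) (cong (λ t → b + + t) (Listₚ.length-++ pre ∙ ℕₚ.+-comm (length pre) 1) ∙ +-1-swap b (+ length pre)) (sym (+-identityʳ b))
leL-ok2 [] k (false ∷ B) (true ∷ C) b ps rewrite does-≰ {b + 1ℤ} {b + 0ℤ + 0ℤ} (λ h → ℤₚ.<⇒≱ (ℤₚ.+-monoʳ-< b (ℤ.+<+ (s≤s z≤n))) (subst (b + 1ℤ ℤ.≤_) (+-identityʳ (b + 0ℤ)) h)) = go (suc k) (n<1+n k) B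
  where
  go : ∀ {n} j → k < j → (B : Vec Bool n) → leL (ascFrom j B) (suc k ∷ ascFrom (suc k) C) ≡ false
  go j l [] = refl
  go j l (true ∷ B) = cong (_∧ leL (ascFrom (suc j) B) (ascFrom (suc k) C)) (<ᵇ-false {j} {suc k} l)
  go j l (false ∷ B) = go (suc j) (<-trans l (n<1+n j)) B
leL-ok2 (p ∷ pre) k (false ∷ B) (true ∷ C) b (l ∷ ps) rewrite does-≤ {b + 1ℤ} {b + + suc (length pre) + 0ℤ} (subst (b + 1ℤ ℤ.≤_) (sym (+-identityʳ (b + + suc (length pre)))) (ℤₚ.+-monoʳ-≤ b (ℤ.+≤+ (s≤s z≤n)))) | ≤ᵇ-true (≤-trans l (n≤1+n k)) =
  leL-ok2 pre (suc k) B C (b + 1ℤ) (All.map (λ x → ≤-trans x (n≤1+n k)) ps) ∙ cong (λ t → ok2 t (b + 1ℤ) (zipB B C)) (+-1-shift-0 b (+ length pre))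
leL-ok2 pre k (false ∷ B) (false ∷ C) b ps rewrite does-≤ {b + 0ℤ} {b + + length pre + 0ℤ} (ℤₚ.+-monoˡ-≤ 0ℤ (ℤₚ.i≤i+j b (+ length pre))) =
  leL-ok2 pre (suc k) B C b (All.map (λ x → ≤-trans x (n≤1+n k)) ps) ∙ cong₂ (λ s t → ok2 s t (zipB B C)) (sym (+-identityʳ (b + + length pre))) (sym (+-identityʳ b))

-- Sum over the columns of a tableau, given as sets of letters.
CS : ∀ {N} → List ℕ → Vec Bool N → (Vec ℕ N → ℤ) → ℤ
CS [] B P = P zerosV
CS {N} (h ∷ hs) B P = ∑ (bits N) λ B' → (size B' ≡ᵇ h) ▸ ok2 0ℤ 0ℤ (zipB B B') ▸ CS hs B' (λ ω → P (ω ⊞ B'))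

CS₀ : ∀ {N} → List ℕ → (Vec ℕ N → ℤ) → ℤ
CS₀ [] P = P zerosV
CS₀ {N} (h ∷ hs) P = ∑ (bits N) λ B → (size B ≡ᵇ h) ▸ CS hs B (λ ω → P (ω ⊞ B))

content : ∀ N → List (List ℕ) → Vec ℕ N
content N T = Vec.tabulate λ j → countᵇ (λ x → x ≡ᵇ suc (toℕ j)) (concat T)

content-[] : ∀ N → content N [] ≡ zerosV
content-[] zero = refl
content-[] (suc N) = cong (0 ∷_) (content-[] N)

count-low : ∀ {n} v k (B : Vec Bool n) → v ≤ k → countᵇ (λ x → x ≡ᵇ v) (ascFrom k B) ≡ 0
count-low v k [] l = refl
count-low v k (true ∷ B) l rewrite ≡ᵇ-false {suc k} {v} (λ e → <⇒≢ (s≤s l) (sym e)) = count-low v (suc k) B (≤-trans l (n≤1+n k))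
count-low v k (false ∷ B) l = count-low v (suc k) B (≤-trans l (n≤1+n k))

count-asc : ∀ {n} k i (B : Vec Bool n) → countᵇ (λ x → x ≡ᵇ suc (k ℕ.+ i)) (ascFrom k B) ≡ nb (bit i B)
count-asc k i [] = refl
count-asc k zero (true ∷ B) rewrite ℕₚ.+-identityʳ k | ≡ᵇ-refl k = cong suc (count-low (suc k) (suc k) B ≤-refl)
count-asc k zero (false ∷ B) rewrite ℕₚ.+-identityʳ k = count-low (suc k) (suc k) B ≤-refl
count-asc k (suc i) (true ∷ B) rewrite ℕₚ.+-suc k i | ≡ᵇ-false {k} {suc (k ℕ.+ i)} (<⇒≢ (s≤s (m≤m+n k i))) = count-asc (suc k) i B
count-asc k (suc i) (false ∷ B) rewrite ℕₚ.+-suc k i = count-asc (suc k) i B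

content-∷ : ∀ {N} (B : Vec Bool N) C → content N (ascFrom 0 B ∷ C) ≡ content N C ⊞ B
content-∷ B C = (Vecₚ.tabulate-cong λ j → countᵇ-++ (λ x → x ≡ᵇ suc (toℕ j)) (ascFrom 0 B) (concat C) ∙ cong (ℕ._+ countᵇ (λ x → x ≡ᵇ suc (toℕ j)) (concat C)) (count-asc 0 (toℕ j) B) ∙ ℕₚ.+-comm (nb (bit (toℕ j) B)) _) ∙
  go (λ i → countᵇ (λ x → x ≡ᵇ suc i) (concat C)) B
  where
  go : ∀ {N} (f : ℕ → ℕ) (B : Vec Bool N) → Vec.tabulate (λ j → f (toℕ j) ℕ.+ nb (bit (toℕ j) B)) ≡ Vec.tabulate (f ∘ toℕ) ⊞ B
  go f [] = refl
  go f (b ∷ B) = cong (_ ∷_) (go (f ∘ suc) B)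

∑-cchain : ∀ {N} hs (B : Vec Bool N) (P : Vec ℕ N → ℤ) → ∑ (fillings hs N) (λ C → cchain (ascFrom 0 B) C ▸ P (content N C)) ≡ CS hs B P
∑-cchain {N} [] B P = +-identityʳ _ ∙ cong P (content-[] N)
∑-cchain {N} (h ∷ hs) B P = ∑-fillings h hs N _ ∙ (∑-cong (words h N) λ w → (∑-cong (fillings hs N) λ C → ▸-∧ (sInc w) _ _ ∙ cong (sInc w ▸_) (▸-∧ (leL (ascFrom 0 B) w) (cchain w C) _)) ∙
    ∑-▸ (fillings hs N) (sInc w) _ ∙ cong (sInc w ▸_) (∑-▸ (fillings hs N) (leL (ascFrom 0 B) w) _)) ∙
  ∑-sInc N h (λ w → leL (ascFrom 0 B) w ▸ ∑ (fillings hs N) λ C → cchain w C ▸ P (content N (w ∷ C))) ∙ ∑-cong (bits N) λ B' → cong ((size B' ≡ᵇ h) ▸_)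
    (cong₂ _▸_ (leL-ok2 [] 0 B B' 0ℤ []) ((∑-cong (fillings hs N) λ C → cong (λ t → cchain (ascFrom 0 B') C ▸ P t) (content-∷ B' C)) ∙ ∑-cchain hs B' (λ ω → P (ω ⊞ B'))))

∑-cchain₀ : ∀ {N} hs (P : Vec ℕ N → ℤ) → ∑ (fillings hs N) (λ C → cchain₀ C ▸ P (content N C)) ≡ CS₀ hs P
∑-cchain₀ {N} [] P = +-identityʳ _ ∙ cong P (content-[] N)
∑-cchain₀ {N} (h ∷ hs) P = ∑-fillings h hs N _ ∙ (∑-cong (words h N) λ w → (∑-cong (fillings hs N) λ C → ▸-∧ (sInc w) (cchain w C) _) ∙ ∑-▸ (fillings hs N) (sInc w) _) ∙
  ∑-sInc N h (λ w → ∑ (fillings hs N) λ C → cchain w C ▸ P (content N (w ∷ C))) ∙ ∑-cong (bits N) λ B' → cong ((size B' ≡ᵇ h) ▸_)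
    ((∑-cong (fillings hs N) λ C → cong (λ t → cchain (ascFrom 0 B') C ▸ P t) (content-∷ B' C)) ∙ ∑-cchain hs B' (λ ω → P (ω ⊞ B')))

-- Prepends a column to a 0/1 matrix given by its rows.
zc : ∀ {N n} → Vec Bool N → List (Vec Bool n) → List (Vec Bool (suc n))
zc [] Ds = []
zc (b ∷ B) [] = []
zc (b ∷ B) (D ∷ Ds) = (b ∷ D) ∷ zc B Ds

∑-zc : ∀ n N (G : List (Vec Bool (suc n)) → ℤ) → ∑ (dseq (suc n) N) G ≡ ∑ (bits N) λ B → ∑ (dseq n N) λ Ds → G (zc B Ds)
∑-zc n zero G = sym (+-identityʳ _)
∑-zc n (suc N) G = ∑-dseq (suc n) N G ∙ ∑-bits n _ ∙ cong₂ _+_ (half true) (half false) ∙ sym (∑-bits N _)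
  where
  half : ∀ b → ∑ (bits n) (λ D → ∑ (dseq (suc n) N) λ Ds → G ((b ∷ D) ∷ Ds)) ≡ ∑ (bits N) λ B → ∑ (dseq n (suc N)) λ Ds → G (zc (b ∷ B) Ds)
  half b = (∑-cong (bits n) λ D → ∑-zc n N (λ Ds → G ((b ∷ D) ∷ Ds))) ∙ ∑-swap (bits n) (bits N) _ ∙ ∑-cong (bits N) λ B → sym (∑-dseq n N _)

All-dseq : ∀ n N → All (λ Ds → length Ds ≡ N) (dseq n N)
All-dseq n zero = refl ∷ []
All-dseq n (suc N) = All-concatMap {Q = λ _ → ⊤} (λ D _ → All-map⁺ (D ∷_) (All.map (cong suc) (All-dseq n N))) (All.universal (λ _ → tt) (bits n))

wtsV : ∀ {n} N → List (Vec Bool n) → Vec ℕ N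
wtsV zero Ds = []
wtsV {n} (suc N) [] = 0 ∷ wtsV {n} N []
wtsV (suc N) (D ∷ Ds) = size D ∷ wtsV N Ds

module _ {n : ℕ} where
  length-zc : ∀ {N} (B : Vec Bool N) (Ds : List (Vec Bool n)) → length Ds ≡ N → length (zc B Ds) ≡ N
  length-zc [] Ds e = refl
  length-zc (b ∷ B) (D ∷ Ds) e = cong suc (length-zc B Ds (suc-injective e))

  tail-zc : ∀ {N} (B : Vec Bool N) (Ds : List (Vec Bool n)) → length Ds ≡ N → map Vec.tail (zc B Ds) ≡ Ds
  tail-zc [] [] e = refl
  tail-zc (b ∷ B) (D ∷ Ds) e = cong (D ∷_) (tail-zc B Ds (suc-injective e))

  pair-zc : ∀ {N} (B C : Vec Bool N) (Ds : List (Vec Bool n)) → length Ds ≡ N → map (λ D → bit 0 D , bit 1 D) (zc B (zc C Ds)) ≡ zipB B C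
  pair-zc [] [] Ds e = refl
  pair-zc (b ∷ B) (c ∷ C) (D ∷ Ds) e = cong ((b , c) ∷_) (pair-zc B C Ds (suc-injective e))

  addD-zc : ∀ {N} a (κ : Vec ℤ n) (B : Vec Bool N) (Ds : List (Vec Bool n)) → length Ds ≡ N → addD (a ∷ κ) (zc B Ds) ≡ (a + + size B) ∷ addD κ Ds
  addD-zc a κ [] [] e = cong (_∷ κ) (sym (+-identityʳ a))
  addD-zc a κ (b ∷ B) (D ∷ Ds) e = addD-zc (a + [ b ]ᵇ) (κ ∔ D) B Ds (suc-injective e) ∙ cong (_∷ addD (κ ∔ D) Ds) (go b)
    where
    lem : ∀ a s → (a + 1ℤ) + s ≡ a + (1ℤ + s)
    lem = solve-∀
    go : ∀ b → a + [ b ]ᵇ + + size B ≡ a + + size (b ∷ B)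
    go true = lem a (+ size B)
    go false = cong (_+ + size B) (+-identityʳ a)

  wtsV-zc : ∀ {N} (B : Vec Bool N) (Ds : List (Vec Bool n)) → length Ds ≡ N → wtsV N (zc B Ds) ≡ wtsV N Ds ⊞ B
  wtsV-zc [] Ds e = refl
  wtsV-zc (b ∷ B) (D ∷ Ds) e = cong₂ _∷_ (size-∷ b D ∙ ℕₚ.+-comm (nb b) (size D)) (wtsV-zc B Ds (suc-injective e))

∑-dseq-0 : ∀ N (G : List (Vec Bool 0) → ℤ) → ∑ (dseq 0 N) G ≡ G (replicate N [])
∑-dseq-0 zero G = +-identityʳ _
∑-dseq-0 (suc N) G = ∑-dseq 0 N G ∙ +-identityʳ _ ∙ ∑-dseq-0 N (G ∘ ([] ∷_))

wtsV-0 : ∀ N → wtsV {0} N (replicate N []) ≡ zerosV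
wtsV-0 zero = refl
wtsV-0 (suc N) = cong (0 ∷_) (wtsV-0 N)

isZ-[] : (α β : Vec ℤ 0) → isZ (α -ᵛ β) ≡ true
isZ-[] [] [] = refl

dseq-column : ∀ {n N} (L : Vec ℕ n) l B (P : Vec ℕ N → ℤ) Ds → length Ds ≡ N → ∀ c →
  c ▸ isZ (addD 0ᵛ (zc B Ds) -ᵛ +ᵛ (l ∷ L)) ▸ P (wtsV N (zc B Ds)) ≡ (size B ≡ᵇ l) ▸ c ▸ isZ (addD 0ᵛ Ds -ᵛ +ᵛ L) ▸ P (wtsV N Ds ⊞ B)
dseq-column L l B P Ds e c = cong₂ (λ s t → c ▸ isZ (s -ᵛ +ᵛ (l ∷ L)) ▸ P t) (addD-zc 0ℤ 0ᵛ B Ds e) (wtsV-zc B Ds e) ∙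
  cong (c ▸_) (▸-∧ (does ((+ size B - + l) ℤₚ.≟ 0ℤ)) (isZ (addD 0ᵛ Ds -ᵛ +ᵛ L)) _ ∙ cong (_▸ isZ (addD 0ᵛ Ds -ᵛ +ᵛ L) ▸ P (wtsV _ Ds ⊞ B)) (sub-==0 (+ size B) (+ l))) ∙
    ▸-comm c (size B ≡ᵇ l) _

-- One 0/1 matrix read in two ways: its rows are the sets added to the weight by each variable, its
-- columns are the letter sets of the tableau columns. Dominance of all prefixes at two neighbouring
-- columns is their row condition.
∑-dseq-CS : ∀ {n N} (L : Vec ℕ n) (B : Vec Bool N) (P : Vec ℕ N → ℤ) →
  ∑ (dseq n N) (λ Ds → domsD 0ᵛ (zc B Ds) ▸ isZ (addD 0ᵛ Ds -ᵛ +ᵛ L) ▸ P (wtsV N Ds)) ≡ CS (toList L) B P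
∑-dseq-CS {zero} {N} [] B P = ∑-dseq-0 N _ ∙ cong₂ (λ a b → a ▸ b ▸ P (wtsV N (replicate N []))) (domsD-small (s≤s z≤n) 0ᵛ (zc B (replicate N []))) (isZ-[] (addD 0ᵛ (replicate N [])) (+ᵛ [])) ∙ cong P (wtsV-0 N)
∑-dseq-CS {suc n} {N} (l ∷ L) B P = ∑-zc n N _ ∙ ∑-cong (bits N) λ B' → (∑-congA (All-dseq n N) λ Ds e →
    dseq-column L l B' P Ds e (domsD 0ᵛ (zc B (zc B' Ds))) ∙ cong ((size B' ≡ᵇ l) ▸_)
      (cong (_▸ isZ (addD 0ᵛ Ds -ᵛ +ᵛ L) ▸ P (wtsV N Ds ⊞ B')) (domsD-split 0ℤ 0ℤ 0ᵛ (zc B (zc B' Ds)) ∙ cong₂ (λ a b → ok2 0ℤ 0ℤ a ∧ domsD 0ᵛ b) (pair-zc B B' Ds e) (tail-zc B (zc B' Ds) (length-zc B' Ds e))) ∙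
        ▸-∧ (ok2 0ℤ 0ℤ (zipB B B')) (domsD 0ᵛ (zc B' Ds)) _)) ∙
  ∑-▸ (dseq n N) (size B' ≡ᵇ l) _ ∙ cong ((size B' ≡ᵇ l) ▸_) (∑-▸ (dseq n N) (ok2 0ℤ 0ℤ (zipB B B')) _ ∙ cong (ok2 0ℤ 0ℤ (zipB B B') ▸_) (∑-dseq-CS L B' (λ ω → P (ω ⊞ B'))))

∑-dseq-CS₀ : ∀ {n N} (L : Vec ℕ n) (P : Vec ℕ N → ℤ) →
  ∑ (dseq n N) (λ Ds → domsD 0ᵛ Ds ▸ isZ (addD 0ᵛ Ds -ᵛ +ᵛ L) ▸ P (wtsV N Ds)) ≡ CS₀ (toList L) P
∑-dseq-CS₀ {zero} {N} [] P = ∑-dseq-0 N _ ∙ cong₂ (λ a b → a ▸ b ▸ P (wtsV N (replicate N []))) (domsD-small z≤n [] (replicate N [])) (isZ-[] (addD 0ᵛ (replicate N [])) (+ᵛ [])) ∙ cong P (wtsV-0 N)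
∑-dseq-CS₀ {suc n} {N} (l ∷ L) P = ∑-zc n N _ ∙ ∑-cong (bits N) λ B → (∑-congA (All-dseq n N) λ Ds e → dseq-column L l B P Ds e (domsD 0ᵛ (zc B Ds))) ∙
  ∑-▸ (dseq n N) (size B ≡ᵇ l) _ ∙ cong ((size B ≡ᵇ l) ▸_) (∑-dseq-CS L B (λ ω → P (ω ⊞ B)))

ch-dseq : ∀ {n N} (L κ : Vec ℤ n) (p : Vec ℤ N → ℤ) ξ → ch L κ p ξ ≡ ∑ (dseq n N) λ Ds → domsD κ Ds ▸ isZ (addD κ Ds -ᵛ L) ▸ p (ξ ⊝ wtsV N Ds)
ch-dseq L κ p [] = sym (+-identityʳ _)
ch-dseq {n} {suc N} L κ p (x ∷ ξ) = (∑-cong (bits n) λ D → cong (dom (κ ∔ D) ▸_) (ch-dseq L (κ ∔ D) (λ ω → p ((x - + size D) ∷ ω)) ξ) ∙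
  sym (∑-▸ (dseq n N) (dom (κ ∔ D)) _) ∙ ∑-cong (dseq n N) λ Ds → sym (▸-∧ (dom (κ ∔ D)) (domsD (κ ∔ D) Ds) _)) ∙ sym (∑-dseq n N _)

wt-anti : ∀ μ {i j} → i ≤ j → wt μ j ≤ wt μ i
wt-anti [] l = z≤n
wt-anti (h ∷ μ) {i} {j} l = ℕₚ.+-mono-≤ one (wt-anti μ l)
  where
  one : (if j <ᵇ h then 1 else 0) ≤ (if i <ᵇ h then 1 else 0)
  one with j <ᵇ h in eq
  ... | false = z≤n
  ... | true rewrite <ᵇ-true (≤-<-trans l (<ᵇ-true⁻ {j} {h} eq)) = ≤-refl

All-up : ∀ {P : ℕ → Set} n {f} → (∀ i → P (f i)) → All P (applyUpTo f n)
All-up zero h = []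
All-up (suc n) h = h 0 ∷ All-up n (h ∘ suc)

Dec-up : ∀ n f → (∀ {i j} → i ≤ j → f j ≤ f i) → Dec≥ (applyUpTo f n)
Dec-up zero f h = tt
Dec-up (suc n) f h = All-up n (λ i → h z≤n) , Dec-up n (f ∘ suc) (h ∘ s≤s)

-- Presents λ as the row lengths belonging to the column heights λ', the form in which sums over
-- fillings by rows become sums by columns.
conj-conj : ∀ λ′ n → Dec≥ λ′ → All (_≤ n) λ′ → λ′ ≡ applyUpTo (wt (applyUpTo (wt λ′) n)) (length λ′)
conj-conj λ′ n d b = (list-up 0 λ′) ∙ applyUpTo-cong (length λ′) λ r r< → sym (count n (wt λ′) (nthD 0 λ′ r) r (nthD-All {λ x → x ≤ n} z≤n b r)
    (λ c l → proj₂ (wt-col (suc c) λ′ c (suc r) d ≤-refl) l) (λ c l → proj₁ (wt-col (suc c) λ′ c (suc r) d ≤-refl) l) ∙ refl)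
  where
  count : ∀ n (f : ℕ → ℕ) h r → h ≤ n → (∀ c → c < h → r < f c) → (∀ c → r < f c → c < h) → wt (applyUpTo f n) r ≡ h
  count zero f zero r l up dn = refl
  count (suc n) f zero r l up dn rewrite <ᵇ-false {r} {f 0} (ℕₚ.≮⇒≥ λ x → case dn 0 x of λ ()) = count n (f ∘ suc) 0 r z≤n (λ c ()) (λ c x → case dn (suc c) x of λ ())
  count (suc n) f (suc h) r (s≤s l) up dn rewrite <ᵇ-true (up 0 (s≤s z≤n)) = cong suc (count n (f ∘ suc) h r l (λ c x → up (suc c) (s≤s x)) (λ c x → ≤-pred (dn (suc c) x)))

content-toT : ∀ N n C → All (_≤ n) (map length C) → content N (toT n C) ≡ content N C
content-toT N n C b = Vecₚ.tabulate-cong λ j → +-injective (count-∑ _ (concat (toT n C)) ∙ ∑-concat (toT n C) _ ∙ ∑-toT-rows n C b _ ∙ sym (count-∑ _ (concat C)))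

∑-filterᵇ : ∀ {A : Set} (p : A → Bool) xs (f : A → ℤ) → ∑ (filterᵇ p xs) f ≡ ∑ xs λ x → p x ▸ f x
∑-filterᵇ p [] f = refl
∑-filterᵇ p (x ∷ xs) f with p x
... | true = +ˡ (f x) (∑-filterᵇ p xs f)
... | false = ∑-filterᵇ p xs f ∙ sym (+-identityˡ _)

toList-padV-conj : ∀ λ′ n → IsPartition λ′ → head0 λ′ ≤ n → toList (padV n (conj λ′)) ≡ applyUpTo (wt λ′) n
toList-padV-conj λ′ n p l = toList-tabulate n (nthD 0 (conj λ′)) ∙ applyUpTo-cong n λ i _ → cong (λ t → nthD 0 t i) (conj-applyUpTo λ′) ∙ go (head0 λ′) (wt λ′) i λ h → wt-zero λ′ i (All≤-trans h (Partition-≤ λ′ p))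
  where
  go : ∀ h f i → (h ≤ i → f i ≡ 0) → nthD 0 (applyUpTo f h) i ≡ f i
  go zero f i k = sym (k z≤n)
  go (suc h) f zero k = refl
  go (suc h) f (suc i) k = go h (f ∘ suc) i (k ∘ s≤s)

-- A tableau becomes a 0/1 matrix with a row for each of the N letters and a column for each of the
-- n columns; columns beyond the shape are empty.
Op-schur : ∀ N λ′ n → IsPartition λ′ → head0 λ′ ≤ n → ∀ (φ : Ser N) e ξ → Op (schur N λ′) φ e ξ ≡ ch (+ᵛ (padV n (conj λ′))) 0ᵛ (φ e) ξ
Op-schur N λ′ n p l φ e ξ =
  ∑-map (filterᵇ isSSYT (fillings λ′ N)) _ _ ∙ ∑-filterᵇ isSSYT (fillings λ′ N) _ ∙
    (∑-cong (fillings λ′ N) λ T → cong (isSSYT T ▸_) (*-identityˡ _ ∙ cong (λ t → φ t (ξ ⊝ content N T)) (+-identityʳ e))) ∙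
    cong (λ t → ∑ (fillings t N) λ T → isSSYT T ▸ P (content N T)) (conj-conj λ′ n (Partition-Dec λ′ p) (All.map (λ x → ≤-trans x l) (Partition-≤ λ′ p))) ∙
    ∑-toT (length λ′) N hs hs≤ _ ∙ (∑-congA (All-fillings hs N) λ C q → cong₂ (λ a b → a ▸ P b)
        (isSSYT-cols (length λ′) C (subst Dec≥ (sym q) (Dec-up n (wt λ′) (wt-anti λ′))) (subst (All (_≤ length λ′)) (sym q) hs≤)) (content-toT N (length λ′) C (subst (All (_≤ length λ′)) (sym q) hs≤))) ∙
    ∑-cchain₀ hs P ∙ sym (ch-dseq (+ᵛ (padV n (conj λ′))) 0ᵛ (φ e) ξ ∙ ∑-dseq-CS₀ (padV n (conj λ′)) P ∙ cong (λ t → CS₀ t P) (toList-padV-conj λ′ n p l))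
  where
  hs : List ℕ
  hs = applyUpTo (wt λ′) n
  hs≤ : All (_≤ length λ′) hs
  hs≤ = All-up n (wt≤ λ′)
  P : Vec ℕ N → ℤ
  P ω = φ e (ξ ⊝ ω)

-- Power series in t, and the list of partitions.

tail-exists : ∀ {N} a as → ∃ λ p → embedT {N} (a ∷ as) ≡ (a , 0 ∷ Vec.replicate N 0) ∷ p
tail-exists a as = _ , refl

-- Unification recovers the local recursion inside embedT, which has no name outside its definition.
mutual
  embedT-go : ∀ {N} → List ℤ → ℕ → List ℤ → Poly N
  embedT-go = _

  embedT-go-unify : ∀ {N} (Q : Poly N → Set) a as → (∀ w k → Q (embedT-go w k as)) → Q (proj₁ (tail-exists a as))
  embedT-go-unify Q a as f with a ∷ as | 1
  ... | w | k = f w k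

tSum : (ℤ → ℤ) → ℤ → ℕ → List ℤ → ℤ
tSum f e k [] = 0ℤ
tSum f e k (a ∷ as) = a * f (e - + k) + tSum f e (suc k) as

Op-embedT : ∀ {N} as (φ : Ser N) e ξ → Op (embedT as) φ e ξ ≡ tSum (λ e → φ e ξ) e 0 as
Op-embedT {N} cs φ e ξ = go 0 cs
  where
  go : ∀ k as → Op (embedT-go cs k as) φ e ξ ≡ tSum (λ e → φ e ξ) e k as
  go k [] = refl
  go k (a ∷ as) = cong₂ (λ s t → a * φ (e - + k) s + t) (⊝-zeros ξ) (go (suc k) as)

-- A power series in t, without negative exponents; this permits cancellation of factors and
-- induction on powers of t.
NegZero : (ℤ → ℤ) → Set
NegZero f = ∀ k → f -[1+ k ] ≡ 0ℤ

minus-suc-suc : ∀ k i → + suc k - + suc (suc i) ≡ + k - + suc i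
minus-suc-suc k i = lem (+ k) (+ i)
  where
  lem : ∀ k i → (1ℤ + k) - (1ℤ + (1ℤ + i)) ≡ k - (1ℤ + i)
  lem = solve-∀

minus-suc : ∀ k i → (∃ λ j → (+ k - + suc i ≡ + j) × j < k) ⊎ (∃ λ j → + k - + suc i ≡ -[1+ j ])
minus-suc zero i = inj₂ (i , refl)
minus-suc (suc k) zero = inj₁ (k , refl , n<1+n k)
minus-suc (suc k) (suc i) with minus-suc k i
... | inj₁ (j , e , l) = inj₁ (j , trans (minus-suc-suc k i) e , ℕₚ.m<n⇒m<1+n l)
... | inj₂ (j , e) = inj₂ (j , trans (minus-suc-suc k i) e)

NegZero-below : ∀ {f} → NegZero f → ∀ c k → k < c → f (+ k - + c) ≡ 0ℤ
NegZero-below {f} nf (suc c) k (s≤s l) with minus-suc k c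
... | inj₂ (j , e) = cong f e ∙ nf j
... | inj₁ (j , e , _) = ⊥-elim (<⇒≱ (s≤s l) (≤-trans (m≤n+m (suc c) j) (≤-reflexive (+-injective (pos-+ j (suc c) ∙ cong (_+ + suc c) (sym e) ∙ lem (+ k) (+ suc c))))))
  where
  lem : ∀ k c → (k - c) + c ≡ k
  lem = solve-∀

NegZero-neg : ∀ {f} → NegZero f → ∀ k c → f (-[1+ k ] - + c) ≡ 0ℤ
NegZero-neg {f} nf k zero = nf k
NegZero-neg nf k (suc c) = nf (suc (k ℕ.+ c))

convolve : ∀ {f} → NegZero f → ∀ k c → f (+ k - + c) ≡ ∑ (range (suc k)) λ i → unit (+ i - + c) * f (+ k - + i)
convolve {f} nf k c = only (<-≤-connex k c) ∙ ∑-cong (range (suc k)) λ i → sym (cong (λ b → (b ▸ 1ℤ) * f (+ k - + i)) (sub-==0 (+ i) (+ c) ∙ Bool-ext {i ≡ᵇ c} {c ≡ᵇ i} (flip i c) (flip c i)) ∙ ▸-1 (c ≡ᵇ i) (f (+ k - + i)))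
  where
  flip : ∀ i c → (i ≡ᵇ c) ≡ true → (c ≡ᵇ i) ≡ true
  flip i c h = subst (λ t → (t ≡ᵇ i) ≡ true) (≡ᵇ-true {i} {c} h) (≡ᵇ-refl i)
  ▸-1 : ∀ b z → (b ▸ 1ℤ) * z ≡ b ▸ z
  ▸-1 true z = *-identityˡ z
  ▸-1 false z = refl
  only : k < c ⊎ c ≤ k → f (+ k - + c) ≡ ∑ (range (suc k)) λ i → (c ≡ᵇ i) ▸ f (+ k - + i)
  only (inj₁ l) = NegZero-below {f} nf c k l ∙ sym (∑-range-none (suc k) c _ l)
  only (inj₂ l) = sym (∑-range-only (suc k) c (λ i → f (+ k - + i)) (s≤s l))

tSum-convolve : ∀ {f} → NegZero f → ∀ as k → tSum f (+ k) 0 as ≡ ∑ (range (suc k)) λ i → coefT as i * f (+ k - + i)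
tSum-convolve {f} nf as k = go 0 as ∙ (∑-cong (range (suc k)) λ i → cong (_* f (+ k - + i)) (sym (coef 0 as i))) ∙ refl
  where
  coefAt : ℕ → List ℤ → ℕ → ℤ
  coefAt j [] i = 0ℤ
  coefAt j (a ∷ as) i = a * unit (+ i - + j) + coefAt (suc j) as i
  go : ∀ j as → tSum f (+ k) j as ≡ ∑ (range (suc k)) λ i → coefAt j as i * f (+ k - + i)
  go j [] = sym (∑-zero (range (suc k)) λ _ → refl)
  go j (a ∷ as) = cong₂ (λ s t → a * s + t) (convolve {f} nf k j) (go (suc j) as) ∙ +ʳ _ (sym (∑-*ˡ (range (suc k)) a _)) ∙
    sym (∑-+ (range (suc k)) (λ i → a * (unit (+ i - + j) * f (+ k - + i))) (λ i → coefAt (suc j) as i * f (+ k - + i))) ∙ ∑-cong (range (suc k)) λ i → lem a (unit (+ i - + j)) (f (+ k - + i)) (coefAt (suc j) as i)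
    where
    lem : ∀ a u z w → a * (u * z) + w * z ≡ (a * u + w) * z
    lem = solve-∀
  unit-< : ∀ i j → i < j → unit (+ i - + j) ≡ 0ℤ
  unit-< i j l = cong (_▸ 1ℤ) (sub-==0 (+ i) (+ j) ∙ ≡ᵇ-false (<⇒≢ l))
  at-< : ∀ j as i → i < j → coefAt j as i ≡ 0ℤ
  at-< j [] i l = refl
  at-< j (a ∷ as) i l = cong₂ (λ s t → a * s + t) (unit-< i j l) (at-< (suc j) as i (ℕₚ.m<n⇒m<1+n l)) ∙ *0+0 a
  coef′ : ∀ j as i → coefAt j as (i ℕ.+ j) ≡ coefT as i
  coef′ j [] i = refl
  coef′ j (a ∷ as) zero = cong₂ (λ s t → a * s + t) (cong (_▸ 1ℤ) (sub-==0 (+ j) (+ j) ∙ ≡ᵇ-refl j)) (at-< (suc j) as j (n<1+n j)) ∙ lem a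
    where
    lem : ∀ a → a * 1ℤ + 0ℤ ≡ a
    lem = solve-∀
  coef′ j (a ∷ as) (suc i) = cong₂ (λ s t → a * s + t) (cong (_▸ 1ℤ) (sub-==0 (+ suc (i ℕ.+ j)) (+ j) ∙ ≡ᵇ-false (λ h → <⇒≢ (s≤s (m≤n+m j i)) (sym h))))
    (cong (coefAt (suc j) as) (sym (ℕₚ.+-suc i j)) ∙ coef′ (suc j) as i) ∙ lem a (coefT as i)
    where
    lem : ∀ a b → a * 0ℤ + b ≡ b
    lem = solve-∀
  coef : ∀ j as i → coefT as i ≡ coefAt 0 as i
  coef j as i = sym (coef′ 0 as i) ∙ cong (coefAt 0 as) (ℕₚ.+-identityʳ i)

-- Each filling shifts the final factor by its maj. So the factor can be split off as an ordinary
-- product of power series, leaving the count with final factor 1.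
hw-convolve : ∀ {n} (L : Vec ℤ n) {f} → NegZero f → ∀ μ v κ k → hw L f μ v κ (+ k) ≡ ∑ (range (suc k)) λ i → hw L unit μ v κ (+ i) * f (+ k - + i)
hw-convolve {n} L {f} nf μ v κ k = hw-dseq L f μ v κ (+ k) ∙ (∑-cong (dseq n (length μ)) λ Ds → cong (λ t → sizes μ Ds ▸ domsD κ Ds ▸ isZ (addD κ Ds -ᵛ L) ▸ t) (convolve {f} nf k (costD v μ Ds)) ∙
    cong (λ t → sizes μ Ds ▸ domsD κ Ds ▸ t) (sym (∑-▸ (range (suc k)) (isZ (addD κ Ds -ᵛ L)) _)) ∙ cong (sizes μ Ds ▸_) (sym (∑-▸ (range (suc k)) (domsD κ Ds) _)) ∙ sym (∑-▸ (range (suc k)) (sizes μ Ds) _)) ∙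
  ∑-swap (dseq n (length μ)) (range (suc k)) _ ∙ ∑-cong (range (suc k)) λ i → (∑-cong (dseq n (length μ)) λ Ds → pull (sizes μ Ds) (domsD κ Ds) (isZ (addD κ Ds -ᵛ L)) (unit (+ i - + costD v μ Ds)) (f (+ k - + i))) ∙
    ∑-*ˡ (dseq n (length μ)) (f (+ k - + i)) _ ∙ ℤₚ.*-comm (f (+ k - + i)) _ ∙ cong (_* f (+ k - + i)) (sym (hw-dseq L unit μ v κ (+ i)))
  where
  pull : ∀ a b c u z → a ▸ b ▸ c ▸ (u * z) ≡ z * (a ▸ b ▸ c ▸ u)
  pull a b c u z = cong (λ t → a ▸ b ▸ t) (cong (c ▸_) (ℤₚ.*-comm u z) ∙ ▸-* c z u) ∙ cong (a ▸_) (▸-* b z _) ∙ ▸-* a z _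

hw-NegZero : ∀ {n} (L : Vec ℤ n) {f} → NegZero f → ∀ μ v κ → NegZero (hw L f μ v κ)
hw-NegZero {n} L {f} nf μ v κ k = hw-dseq L f μ v κ -[1+ k ] ∙ ∑-zero (dseq n (length μ)) λ Ds → cong (λ t → sizes μ Ds ▸ domsD κ Ds ▸ isZ (addD κ Ds -ᵛ L) ▸ t) (NegZero-neg {f} nf k (costD v μ Ds)) ∙
  cong (λ t → sizes μ Ds ▸ domsD κ Ds ▸ t) (▸-zero (isZ (addD κ Ds -ᵛ L))) ∙ cong (sizes μ Ds ▸_) (▸-zero (domsD κ Ds)) ∙ ▸-zero (sizes μ Ds)

hw-cong : ∀ {n} (L : Vec ℤ n) {f g} → (∀ e → f e ≡ g e) → ∀ μ v κ e → hw L f μ v κ e ≡ hw L g μ v κ e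
hw-cong L h [] v κ e = cong (isZ (κ -ᵛ L) ▸_) (h e)
hw-cong {n} L h (x ∷ μ) v κ e = ∑-cong (bits n) λ D → cong (λ t → (size D ≡ᵇ x) ▸ dom (κ ∔ D) ▸ t) (hw-cong L h μ (arr v D) (κ ∔ D) _)

hw-q : ∀ {n} (L : Vec ℤ n) j f μ v κ e → hw L (q j f) μ v κ e ≡ q j (hw L f μ v κ) e
hw-q L j f [] v κ e = sym (∑-▸ (range j) (isZ (κ -ᵛ L)) _)
hw-q {n} L j f (x ∷ μ) v κ e = (∑-cong (bits n) λ D → cong (λ t → (size D ≡ᵇ x) ▸ dom (κ ∔ D) ▸ t) (hw-q L j f μ (arr v D) (κ ∔ D) _) ∙
    cong ((size D ≡ᵇ x) ▸_) (sym (∑-▸ (range j) (dom (κ ∔ D)) _)) ∙ sym (∑-▸ (range j) (size D ≡ᵇ x) _)) ∙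
  ∑-swap (bits n) (range j) _ ∙ ∑-cong (range j) λ i → ∑-cong (bits n) λ D → cong (λ t → (size D ≡ᵇ x) ▸ dom (κ ∔ D) ▸ hw L f μ (arr v D) (κ ∔ D) t) (minus-comm e (+ cst (wt (x ∷ μ)) v D) (+ i))

hw-vOp : ∀ {n N} (L : Vec ℤ n) ss (β : Vec ℕ N) f μ v κ e → hw L (vOp ss β f) μ v κ e ≡ vOp ss β (hw L f μ v κ) e
hw-vOp L [] β f μ v κ e = refl
hw-vOp L (s ∷ ss) β f μ v κ e = hw-QF (cntV s β) (vOp ss β f) e ∙ QF-cong (cntV s β) (hw-vOp L ss β f μ v κ) e
  where
  hw-QF : ∀ j f e → hw L (QF j f) μ v κ e ≡ QF j (hw L f μ v κ) e
  hw-QF zero f e = refl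
  hw-QF (suc j) f e = hw-q L (suc j) (QF j f) μ v κ e ∙ q-cong (suc j) (hw-QF j f) e

q-NegZero : ∀ j {f} → NegZero f → NegZero (q j f)
q-NegZero j {f} nf k = ∑-zero (range j) λ i → NegZero-neg {f} nf k i

QF-NegZero : ∀ j {f} → NegZero f → NegZero (QF j f)
QF-NegZero zero nf = nf
QF-NegZero (suc j) {f} nf = q-NegZero (suc j) {QF j f} (QF-NegZero j {f} nf)

q-0 : ∀ j {f} → NegZero f → q (suc j) f 0ℤ ≡ f 0ℤ
q-0 j {f} nf = ∑-range-bot j (λ i → f (0ℤ - + i)) ∙ +ˡ (f 0ℤ) (∑-zero (range j) λ i → nf i) ∙ +-identityʳ (f 0ℤ)

vOp-0 : ∀ {N} ss (β : Vec ℕ N) {f} → NegZero f → NegZero (vOp ss β f) × vOp ss β f 0ℤ ≡ f 0ℤ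
vOp-0 [] β nf = nf , refl
vOp-0 (s ∷ ss) β {f} nf = QF-NegZero (cntV s β) {vOp ss β f} (proj₁ (vOp-0 ss β {f} nf)) , trans (QF-0 (cntV s β) {vOp ss β f} (proj₁ (vOp-0 ss β {f} nf))) (proj₂ (vOp-0 ss β {f} nf))
  where
  QF-0 : ∀ j {f} → NegZero f → QF j f 0ℤ ≡ f 0ℤ
  QF-0 zero nf = refl
  QF-0 (suc j) {f} nf = q-0 j {QF j f} (QF-NegZero j {f} nf) ∙ QF-0 j {f} nf

+-cancelʳ : ∀ c a b → a + c ≡ b + c → a ≡ b
+-cancelʳ c a b h = plus-minus a c ∙ cong (_- c) h ∙ sym (plus-minus b c)

-- [j + 1] has constant term 1, so the coefficients of the factor are determined one after the other
-- in increasing degree.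
q-injective : ∀ j {f g} → NegZero f → NegZero g → (∀ e → q (suc j) f e ≡ q (suc j) g e) → ∀ e → f e ≡ g e
q-injective j nf ng h -[1+ k ] = nf k ∙ sym (ng k)
q-injective j {f} {g} nf ng h (+ k) = agree-below (suc k) k (n<1+n k)
  where
  agree-below : ∀ m k → k < m → f (+ k) ≡ g (+ k)
  agree-below (suc m) k (s≤s l) = sym (cong f (+-identityʳ (+ k))) ∙ +-cancelʳ (∑ (range j) λ i → f (+ k - + suc i)) _ _
    (sym (∑-range-bot j (λ i → f (+ k - + i))) ∙ h (+ k) ∙ ∑-range-bot j (λ i → g (+ k - + i)) ∙ +ˡ (g (+ k - 0ℤ)) (∑-cong (range j) λ i → sym (rest i))) ∙
    cong g (+-identityʳ (+ k))
    where
    rest : ∀ i → f (+ k - + suc i) ≡ g (+ k - + suc i)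
    rest i with minus-suc k i
    ... | inj₁ (j' , e , l') = subst (λ t → f t ≡ g t) (sym e) (agree-below m j' (<-≤-trans l' l))
    ... | inj₂ (j' , e) = subst (λ t → f t ≡ g t) (sym e) (nf j' ∙ sym (ng j'))

QF-injective : ∀ j {f g} → NegZero f → NegZero g → (∀ e → QF j f e ≡ QF j g e) → ∀ e → f e ≡ g e
QF-injective zero nf ng h = h
QF-injective (suc j) {f} {g} nf ng h = QF-injective j {f} {g} nf ng (q-injective j {QF j f} {QF j g} (QF-NegZero j {f} nf) (QF-NegZero j {g} ng) h)

QF-∑ : ∀ {A : Set} k (xs : List A) (f : A → ℤ → ℤ) e → QF k (λ k → ∑ xs λ x → f x k) e ≡ ∑ xs λ x → QF k (f x) e
QF-∑ zero xs f e = refl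
QF-∑ (suc k) xs f e = q-cong (suc k) (QF-∑ k xs f) e ∙ ∑-swap (range (suc k)) xs _

QF-*ʳ : ∀ k f z e → QF k (λ k → f k * z) e ≡ QF k f e * z
QF-*ʳ zero f z e = refl
QF-*ʳ (suc k) f z e = q-cong (suc k) (QF-*ʳ k f z) e ∙ (∑-cong (range (suc k)) λ i → ℤₚ.*-comm (QF k f (e - + i)) z) ∙ ∑-*ˡ (range (suc k)) z _ ∙ ℤₚ.*-comm z _

strip : List ℕ → List ℕ
strip [] = []
strip (zero ∷ l) = []
strip (suc a ∷ l) = suc a ∷ strip l

sum-zeros : ∀ l → All (_≤ 0) l → sum l ≡ 0
sum-zeros [] [] = refl
sum-zeros (.0 ∷ l) (z≤n ∷ ps) = sum-zeros l ps

zeros-padV : ∀ {N} (β : Vec ℕ N) → sum (toList β) ≡ 0 → eqN (padV N []) β ≡ true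
zeros-padV [] h = refl
zeros-padV (zero ∷ β) h = zeros-padV β h

strip-zeros : ∀ l → sum l ≡ 0 → strip l ≡ []
strip-zeros [] h = refl
strip-zeros (zero ∷ l) h = refl

-- The list contains every partition of n with parts at most k exactly once, so the sum selects the
-- one obtained from β by dropping its zeros.
∑-partsGo : ∀ f n k {N} (β : Vec ℕ N) → Sorted β → All (_≤ k) (toList β) → sum (toList β) ≡ n → n ≤ f → (F : List ℕ → ℤ) →
            ∑ (partsGo f n k) (λ ν → eqN (padV N ν) β ▸ F ν) ≡ F (strip (toList β))
∑-partsGo zero zero k β s b h l F = +-identityʳ _ ∙ cong (_▸ F []) (zeros-padV β h) ∙ cong F (sym (strip-zeros (toList β) h))
∑-partsGo (suc f) zero k β s b h l F = +-identityʳ _ ∙ cong (_▸ F []) (zeros-padV β h) ∙ cong F (sym (strip-zeros (toList β) h))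
∑-partsGo (suc f) (suc n) k [] s b () l F
∑-partsGo (suc f) (suc n) k (zero ∷ β) (z , s) b h l F = ⊥-elim (case trans (sym (sum-zeros (toList β) z)) h of λ ())
∑-partsGo (suc f) (suc n) k {suc N} (suc a ∷ β) (z , s) (ak ∷ b) h (s≤s l) F =
  ∑-concatMap (filterᵇ (_≤ᵇ k) (from1 (suc n))) _ _ ∙ ∑-filterᵇ (_≤ᵇ k) (from1 (suc n)) _ ∙ ∑-map (upTo (suc n)) ℕ.suc term₀ ∙ ∑-applyUpTo (suc n) id (term₀ ∘ ℕ.suc) ∙
    ∑-cong (range (suc n)) step ∙ ∑-range-only (suc n) a inner a< ∙ cong (_▸ ∑ (partsGo f (n ∸ a) (suc a)) (λ ν → eqN (padV N ν) β ▸ F (suc a ∷ ν))) (≤ᵇ-true ak) ∙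
      ∑-partsGo f (n ∸ a) (suc a) β s z (sym (ℕₚ.m+n∸m≡n a _) ∙ cong (_∸ a) sum≡) (≤-trans (ℕₚ.m∸n≤m n a) l) (F ∘ (suc a ∷_))
  where
  sum≡ : a ℕ.+ sum (toList β) ≡ n
  sum≡ = suc-injective h
  a< : a < suc n
  a< = s≤s (≤-trans (m≤m+n a _) (≤-reflexive sum≡))
  term₀ : ℕ → ℤ
  term₀ x = (x ≤ᵇ k) ▸ ∑ (map (x ∷_) (partsGo f (suc n ∸ x) x)) λ ν → eqN (padV (suc N) ν) (suc a ∷ β) ▸ F ν
  inner : ℕ → ℤ
  inner j = (suc j ≤ᵇ k) ▸ ∑ (partsGo f (n ∸ j) (suc j)) λ ν → eqN (padV N ν) β ▸ F (suc j ∷ ν)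
  step : ∀ j → (suc j ≤ᵇ k) ▸ ∑ (map (suc j ∷_) (partsGo f (n ∸ j) (suc j))) (λ ν → eqN (padV (suc N) ν) (suc a ∷ β) ▸ F ν) ≡ (a ≡ᵇ j) ▸ inner j
  step j = cong ((suc j ≤ᵇ k) ▸_) (∑-map (partsGo f (n ∸ j) (suc j)) (suc j ∷_) _ ∙ (∑-cong (partsGo f (n ∸ j) (suc j)) λ ν → ▸-∧ (j ≡ᵇ a) (eqN (padV N ν) β) _) ∙ ∑-▸ (partsGo f (n ∸ j) (suc j)) (j ≡ᵇ a) _) ∙
    ▸-comm (suc j ≤ᵇ k) (j ≡ᵇ a) _ ∙ cong (_▸ inner j) (Bool-ext {j ≡ᵇ a} {a ≡ᵇ j} (λ e → subst (λ t → (t ≡ᵇ j) ≡ true) (≡ᵇ-true {j} {a} e) (≡ᵇ-refl j)) (λ e → subst (λ t → (t ≡ᵇ a) ≡ true) (≡ᵇ-true {a} {j} e) (≡ᵇ-refl a)))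

All-filterᵇ-× : ∀ {P : ℕ → Set} p xs → All P xs → All (λ x → P x × p x ≡ true) (filterᵇ p xs)
All-filterᵇ-× p [] [] = []
All-filterᵇ-× p (x ∷ xs) (q ∷ qs) with p x in eq
... | true = (q , eq) ∷ All-filterᵇ-× p xs qs
... | false = All-filterᵇ-× p xs qs

cons-partition : ∀ a ν → IsPartition ν → All (_≤ suc a) ν → IsPartition (suc a ∷ ν)
cons-partition a [] p b = s≤s z≤n
cons-partition a (x ∷ ν) p (l ∷ _) = l , p

partsGo-spec : ∀ f n k → All (λ ν → IsPartition ν × sum ν ≡ n × All (_≤ k) ν) (partsGo f n k)
partsGo-spec zero zero k = (tt , refl , []) ∷ []
partsGo-spec (suc f) zero k = (tt , refl , []) ∷ []
partsGo-spec zero (suc n) k = []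
partsGo-spec (suc f) (suc n) k = All-concatMap {Q = λ a → (1 ≤ a × a ≤ suc n) × (a ≤ᵇ k) ≡ true} one
    (All-filterᵇ-× (_≤ᵇ k) (from1 (suc n)) (All-map⁺ suc (All-applyUpTo (suc n) id λ i l → s≤s z≤n , l)))
  where
  All-applyUpTo : ∀ {P : ℕ → Set} m g → (∀ i → i < m → P (g i)) → All P (applyUpTo g m)
  All-applyUpTo zero g h = []
  All-applyUpTo (suc m) g h = h 0 (s≤s z≤n) ∷ All-applyUpTo m (g ∘ suc) λ i l → h (suc i) (s≤s l)
  one : ∀ a → (1 ≤ a × a ≤ suc n) × (a ≤ᵇ k) ≡ true → All (λ ν → IsPartition ν × sum ν ≡ suc n × All (_≤ k) ν) (map (a ∷_) (partsGo f (suc n ∸ a) a))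
  one (suc a) ((_ , s≤s l) , e) = All-map⁺ (suc a ∷_) (All.map (λ { {ν} (p , s , b) → cons-partition a ν p b , cong suc (cong (a ℕ.+_) s ∙ ℕₚ.m+[n∸m]≡n l) ,
    (≤ᵇ-true⁻ {suc a} {k} e ∷ All≤-trans (≤ᵇ-true⁻ {suc a} {k} e) b) }) (partsGo-spec f (n ∸ a) (suc a)))

length≤sum : ∀ ν → All (1 ≤_) ν → length ν ≤ sum ν
length≤sum [] [] = z≤n
length≤sum (a ∷ ν) (p ∷ ps) = ℕₚ.+-mono-≤ p (length≤sum ν ps)

parts≤sum : ∀ ν → All (_≤ sum ν) ν
parts≤sum [] = []
parts≤sum (a ∷ ν) = m≤m+n a _ ∷ All.map (λ l → ≤-trans l (m≤n+m _ a)) (parts≤sum ν)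

Dec-padTo : ∀ ν j → Dec≥ ν → Dec≥ (ν ++ replicate j 0)
Dec-padTo [] zero d = tt
Dec-padTo [] (suc j) d = All.tabulate (λ m → zeros-≤ j m) , Dec-padTo [] j tt
  where
  open import Data.List.Membership.Propositional using (_∈_)
  open import Data.List.Relation.Unary.Any using (here; there)
  zeros-≤ : ∀ j {x} → x ∈ replicate j 0 → x ≤ 0
  zeros-≤ (suc j) (here refl) = z≤n
  zeros-≤ (suc j) (there m) = zeros-≤ j m
Dec-padTo (x ∷ ν) j (b , d) = All-++⁺ b (All-zeros j) , Dec-padTo ν j d
  where
  All-zeros : ∀ j → All (_≤ x) (replicate j 0)
  All-zeros zero = []
  All-zeros (suc j) = z≤n ∷ All-zeros j

sum-padTo : ∀ ν j → sum (ν ++ replicate j 0) ≡ sum ν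
sum-padTo [] zero = refl
sum-padTo [] (suc j) = sum-padTo [] j
sum-padTo (x ∷ ν) j = cong (x ℕ.+_) (sum-padTo ν j)

strip-padTo : ∀ ν j → All (1 ≤_) ν → strip (ν ++ replicate j 0) ≡ ν
strip-padTo [] zero ps = refl
strip-padTo [] (suc j) ps = refl
strip-padTo (suc x ∷ ν) j (p ∷ ps) = cong (suc x ∷_) (strip-padTo ν j ps)

vOp-big : ∀ {N M} j (β : Vec ℕ N) → All (_≤ M) (toList β) → ∀ f e → vOp (range (j ℕ.+ suc M)) β f e ≡ vOp (range (suc M)) β f e
vOp-big zero β b f e = refl
vOp-big {M = M} (suc j) β b f e = cong (λ c → QF c (vOp (range (j ℕ.+ suc M)) β f) e) (absent β b) ∙ vOp-big j β b f e
  where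
  absent : ∀ {N} (β : Vec ℕ N) → All (_≤ M) (toList β) → cntV (j ℕ.+ suc M) β ≡ 0
  absent [] [] = refl
  absent (a ∷ β) (l ∷ b) rewrite ≡ᵇ-false {a} {j ℕ.+ suc M} (<⇒≢ (≤-<-trans l (m≤n+m (suc M) j))) = absent β b

-- Comparison of the two expansions of a Schur polynomial.

module Expansion (lam : List ℕ) (pl : IsPartition lam) (n : ℕ) (hn : head0 lam ≤ n)
  (P : List ℕ → Poly (sum lam))
  (hP : ∀ ν → IsPartition ν → sum ν ≡ sum lam → ((vPoly (sum lam) ν ⊗ aDelta (sum lam)) ⊗ P ν) ≈P hlNum (sum lam) ν)
  (c : List ℕ → List ℤ)
  (hc : schur (sum lam) lam ≈P sumP (map (λ ν → embedT (c ν) ⊗ P ν) (partitions (sum lam)))) where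

  N : ℕ
  N = sum lam

  L : Vec ℤ n
  L = +ᵛ (padV n (conj lam))

  length-conj : length (conj lam) ≤ n
  length-conj = subst (_≤ n) (sym (cong length (conj-applyUpTo lam) ∙ Listₚ.length-applyUpTo (wt lam) (head0 lam))) hn

  dom-L : dom L ≡ true
  dom-L = dom-+ᵛ (padV n (conj lam)) (subst Dec≥ (sym (toList-padV-conj lam n pl hn)) (Dec-up n (wt lam) (wt-anti lam)))

  -- The series of a_δ P_ν. The hypothesis on P determines v_ν times this product, so P_ν enters the
  -- comparison only together with a_δ.
  Z : List ℕ → Ser N
  Z ν = Op (aDelta N) (Op (P ν) δ₀)

  Z-NegZero : ∀ ν ξ → NegZero (λ e → Z ν e ξ)
  Z-NegZero ν ξ k = sym (Op-⊗ (aDelta N) (P ν) δ₀ -[1+ k ] ξ) ∙ Op-neg-exponent (aDelta N ⊗ P ν) k ξ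

  module _ (ν : List ℕ) (pν : IsPartition ν) (sν : sum ν ≡ N) where

    len≤ : length ν ≤ N
    len≤ = subst (length ν ≤_) sν (length≤sum ν (Partition-pos ν pν))

    toList-ν : toList (padV N ν) ≡ ν ++ replicate (N ∸ length ν) 0
    toList-ν = toList-padV N ν len≤

    sorted-ν : Sorted (padV N ν)
    sorted-ν = subst Dec≥ (sym toList-ν) (Dec-padTo ν (N ∸ length ν) (Partition-Dec ν pν))

    parts≤N : All (_≤ N) (toList (padV N ν))
    parts≤N = subst (λ t → All (_≤ t) (toList (padV N ν))) (cong sum toList-ν ∙ sum-padTo ν (N ∸ length ν) ∙ sν) (parts≤sum (toList (padV N ν)))

    sum-ν : sum (toList (padV N ν)) ≡ N
    sum-ν = cong sum toList-ν ∙ sum-padTo ν (N ∸ length ν) ∙ sν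

    strip-ν : strip (toList (padV N ν)) ≡ ν
    strip-ν = cong strip toList-ν ∙ strip-padTo ν (N ∸ length ν) (Partition-pos ν pν)

    vOp-Z : ∀ e ξ → vOp (range (suc N)) (padV N ν) (λ k → Z ν k ξ) e ≡ R (padV N ν) e ξ
    vOp-Z e ξ = sym (Op-vPoly N ν len≤ (Z ν) e ξ) ∙ sym (Op-⊗ (vPoly N ν) (aDelta N) (Op (P ν) δ₀) e ξ) ∙
      sym (Op-⊗ (vPoly N ν ⊗ aDelta N) (P ν) δ₀ e ξ) ∙ Op-≈ {p = (vPoly N ν ⊗ aDelta N) ⊗ P ν} {hlNum N ν} (hP ν pν sν) e ξ ∙ Op-hlNum N ν e ξ

    Z-0 : ∀ ξ → Z ν 0ℤ ξ ≡ R (padV N ν) 0ℤ ξ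
    Z-0 ξ = sym (proj₂ (vOp-0 (range (suc N)) (padV N ν) {λ e → Z ν e ξ} (Z-NegZero ν ξ))) ∙ vOp-Z 0ℤ ξ

  -- Exceeds n, as the expansion into `boxV` demands, and also every part of a partition of N, as
  -- the multinomial identity demands.
  bound : ℕ
  bound = n ℕ.+ suc N

  hwSer : Vec ℤ N → List ℕ → ℤ → ℤ
  hwSer ξ ν e = hw L (λ k → Z ν k ξ) (toList (padV N ν)) (dn 0 n) 0ᵛ e

  coefSer : Vec ℤ N → List ℕ → ℤ → ℤ
  coefSer ξ ν e = Op (embedT (c ν)) (Z ν) e ξ

  spec : All (λ ν → IsPartition ν × sum ν ≡ N) (partitions N)
  spec = All.map (λ { (p , s , _) → p , s }) (partsGo-spec N N N)

  sum-L : sumᵛ L ≡ + N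
  sum-L = sumᵛ-padV n (conj lam) length-conj ∙ cong (λ t → + t) (sum-conj lam pl)

  hw-offsize : ∀ φ μ e → sum μ ≢ N → hw L φ μ (dn 0 n) 0ᵛ e ≡ 0ℤ
  hw-offsize φ μ e ne = hw-size L φ μ (dn 0 n) 0ᵛ e λ h → ne (+-injective (sym (cong (_+ + sum μ) (sumᵛ-0 n) ∙ +-identityˡ (+ sum μ)) ∙ h ∙ sum-L))

  -- The factor [N]! turns a_δ into R_0, so the given expansion of s_λ, multiplied by [N]! a_δ, is
  -- the action of s_λ on R_0.
  schur-side : ∀ e ξ → QF N (λ k → ∑ (partitions N) λ ν → coefSer ξ ν k) e ≡ ch L 0ᵛ (R zerosV e) ξ
  schur-side e ξ = sym (Op-vm N (λ e ξ → ∑ (partitions N) λ ν → coefSer ξ ν e) e ξ) ∙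
    Op-cong (vm N) (λ e ξ → (∑-cong (partitions N) λ ν → Op-comm (embedT (c ν)) (aDelta N) (Op (P ν) δ₀) e ξ) ∙
        sym (Op-∑ (aDelta N) (partitions N) (λ ν → Op (embedT (c ν)) (Op (P ν) δ₀)) e ξ) ∙ Op-cong (aDelta N) schur-δ e ξ ∙ Op-comm (aDelta N) (schur N lam) δ₀ e ξ) e ξ ∙
    Op-comm (vm N) (schur N lam) (Op (aDelta N) δ₀) e ξ ∙ Op-cong (schur N lam) R₀ e ξ ∙ Op-schur N lam n pl hn (R zerosV) e ξ
    where
    schur-δ : ∀ e ξ → ∑ (partitions N) (λ ν → Op (embedT (c ν)) (Op (P ν) δ₀) e ξ) ≡ Op (schur N lam) δ₀ e ξ
    schur-δ e ξ = sym (Op-≈ {p = schur N lam} {sumP (map (λ ν → embedT (c ν) ⊗ P ν) (partitions N))} hc e ξ ∙ Op-sum (partitions N) (λ ν → embedT (c ν) ⊗ P ν) δ₀ e ξ ∙ ∑-cong (partitions N) λ ν → Op-⊗ (embedT (c ν)) (P ν) δ₀ e ξ)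
    R₀ : ∀ e ξ → Op (vm N) (Op (aDelta N) δ₀) e ξ ≡ R zerosV e ξ
    R₀ e ξ = Op-vm N (Op (aDelta N) δ₀) e ξ ∙ QF-cong N (λ k → Op-aDelta N k ξ) e ∙ QF-*ʳ N unit (Dv ξ) e ∙ sym (R-zeros e ξ)

  -- Collects α under its sorted partition. Vectors of total different from N are excluded by
  -- weight, and v_ν, which commutes with the count, turns a_δ P_ν into R_ν.
  group : ∀ ξ e α → hw L (λ j → R (sortV α) j ξ) (toList (sortV α)) (dn 0 n) 0ᵛ (e - + inv α) ≡
          ∑ (partitions N) λ ν → eqN (sortV α) (padV N ν) ▸ vOp (range bound) (padV N ν) (hwSer ξ ν) (e - + inv α)
  group ξ e α with sum (toList (sortV α)) ℕₚ.≟ N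
  ... | no ne = hw-offsize _ (toList (sortV α)) (e - + inv α) ne ∙ sym ((∑-congA {g = λ _ → 0ℤ} spec λ { ν (p , s) → cong (_▸ vOp (range bound) (padV N ν) (hwSer ξ ν) (e - + inv α)) (differ ν p s) }) ∙ ∑-zero (partitions N) λ _ → refl)
    where
    differ : ∀ ν → IsPartition ν → sum ν ≡ N → eqN (sortV α) (padV N ν) ≡ false
    differ ν p s with eqN (sortV α) (padV N ν) in eq
    ... | false = refl
    ... | true = ⊥-elim (ne (cong (sum ∘ toList) (eqN-true (sortV α) (padV N ν) eq) ∙ sum-ν ν p s))
  ... | yes sα = sym ((∑-congA spec λ { ν (p , s) → matches ν p s }) ∙ ∑-partsGo N N N (sortV α) (sortV-sorted α) (subst (λ t → All (_≤ t) (toList (sortV α))) sα (parts≤sum (toList (sortV α)))) sα ≤-refl (λ _ → target))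
    where
    target : ℤ
    target = hw L (λ j → R (sortV α) j ξ) (toList (sortV α)) (dn 0 n) 0ᵛ (e - + inv α)
    flipN : ∀ {N} (α β : Vec ℕ N) → eqN α β ≡ eqN β α
    flipN α β = Bool-ext (λ h → subst (λ t → eqN t α ≡ true) (eqN-true α β h) (eqN-refl α)) (λ h → subst (λ t → eqN t β ≡ true) (eqN-true β α h) (eqN-refl β))
    matches : ∀ ν → IsPartition ν → sum ν ≡ N → eqN (sortV α) (padV N ν) ▸ vOp (range bound) (padV N ν) (hwSer ξ ν) (e - + inv α) ≡ eqN (padV N ν) (sortV α) ▸ target
    matches ν p s = cong (_▸ vOp (range bound) (padV N ν) (hwSer ξ ν) (e - + inv α)) (flipN (sortV α) (padV N ν)) ∙ ▸-cong (eqN (padV N ν) (sortV α)) λ h →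
      vOp-big n (padV N ν) (parts≤N ν p s) (hwSer ξ ν) (e - + inv α) ∙ sym (hw-vOp L (range (suc N)) (padV N ν) (λ k → Z ν k ξ) (toList (padV N ν)) (dn 0 n) 0ᵛ (e - + inv α)) ∙
        hw-cong L (λ e → vOp-Z ν p s e ξ) (toList (padV N ν)) (dn 0 n) 0ᵛ (e - + inv α) ∙
          cong (λ β → hw L (λ j → R β j ξ) (toList β) (dn 0 n) 0ᵛ (e - + inv α)) (eqN-true (padV N ν) (sortV α) h)

  -- The rearrangements α of a fixed ν contribute v_ν t^{inv α}; their sum is [N]! by `multinomial`,
  -- the same factor as on the other side.
  hw-side : ∀ e ξ → QF N (λ k → ∑ (partitions N) λ ν → hwSer ξ ν k) e ≡ ch L 0ᵛ (R zerosV e) ξ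
  hw-side e ξ = QF-∑ N (partitions N) (hwSer ξ) e ∙ sym (chains-hw (n ℕ.+ N) (m≤m+n n N) L dom-L e ξ ∙
    ∑-cong (boxV (suc (n ℕ.+ N)) N) (group ξ e) ∙ cong (λ k → ∑ (boxV k N) λ α → ∑ (partitions N) λ ν → eqN (sortV α) (padV N ν) ▸ vOp (range bound) (padV N ν) (hwSer ξ ν) (e - + inv α)) (sym (ℕₚ.+-suc n N)) ∙
      ∑-swap (boxV bound N) (partitions N) _ ∙ ∑-congA spec λ { ν (p , s) → multinomial bound N (padV N ν) (sorted-ν ν p s) (All.map (λ l → ≤-<-trans l (m≤n+m (suc N) n)) (parts≤N ν p s)) (hwSer ξ ν) e })

  expansions-agree : ∀ ξ e → ∑ (partitions N) (λ ν → coefSer ξ ν e) ≡ ∑ (partitions N) λ ν → hwSer ξ ν e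
  expansions-agree ξ = QF-injective N {λ e → ∑ (partitions N) λ ν → coefSer ξ ν e} {λ e → ∑ (partitions N) λ ν → hwSer ξ ν e}
    (λ k → ∑-zero (partitions N) λ ν → Op-embedT (c ν) (Z ν) -[1+ k ] ξ ∙ tSum-NegZero {λ e → Z ν e ξ} (Z-NegZero ν ξ) k 0 (c ν))
    (λ k → ∑-zero (partitions N) λ ν → hw-NegZero L {λ e → Z ν e ξ} (Z-NegZero ν ξ) (toList (padV N ν)) (dn 0 n) 0ᵛ k)
    λ e → trans (schur-side e ξ) (sym (hw-side e ξ))
    where
    tSum-NegZero : ∀ {f} → NegZero f → ∀ k j as → tSum f -[1+ k ] j as ≡ 0ℤ
    tSum-NegZero nf k j [] = refl
    tSum-NegZero {f} nf k j (a ∷ as) = cong₂ (λ s t → a * s + t) (NegZero-neg {f} nf k j) (tSum-NegZero {f} nf k (suc j) as) ∙ *0+0 a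

  gap : List ℕ → ℕ → ℤ
  gap ν i = coefT (c ν) i - hw L unit (toList (padV N ν)) (dn 0 n) 0ᵛ (+ i)

  gap-relation : ∀ ξ k → ∑ (partitions N) (λ ν → ∑ (range (suc k)) λ i → gap ν i * Z ν (+ k - + i) ξ) ≡ 0ℤ
  gap-relation ξ k = (∑-cong (partitions N) λ ν → (∑-cong (range (suc k)) λ i → lem (coefT (c ν) i) (hw L unit (toList (padV N ν)) (dn 0 n) 0ᵛ (+ i)) (Z ν (+ k - + i) ξ)) ∙
      ∑-- (range (suc k)) (λ i → coefT (c ν) i * Z ν (+ k - + i) ξ) (λ i → hw L unit (toList (padV N ν)) (dn 0 n) 0ᵛ (+ i) * Z ν (+ k - + i) ξ) ∙
        sym (cong₂ _-_ (Op-embedT (c ν) (Z ν) (+ k) ξ ∙ tSum-convolve {λ e → Z ν e ξ} (Z-NegZero ν ξ) (c ν) k) (hw-convolve L {λ e → Z ν e ξ} (Z-NegZero ν ξ) (toList (padV N ν)) (dn 0 n) 0ᵛ k))) ∙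
    ∑-- (partitions N) (λ ν → coefSer ξ ν (+ k)) (λ ν → hwSer ξ ν (+ k)) ∙ ℤₚ.i≡j⇒i-j≡0 (expansions-agree ξ (+ k))
    where
    lem : ∀ a b z → (a - b) * z ≡ a * z - b * z
    lem = solve-∀

  -- At ξ = ρ⁺ μ the series Z ν starts with the coefficient [ν = μ].
  gap-zero : ∀ m k → k < m → ∀ μ → IsPartition μ → sum μ ≡ N → gap μ k ≡ 0ℤ
  gap-zero (suc m) k (s≤s l) μ p s = cong (λ t → gap t k) (sym (strip-ν μ p s)) ∙ sym (∑-partsGo N N N (padV N μ) (sorted-ν μ p s) (parts≤N μ p s) (sum-ν μ p s) ≤-refl (λ ν → gap ν k)) ∙
    (∑-congA spec λ { ν (p' , s') → sym (lead ν p' s') }) ∙ gap-relation ξ k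
    where
    ξ : Vec ℤ N
    ξ = ρ⁺ (+ᵛ (padV N μ))
    one▸ : ∀ b z → z * (b ▸ 1ℤ) ≡ b ▸ z
    one▸ true z = *-identityʳ z
    one▸ false z = *-zeroʳ z
    lead : ∀ ν → IsPartition ν → sum ν ≡ N → ∑ (range (suc k)) (λ i → gap ν i * Z ν (+ k - + i) ξ) ≡ eqN (padV N ν) (padV N μ) ▸ gap ν k
    -- The terms with i < k vanish by the induction hypothesis, for all ν at once; the term i = k
    -- meets the constant term of `Z ν`.
    lead ν p' s' = cong₂ (λ a b → gap ν k * a + b) (cong (λ t → Z ν t ξ) (+-inverseʳ (+ k)) ∙ Z-0 ν p' s' ξ ∙
          R-lead (padV N ν) (sorted-ν ν p' s') (+ᵛ (padV N μ)) (dom-+ᵛ (padV N μ) (sorted-ν μ p s)))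
        ((∑-cong-range k {g = λ _ → 0ℤ} λ i l' → cong (_* Z ν (+ k - + i) ξ) (gap-zero m i (<-≤-trans l' l) ν p' s')) ∙ ∑-zero (range k) λ _ → refl) ∙
      +-identityʳ _ ∙ cong (λ b → gap ν k * (b ▸ 1ℤ)) (eqN-isZ (padV N ν) (padV N μ)) ∙ one▸ (eqN (padV N ν) (padV N μ)) (gap ν k)
      where
      eqN-isZ : ∀ {N} (α β : Vec ℕ N) → isZ (+ᵛ α -ᵛ +ᵛ β) ≡ eqN α β
      eqN-isZ [] [] = refl
      eqN-isZ (a ∷ α) (b ∷ β) = cong₂ _∧_ (sub-==0 (+ a) (+ b)) (eqN-isZ α β)

  coefficient : ∀ μ → IsPartition μ → sum μ ≡ N → ∀ k → coefT (c μ) k ≡ hw L unit μ (dn 0 n) 0ᵛ (+ k)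
  coefficient μ p s k = i-j≡0⇒i≡j _ _ (gap-zero (suc k) k (n<1+n k) μ p s) ∙
    cong (λ t → hw L unit t (dn 0 n) 0ᵛ (+ k)) (toList-ν μ p s) ∙ hw-zeros L unit μ (N ∸ length μ) (dn 0 n) 0ᵛ (+ k) (dom-0 n)

head≤sum : ∀ ν → head0 ν ≤ sum ν
head≤sum [] = z≤n
head≤sum (a ∷ ν) = m≤m+n a (sum ν)

theorem6p5 : (lam mu : List ℕ) → IsPartition lam → IsPartition mu →
    (m : ℕ) → sum mu ∸ head0 mu ≤ m →
    (P : List ℕ → Poly (sum lam)) →
    ((ν : List ℕ) → IsPartition ν → sum ν ≡ sum lam →
      ((vPoly (sum lam) ν ⊗ aDelta (sum lam)) ⊗ P ν) ≈P hlNum (sum lam) ν) →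
    (c : List ℕ → List ℤ) →
    schur (sum lam) lam ≈P sumP (map (λ ν → embedT (c ν) ⊗ P ν) (partitions (sum lam))) →
    ((sum mu ≡ sum lam → (k : ℕ) → coefT (c mu) k ≡ + (kfGen lam mu m k)) ×
     (sum mu ≢ sum lam → (k : ℕ) → kfGen lam mu m k ≡ 0))
theorem6p5 lam mu plam pmu m hm P hP c hc = equal-size , λ ne k → kfGen-size lam mu m k plam pmu ne
  where
  equal-size : sum mu ≡ sum lam → (k : ℕ) → coefT (c mu) k ≡ + (kfGen lam mu m k)
  equal-size s k = Exp′.coefficient mu pmu s k ∙ sym (kfGen-hw lam mu m k pmu Exp′.length-conj)
    where
    -- λ_1 ≤ |λ| = |μ| ≤ μ_1 + m = n. Here the bound on m enters: the λ_1 parts of λ' fit into n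
    -- letters.
    hn : head0 lam ≤ nLen m mu
    hn = ≤-trans (head≤sum lam) (≤-trans (≤-reflexive (sym s)) (≤-trans (ℕₚ.m≤n+m∸n (sum mu) (head0 mu))
      (≤-trans (ℕₚ.+-monoʳ-≤ (head0 mu) hm) (≤-reflexive (ℕₚ.+-comm (head0 mu) m)))))
    module Exp′ = Expansion lam plam (nLen m mu) hn P hP c hc
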